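{- Given a composition $\overline{w}=(w_1,\ldots,w_{q-1})$ with at least two components. Let $\lambda=\lceil\frac{w}{w_1}\rceil$ and $s=\lambda w_1-w$. Then \[N_{ccc}(\overline{w})\geq \lambda(\lambda-1)w_1^2-2(\lambda-1)sw_1+w_1-\lfloor\frac{2s}{\lambda}\rfloor.\] In particular, equality holds for all $\overline{w}$ provided that $3w_1\geq w$, and $\overline{w}$ is not a refinement of any composition in $\{(4,4,2), (4,3,3), (5,5,3), (5,4,4)\}$.
   Context: A $q$-ary code of length $n$ is a subset of $\mathbb{Z}_q^n$ with Hamming distance. The composition of a vector $u$ is the tuple $(w_1,\ldots,w_{q-1})$ where $w_i$ is the number of coordinates of $u$ equal to $i$; compositions are written with positive components in non-increasing order $w_1\geq w_2\geq\cdots\geq w_{q-1}\geq 1$, and $w=\sum_i w_i$ is the total weight. $A_q(n,d,\overline{w})$ is the maximum size of a $q$-ary code of length $n$, minimum distance $d$, in which every codeword has composition $\overline{w}$. $N_{ccc}(\overline{w})=\min\{n_0: A_q(n,2w-1,\overline{w})=\lfloor n/w_1\rfloor \text{ for all } n\geq n_0\}$. A composition $(w_1,\ldots,w_q)$ is a refinement of $(v_1,\ldots,v_{q'})$ ($q>q'$) if $[q]$ can be partitioned into sets $S_1,\ldots,S_{q'}$ with $\sum_{i\in S_j}w_i=v_j$ for each $j$. -}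

module Defs where

open import Data.Nat using (ℕ; zero; suc; _+_; _*_; _∸_; _≤_; _<_; _/_)
open import Data.Integer as ℤ using (ℤ; +_)
open import Data.Fin as Fin using (Fin; zero; suc)
open import Data.Fin.Properties using (_≟_)
open import Data.Vec using (Vec; []; _∷_; lookup; head)
import Data.Vec as Vec
open import Data.List using (List; length; map; allFin)
open import Data.Nat.ListAction using (sum)
open import Data.List.Relation.Unary.All using (All)
open import Data.List.Relation.Unary.Unique.Propositional using (Unique)
open import Data.List.Membership.Propositional using (_∈_)
open import Data.Bool using (if_then_else_)
open import Data.Product using (Σ; _×_)
open import Relation.Nullary using (¬_)
open import Relation.Nullary.Decidable using (⌊_⌋)
open import Relation.Binary.PropositionalEquality using (_≡_; _≢_)

dist : ∀ {q n} → Vec (Fin q) n → Vec (Fin q) n → ℕ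
dist [] [] = 0
dist (x ∷ xs) (y ∷ ys) = (if ⌊ x ≟ y ⌋ then 0 else 1) + dist xs ys

occ : ∀ {q n} → Fin q → Vec (Fin q) n → ℕ
occ a [] = 0
occ a (x ∷ xs) = (if ⌊ x ≟ a ⌋ then 1 else 0) + occ a xs

-- floor division a / b, with the (irrelevant) convention a/0 = 0
floorDiv : ℕ → ℕ → ℕ
floorDiv a zero = 0
floorDiv a (suc b) = a / suc b

ceilDiv : ℕ → ℕ → ℕ
ceilDiv a zero = 0
ceilDiv a (suc b) = (a + b) / suc b

IsComposition : ∀ {k} → Vec ℕ k → Set
IsComposition {k} w =
  (∀ (i : Fin k) → 1 ≤ lookup w i) ×
  (∀ (i j : Fin k) → i Fin.≤ j → lookup w j ≤ lookup w i)

weight : ∀ {k} → Vec ℕ k → ℕ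
weight w = Vec.sum w

-- u ∈ Z_q^n (q = k+1) has composition w: exactly w_i coordinates equal to i, i = 1..q-1
HasComposition : ∀ {k n} → Vec ℕ k → Vec (Fin (suc k)) n → Set
HasComposition {k} w u = ∀ (i : Fin k) → occ (suc i) u ≡ lookup w i

-- C (a finite subset of Z_q^n, as a duplicate-free list) is a constant-composition
-- code of length n with minimum distance (at least) d and composition w
IsCCC : ∀ {k} (n d : ℕ) → Vec ℕ k → List (Vec (Fin (suc k)) n) → Set
IsCCC n d w C =
  Unique C × All (HasComposition w) C ×
  (∀ {x y} → x ∈ C → y ∈ C → x ≢ y → d ≤ dist x y)

AEq : ∀ {k} (n d : ℕ) → Vec ℕ k → ℕ → Set
AEq {k} n d w m =
  Σ (List (Vec (Fin (suc k)) n)) (λ C → IsCCC n d w C × length C ≡ m) ×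
  (∀ (C : List (Vec (Fin (suc k)) n)) → IsCCC n d w C → length C ≤ m)

StableFrom : ∀ {k} → Vec ℕ (suc k) → ℕ → Set
StableFrom w n0 =
  ∀ n → n0 ≤ n → AEq n (2 * weight w ∸ 1) w (floorDiv n (head w))

IsNccc : ∀ {k} → Vec ℕ (suc k) → ℕ → Set
IsNccc w b = StableFrom w b × (∀ n0 → StableFrom w n0 → b ≤ n0)

-- w (k components) is a refinement of v (k' components), k > k':
-- [k] is partitioned into S_1..S_k' (S_j = f⁻¹(j)) with Σ_{i ∈ S_j} w_i = v_j
Refines : ∀ {k k'} → Vec ℕ k → Vec ℕ k' → Set
Refines {k} {k'} w v =
  k' < k ×
  Σ (Fin k → Fin k') (λ f →
    ∀ (j : Fin k') →
      sum (map (λ i → if ⌊ f i ≟ j ⌋ then lookup w i else 0) (allFin k)) ≡ lookup v j)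

lam : ∀ {k} → Vec ℕ (suc k) → ℕ
lam w = ceilDiv (weight w) (head w)

sOf : ∀ {k} → Vec ℕ (suc k) → ℕ
sOf w = lam w * head w ∸ weight w

bound : ∀ {k} → Vec ℕ (suc k) → ℤ
bound w =
  (((+ (l * (l ∸ 1) * w1 * w1)) ℤ.- (+ (2 * (l ∸ 1) * s * w1))) ℤ.+ (+ w1))
    ℤ.- (+ floorDiv (2 * s) l)
  where
    l = lam w
    s = sOf w
    w1 = head w

{-# OPTIONS --safe #-}
module Submission where

-- Two words at distance 2w - 1 share at most one nonzero coordinate, and carry different symbols
-- there. If d_x words are nonzero at x, then Σ d_x = M w and Σ C(d_x,2) ≤ C(M,2); together with
-- (d_x - λ)(d_x - λ + 1) ≥ 0 this excludes M = (λ - 1)(λ w₁ - 2s) words of length bound - 1.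
--
-- Conversely let 3 w₁ ≥ w, so λ ≤ 3. View the M words as vertices with w coloured slots each and
-- the coordinates as points, i.e. sets of at most λ vertices of which any two share at most one
-- point. It suffices to choose the points of size 3 and some of size 2: the uncovered pairs form
-- a graph whose degrees fit the free slots, and an Eulerian orientation lets the tail of each
-- pair use colour 1 and its head another colour. With t = w₁ - s the chosen points come from
--   λ = 2: a cyclic difference family for M > 2t, no points at all for M = 2t;
--   λ = 3: a cyclic difference family for M > 6t + 2s, except that s = 0 needs zigzag paths for
--   M = 6t + 1 and Bose's triple system for M = 6t + 2; and three layers of starters together
--   with one special level for M = 6t + 2s, where ⌊2s/3⌋ coordinates are saved.

-- The critical M is one less than that of a perfect system: if M w₁ coordinates meet λ or λ - 1
-- words each and every two words meet, counting gives M - 1 = (λ - 1)(λ w₁ - 2s). For λ = 3, s = 0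
-- this is a Steiner triple system of order 6t + 1, built here in Skolem's way; 6t + 2 comes from
-- order 6t + 3 by deleting a vertex. Let M = 6t + 2s, with at most three words at a coordinate and
-- every two words meeting once. Then there are M w - C(M,2) coordinates plus the number of triples.
-- So triples should be few; the minimum, reached when no coordinate has a single word, is 3t - 1
-- per vertex on average. Hence the two triples and one pair of the special level: the uncovered
-- pairs form a graph of even degree 2s, with s tails and s heads at a vertex. The obstacle is the
-- colouring. Colours are intervals of slots of length at most w₁, so two colours other than 1 are
-- known to differ only for slots almost w₁ apart. A triple system alone is not enough: its members
-- must be spread over three blocks A, B, C of slots, with an index in B at most one above that in
-- C.

open import Defs
import Data.Fin.Properties as FinP
import Data.Fin.Relation.Unary.Top as TopP
import Data.Integer as ℤ
import Data.Integer.Properties as ℤP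
import Data.List.Membership.Propositional.Properties as MemP
import Data.List.Properties as ListP
import Data.List.Relation.Unary.All.Properties as AllP
import Data.List.Relation.Unary.Unique.Propositional.Properties as UniqueP
import Data.Maybe.Properties as MaybeP
import Data.Nat.Properties
open import Algebra.Properties.Semiring.Sum Data.Nat.Properties.+-*-semiring using (sum; sum-cong-≗; ∑-distrib-+; ∑-comm; sum-replicate-zero; *-distribˡ-sum)
open import Data.Bool using (Bool; true; false; _∧_; not; T; if_then_else_)
open import Data.Bool.Properties using (∧-comm; ∧-idem)
open import Data.Empty using (⊥; ⊥-elim)
open import Data.Fin using (Fin; zero; suc; toℕ; fromℕ; fromℕ<; inject₁; inject≤; combine; remQuot; splitAt; join; cast; _↑ˡ_; _↑ʳ_)
open import Data.Fin.Relation.Unary.Top using (‵fromℕ; ‵inject₁) renaming (view to top)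
open import Data.List as List using (List; []; _∷_; length; allFin; _++_; concatMap; replicate)
open import Data.List.Membership.Propositional using (_∈_)
open import Data.List.Relation.Unary.All as All using (All; []; _∷_)
open import Data.List.Relation.Unary.AllPairs as AllPairs using (AllPairs; []; _∷_)
open import Data.List.Relation.Unary.Any using (here; there)
open import Data.List.Relation.Unary.Unique.Propositional using (Unique)
open import Data.Maybe as Maybe using (Maybe; just; nothing; is-just; is-nothing)
open import Data.Maybe.Properties using (just-injective)
open import Data.Nat hiding (parity)
open import Data.Nat.DivMod using (m%n<n; m<n⇒m%n≡m; m%n%n≡m%n; %-distribˡ-+; [m+kn]%n≡m%n; m*n/n≡m; /-monoˡ-≤; m≡m%n+[m/n]*n)
open import Data.Nat.Properties
open import Data.Nat.Tactic.RingSolver using (solve-∀)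
open import Data.Product using (Σ; _×_; _,_; proj₁; proj₂; ∃)
open import Data.Product.Function.NonDependent.Propositional using (_×-↔_)
open import Data.Product.Properties using (,-injectiveˡ)
open import Data.Sum as Sum using (_⊎_; inj₁; inj₂; [_,_]′)
open import Data.Sum.Function.Propositional using (_⊎-↔_)
open import Data.Sum.Properties using (inj₁-injective)
open import Data.Vec as Vec using (Vec; []; _∷_; lookup)
open import Function using (_∘_; case_of_; _↔_; Inverse; mk↔ₛ′)
open import Function.Properties.Inverse using (↔-refl; ↔-sym; ↔-trans)
open import Relation.Binary.Definitions using (tri<; tri≈; tri>)
open import Relation.Binary.PropositionalEquality
open import Relation.Nullary using (¬_; yes; no; Dec)
open import Relation.Nullary.Decidable using (⌊_⌋)

-- Linear arithmetic over ℕ by Fourier-Motzkin elimination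
module Linear where

  open import Data.Bool using (Bool; true; false; _∧_; _∨_; T; if_then_else_)
  open import Data.Empty using (⊥; ⊥-elim)
  open import Data.Fin using (Fin; zero; suc)
  open import Data.Integer as ℤ using (ℤ; +_; -[1+_]; ∣_∣)
  import Data.Integer.Properties as ℤP
  open import Data.Integer.Tactic.RingSolver using () renaming (solve-∀ to ring)
  open import Data.List using (List; []; _∷_; _++_; concatMap; map)
  open import Data.List.Relation.Unary.All as All using (All; []; _∷_)
  import Data.List.Relation.Unary.All.Properties as AllP
  open import Data.Nat as ℕ using (ℕ; zero; suc; z≤n; s≤s)
  import Data.Nat.Properties as ℕP
  open import Data.Nat.DivMod using (_/_; _%_)
  open import Data.Product using (_×_; _,_; proj₁; proj₂)
  open import Data.Vec as Vec using (Vec; []; _∷_)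
  open import Relation.Binary.PropositionalEquality
  open import Relation.Nullary using (¬_)

  Form : ℕ → Set
  Form n = ℤ × Vec ℤ n

  dot : ∀ {n} → Vec ℤ n → Vec ℤ n → ℤ
  dot [] [] = + 0
  dot (a ∷ as) (x ∷ xs) = a ℤ.* x ℤ.+ dot as xs

  val : ∀ {n} → Form n → Vec ℤ n → ℤ
  val (c , as) ρ = c ℤ.+ dot as ρ

  comb : ∀ {n} → ℤ → Form n → ℤ → Form n → Form n
  comb k (c , as) l (d , bs) =
    k ℤ.* c ℤ.+ l ℤ.* d , Vec.zipWith (λ a b → k ℤ.* a ℤ.+ l ℤ.* b) as bs

  dot-comb : ∀ {n} k (as : Vec ℤ n) l bs ρ →
    dot (Vec.zipWith (λ a b → k ℤ.* a ℤ.+ l ℤ.* b) as bs) ρ ≡ k ℤ.* dot as ρ ℤ.+ l ℤ.* dot bs ρ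
  dot-comb k [] l [] [] = lem k l
    where lem : ∀ k l → + 0 ≡ k ℤ.* + 0 ℤ.+ l ℤ.* + 0
          lem = ring
  dot-comb k (a ∷ as) l (b ∷ bs) (x ∷ ρ) rewrite dot-comb k as l bs ρ = lem k l a b x (dot as ρ) (dot bs ρ)
    where lem : ∀ k l a b x p q → (k ℤ.* a ℤ.+ l ℤ.* b) ℤ.* x ℤ.+ (k ℤ.* p ℤ.+ l ℤ.* q) ≡
                  k ℤ.* (a ℤ.* x ℤ.+ p) ℤ.+ l ℤ.* (b ℤ.* x ℤ.+ q)
          lem = ring

  val-comb : ∀ {n} k (f : Form n) l g ρ → val (comb k f l g) ρ ≡ k ℤ.* val f ρ ℤ.+ l ℤ.* val g ρ
  val-comb k (c , as) l (d , bs) ρ rewrite dot-comb k as l bs ρ = lem k l c d (dot as ρ) (dot bs ρ)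
    where lem : ∀ k l c d p q → (k ℤ.* c ℤ.+ l ℤ.* d) ℤ.+ (k ℤ.* p ℤ.+ l ℤ.* q) ≡ k ℤ.* (c ℤ.+ p) ℤ.+ l ℤ.* (d ℤ.+ q)
          lem = ring

  NonNeg Zero : ∀ {n} → Vec ℤ n → Form n → Set
  NonNeg ρ f = + 0 ℤ.≤ val f ρ
  Zero ρ f = val f ρ ≡ + 0

  nonneg-* : ∀ k {x} → + 0 ℤ.≤ x → + 0 ℤ.≤ + k ℤ.* x
  nonneg-* k {x} p = subst (ℤ._≤ (+ k ℤ.* x)) (ℤP.*-zeroʳ (+ k)) (ℤP.*-monoˡ-≤-nonNeg (+ k) p)

  comb-nonneg : ∀ {n} ρ k l (f g : Form n) → NonNeg ρ f → NonNeg ρ g → NonNeg ρ (comb (+ k) f (+ l) g)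
  comb-nonneg ρ k l f g p q rewrite val-comb (+ k) f (+ l) g ρ = ℤP.+-mono-≤ (nonneg-* k p) (nonneg-* l q)

  comb-eq-nonneg : ∀ {n} ρ k l (f g : Form n) → NonNeg ρ f → Zero ρ g → NonNeg ρ (comb (+ k) f l g)
  comb-eq-nonneg ρ k l f g p q rewrite val-comb (+ k) f l g ρ | q | ℤP.*-zeroʳ l | ℤP.+-identityʳ (+ k ℤ.* val f ρ) = nonneg-* k p

  comb-zero : ∀ {n} ρ k l (f g : Form n) → Zero ρ f → Zero ρ g → Zero ρ (comb k f l g)
  comb-zero ρ k l f g p q rewrite val-comb k f l g ρ | p | q | ℤP.*-zeroʳ k | ℤP.*-zeroʳ l = refl

  isZero : ℤ → Bool
  isZero (+ 0) = true
  isZero _ = false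

  -- A form whose first coefficient is not 0 yields the empty list. Losing a fact is harmless in a
  -- refutation, so the cancellations below never have to be proved.
  tail0 : ∀ {n} → Form (suc n) → List (Form n)
  tail0 (c , + 0 ∷ as) = (c , as) ∷ []
  tail0 _ = []

  tail0-val : ∀ {n} c (as : Vec ℤ n) x ρ → val (c , + 0 ∷ as) (x ∷ ρ) ≡ val (c , as) ρ
  tail0-val c as x ρ = cong (λ z → c ℤ.+ z) (trans (cong (ℤ._+ dot as ρ) (ℤP.*-zeroˡ x)) (ℤP.+-identityˡ _))

  tail0-nonneg : ∀ {n} x ρ (f : Form (suc n)) → NonNeg (x ∷ ρ) f → All (NonNeg ρ) (tail0 f)
  tail0-nonneg x ρ (c , + 0 ∷ as) p = subst (+ 0 ℤ.≤_) (tail0-val c as x ρ) p ∷ []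
  tail0-nonneg x ρ (c , + suc _ ∷ as) p = []
  tail0-nonneg x ρ (c , -[1+ _ ] ∷ as) p = []

  tail0-zero : ∀ {n} x ρ (f : Form (suc n)) → Zero (x ∷ ρ) f → All (Zero ρ) (tail0 f)
  tail0-zero x ρ (c , + 0 ∷ as) p = trans (sym (tail0-val c as x ρ)) p ∷ []
  tail0-zero x ρ (c , + suc _ ∷ as) p = []
  tail0-zero x ρ (c , -[1+ _ ] ∷ as) p = []

  -- The first argument is fuel. A wrong value would cost only strength, since `choose` verifies the
  -- division before relying on it.
  gcdF : ℕ → ℕ → ℕ → ℕ
  gcdF zero a b = a
  gcdF (suc n) a zero = a
  gcdF (suc n) a (suc b) = gcdF n (suc b) (a % suc b)

  content : ∀ {n} → Vec ℤ n → ℕ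
  content [] = 0
  content (a ∷ as) = gcdF 100 (content as) ∣ a ∣

  -- Both signs round towards minus infinity: -(n + 1) divided by g + 1 gives -(n / (g + 1)) - 1.
  -- This makes the remainder in `choose` nonnegative.
  divFloor : ℤ → ℕ → ℤ
  divFloor z 0 = z
  divFloor (+ n) (suc g) = + (n / suc g)
  divFloor -[1+ n ] (suc g) = -[1+ n / suc g ]

  allZero : ∀ {n} → Vec ℤ n → Bool
  allZero [] = true
  allZero (a ∷ as) = isZero a ∧ allZero as

  allZero-dot : ∀ {n} (as : Vec ℤ n) ρ → T (allZero as) → dot as ρ ≡ + 0
  allZero-dot [] [] _ = refl
  allZero-dot (+ 0 ∷ as) (x ∷ ρ) p = trans (cong₂ ℤ._+_ (ℤP.*-zeroˡ x) (allZero-dot as ρ p)) refl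

  -- Dividing by the content and rounding the constant down loses no integer solution;
  -- the result is only used if the remainder form is a constant r with 0 ≤ r < g.
  choose : ∀ {n} → ℕ → Form n → Form n → Form n → Form n
  choose g f f′ (+ r , bs) = if allZero bs ∧ (r ℕ.<ᵇ suc g) then f′ else f
  choose g f f′ (-[1+ _ ] , bs) = f

  divide : ∀ {n} → ℕ → Form n → Form n
  divide g (c , as) = divFloor c g , Vec.map (λ a → divFloor a g) as

  tightenBy : ∀ {n} → ℕ → Form n → Form n
  tightenBy zero f = f
  tightenBy (suc g) f = choose g f (divide (suc g) f) (comb (+ 1) f (ℤ.- (+ suc g)) (divide (suc g) f))

  tighten : ∀ {n} → Form n → Form n
  tighten f = tightenBy (content (proj₂ f)) f

  -- If v′ ≤ -1, then v = r + (g + 1) v′ ≤ r - (g + 1) < 0.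
  tighten-lemma : ∀ g r v v′ → + 1 ℤ.* v ℤ.+ ℤ.- (+ suc g) ℤ.* v′ ≡ + r → r ℕ.< suc g → + 0 ℤ.≤ v → + 0 ℤ.≤ v′
  tighten-lemma g r v (+ n) eq r<g v≥0 = ℤ.+≤+ z≤n
  tighten-lemma g r v (-[1+ n ]) eq r<g v≥0 = ⊥-elim (ℤP.<-irrefl refl (ℤP.≤-<-trans v≥0 v<0))
    where
    lem : ∀ v w a → + 1 ℤ.* v ℤ.+ ℤ.- a ℤ.* w ≡ v ℤ.- a ℤ.* w
    lem = ring
    lem2 : ∀ v b → v ≡ (v ℤ.- b) ℤ.+ b
    lem2 = ring
    v≡ : v ≡ + r ℤ.+ + suc g ℤ.* -[1+ n ]
    v≡ = trans (lem2 v (+ suc g ℤ.* -[1+ n ])) (cong (ℤ._+ _) (trans (sym (lem v -[1+ n ] (+ suc g))) eq))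
    le : + suc g ℤ.* -[1+ n ] ℤ.≤ ℤ.- (+ suc g)
    le = subst (λ z → + suc g ℤ.* -[1+ n ] ℤ.≤ z) (trans (ℤP.*-comm (+ suc g) -[1+ 0 ]) (ℤP.-1*i≡-i (+ suc g))) (ℤP.*-monoˡ-≤-nonNeg (+ suc g) (ℤ.-≤- z≤n))
    v<0 : v ℤ.< + 0
    v<0 = subst (ℤ._< + 0) (sym v≡) (ℤP.≤-<-trans (ℤP.+-monoʳ-≤ (+ r) le)
            (subst (λ z → + r ℤ.+ (ℤ.- (+ suc g)) ℤ.< z) (ℤP.+-inverseʳ (+ suc g)) (ℤP.+-monoˡ-< (ℤ.- (+ suc g)) (ℤ.+<+ r<g))))

  T-∧ : ∀ {a b} → T (a ∧ b) → T a × T b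
  T-∧ {true} {true} _ = _ , _

  if-prop : ∀ {A : Set} (P : A → Set) b {x y} → (T b → P x) → P y → P (if b then x else y)
  if-prop P true p q = p _
  if-prop P false p q = q

  choose-nonneg : ∀ {n} g ρ (f f′ h : Form n) → val h ρ ≡ + 1 ℤ.* val f ρ ℤ.+ ℤ.- (+ suc g) ℤ.* val f′ ρ →
    NonNeg ρ f → NonNeg ρ (choose g f f′ h)
  choose-nonneg g ρ f f′ (-[1+ _ ] , bs) eq p = p
  choose-nonneg g ρ f f′ (+ r , bs) eq p = if-prop (NonNeg ρ) (allZero bs ∧ (r ℕ.<ᵇ suc g))
    (λ t → tighten-lemma g r (val f ρ) (val f′ ρ)
             (trans (sym eq) (trans (cong (λ z → + r ℤ.+ z) (allZero-dot bs ρ (proj₁ (T-∧ t)))) (ℤP.+-identityʳ (+ r))))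
             (ℕP.<ᵇ⇒< r _ (proj₂ (T-∧ {allZero bs} t))) p)
    p

  tightenBy-nonneg : ∀ {n} g ρ (f : Form n) → NonNeg ρ f → NonNeg ρ (tightenBy g f)
  tightenBy-nonneg zero ρ f p = p
  tightenBy-nonneg (suc g) ρ f p = choose-nonneg g ρ f (divide (suc g) f) (comb (+ 1) f (ℤ.- (+ suc g)) (divide (suc g) f)) (val-comb (+ 1) f (ℤ.- (+ suc g)) (divide (suc g) f) ρ) p

  tighten-nonneg : ∀ {n} ρ (f : Form n) → NonNeg ρ f → NonNeg ρ (tighten f)
  tighten-nonneg ρ f = tightenBy-nonneg (content (proj₂ f)) ρ f

  headC : ∀ {n} → Form (suc n) → ℤ
  headC (_ , a ∷ _) = a

  unit? : ℤ → Bool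
  unit? (+ 1) = true
  unit? -[1+ 0 ] = true
  unit? _ = false

  -- Only a head coefficient ±1 allows a substitution without scaling the other forms. If there is
  -- none, `eqSplit` takes over.
  pivot : ∀ {n} (es : List (Form (suc n))) → List (Form (suc n))
  pivot [] = []
  pivot (e ∷ es) = if unit? (headC e) then e ∷ [] else pivot es

  pivot-zero : ∀ {n} ρ (es : List (Form (suc n))) → All (Zero ρ) es → All (Zero ρ) (pivot es)
  pivot-zero ρ [] ps = []
  pivot-zero ρ (e ∷ es) (p ∷ ps) = if-prop (All (Zero ρ)) (unit? (headC e)) (λ _ → p ∷ []) (pivot-zero ρ es ps)

  -- For a pivot with head ±1, c - (head c * head e) e has head 0.
  elimEq : ∀ {n} → Form (suc n) → Form (suc n) → Form (suc n)
  elimEq e c = comb (+ 1) c (ℤ.- (headC c ℤ.* headC e)) e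

  neg : ∀ {n} → Form n → Form n
  neg f = comb -[1+ 0 ] f (+ 0) f

  neg-nonneg : ∀ {n} ρ (f : Form n) → Zero ρ f → NonNeg ρ (neg f)
  neg-nonneg ρ f p rewrite val-comb -[1+ 0 ] f (+ 0) f ρ | p = ℤ.+≤+ z≤n

  split : ∀ {n} → List (Form (suc n)) → List (Form n) × List (Form (suc n)) × List (Form (suc n))
  split [] = [] , [] , []
  split (f@(c , + 0 ∷ as) ∷ fs) with split fs
  ... | z , p , m = (c , as) ∷ z , p , m
  split (f@(c , + suc _ ∷ as) ∷ fs) with split fs
  ... | z , p , m = z , f ∷ p , m
  split (f@(c , -[1+ _ ] ∷ as) ∷ fs) with split fs
  ... | z , p , m = z , p , f ∷ m

  split-nonneg : ∀ {n} x ρ (fs : List (Form (suc n))) → All (NonNeg (x ∷ ρ)) fs →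
    let z , p , m = split fs in All (NonNeg ρ) z × All (NonNeg (x ∷ ρ)) p × All (NonNeg (x ∷ ρ)) m
  split-nonneg x ρ [] [] = [] , [] , []
  split-nonneg x ρ ((c , + 0 ∷ as) ∷ fs) (q ∷ qs) with split fs | split-nonneg x ρ fs qs
  ... | _ | a , b , d = subst (+ 0 ℤ.≤_) (tail0-val c as x ρ) q ∷ a , b , d
  split-nonneg x ρ ((c , + suc _ ∷ as) ∷ fs) (q ∷ qs) with split fs | split-nonneg x ρ fs qs
  ... | _ | a , b , d = a , q ∷ b , d
  split-nonneg x ρ ((c , -[1+ _ ] ∷ as) ∷ fs) (q ∷ qs) with split fs | split-nonneg x ρ fs qs
  ... | _ | a , b , d = a , b , q ∷ d

  -- The two heads have opposite signs, so these multipliers cancel the first variable: one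
  -- Fourier-Motzkin step.
  pairUp : ∀ {n} → Form (suc n) → Form (suc n) → List (Form n)
  pairUp p m = map tighten (tail0 (comb (+ ∣ headC m ∣) p (+ ∣ headC p ∣) m))

  -- Tightening both halves of an equation recovers divisibility: 2x = 1 becomes 0 ≤ x - 1 and 0 ≤
  -- -x, which is refuted in the next step.
  eqSplit : ∀ {n} → List (Form (suc n)) → List (Form n) × List (Form (suc n))
  eqSplit [] = [] , []
  eqSplit (f@(c , + 0 ∷ as) ∷ fs) with eqSplit fs
  ... | z , r = (c , as) ∷ z , r
  eqSplit (f@(c , + suc _ ∷ as) ∷ fs) with eqSplit fs
  ... | z , r = z , tighten f ∷ tighten (neg f) ∷ r
  eqSplit (f@(c , -[1+ _ ] ∷ as) ∷ fs) with eqSplit fs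
  ... | z , r = z , tighten f ∷ tighten (neg f) ∷ r

  zero⇒nonneg : ∀ {n} ρ (f : Form n) → Zero ρ f → NonNeg ρ f
  zero⇒nonneg ρ f p = ℤP.≤-reflexive (sym p)

  eqSplit-ok : ∀ {n} x ρ (fs : List (Form (suc n))) → All (Zero (x ∷ ρ)) fs →
    let z , r = eqSplit fs in All (Zero ρ) z × All (NonNeg (x ∷ ρ)) r
  eqSplit-ok x ρ [] [] = [] , []
  eqSplit-ok x ρ ((c , + 0 ∷ as) ∷ fs) (q ∷ qs) with eqSplit fs | eqSplit-ok x ρ fs qs
  ... | _ | a , b = trans (sym (tail0-val c as x ρ)) q ∷ a , b
  eqSplit-ok x ρ (f@(c , + suc _ ∷ as) ∷ fs) (q ∷ qs) with eqSplit fs | eqSplit-ok x ρ fs qs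
  ... | _ | a , b = a , tighten-nonneg (x ∷ ρ) f (zero⇒nonneg (x ∷ ρ) f q) ∷ tighten-nonneg (x ∷ ρ) (neg f) (neg-nonneg (x ∷ ρ) f q) ∷ b
  eqSplit-ok x ρ (f@(c , -[1+ _ ] ∷ as) ∷ fs) (q ∷ qs) with eqSplit fs | eqSplit-ok x ρ fs qs
  ... | _ | a , b = a , tighten-nonneg (x ∷ ρ) f (zero⇒nonneg (x ∷ ρ) f q) ∷ tighten-nonneg (x ∷ ρ) (neg f) (neg-nonneg (x ∷ ρ) f q) ∷ b

  negConst : Form 0 → Bool
  negConst (-[1+ _ ] , _) = true
  negConst (+ _ , _) = false

  nonzeroConst : Form 0 → Bool
  nonzeroConst (+ 0 , _) = false
  nonzeroConst _ = true

  anyB : ∀ {A : Set} → (A → Bool) → List A → Bool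
  anyB p [] = false
  anyB p (x ∷ xs) = p x ∨ anyB p xs

  refute : ∀ n → List (Form n) → List (Form n) → Bool
  refute zero es fs = anyB nonzeroConst es ∨ anyB negConst fs
  refute (suc n) es fs with pivot es
  ... | e ∷ _ = refute n (concatMap (λ c → tail0 (elimEq e c)) es) (concatMap (λ c → map tighten (tail0 (elimEq e c))) fs)
  ... | [] with eqSplit es
  ... | es′ , gs with split (gs ++ fs)
  ... | z , ps , ms = refute n es′ (z ++ concatMap (λ p → concatMap (pairUp p) ms) ps)

  T-∨ : ∀ a {b} {A : Set} → (T a → A) → (T b → A) → T (a ∨ b) → A
  T-∨ true f g t = f t
  T-∨ false f g t = g t

  map-tighten : ∀ {n} ρ (fs : List (Form n)) → All (NonNeg ρ) fs → All (NonNeg ρ) (map tighten fs)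
  map-tighten ρ [] [] = []
  map-tighten ρ (f ∷ fs) (p ∷ ps) = tighten-nonneg ρ f p ∷ map-tighten ρ fs ps

  all-concatMap : ∀ {A B : Set} {P : A → Set} {Q : B → Set} (f : A → List B) →
    (∀ x → P x → All Q (f x)) → ∀ xs → All P xs → All Q (concatMap f xs)
  all-concatMap f h [] [] = []
  all-concatMap f h (x ∷ xs) (p ∷ ps) = AllP.++⁺ (h x p) (all-concatMap f h xs ps)

  anyB-elim : ∀ {A : Set} {P : A → Set} {q : A → Bool} → (∀ x → T (q x) → ¬ P x) → ∀ xs → All P xs → ¬ T (anyB q xs)
  anyB-elim h (x ∷ xs) (p ∷ ps) = T-∨ _ (λ t → h x t p) (anyB-elim h xs ps)

  -- Soundness suffices: every use below is an instance with closed coefficients, on which `refute`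
  -- evaluates to `true`.
  refute-sound : ∀ n ρ es fs → All (Zero ρ) es → All (NonNeg ρ) fs → ¬ T (refute n es fs)
  refute-sound zero [] es fs zs ps = T-∨ (anyB nonzeroConst es) (anyB-elim h₁ es zs) (anyB-elim h₂ fs ps)
    where
    h₁ : ∀ f → T (nonzeroConst f) → ¬ Zero [] f
    h₁ (+ suc n , []) _ ()
    h₁ (-[1+ n ] , []) _ ()
    h₂ : ∀ f → T (negConst f) → ¬ NonNeg [] f
    h₂ (-[1+ n ] , []) _ ()
  refute-sound (suc n) (x ∷ ρ) es fs zs ps with pivot es | pivot-zero (x ∷ ρ) es zs
  ... | e ∷ _ | ez ∷ _ = refute-sound n ρ _ _
          (all-concatMap (λ c → tail0 (elimEq e c)) (λ c cz → tail0-zero x ρ (elimEq e c) (comb-zero (x ∷ ρ) (+ 1) (ℤ.- (headC c ℤ.* headC e)) c e cz ez)) es zs)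
          (all-concatMap _ (λ c cp → map-tighten ρ _ (tail0-nonneg x ρ (elimEq e c) (comb-eq-nonneg (x ∷ ρ) 1 (ℤ.- (headC c ℤ.* headC e)) c e cp ez))) fs ps)
  ... | [] | _ with eqSplit es | eqSplit-ok x ρ es zs
  ... | es′ , gs | zs′ , gp with split (gs ++ fs) | split-nonneg x ρ (gs ++ fs) (AllP.++⁺ gp ps)
  ... | z , pp , mm | zp , ppp , mmp = refute-sound n ρ _ _ zs′
          (AllP.++⁺ zp (all-concatMap _ (λ p pn → all-concatMap (pairUp p)
             (λ m mn → map-tighten ρ _ (tail0-nonneg x ρ (comb (+ ∣ headC m ∣) p (+ ∣ headC p ∣) m) (comb-nonneg (x ∷ ρ) ∣ headC m ∣ ∣ headC p ∣ p m pn mn))) mm mmp) pp ppp))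

  infixl 7 _:+_
  infixr 8 _:*_
  infix 6 _:≤_ _:<_ _:=_
  infix 3 _⊢_

  data Ex (n : ℕ) : Set where
    var : Fin n → Ex n
    K : ℕ → Ex n
    _:+_ : Ex n → Ex n → Ex n
    _:*_ : ℕ → Ex n → Ex n

  data Fact (n : ℕ) : Set where
    _:≤_ _:<_ _:=_ : Ex n → Ex n → Fact n
    absurd : Fact n

  ev : ∀ {n} → Ex n → Vec ℕ n → ℕ
  ev (var i) ρ = Vec.lookup ρ i
  ev (K k) ρ = k
  ev (a :+ b) ρ = ev a ρ ℕ.+ ev b ρ
  ev (k :* a) ρ = k ℕ.* ev a ρ

  holds : ∀ {n} → Fact n → Vec ℕ n → Set
  holds (a :≤ b) ρ = ev a ρ ℕ.≤ ev b ρ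
  holds (a :< b) ρ = ev a ρ ℕ.< ev b ρ
  holds (a := b) ρ = ev a ρ ≡ ev b ρ
  holds absurd ρ = ⊥

  constF : ∀ {n} → ℤ → Form n
  constF c = c , Vec.replicate _ (+ 0)

  dot-0 : ∀ {n} (ρ : Vec ℤ n) → dot (Vec.replicate n (+ 0)) ρ ≡ + 0
  dot-0 [] = refl
  dot-0 (x ∷ ρ) = trans (cong₂ ℤ._+_ (ℤP.*-zeroˡ x) (dot-0 ρ)) refl

  unitV : ∀ {n} → Fin n → Vec ℤ n
  unitV zero = + 1 ∷ Vec.replicate _ (+ 0)
  unitV (suc i) = + 0 ∷ unitV i

  dot-unit : ∀ {n} (i : Fin n) (ρ : Vec ℕ n) → dot (unitV i) (Vec.map +_ ρ) ≡ + Vec.lookup ρ i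
  dot-unit zero (x ∷ ρ) = trans (cong₂ ℤ._+_ (ℤP.*-identityˡ (+ x)) (dot-0 (Vec.map +_ ρ))) (ℤP.+-identityʳ (+ x))
  dot-unit (suc i) (x ∷ ρ) = trans (cong₂ ℤ._+_ (ℤP.*-zeroˡ (+ x)) (dot-unit i ρ)) (ℤP.+-identityˡ _)

  form : ∀ {n} → Ex n → Form n
  form (var i) = + 0 , unitV i
  form (K k) = constF (+ k)
  form (a :+ b) = comb (+ 1) (form a) (+ 1) (form b)
  form (k :* a) = comb (+ k) (form a) (+ 0) (form a)

  form-val : ∀ {n} (e : Ex n) ρ → val (form e) (Vec.map +_ ρ) ≡ + ev e ρ
  form-val (var i) ρ = trans (ℤP.+-identityˡ _) (dot-unit i ρ)
  form-val (K k) ρ = trans (cong (λ z → + k ℤ.+ z) (dot-0 (Vec.map +_ ρ))) (ℤP.+-identityʳ (+ k))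
  form-val (a :+ b) ρ = trans (val-comb (+ 1) (form a) (+ 1) (form b) (Vec.map +_ ρ))
    (cong₂ ℤ._+_ (trans (ℤP.*-identityˡ _) (form-val a ρ)) (trans (ℤP.*-identityˡ _) (form-val b ρ)))
  form-val (k :* a) ρ = trans (val-comb (+ k) (form a) (+ 0) (form a) (Vec.map +_ ρ))
    (trans (cong₂ ℤ._+_ (cong (λ z → + k ℤ.* z) (form-val a ρ)) (ℤP.*-zeroˡ (val (form a) (Vec.map +_ ρ))))
      (trans (ℤP.+-identityʳ _) (sym (ℤP.pos-* k (ev a ρ)))))

  -- The constant c is 0 for ≤ and for equations, and -1 for <, since a < b over ℤ means 0 ≤ b - a -
  -- 1.
  diff : ∀ {n} → ℤ → Ex n → Ex n → Form n
  diff c a b = comb (+ 1) (constF c) (+ 1) (comb (+ 1) (form b) -[1+ 0 ] (form a))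

  diff-val : ∀ {n} c (a b : Ex n) ρ → val (diff c a b) (Vec.map +_ ρ) ≡ c ℤ.+ (+ ev b ρ ℤ.- + ev a ρ)
  diff-val c a b ρ =
    trans (val-comb (+ 1) (constF c) (+ 1) (comb (+ 1) (form b) -[1+ 0 ] (form a)) (Vec.map +_ ρ))
     (cong₂ ℤ._+_ (trans (ℤP.*-identityˡ _) (trans (cong (λ z → c ℤ.+ z) (dot-0 (Vec.map +_ ρ))) (ℤP.+-identityʳ c)))
       (trans (ℤP.*-identityˡ _) (trans (val-comb (+ 1) (form b) -[1+ 0 ] (form a) (Vec.map +_ ρ))
         (cong₂ ℤ._+_ (trans (ℤP.*-identityˡ _) (form-val b ρ)) (trans (ℤP.-1*i≡-i _) (cong ℤ.-_ (form-val a ρ)))))))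

  nonnegVars : ∀ {n} → List (Form n)
  nonnegVars {zero} = []
  nonnegVars {suc n} = (+ 0 , unitV zero) ∷ map (λ (c , as) → c , + 0 ∷ as) nonnegVars

  nonnegVars-ok : ∀ {n} (ρ : Vec ℕ n) → All (NonNeg (Vec.map +_ ρ)) nonnegVars
  nonnegVars-ok [] = []
  nonnegVars-ok (x ∷ ρ) =
    subst (+ 0 ℤ.≤_) (sym (trans (ℤP.+-identityˡ _) (dot-unit zero (x ∷ ρ)))) (ℤ.+≤+ z≤n) ∷
    AllP.map⁺ (All.map (λ {f} p → subst (+ 0 ℤ.≤_) (sym (tail0-val (proj₁ f) (proj₂ f) (+ x) (Vec.map +_ ρ))) p) (nonnegVars-ok ρ))

  eqs ineqs : ∀ {n} → List (Fact n) → List (Form n)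
  eqs [] = []
  eqs ((a := b) ∷ hs) = diff (+ 0) a b ∷ eqs hs
  eqs (_ ∷ hs) = eqs hs
  ineqs [] = nonnegVars
  ineqs ((a :≤ b) ∷ hs) = diff (+ 0) a b ∷ ineqs hs
  ineqs ((a :< b) ∷ hs) = diff -[1+ 0 ] a b ∷ ineqs hs
  ineqs (_ ∷ hs) = ineqs hs

  diff-≤ : ∀ {n} (a b : Ex n) ρ → ev a ρ ℕ.≤ ev b ρ → NonNeg (Vec.map +_ ρ) (diff (+ 0) a b)
  diff-≤ a b ρ p = subst (+ 0 ℤ.≤_) (sym (trans (diff-val (+ 0) a b ρ) (ℤP.+-identityˡ _))) (ℤP.i≤j⇒0≤j-i (ℤ.+≤+ p))

  diff-< : ∀ {n} (a b : Ex n) ρ → ev a ρ ℕ.< ev b ρ → NonNeg (Vec.map +_ ρ) (diff -[1+ 0 ] a b)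
  diff-< a b ρ p = subst (+ 0 ℤ.≤_) (sym (trans (diff-val -[1+ 0 ] a b ρ) (lem (+ ev a ρ) (+ ev b ρ)))) (ℤP.i≤j⇒0≤j-i (ℤ.+≤+ p))
    where lem : ∀ x y → -[1+ 0 ] ℤ.+ (y ℤ.- x) ≡ y ℤ.- (+ 1 ℤ.+ x)
          lem = ring

  eqs-ok : ∀ {n} (hs : List (Fact n)) ρ → All (λ h → holds h ρ) hs → All (Zero (Vec.map +_ ρ)) (eqs hs)
  eqs-ok [] ρ [] = []
  eqs-ok ((a := b) ∷ hs) ρ (p ∷ ps) =
    trans (diff-val (+ 0) a b ρ) (trans (ℤP.+-identityˡ _) (trans (cong (λ z → + ev b ρ ℤ.- + z) p) (ℤP.+-inverseʳ (+ ev b ρ)))) ∷ eqs-ok hs ρ ps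
  eqs-ok ((a :≤ b) ∷ hs) ρ (p ∷ ps) = eqs-ok hs ρ ps
  eqs-ok ((a :< b) ∷ hs) ρ (p ∷ ps) = eqs-ok hs ρ ps

  ineqs-ok : ∀ {n} (hs : List (Fact n)) ρ → All (λ h → holds h ρ) hs → All (NonNeg (Vec.map +_ ρ)) (ineqs hs)
  ineqs-ok [] ρ [] = nonnegVars-ok ρ
  ineqs-ok ((a :≤ b) ∷ hs) ρ (p ∷ ps) = diff-≤ a b ρ p ∷ ineqs-ok hs ρ ps
  ineqs-ok ((a :< b) ∷ hs) ρ (p ∷ ps) = diff-< a b ρ p ∷ ineqs-ok hs ρ ps
  ineqs-ok ((a := b) ∷ hs) ρ (p ∷ ps) = ineqs-ok hs ρ ps

  contra : ∀ {n} → List (Fact n) → Bool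
  contra hs = refute _ (eqs hs) (ineqs hs)

  data Sequent (n : ℕ) : Set where
    _⊢_ : List (Fact n) → Fact n → Sequent n

  hyps : ∀ {n} → Sequent n → List (Fact n)
  hyps (hs ⊢ g) = hs
  goal : ∀ {n} → Sequent n → Fact n
  goal (hs ⊢ g) = g

  decide : ∀ {n} → Sequent n → Bool
  decide (hs ⊢ a :≤ b) = contra ((b :< a) ∷ hs)
  decide (hs ⊢ a :< b) = contra ((b :≤ a) ∷ hs)
  decide (hs ⊢ a := b) = contra ((b :< a) ∷ hs) ∧ contra ((a :< b) ∷ hs)
  decide (hs ⊢ absurd) = contra hs

  contra-sound : ∀ {n} (hs : List (Fact n)) ρ → T (contra hs) → ¬ All (λ h → holds h ρ) hs
  contra-sound hs ρ t ps = refute-sound _ (Vec.map +_ ρ) (eqs hs) (ineqs hs) (eqs-ok hs ρ ps) (ineqs-ok hs ρ ps) t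

  decide-sound : ∀ {n} (s : Sequent n) → T (decide s) → ∀ ρ → All (λ h → holds h ρ) (hyps s) → holds (goal s) ρ
  decide-sound (hs ⊢ a :≤ b) t ρ ps = ℕP.≮⇒≥ λ p → contra-sound ((b :< a) ∷ hs) ρ t (p ∷ ps)
  decide-sound (hs ⊢ a :< b) t ρ ps = ℕP.≰⇒> λ p → contra-sound ((b :≤ a) ∷ hs) ρ t (p ∷ ps)
  decide-sound (hs ⊢ a := b) t ρ ps = ℕP.≤-antisym
    (ℕP.≮⇒≥ λ p → contra-sound ((b :< a) ∷ hs) ρ (proj₁ (T-∧ t)) (p ∷ ps))
    (ℕP.≮⇒≥ λ p → contra-sound ((a :< b) ∷ hs) ρ (proj₂ (T-∧ {contra ((b :< a) ∷ hs)} t)) (p ∷ ps))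
  decide-sound (hs ⊢ absurd) t ρ ps = contra-sound hs ρ t ps

  Fun : ℕ → Set → Set → Set
  Fun zero A B = B
  Fun (suc n) A B = A → Fun n A B

  apply : ∀ {A B : Set} n → Fun n A B → Vec A n → B
  apply zero f [] = f
  apply (suc n) f (x ∷ xs) = apply n (f x) xs

  Quant : ∀ n → (Vec ℕ n → Set) → Set
  Quant zero P = P []
  Quant (suc n) P = (x : ℕ) → Quant n (λ xs → P (x ∷ xs))

  quant : ∀ n {P : Vec ℕ n → Set} → (∀ xs → P xs) → Quant n P
  quant zero f = f []
  quant (suc n) f x = quant n (λ xs → f (x ∷ xs))

  Curry : ∀ {n} → List (Fact n) → Set → Vec ℕ n → Set
  Curry [] G ρ = G
  Curry (h ∷ hs) G ρ = holds h ρ → Curry hs G ρ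

  curryHyps : ∀ {n} (hs : List (Fact n)) {G : Set} ρ → (All (λ h → holds h ρ) hs → G) → Curry hs G ρ
  curryHyps [] ρ f = f []
  curryHyps (h ∷ hs) ρ f p = curryHyps hs ρ (λ ps → f (p ∷ ps))

  -- A use names its variables by abstraction; applying the function to all `var i` recovers the
  -- syntax tree.
  problem : ∀ n → Fun n (Ex n) (Sequent n) → Sequent n
  problem n f = apply n f (Vec.map var (Vec.allFin n))

  -- Abstract, so that conversion checking never unfolds these proofs.
  abstract
    lin : ∀ n (f : Fun n (Ex n) (Sequent n)) → {_ : T (decide (problem n f))} →
      Quant n (λ ρ → Curry (hyps (problem n f)) (holds (goal (problem n f)) ρ) ρ)
    lin n f {t} = quant n (λ ρ → curryHyps (hyps (problem n f)) ρ (decide-sound (problem n f) t ρ))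

open Linear using (lin; K; _:+_; _:*_; _:≤_; _:<_; _:=_; absurd; _⊢_)

-- Codes as lists of columns

𝟙 : Bool → ℕ
𝟙 b = if b then 1 else 0

infix 5 _==_
_==_ : ∀ {n} → Fin n → Fin n → Bool
x == y = ⌊ x FinP.≟ y ⌋

nz : ∀ {k} → Fin (suc k) → Bool
nz zero = false
nz (suc _) = true

sumL : ∀ {A : Set} → (A → ℕ) → List A → ℕ
sumL f [] = 0
sumL f (x ∷ xs) = f x + sumL f xs

sumL-+ : ∀ {A : Set} (f g : A → ℕ) xs → sumL (λ x → f x + g x) xs ≡ sumL f xs + sumL g xs
sumL-+ f g [] = refl
sumL-+ f g (x ∷ xs) rewrite sumL-+ f g xs =
  lin 4 (λ a b c d → [] ⊢ (a :+ b) :+ (c :+ d) := (a :+ c) :+ (b :+ d)) (f x) (g x) (sumL f xs) (sumL g xs)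

sumL-≤ : ∀ {A : Set} {f g : A → ℕ} xs → All (λ x → f x ≤ g x) xs → sumL f xs ≤ sumL g xs
sumL-≤ [] [] = z≤n
sumL-≤ (x ∷ xs) (p ∷ ps) = +-mono-≤ p (sumL-≤ xs ps)

sumL-const : ∀ {A : Set} (f : A → ℕ) c xs → All (λ x → f x ≡ c) xs → sumL f xs ≡ length xs * c
sumL-const f c [] [] = refl
sumL-const f c (x ∷ xs) (p ∷ ps) = cong₂ _+_ p (sumL-const f c xs ps)

sumL-map : ∀ {A B : Set} (f : B → ℕ) (g : A → B) xs → sumL f (List.map g xs) ≡ sumL (f ∘ g) xs
sumL-map f g [] = refl
sumL-map f g (x ∷ xs) = cong (f (g x) +_) (sumL-map f g xs)

sumL-++ : ∀ {A : Set} (f : A → ℕ) xs ys → sumL f (xs List.++ ys) ≡ sumL f xs + sumL f ys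
sumL-++ f [] ys = refl
sumL-++ f (x ∷ xs) ys rewrite sumL-++ f xs ys = sym (+-assoc (f x) _ _)

sumL-0 : ∀ {A : Set} (xs : List A) → sumL (λ _ → 0) xs ≡ 0
sumL-0 [] = refl
sumL-0 (x ∷ xs) = sumL-0 xs

sumL-cong : ∀ {A : Set} {f g : A → ℕ} → (∀ x → f x ≡ g x) → ∀ xs → sumL f xs ≡ sumL g xs
sumL-cong h [] = refl
sumL-cong h (x ∷ xs) = cong₂ _+_ (h x) (sumL-cong h xs)

wt : ∀ {k n} → Vec (Fin (suc k)) n → ℕ
wt [] = 0
wt (x ∷ xs) = 𝟙 (nz x) + wt xs

both agree : ∀ {k n} → Vec (Fin (suc k)) n → Vec (Fin (suc k)) n → ℕ
both [] [] = 0
both (x ∷ xs) (y ∷ ys) = 𝟙 (nz x ∧ nz y) + both xs ys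
agree [] [] = 0
agree (x ∷ xs) (y ∷ ys) = 𝟙 (nz x ∧ (x == y)) + agree xs ys

coord : ∀ {k} (x y : Fin (suc k)) →
  (if ⌊ x FinP.≟ y ⌋ then 0 else 1) + 𝟙 (nz x ∧ nz y) + 𝟙 (nz x ∧ (x == y)) ≡ 𝟙 (nz x) + 𝟙 (nz y)
coord zero zero = refl
coord zero (suc y) = refl
coord (suc x) zero = refl
coord (suc x) (suc y) with x FinP.≟ y
... | yes p = refl
... | no p = refl

-- In the sum of the weights a coordinate nonzero in both words counts twice, but it adds at most 1
-- to the distance: `both` makes up for one unit, and `agree` for the other if the symbols coincide.
dist-share : ∀ {k n} (x y : Vec (Fin (suc k)) n) → dist x y + both x y + agree x y ≡ wt x + wt y
dist-share [] [] = refl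
dist-share (x ∷ xs) (y ∷ ys) =
  lin 10 (λ a b c d e f p q r s → a :+ b :+ c := p :+ q ∷ d :+ e :+ f := r :+ s ∷ [] ⊢
          (a :+ d) :+ (b :+ e) :+ (c :+ f) := (p :+ r) :+ (q :+ s))
    (if ⌊ x FinP.≟ y ⌋ then 0 else 1) (𝟙 (nz x ∧ nz y)) (𝟙 (nz x ∧ (x == y)))
    (dist xs ys) (both xs ys) (agree xs ys) (𝟙 (nz x)) (𝟙 (nz y)) (wt xs) (wt ys) (coord x y) (dist-share xs ys)

agree≤both : ∀ {k n} (x y : Vec (Fin (suc k)) n) → agree x y ≤ both x y
agree≤both [] [] = z≤n
agree≤both (x ∷ xs) (y ∷ ys) = +-mono-≤ (lem x y) (agree≤both xs ys)
  where
  lem : ∀ {k} (x y : Fin (suc k)) → 𝟙 (nz x ∧ (x == y)) ≤ 𝟙 (nz x ∧ nz y)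
  lem zero y = z≤n
  lem (suc x) zero = z≤n
  lem (suc x) (suc y) with suc x == suc y
  ... | true = ≤-refl
  ... | false = z≤n

==-suc : ∀ {k} (x y : Fin k) → (Fin.suc x == suc y) ≡ (x == y)
==-suc x y with x FinP.≟ y
... | yes p = refl
... | no p = refl

sum-one : ∀ {k} (x : Fin k) → sum (λ i → 𝟙 (x == i)) ≡ 1
sum-one {suc k} zero = cong suc (sum-replicate-zero k)
sum-one (suc x) = trans (sum-cong-≗ (λ i → cong 𝟙 (==-suc x i))) (sum-one x)

wt-occ : ∀ {k n} (u : Vec (Fin (suc k)) n) → wt u ≡ sum (λ i → occ (suc i) u)
wt-occ {k} [] = sym (sum-replicate-zero k)
wt-occ (x ∷ u) = trans (cong₂ _+_ (lem x) (wt-occ u)) (sym (∑-distrib-+ (λ i → 𝟙 (x == suc i)) (λ i → occ (suc i) u)))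
  where
  lem : ∀ {k} (x : Fin (suc k)) → 𝟙 (nz x) ≡ sum (λ i → 𝟙 (x == suc i))
  lem {k} zero = sym (sum-replicate-zero k)
  lem (suc x) = sym (trans (sum-cong-≗ (λ i → cong 𝟙 (==-suc x i))) (sum-one x))

sum-lookup : ∀ {k} (w : Vec ℕ k) → sum (Vec.lookup w) ≡ Vec.sum w
sum-lookup [] = refl
sum-lookup (x ∷ w) = cong (x +_) (sum-lookup w)

composition-weight : ∀ {k n} (w : Vec ℕ k) (u : Vec (Fin (suc k)) n) → HasComposition w u → wt u ≡ weight w
composition-weight w u h = trans (wt-occ u) (trans (sum-cong-≗ h) (sum-lookup w))

toAllPairs : ∀ {A : Set} {R : A → A → Set} {C : List A} → Unique C →
  (∀ {x y} → x ∈ C → y ∈ C → x ≢ y → R x y) → AllPairs R C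
toAllPairs [] h = []
toAllPairs (p ∷ u) h =
  All.tabulate (λ y∈ → h (here refl) (there y∈) (All.lookup p y∈)) ∷ toAllPairs u (λ x∈ y∈ → h (there x∈) (there y∈))

Disjoint : ∀ {k n} → Vec (Fin (suc k)) n → Vec (Fin (suc k)) n → Set
Disjoint x y = both x y ≤ 1 × agree x y ≡ 0

-- By `dist-share`, `both` + `agree` ≤ 1; since `agree` ≤ `both`, the unit can only go to `both`.
far⇒disjoint : ∀ {k n} W (x y : Vec (Fin (suc k)) n) → 1 ≤ W → wt x ≡ W → wt y ≡ W →
  2 * W ∸ 1 ≤ dist x y → Disjoint x y
far⇒disjoint W x y 1≤W p q d =
    lin 6 (λ d b a x y W → d :+ b :+ a := x :+ y ∷ x := W ∷ y := W ∷ 2 :* W :≤ d :+ K 1 ∷ [] ⊢ b :≤ K 1) _ _ _ _ _ W (dist-share x y) p q d′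
  , lin 6 (λ d b a x y W → d :+ b :+ a := x :+ y ∷ x := W ∷ y := W ∷ 2 :* W :≤ d :+ K 1 ∷ a :≤ b ∷ [] ⊢ a := K 0) _ _ _ _ _ W (dist-share x y) p q d′ (agree≤both x y)
  where
  d′ : 2 * W ≤ dist x y + 1
  d′ = ≤-trans (m≤n+m∸n (2 * W) 1) (≤-trans (+-monoʳ-≤ 1 d) (≤-reflexive (+-comm 1 _)))

disjoint⇒far : ∀ {k n} W (x y : Vec (Fin (suc k)) n) → wt x ≡ W → wt y ≡ W → Disjoint x y → 2 * W ∸ 1 ≤ dist x y
disjoint⇒far W x y p q (b , a) = m≤n+o⇒m∸n≤o (2 * W) 1
  (lin 6 (λ d b a x y W → d :+ b :+ a := x :+ y ∷ x := W ∷ y := W ∷ b :≤ K 1 ∷ a := K 0 ∷ [] ⊢ 2 :* W :≤ K 1 :+ d) _ _ _ _ _ W (dist-share x y) p q b a)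

ccc-disjoint : ∀ {k n} (w : Vec ℕ k) C → 1 ≤ weight w → IsCCC {k} n (2 * weight w ∸ 1) w C → AllPairs Disjoint C
ccc-disjoint w C 1≤W (u , comp , far) = toAllPairs u λ {x} {y} x∈ y∈ x≢y →
  far⇒disjoint (weight w) x y 1≤W (composition-weight w x (All.lookup comp x∈))
    (composition-weight w y (All.lookup comp y∈)) (far x∈ y∈ x≢y)

shift-agree : ∀ {k n} (C : List (Vec (Fin (suc k)) (suc n))) → AllPairs (λ x y → agree x y ≡ 0) C →
  AllPairs (λ x y → agree x y ≡ 0) (List.map Vec.tail C)
shift-agree [] [] = []
shift-agree (x ∷ C) (p ∷ ps) = AllP.map⁺ (All.map (λ {y} → lem x y) p) ∷ shift-agree C ps
  where
  lem : ∀ {k n} (x y : Vec (Fin (suc k)) (suc n)) → agree x y ≡ 0 → agree (Vec.tail x) (Vec.tail y) ≡ 0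
  lem (x ∷ xs) (y ∷ ys) e = m+n≡0⇒n≡0 (𝟙 (nz x ∧ (x == y))) e

occ-head-tail : ∀ {k n} (a : Fin (suc k)) (C : List (Vec (Fin (suc k)) (suc n))) →
  sumL (occ a) C ≡ sumL (λ c → 𝟙 (Vec.head c == a)) C + sumL (occ a) (List.map Vec.tail C)
occ-head-tail a C = trans (sumL-cong (λ { (x ∷ c) → refl }) C)
  (trans (sumL-+ (λ c → 𝟙 (Vec.head c == a)) (λ c → occ a (Vec.tail c)) C)
    (cong (sumL (λ c → 𝟙 (Vec.head c == a)) C +_) (sym (sumL-map (occ a) Vec.tail C))))

same-head : ∀ {k n} (a : Fin k) (C : List (Vec (Fin (suc k)) (suc n))) → AllPairs (λ x y → agree x y ≡ 0) C →
  sumL (λ c → 𝟙 (Vec.head c == suc a)) C ≤ 1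
same-head a [] [] = z≤n
same-head a ((x ∷ xs) ∷ C) (p ∷ ps) with x FinP.≟ suc a
... | no _ = same-head a C ps
... | yes refl = s≤s (≤-reflexive (none C p))
  where
  none : ∀ C → All (λ y → agree (suc a ∷ xs) y ≡ 0) C → sumL (λ c → 𝟙 (Vec.head c == suc a)) C ≡ 0
  none [] [] = refl
  none ((y ∷ ys) ∷ C) (q ∷ qs) with y FinP.≟ suc a
  ... | no _ = none C qs
  ... | yes refl with a FinP.≟ a
  ...   | yes _ = case q of λ ()
  ...   | no a≢a = ⊥-elim (a≢a refl)

-- Two words with the same nonzero symbol at a coordinate would agree there, so each coordinate is
-- used by at most one word.
colour-bound : ∀ {k n} (a : Fin k) (C : List (Vec (Fin (suc k)) n)) → AllPairs (λ x y → agree x y ≡ 0) C →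
  sumL (occ (suc a)) C ≤ n
colour-bound {n = zero} a C ps = ≤-reflexive (trans (sumL-cong (λ { [] → refl }) C) (sumL-0 C))
colour-bound {n = suc n} a C ps = ≤-trans (≤-reflexive (occ-head-tail (suc a) C))
  (+-mono-≤ (same-head a C ps) (colour-bound a (List.map Vec.tail C) (shift-agree C ps)))

≤-floorDiv : ∀ {m n} d → 1 ≤ d → m * d ≤ n → m ≤ floorDiv n d
≤-floorDiv {m} {n} (suc d) _ le = ≤-trans (≤-reflexive (sym (m*n/n≡m m (suc d)))) (/-monoˡ-≤ (suc d) le)

-- Symbol 1 is the most frequent one of a composition, so `colour-bound` for it gives the sharpest
-- of the bounds n / w_i.
ccc-upper : ∀ {k n} (w : Vec ℕ (suc k)) → 1 ≤ Vec.head w → ∀ C → IsCCC n (2 * weight w ∸ 1) w C →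
  length C ≤ floorDiv n (Vec.head w)
ccc-upper {k} {n} (w₁ ∷ w) 1≤w₁ C ccc@(_ , comp , _) = ≤-floorDiv w₁ 1≤w₁
  (≤-trans (≤-reflexive (sym (sumL-const (occ (suc zero)) w₁ C (All.map (λ h → h zero) comp))))
    (colour-bound zero C (AllPairs.map proj₂ (ccc-disjoint (w₁ ∷ w) C (≤-trans 1≤w₁ (m≤m+n w₁ _)) ccc))))

-- Counting common coordinates of pairs of words

tri : ℕ → ℕ
tri zero = 0
tri (suc n) = n + tri n

pairSum : ∀ {A : Set} → (A → A → ℕ) → List A → ℕ
pairSum f [] = 0
pairSum f (x ∷ xs) = sumL (f x) xs + pairSum f xs

pairSum-bound : ∀ {A : Set} (f : A → A → ℕ) xs → AllPairs (λ x y → f x y ≤ 1) xs → pairSum f xs ≤ tri (length xs)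
pairSum-bound f [] [] = z≤n
pairSum-bound f (x ∷ xs) (p ∷ ps) = +-mono-≤
  (≤-trans (sumL-≤ {g = λ _ → 1} xs p) (≤-reflexive (trans (sumL-const (λ _ → 1) 1 xs (All.tabulate λ _ → refl)) (*-identityʳ _))))
  (pairSum-bound f xs ps)

-- Twice the difference of the two sides is (d - L)(d - L - 1), a product of consecutive integers.
-- Lowering L and d together leaves it unchanged, hence the double induction.
tri-convex : ∀ L d → L * d ≤ tri d + tri (suc L)
tri-convex zero d = z≤n
tri-convex (suc L) zero = ≤-trans (≤-reflexive (*-zeroʳ (suc L))) z≤n
tri-convex (suc L) (suc d) = begin
  suc L * suc d ≡⟨ lem L d ⟩
  1 + d + (L + L * d) ≤⟨ +-monoʳ-≤ (1 + d) (+-monoʳ-≤ L (tri-convex L d)) ⟩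
  1 + d + (L + (tri d + tri (suc L))) ≡⟨ lin 4 (λ d a L b → [] ⊢ K 1 :+ d :+ (L :+ (a :+ b)) := d :+ a :+ (K 1 :+ L :+ b)) d (tri d) L (tri (suc L)) ⟩
  d + tri d + (suc L + tri (suc L)) ∎
  where
  open ≤-Reasoning
  lem : ∀ L d → suc L * suc d ≡ 1 + d + (L + L * d)
  lem = solve-∀

heads : ∀ {k n} → List (Vec (Fin (suc k)) (suc n)) → ℕ
heads = sumL (λ c → 𝟙 (nz (Vec.head c)))

head-pairs : ∀ {k n} (C : List (Vec (Fin (suc k)) (suc n))) →
  pairSum (λ x y → 𝟙 (nz (Vec.head x) ∧ nz (Vec.head y))) C ≡ tri (heads C)
head-pairs [] = refl
head-pairs ((zero ∷ _) ∷ C) = cong₂ _+_ (sumL-0 C) (head-pairs C)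
head-pairs ((suc _ ∷ _) ∷ C) = cong₂ _+_ refl (head-pairs C)

pairSum-+ : ∀ {A : Set} (f g : A → A → ℕ) xs → pairSum (λ x y → f x y + g x y) xs ≡ pairSum f xs + pairSum g xs
pairSum-+ f g [] = refl
pairSum-+ f g (x ∷ xs) rewrite pairSum-+ f g xs | sumL-+ (f x) (g x) xs =
  lin 4 (λ a b c d → [] ⊢ (a :+ b) :+ (c :+ d) := (a :+ c) :+ (b :+ d)) (sumL (f x) xs) (sumL (g x) xs) (pairSum f xs) (pairSum g xs)

pairSum-cong : ∀ {A : Set} {f g : A → A → ℕ} → (∀ x y → f x y ≡ g x y) → ∀ xs → pairSum f xs ≡ pairSum g xs
pairSum-cong h [] = refl
pairSum-cong h (x ∷ xs) = cong₂ _+_ (sumL-cong (h x) xs) (pairSum-cong h xs)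

pairSum-map : ∀ {A B : Set} (f : B → B → ℕ) (g : A → B) xs → pairSum f (List.map g xs) ≡ pairSum (λ x y → f (g x) (g y)) xs
pairSum-map f g [] = refl
pairSum-map f g (x ∷ xs) = cong₂ _+_ (sumL-map (f (g x)) g xs) (pairSum-map f g xs)

-- The coordinate with d nonzero entries contributes tri d to the pair count, and
-- (d - λ)(d - λ + 1) ≥ 0 for λ = suc L.
pair-count : ∀ {k n} L (C : List (Vec (Fin (suc k)) n)) → L * sumL wt C ≤ pairSum both C + n * tri (suc L)
pair-count {n = zero} L C = ≤-trans (≤-reflexive (trans (cong (L *_) (trans (sumL-cong (λ { [] → refl }) C) (sumL-0 C))) (*-zeroʳ L))) z≤n
pair-count {n = suc n} L C = begin
  L * sumL wt C ≡⟨ cong (L *_) wts ⟩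
  L * (heads C + sumL wt C′) ≡⟨ *-distribˡ-+ L (heads C) (sumL wt C′) ⟩
  L * heads C + L * sumL wt C′ ≤⟨ +-mono-≤ (tri-convex L (heads C)) (pair-count L C′) ⟩
  (tri (heads C) + tri (suc L)) + (pairSum both C′ + n * tri (suc L))
    ≡⟨ lin 4 (λ a b c d → [] ⊢ (a :+ b) :+ (c :+ d) := (a :+ c) :+ (b :+ d)) (tri (heads C)) (tri (suc L)) (pairSum both C′) (n * tri (suc L)) ⟩
  (tri (heads C) + pairSum both C′) + suc n * tri (suc L) ≡⟨ cong (_+ suc n * tri (suc L)) (sym boths) ⟩
  pairSum both C + suc n * tri (suc L) ∎
  where
  open ≤-Reasoning
  C′ = List.map Vec.tail C
  wts : sumL wt C ≡ heads C + sumL wt C′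
  wts = trans (sumL-cong (λ { (x ∷ c) → refl }) C)
    (trans (sumL-+ (λ c → 𝟙 (nz (Vec.head c))) (λ c → wt (Vec.tail c)) C) (cong (heads C +_) (sym (sumL-map wt Vec.tail C))))
  boths : pairSum both C ≡ tri (heads C) + pairSum both C′
  boths = trans (pairSum-cong (λ { (x ∷ c) (y ∷ d) → refl }) C)
    (trans (pairSum-+ (λ x y → 𝟙 (nz (Vec.head x) ∧ nz (Vec.head y))) (λ x y → both (Vec.tail x) (Vec.tail y)) C)
      (cong₂ _+_ (head-pairs C) (sym (pairSum-map both Vec.tail C))))

-- The choice L = λ - 1, made later, fits coordinates with λ or λ - 1 nonzero entries, for which
-- `tri-convex` is an equality.
ccc-count : ∀ {k n} (w : Vec ℕ k) L → 1 ≤ weight w → ∀ C → IsCCC {k} n (2 * weight w ∸ 1) w C →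
  L * (length C * weight w) ≤ tri (length C) + n * tri (suc L)
ccc-count {n = n} w L 1≤W C ccc@(_ , comp , _) = begin
  L * (length C * weight w) ≡⟨ cong (L *_) (sym (sumL-const wt (weight w) C (All.map (λ {u} → composition-weight w u) comp))) ⟩
  L * sumL wt C ≤⟨ pair-count L C ⟩
  pairSum both C + n * tri (suc L) ≤⟨ +-monoˡ-≤ _ (pairSum-bound both C (AllPairs.map proj₁ (ccc-disjoint w C 1≤W ccc))) ⟩
  tri (length C) + n * tri (suc L) ∎
  where open ≤-Reasoning

-- From columns to codes

Column : ℕ → ℕ → Set
Column M k = Fin M → Fin (suc k)

-- Missing columns are read as zeros, which affect neither compositions nor common coordinates; so
-- it is enough to find at most n columns.
word : ∀ {M k} → List (Column M k) → (n : ℕ) → Fin M → Vec (Fin (suc k)) n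
word cs zero v = []
word [] (suc n) v = zero ∷ word [] n v
word (c ∷ cs) (suc n) v = c v ∷ word cs n v

word-occ : ∀ {M k} (cs : List (Column M k)) n v (a : Fin k) → length cs ≤ n →
  occ (suc a) (word cs n v) ≡ sumL (λ c → 𝟙 (c v == suc a)) cs
word-occ [] zero v a p = refl
word-occ [] (suc n) v a p = word-occ [] n v a z≤n
word-occ (c ∷ cs) (suc n) v a (s≤s p) = cong (𝟙 (c v == suc a) +_) (word-occ cs n v a p)

word-both : ∀ {M k} (cs : List (Column M k)) n u v → both (word cs n u) (word cs n v) ≤ sumL (λ c → 𝟙 (nz (c u) ∧ nz (c v))) cs
word-both cs zero u v = z≤n
word-both [] (suc n) u v = word-both [] n u v
word-both (c ∷ cs) (suc n) u v = +-monoʳ-≤ _ (word-both cs n u v)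

word-agree : ∀ {M k} (cs : List (Column M k)) n u v → All (λ c → nz (c u) ≡ true → c u ≢ c v) cs →
  agree (word cs n u) (word cs n v) ≡ 0
word-agree cs zero u v h = refl
word-agree [] (suc n) u v h = word-agree [] n u v h
word-agree (c ∷ cs) (suc n) u v (h ∷ hs) with c u | c v
... | zero | _ = word-agree cs n u v hs
... | suc a | b with suc a FinP.≟ b
...   | yes p = ⊥-elim (h refl p)
...   | no p = word-agree cs n u v hs

-- The code transposed: a column lists the symbols of all M words at one coordinate. The designs
-- below produce columns, never words.
record Columns {k} (w : Vec ℕ k) (M n : ℕ) : Set where
  field
    columns : List (Column M k)
    columns-length : length columns ≤ n
    columns-occ : ∀ v a → sumL (λ c → 𝟙 (c v == suc a)) columns ≡ Vec.lookup w a
    columns-both : ∀ u v → u ≢ v → sumL (λ c → 𝟙 (nz (c u) ∧ nz (c v))) columns ≤ 1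
    columns-agree : ∀ u v → u ≢ v → All (λ c → nz (c u) ≡ true → c u ≢ c v) columns

columns⇒ccc : ∀ {k M n} (w : Vec ℕ k) → 2 ≤ weight w → Columns w M n →
  Σ (List (Vec (Fin (suc k)) n)) (λ C → IsCCC n (2 * weight w ∸ 1) w C × length C ≡ M)
columns⇒ccc {k} {M} {n} w 2≤W cols =
  List.map W (allFin M) , (unique , AllP.map⁺ (All.tabulate λ {v} _ → comp v) , far) ,
  trans (ListP.length-map W (allFin M)) (ListP.length-tabulate {n = M} (λ i → i))
  where
  open Columns cols
  W : Fin M → Vec (Fin (suc k)) n
  W = word columns n
  comp : ∀ v → HasComposition w (W v)
  comp v a = trans (word-occ columns n v a columns-length) (columns-occ v a)
  dis : ∀ u v → u ≢ v → Disjoint (W u) (W v)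
  dis u v u≢v = ≤-trans (word-both columns n u v) (columns-both u v u≢v) , word-agree columns n u v (columns-agree u v u≢v)
  farW : ∀ u v → u ≢ v → 2 * weight w ∸ 1 ≤ dist (W u) (W v)
  farW u v u≢v = disjoint⇒far (weight w) (W u) (W v) (composition-weight w (W u) (comp u)) (composition-weight w (W v) (comp v)) (dis u v u≢v)
  dist-self : ∀ {m} (x : Vec (Fin (suc k)) m) → dist x x ≡ 0
  dist-self [] = refl
  dist-self (x ∷ xs) with x FinP.≟ x
  ... | yes _ = dist-self xs
  ... | no x≢x = ⊥-elim (x≢x refl)
  inj : ∀ {u v} → W u ≡ W v → u ≡ v
  inj {u} {v} e with u FinP.≟ v
  ... | yes p = p
  -- Different indices give words at distance at least 2W - 1 ≥ 1, whereas equal words have distance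
  -- 0.
  ... | no p = ⊥-elim (1+n≰n (≤-trans (m+n≤o⇒m≤o∸n 1 (≤-trans (≤-trans 2≤W (m≤m+n _ _)) ≤-refl))
      (≤-trans (farW u v p) (≤-reflexive (trans (cong (dist (W u)) (sym e)) (dist-self (W u)))))))
  unique : Unique (List.map W (allFin M))
  unique = UniqueP.map⁺ inj (UniqueP.allFin⁺ M)
  far : ∀ {x y} → x ∈ List.map W (allFin M) → y ∈ List.map W (allFin M) → x ≢ y → 2 * weight w ∸ 1 ≤ dist x y
  far x∈ y∈ x≢y with MemP.∈-map⁻ W x∈ | MemP.∈-map⁻ W y∈
  ... | u , _ , refl | v , _ , refl = farW u v (λ e → x≢y (cong W e))

-- Completing a partial system of points

sum-0 : ∀ {n} {f : Fin n → ℕ} → (∀ i → f i ≡ 0) → sum f ≡ 0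
sum-0 {n} h = trans (sum-cong-≗ h) (sum-replicate-zero n)

sum-at : ∀ {n} (f : Fin n → ℕ) i → (∀ j → j ≢ i → f j ≡ 0) → sum f ≡ f i
sum-at f zero h = trans (cong (f zero +_) (sum-0 λ j → h (suc j) λ ())) (+-identityʳ _)
sum-at f (suc i) h = cong₂ _+_ (h zero λ ()) (sum-at (f ∘ suc) i λ j ne → h (suc j) λ e → ne (FinP.suc-injective e))

sum-mono : ∀ {n} {f g : Fin n → ℕ} → (∀ i → f i ≤ g i) → sum f ≤ sum g
sum-mono {zero} h = z≤n
sum-mono {suc n} h = +-mono-≤ (h zero) (sum-mono (h ∘ suc))

sum-const : ∀ n c → sum {n} (λ _ → c) ≡ n * c
sum-const zero c = refl
sum-const (suc n) c = cong (c +_) (sum-const n c)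

==-refl : ∀ {n} (i : Fin n) → (i == i) ≡ true
==-refl i with i FinP.≟ i
... | yes _ = refl
... | no ne = ⊥-elim (ne refl)

==-≢ : ∀ {n} {i j : Fin n} → i ≢ j → (i == j) ≡ false
==-≢ {i = i} {j} ne with i FinP.≟ j
... | yes e = ⊥-elim (ne e)
... | no _ = refl

==-≡ : ∀ {n} {i j : Fin n} → (i == j) ≡ true → i ≡ j
==-≡ {i = i} {j} e with i FinP.≟ j
... | yes p = p

∧-true : ∀ {a b} → (a ∧ b) ≡ true → a ≡ true × b ≡ true
∧-true {true} {true} _ = refl , refl

𝟙-≤1 : ∀ b → 𝟙 b ≤ 1
𝟙-≤1 true = ≤-refl
𝟙-≤1 false = z≤n

sum-at-most-1 : ∀ {n} (P : Fin n → Bool) → (∀ i j → P i ≡ true → P j ≡ true → i ≡ j) → sum (𝟙 ∘ P) ≤ 1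
sum-at-most-1 {zero} P h = z≤n
sum-at-most-1 {suc n} P h with P zero in eq
... | true = s≤s (≤-reflexive (sum-0 λ j → none j))
  where
  none : ∀ j → 𝟙 (P (suc j)) ≡ 0
  none j with P (suc j) in eq′
  ... | false = refl
  ... | true with h zero (suc j) eq eq′
  ...   | ()
... | false = sum-at-most-1 (P ∘ suc) λ i j p q → FinP.suc-injective (h (suc i) (suc j) p q)

sumL-tabulate : ∀ {A : Set} {n} (f : A → ℕ) (g : Fin n → A) → sumL f (List.tabulate g) ≡ sum (f ∘ g)
sumL-tabulate {n = zero} f g = refl
sumL-tabulate {n = suc n} f g = cong (f (g zero) +_) (sumL-tabulate f (g ∘ suc))

sumL-concatMap : ∀ {A B : Set} (f : B → ℕ) (g : A → List B) xs → sumL f (concatMap g xs) ≡ sumL (λ x → sumL f (g x)) xs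
sumL-concatMap f g [] = refl
sumL-concatMap f g (x ∷ xs) = trans (sumL-++ f (g x) (concatMap g xs)) (cong (sumL f (g x) +_) (sumL-concatMap f g xs))

sumL-length : ∀ {A : Set} (xs : List A) → length xs ≡ sumL (λ _ → 1) xs
sumL-length [] = refl
sumL-length (x ∷ xs) = cong suc (sumL-length xs)

-- Filling free slots along directed edges

Edge : ℕ → Set
Edge M = Fin M × Fin M

outdeg indeg : ∀ {M} → List (Edge M) → Fin M → ℕ
outdeg E x = sumL (λ e → 𝟙 (proj₁ e == x)) E
indeg E x = sumL (λ e → 𝟙 (proj₂ e == x)) E

joins : ∀ {M} → Fin M → Fin M → Edge M → ℕ
joins u v (a , b) = 𝟙 ((a == u) ∧ (b == v)) + 𝟙 ((a == v) ∧ (b == u))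

between : ∀ {M} → List (Edge M) → Fin M → Fin M → ℕ
between E u v = sumL (joins u v) E

-- `RA x` counts the free slots of colour 1 at x, and `R x` lists its other free colours. An edge
-- takes colour 1 at its tail and some other colour at its head, so its two symbols differ whichever
-- colour that is; only out-degrees and in-degrees have to fit.
module Edges {M k : ℕ} where

  Col = Column M (suc k)

  edgeColumn : Fin M → Fin M → Fin (suc k) → Col
  edgeColumn u v c x = if x == u then suc zero else (if x == v then suc c else zero)

  singleton : Fin M → Fin (suc k) → Col
  singleton x c y = if y == x then suc c else zero

  update : {A : Set} → (Fin M → A) → Fin M → A → Fin M → A
  update f v a x = if x == v then a else f x

  pool : (Fin M → ℕ) → (Fin M → List (Fin (suc k))) → Fin M → List (Fin (suc k))
  pool RA R x = replicate (RA x) zero ++ R x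

  solo : (Fin M → ℕ) → (Fin M → List (Fin (suc k))) → Fin M → List Col
  solo RA R x = List.map (singleton x) (pool RA R x)

  edgeColumns : List (Edge M) → (Fin M → ℕ) → (Fin M → List (Fin (suc k))) → List Col
  edgeColumns [] RA R = concatMap (solo RA R) (allFin M)
  edgeColumns ((u , v) ∷ E) RA R with R v
  -- Under `Fits` this case is impossible, by `head-colour`.
  ... | [] = []
  ... | c ∷ cs = edgeColumn u v c ∷ edgeColumns E (update RA u (pred (RA u))) (update R v cs)

  count : Fin (suc k) → List (Fin (suc k)) → ℕ
  count a = sumL (λ c → 𝟙 (c == a))

  avail : (Fin M → ℕ) → (Fin M → List (Fin (suc k))) → Fin M → Fin (suc k) → ℕ
  avail RA R x a = RA x * 𝟙 (zero == a) + count a (R x)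

  record Fits (E : List (Edge M)) (RA : Fin M → ℕ) (R : Fin M → List (Fin (suc k))) : Set where
    constructor fits
    field
      proper : All (λ e → proj₁ e ≢ proj₂ e) E
      out-fits : ∀ x → outdeg E x ≤ RA x
      in-fits : ∀ x → indeg E x ≤ length (R x)
      colours : ∀ x → All (_≢ zero) (R x)

  head-colour : ∀ {u v E RA R} → Fits ((u , v) ∷ E) RA R → R v ≡ [] → ⊥
  head-colour {u} {v} {E} {RA} {R} (fits _ _ i _) e =
    1+n≰n (≤-trans (≤-trans (≤-reflexive (sym (cong 𝟙 (==-refl v)))) (m≤m+n _ _)) (≤-trans (i v) (≤-reflexive (cong length e))))

  step-fits : ∀ {u v E RA R c cs} → Fits ((u , v) ∷ E) RA R → R v ≡ c ∷ cs →
    Fits E (update RA u (pred (RA u))) (update R v cs)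
  step-fits {u} {v} {E} {RA} {R} {c} {cs} (fits (_ ∷ p) o i h) e = fits p o′ i′ h′
    where
    o′ : ∀ x → outdeg E x ≤ update RA u (pred (RA u)) x
    o′ x with x FinP.≟ u
    ... | yes refl = ≤-trans (≤-reflexive refl) (pred-mono-≤ (≤-trans (≤-reflexive (cong (λ b → 𝟙 b + outdeg E x) (sym (==-refl x)))) (o x)))
    ... | no ne = ≤-trans (≤-reflexive (cong (λ b → 𝟙 b + outdeg E x) (sym (==-≢ (ne ∘ sym))))) (o x)
    i′ : ∀ x → indeg E x ≤ length (update R v cs x)
    i′ x with x FinP.≟ v
    ... | yes refl = s≤s⁻¹ (≤-trans (≤-reflexive (cong (λ b → 𝟙 b + indeg E x) (sym (==-refl x)))) (≤-trans (i x) (≤-reflexive (cong length e))))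
    ... | no ne = ≤-trans (≤-reflexive (cong (λ b → 𝟙 b + indeg E x) (sym (==-≢ (ne ∘ sym))))) (i x)
    h′ : ∀ x → All (_≢ zero) (update R v cs x)
    h′ x with x FinP.≟ v
    ... | yes refl = All.tail (subst (All (_≢ zero)) e (h x))
    ... | no ne = h x

  pred-RA : ∀ {u v E RA R} → Fits ((u , v) ∷ E) RA R → RA u ≡ suc (pred (RA u))
  pred-RA {u} {v} {E} {RA} (fits _ o _ _) with RA u | ≤-trans (≤-trans (≤-reflexive (sym (cong 𝟙 (==-refl u)))) (m≤m+n (𝟙 (u == u)) _)) (o u)
  ... | suc r | _ = refl

  sumL-map-singleton : ∀ x (f : Col → ℕ) cs → sumL f (List.map (singleton x) cs) ≡ sumL (λ c → f (singleton x c)) cs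
  sumL-map-singleton x f cs = sumL-map f (singleton x) cs

  count-replicate : ∀ a n → count a (replicate n zero) ≡ n * 𝟙 (zero == a)
  count-replicate a zero = refl
  count-replicate a (suc n) = cong (_ +_) (count-replicate a n)

  colour-at : Fin M → Fin (suc k) → Col → ℕ
  colour-at x a c = 𝟙 (c x == suc a)

  solo-occ : ∀ RA R y x a → sumL (colour-at x a) (solo RA R y) ≡ (if x == y then avail RA R x a else 0)
  solo-occ RA R y x a = trans (sumL-map-singleton y (colour-at x a) (pool RA R y)) lem
    where
    lem : sumL (λ c → 𝟙 (singleton y c x == suc a)) (pool RA R y) ≡ (if x == y then avail RA R x a else 0)
    lem with x FinP.≟ y
    ... | yes refl = trans (sumL-cong (λ c → cong 𝟙 (==-suc c a)) (pool RA R y))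
           (trans (sumL-++ (λ c → 𝟙 (c == a)) (replicate (RA y) zero) (R y)) (cong (_+ count a (R y)) (count-replicate a (RA y))))
    ... | no _ = sumL-0 (pool RA R y)

  if-true : ∀ {A : Set} {b : Bool} {x y : A} → b ≡ true → (if b then x else y) ≡ x
  if-true refl = refl
  if-false : ∀ {A : Set} {b : Bool} {x y : A} → b ≡ false → (if b then x else y) ≡ y
  if-false refl = refl

  -- `avail` counts the unspent slots of a colour. An edge spends one slot at either end, its column
  -- accounts for them, and the final singletons use up the rest.
  occ-edges : ∀ E RA R → Fits E RA R → ∀ x a → sumL (colour-at x a) (edgeColumns E RA R) ≡ avail RA R x a
  occ-edges [] RA R f x a =
    trans (sumL-concatMap (colour-at x a) (solo RA R) (allFin M))
      (trans (sumL-tabulate (λ y → sumL (colour-at x a) (solo RA R y)) (λ y → y))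
        (trans (sum-cong-≗ (λ y → solo-occ RA R y x a))
          (trans (sum-at _ x λ y ne → if-false (==-≢ (ne ∘ sym))) (if-true (==-refl x)))))
  occ-edges ((u , v) ∷ E) RA R f x a with R v in eq
  ... | [] = ⊥-elim (head-colour f eq)
  ... | c ∷ cs = trans (cong (colour-at x a (edgeColumn u v c) +_) (occ-edges E _ _ (step-fits f eq) x a)) lem
    where
    lem : colour-at x a (edgeColumn u v c) + avail (update RA u (pred (RA u))) (update R v cs) x a ≡ avail RA R x a
    lem with x FinP.≟ u
    lem | yes refl with u FinP.≟ v
    lem | yes refl | yes refl = ⊥-elim (All.head (Fits.proper f) refl)
    lem | yes refl | no _ = trans (cong (_+ (pred (RA u) * 𝟙 (zero == a) + count a (R u))) (cong 𝟙 (==-suc zero a)))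
            (trans (sym (+-assoc (𝟙 (zero == a)) _ _)) (cong (λ r → r * 𝟙 (zero == a) + count a (R u)) (sym (pred-RA f))))
    lem | no _ with x FinP.≟ v
    lem | no _ | yes refl = trans (cong (_+ (RA x * 𝟙 (zero == a) + count a cs)) (cong 𝟙 (==-suc c a)))
            (trans (lin 3 (λ p q r → [] ⊢ p :+ (q :+ r) := q :+ (p :+ r)) (𝟙 (c == a)) (RA x * 𝟙 (zero == a)) (count a cs))
              (cong (λ l → RA x * 𝟙 (zero == a) + count a l) (sym eq)))
    lem | no _ | no _ = refl

  both-at : Fin M → Fin M → Col → ℕ
  both-at p q c = 𝟙 (nz (c p) ∧ nz (c q))

  both-edges : ∀ E RA R → Fits E RA R → ∀ p q → p ≢ q → sumL (both-at p q) (edgeColumns E RA R) ≤ between E p q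
  both-edges [] RA R f p q p≢q = ≤-reflexive
    (trans (sumL-concatMap (both-at p q) (solo RA R) (allFin M))
      (trans (sumL-tabulate (λ y → sumL (both-at p q) (solo RA R y)) (λ y → y)) (sum-0 none)))
    where
    none : ∀ y → sumL (both-at p q) (solo RA R y) ≡ 0
    none y = trans (sumL-map-singleton y (both-at p q) (pool RA R y)) (trans (sumL-cong h (pool RA R y)) (sumL-0 (pool RA R y)))
      where
      h : ∀ c → both-at p q (singleton y c) ≡ 0
      h c with p FinP.≟ y | q FinP.≟ y
      ... | yes refl | yes refl = ⊥-elim (p≢q refl)
      ... | yes refl | no _ = refl
      ... | no _ | _ = refl
  both-edges ((u , v) ∷ E) RA R f p q p≢q with R v in eq
  ... | [] = z≤n
  ... | c ∷ cs = +-mono-≤ lem (both-edges E _ _ (step-fits f eq) p q p≢q)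
    where
    lem : both-at p q (edgeColumn u v c) ≤ joins p q (u , v)
    lem with p FinP.≟ u | p FinP.≟ v | q FinP.≟ u | q FinP.≟ v
    ... | no _ | no _ | _ | _ = z≤n
    ... | yes refl | _ | yes refl | _ = ⊥-elim (p≢q refl)
    ... | _ | yes refl | _ | yes refl = ⊥-elim (p≢q refl)
    ... | yes refl | _ | no _ | no _ = z≤n
    ... | no _ | yes _ | no _ | no _ = z≤n
    ... | yes refl | _ | no _ | yes refl rewrite ==-refl u | ==-refl v = s≤s z≤n
    ... | no _ | yes refl | yes refl | _ rewrite ==-refl u | ==-refl v = m≤n+m 1 _

  agree-edges : ∀ E RA R → Fits E RA R → ∀ p q → p ≢ q → All (λ c → nz (c p) ≡ true → c p ≢ c q) (edgeColumns E RA R)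
  agree-edges [] RA R f p q p≢q = AllP.concat⁺ (AllP.map⁺ {f = solo RA R} (All.tabulate {xs = allFin M} λ {y} _ → AllP.map⁺ {f = singleton y} (All.tabulate λ {c} _ → h y c)))
    where
    h : ∀ y c → nz (singleton y c p) ≡ true → singleton y c p ≢ singleton y c q
    h y c t e with p FinP.≟ y | q FinP.≟ y
    ... | yes refl | yes refl = p≢q refl
    ... | yes refl | no _ = case e of λ ()
    ... | no _ | _ = case t of λ ()
  agree-edges ((u , v) ∷ E) RA R f p q p≢q with R v in eq
  ... | [] = []
  ... | c ∷ cs = h ∷ agree-edges E _ _ (step-fits f eq) p q p≢q
    where
    c≢0 : c ≢ zero
    c≢0 = All.head (subst (All (_≢ zero)) eq (Fits.colours f v))
    h : nz (edgeColumn u v c p) ≡ true → edgeColumn u v c p ≢ edgeColumn u v c q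
    h t e with p FinP.≟ u | p FinP.≟ v | q FinP.≟ u | q FinP.≟ v
    ... | no _ | no _ | _ | _ = case t of λ ()
    ... | yes refl | _ | yes refl | _ = p≢q refl
    ... | yes refl | _ | no _ | yes refl = c≢0 (sym (FinP.suc-injective e))
    ... | yes refl | _ | no _ | no _ = case e of λ ()
    ... | no _ | yes refl | yes refl | _ = c≢0 (FinP.suc-injective e)
    ... | no _ | yes refl | no _ | yes refl = p≢q refl
    ... | no _ | yes refl | no _ | no _ = case e of λ ()

  sum-update : ∀ (f g : Fin M → ℕ) v → (∀ x → x ≢ v → g x ≡ f x) → suc (g v) ≡ f v → suc (sum g) ≡ sum f
  sum-update f g v same e = trans (cong (_+ sum g) (sym one)) (trans (sym (∑-distrib-+ (λ x → 𝟙 (x == v)) g)) (sum-cong-≗ h))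
    where
    one : sum (λ x → 𝟙 (x == v)) ≡ 1
    one = trans (sum-at _ v λ x ne → cong 𝟙 (==-≢ ne)) (cong 𝟙 (==-refl v))
    h : ∀ x → 𝟙 (x == v) + g x ≡ f x
    h x with x FinP.≟ v
    ... | yes refl = e
    ... | no ne = same x ne

  -- By itself every slot would give a column; an edge merges two of them and so saves one.
  length-edges : ∀ E RA R → Fits E RA R → length (edgeColumns E RA R) + length E ≡ sum (λ x → RA x + length (R x))
  length-edges [] RA R f = trans (+-identityʳ _) (trans (sumL-length (edgeColumns [] RA R)) (trans (sumL-concatMap (λ _ → 1) (solo RA R) (allFin M))
    (trans (sumL-tabulate (λ y → sumL (λ _ → 1) (solo RA R y)) (λ y → y)) (sum-cong-≗ h))))
    where
    h : ∀ y → sumL (λ _ → 1) (solo RA R y) ≡ RA y + length (R y)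
    h y = trans (sym (sumL-length (solo RA R y))) (trans (ListP.length-map (singleton y) (pool RA R y))
      (trans (ListP.length-++ (replicate (RA y) zero)) (cong (_+ length (R y)) (ListP.length-replicate (RA y)))))
  length-edges ((u , v) ∷ E) RA R f with R v in eq
  ... | [] = ⊥-elim (head-colour f eq)
  ... | c ∷ cs = begin
      suc (length cols) + suc (length E) ≡⟨ lin 2 (λ a b → [] ⊢ (K 1 :+ a) :+ (K 1 :+ b) := K 1 :+ (K 1 :+ (a :+ b))) (length cols) (length E) ⟩
      suc (suc (length cols + length E)) ≡⟨ cong 2+ (trans (length-edges E RA′ R′ (step-fits f eq)) (∑-distrib-+ RA′ (length ∘ R′))) ⟩
      suc (suc (sum RA′ + sum (length ∘ R′))) ≡⟨ cong suc (sym (+-suc (sum RA′) _)) ⟩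
      suc (sum RA′) + suc (sum (length ∘ R′)) ≡⟨ cong₂ _+_ (sum-update RA RA′ u (λ x ne → if-false (==-≢ ne)) (trans (cong suc (if-true (==-refl u))) (sym (pred-RA f))))
              (sum-update (length ∘ R) (length ∘ R′) v (λ x ne → cong length (if-false {x = cs} {R x} (==-≢ ne))) (trans (cong (suc ∘ length) (if-true {x = cs} {R v} (==-refl v))) (cong length (sym eq)))) ⟩
      sum RA + sum (length ∘ R) ≡⟨ sym (∑-distrib-+ RA (length ∘ R)) ⟩
      sum (λ x → RA x + length (R x)) ∎
    where
    open ≡-Reasoning
    RA′ = update RA u (pred (RA u))
    R′ = update R v cs
    cols = edgeColumns E RA′ R′

-- Eulerian orientations

degree : ∀ {M} → List (Edge M) → Fin M → ℕ
degree E x = outdeg E x + indeg E x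

Proper : ∀ {M} → List (Edge M) → Set
Proper = All (λ e → proj₁ e ≢ proj₂ e)

direct : ∀ {M} → Bool → Fin M → Fin M → Edge M
direct true a b = a , b
direct false a b = b , a

-- What survives reordering a list of edges and reversing some of them.
record Like {M} (E E′ : List (Edge M)) : Set where
  field
    degrees : ∀ x → degree E′ x ≡ degree E x
    joined : ∀ u v → between E′ u v ≡ between E u v
    lengths : length E′ ≡ length E
    keepProper : Proper E → Proper E′

Balanced : ∀ {M} → List (Edge M) → Set
Balanced E = ∀ x → outdeg E x ≤ 1 + indeg E x × indeg E x ≤ 1 + outdeg E x

joins-direct : ∀ {M} f (a b : Fin M) u v → joins u v (direct f a b) ≡ joins u v (a , b)
joins-direct true a b u v = refl
joins-direct false a b u v = trans (+-comm (𝟙 ((b == u) ∧ (a == v))) _) (cong₂ _+_ (h (b == v) (a == u)) (h (b == u) (a == v)))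
  where
  h : ∀ p q → 𝟙 (p ∧ q) ≡ 𝟙 (q ∧ p)
  h true true = refl
  h true false = refl
  h false true = refl
  h false false = refl

degree-direct : ∀ {M} f (a b : Fin M) E x → degree (direct f a b ∷ E) x ≡ 𝟙 (a == x) + 𝟙 (b == x) + degree E x
degree-direct true a b E x = lin 4 (λ a b o i → [] ⊢ (a :+ o) :+ (b :+ i) := a :+ b :+ (o :+ i)) (𝟙 (a == x)) (𝟙 (b == x)) (outdeg E x) (indeg E x)
degree-direct false a b E x = lin 4 (λ a b o i → [] ⊢ (b :+ o) :+ (a :+ i) := a :+ b :+ (o :+ i)) (𝟙 (a == x)) (𝟙 (b == x)) (outdeg E x) (indeg E x)

direct-proper : ∀ {M} f {a b : Fin M} → a ≢ b → proj₁ (direct f a b) ≢ proj₂ (direct f a b)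
direct-proper true ne = ne
direct-proper false ne = ne ∘ sym

like-direct : ∀ {M} f {a b : Fin M} {E E′} → Like E E′ → Like ((a , b) ∷ E) (direct f a b ∷ E′)
like-direct f {a} {b} {E} {E′} L = record
  { degrees = λ x → trans (degree-direct f a b E′ x) (trans (cong (𝟙 (a == x) + 𝟙 (b == x) +_) (degrees x)) (sym (degree-direct true a b E x)))
  ; joined = λ u v → cong₂ _+_ (joins-direct f a b u v) (joined u v)
  ; lengths = cong suc lengths
  ; keepProper = λ { (p ∷ ps) → direct-proper f p ∷ keepProper ps }
  }
  where open Like L

like-trans : ∀ {M} {E E′ E″ : List (Edge M)} → Like E E′ → Like E′ E″ → Like E E″
like-trans L L′ = record
  { degrees = λ x → trans (Like.degrees L′ x) (Like.degrees L x)
  ; joined = λ u v → trans (Like.joined L′ u v) (Like.joined L u v)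
  ; lengths = trans (Like.lengths L′) (Like.lengths L)
  ; keepProper = Like.keepProper L′ ∘ Like.keepProper L
  }

like-refl : ∀ {M} {E : List (Edge M)} → Like E E
like-refl = record { degrees = λ _ → refl ; joined = λ _ _ → refl ; lengths = refl ; keepProper = λ p → p }

like-swap : ∀ {M} {e f : Edge M} {E} → Like (e ∷ f ∷ E) (f ∷ e ∷ E)
like-swap {e = e} {f} {E} = record
  { degrees = λ x → lin 6 (λ a b c d o i → [] ⊢ (c :+ (a :+ o)) :+ (d :+ (b :+ i)) := (a :+ (c :+ o)) :+ (b :+ (d :+ i)))
      (𝟙 (proj₁ e == x)) (𝟙 (proj₂ e == x)) (𝟙 (proj₁ f == x)) (𝟙 (proj₂ f == x)) (outdeg E x) (indeg E x)
  ; joined = λ u v → lin 3 (λ a b c → [] ⊢ a :+ (b :+ c) := b :+ (a :+ c)) (joins u v f) (joins u v e) (between E u v)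
  ; lengths = refl
  ; keepProper = λ { (p ∷ q ∷ ps) → q ∷ p ∷ ps }
  }

like-cons : ∀ {M} {e : Edge M} {E E′} → Like E E′ → Like (e ∷ E) (e ∷ E′)
like-cons = like-direct true

data Locate {M} (b : Fin M) (E : List (Edge M)) : Set where
  absent : degree E b ≡ 0 → Locate b E
  found : ∀ c E′ → Like E ((b , c) ∷ E′) → Locate b E

locate : ∀ {M} (b : Fin M) E → Locate b E
locate b [] = absent refl
locate b ((x , y) ∷ E) with x FinP.≟ b
... | yes refl = found y E like-refl
... | no x≢b with y FinP.≟ b
...   | yes refl = found x E (like-direct false like-refl)
...   | no y≢b with locate b E
...     | absent d = absent (trans (degree-direct true x y E b) (cong₂ _+_ (cong₂ (λ p q → 𝟙 p + 𝟙 q) (==-≢ x≢b) (==-≢ y≢b)) d))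
...     | found c E′ L = found c ((x , y) ∷ E′) (like-trans (like-cons L) like-swap)

-- The edge ab stays apart from the list because it is the one that splitting off alters; `forward`
-- is the direction of the trail through it.
record Orientation {M} (a b : Fin M) (E : List (Edge M)) : Set where
  constructor orientation
  field
    forward : Bool
    rest : List (Edge M)
    like : Like E rest
    balanced : Balanced (direct forward a b ∷ rest)

-- The intermediate vertex b gains one incoming and one outgoing arc, and the ends keep theirs.
direct-through : ∀ {M} f (a b c : Fin M) E → Balanced (direct f a c ∷ E) → Balanced (direct f a b ∷ direct f b c ∷ E)
direct-through true a b c E bal x =
  lin 5 (λ p q r o i → p :+ o :≤ K 1 :+ (r :+ i) ∷ [] ⊢ p :+ (q :+ o) :≤ K 1 :+ (q :+ (r :+ i))) (𝟙 (a == x)) (𝟙 (b == x)) (𝟙 (c == x)) (outdeg E x) (indeg E x) (proj₁ (bal x)) ,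
  lin 5 (λ p q r o i → r :+ i :≤ K 1 :+ (p :+ o) ∷ [] ⊢ q :+ (r :+ i) :≤ K 1 :+ (p :+ (q :+ o))) (𝟙 (a == x)) (𝟙 (b == x)) (𝟙 (c == x)) (outdeg E x) (indeg E x) (proj₂ (bal x))
direct-through false a b c E bal x =
  lin 5 (λ p q r o i → r :+ o :≤ K 1 :+ (p :+ i) ∷ [] ⊢ q :+ (r :+ o) :≤ K 1 :+ (p :+ (q :+ i))) (𝟙 (a == x)) (𝟙 (b == x)) (𝟙 (c == x)) (outdeg E x) (indeg E x) (proj₁ (bal x)) ,
  lin 5 (λ p q r o i → p :+ i :≤ K 1 :+ (r :+ o) ∷ [] ⊢ p :+ (q :+ i) :≤ K 1 :+ (q :+ (r :+ o))) (𝟙 (a == x)) (𝟙 (b == x)) (𝟙 (c == x)) (outdeg E x) (indeg E x) (proj₂ (bal x))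

balanced-swap : ∀ {M} {e f : Edge M} {E} → Balanced (e ∷ f ∷ E) → Balanced (f ∷ e ∷ E)
balanced-swap {e = e} {f} {E} bal x =
  lin 6 (λ p q r s o i → p :+ (q :+ o) :≤ K 1 :+ (r :+ (s :+ i)) ∷ [] ⊢ q :+ (p :+ o) :≤ K 1 :+ (s :+ (r :+ i))) (𝟙 (proj₁ e == x)) (𝟙 (proj₁ f == x)) (𝟙 (proj₂ e == x)) (𝟙 (proj₂ f == x)) (outdeg E x) (indeg E x) (proj₁ (bal x)) ,
  lin 6 (λ p q r s o i → r :+ (s :+ i) :≤ K 1 :+ (p :+ (q :+ o)) ∷ [] ⊢ s :+ (r :+ i) :≤ K 1 :+ (q :+ (p :+ o))) (𝟙 (proj₁ e == x)) (𝟙 (proj₁ f == x)) (𝟙 (proj₂ e == x)) (𝟙 (proj₂ f == x)) (outdeg E x) (indeg E x) (proj₂ (bal x))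

isolated : ∀ {M} (a b : Fin M) E → Balanced E → degree E a ≡ 0 → degree E b ≡ 0 → Balanced ((a , b) ∷ E)
isolated a b E bal za zb x with a FinP.≟ x | b FinP.≟ x
... | yes refl | yes refl = lin 2 (λ o i → o :+ i := K 0 ∷ [] ⊢ K 1 :+ o :≤ K 1 :+ (K 1 :+ i)) (outdeg E a) (indeg E a) za , lin 2 (λ o i → o :+ i := K 0 ∷ [] ⊢ K 1 :+ i :≤ K 1 :+ (K 1 :+ o)) (outdeg E a) (indeg E a) za
... | yes refl | no _ = lin 2 (λ o i → o :+ i := K 0 ∷ [] ⊢ K 1 :+ o :≤ K 1 :+ i) (outdeg E a) (indeg E a) za , lin 2 (λ o i → o :+ i := K 0 ∷ [] ⊢ i :≤ K 1 :+ (K 1 :+ o)) (outdeg E a) (indeg E a) za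
... | no _ | yes refl = lin 2 (λ o i → o :+ i := K 0 ∷ [] ⊢ o :≤ K 1 :+ (K 1 :+ i)) (outdeg E b) (indeg E b) zb , lin 2 (λ o i → o :+ i := K 0 ∷ [] ⊢ K 1 :+ i :≤ K 1 :+ o) (outdeg E b) (indeg E b) zb
... | no _ | no _ = bal x

-- Splitting off: two edges a - b - c are replaced by a - c, and an orientation of the
-- shorter list is pulled back along the path.
orient : ∀ {M} n (a b : Fin M) E → length E ≤ n → Orientation a b E
orient n a b [] le = orientation true [] like-refl λ x →
  lin 2 (λ p q → p :≤ K 1 ∷ q :≤ K 1 ∷ [] ⊢ p :+ K 0 :≤ K 1 :+ (q :+ K 0)) (𝟙 (a == x)) (𝟙 (b == x)) (𝟙-≤1 _) (𝟙-≤1 _) ,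
  lin 2 (λ p q → p :≤ K 1 ∷ q :≤ K 1 ∷ [] ⊢ q :+ K 0 :≤ K 1 :+ (p :+ K 0)) (𝟙 (a == x)) (𝟙 (b == x)) (𝟙-≤1 _) (𝟙-≤1 _)
orient (suc n) a b E@((c , d) ∷ E₁) le with locate b E
... | found e E′ L with orient n a e E′ (s≤s⁻¹ (≤-trans (≤-reflexive (Like.lengths L)) le))
...   | orientation f R L′ bal = orientation f (direct f b e ∷ R) (like-trans L (like-direct f L′)) (direct-through f a b e R bal)
orient (suc n) a b E@((c , d) ∷ E₁) le | absent zb with locate a E
... | found e E′ L with orient n e b E′ (s≤s⁻¹ (≤-trans (≤-reflexive (Like.lengths L)) le))
...   | orientation f R L′ bal = orientation f (direct f e a ∷ R)
          (like-trans L (like-trans (like-direct false L′) (like-direct f like-refl)))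
          (balanced-swap {e = direct f e a} {f = direct f a b} {E = R} (direct-through f e a b R bal))
-- Neither end of ab meets another edge: the trail is finished, and the next one starts with cd.
-- Adding ab afterwards is safe because its ends are isolated there.
orient (suc n) a b E@((c , d) ∷ E₁) le | absent zb | absent za with orient n c d E₁ (s≤s⁻¹ le)
... | orientation f R L bal = orientation true (direct f c d ∷ R) (like-direct f L)
        (isolated a b (direct f c d ∷ R) bal (trans (Like.degrees (like-direct f L) a) za) (trans (Like.degrees (like-direct f L) b) zb))

orientAll : ∀ {M} (E : List (Edge M)) → Σ (List (Edge M)) λ E′ → Like E E′ × Balanced E′
orientAll [] = [] , like-refl , λ x → z≤n , z≤n
orientAll ((a , b) ∷ E) with orient (length E) a b E ≤-refl
... | orientation f R L bal = direct f a b ∷ R , like-direct f L , bal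

degree-sum : ∀ {M} (E : List (Edge M)) → sum (degree E) ≡ 2 * length E
degree-sum {M} [] = sum-0 {M} λ _ → refl
degree-sum ((a , b) ∷ E) = trans (sum-cong-≗ (degree-direct true a b E))
  (trans (∑-distrib-+ (λ x → 𝟙 (a == x) + 𝟙 (b == x)) (degree E))
    (trans (cong₂ _+_ (trans (∑-distrib-+ (λ x → 𝟙 (a == x)) (λ x → 𝟙 (b == x))) (cong₂ _+_ (sum-one a) (sum-one b))) (degree-sum E))
      (lin 1 (λ l → [] ⊢ K 2 :+ 2 :* l := 2 :* (K 1 :+ l)) (length E))))

-- Balanced orientation of a graph given by adjacency

<ᵇ-true : ∀ {m n} → m < n → (m <ᵇ n) ≡ true
<ᵇ-true {m} {n} p with m <ᵇ n | <⇒<ᵇ p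
... | true | _ = refl

<ᵇ-false : ∀ {m n} → ¬ m < n → (m <ᵇ n) ≡ false
<ᵇ-false {m} {n} p with m <ᵇ n in eq
... | false = refl
... | true = ⊥-elim (p (<ᵇ⇒< m n (subst T (sym eq) _)))

module Graph {M} (adj : Fin M → Fin M → Bool) (adj-sym : ∀ u v → adj u v ≡ adj v u) (irrefl : ∀ u → adj u u ≡ false) where

  below : Fin M → Fin M → Bool
  below u v = (toℕ u <ᵇ toℕ v) ∧ adj u v

  pick : Fin M → Fin M → List (Edge M)
  pick u v = if below u v then (u , v) ∷ [] else []

  edges : List (Edge M)
  edges = concatMap (λ u → concatMap (pick u) (allFin M)) (allFin M)

  sum-pick : (f : Edge M → ℕ) → ∀ u v → sumL f (pick u v) ≡ 𝟙 (below u v) * f (u , v)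
  sum-pick f u v with below u v
  ... | true = refl
  ... | false = refl

  sum-edges : (f : Edge M → ℕ) → sumL f edges ≡ sum λ u → sum λ v → 𝟙 (below u v) * f (u , v)
  sum-edges f = trans (sumL-concatMap f (λ u → concatMap (pick u) (allFin M)) (allFin M))
    (trans (sumL-tabulate (λ u → sumL f (concatMap (pick u) (allFin M))) (λ u → u)) (sum-cong-≗ λ u →
      trans (sumL-concatMap f (pick u) (allFin M)) (trans (sumL-tabulate (λ v → sumL f (pick u v)) (λ v → v)) (sum-cong-≗ (sum-pick f u)))))

  below-one : ∀ u v → 𝟙 (below u v) + 𝟙 (below v u) ≡ 𝟙 (adj u v)
  below-one u v with <-cmp (toℕ u) (toℕ v)
  ... | tri< a _ c rewrite <ᵇ-true a | <ᵇ-false c = +-identityʳ _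
  ... | tri≈ _ e _ with FinP.toℕ-injective e
  ...   | refl rewrite irrefl u with toℕ u <ᵇ toℕ u
  ...     | true = refl
  ...     | false = refl
  below-one u v | tri> a _ c rewrite <ᵇ-true c | <ᵇ-false a = cong 𝟙 (adj-sym v u)

  sum-select : ∀ (g : Fin M → ℕ) x → sum (λ v → g v * 𝟙 (v == x)) ≡ g x
  sum-select g x = trans (sum-at _ x λ v ne → trans (cong (λ b → g v * 𝟙 b) (==-≢ ne)) (*-zeroʳ (g v)))
    (trans (cong (λ b → g x * 𝟙 b) (==-refl x)) (*-identityʳ (g x)))

  edges-out : ∀ x → outdeg edges x ≡ sum (λ v → 𝟙 (below x v))
  edges-out x = trans (sum-edges (λ e → 𝟙 (proj₁ e == x))) (trans (∑-comm (λ u v → 𝟙 (below u v) * 𝟙 (u == x)))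
    (sum-cong-≗ λ v → sum-select (λ u → 𝟙 (below u v)) x))

  edges-in : ∀ x → indeg edges x ≡ sum (λ v → 𝟙 (below v x))
  edges-in x = trans (sum-edges (λ e → 𝟙 (proj₂ e == x))) (sum-cong-≗ λ u → sum-select (λ v → 𝟙 (below u v)) x)

  edges-degree : ∀ x → degree edges x ≡ sum (λ v → 𝟙 (adj x v))
  edges-degree x = trans (cong₂ _+_ (edges-out x) (edges-in x)) (trans (sym (∑-distrib-+ (λ v → 𝟙 (below x v)) (λ v → 𝟙 (below v x)))) (sum-cong-≗ (below-one x)))

  select₂ : ∀ p q → sum (λ u → sum (λ v → 𝟙 (below u v) * 𝟙 ((u == p) ∧ (v == q)))) ≡ 𝟙 (below p q)
  select₂ p q = trans (sum-cong-≗ λ u → trans (sum-cong-≗ λ v → h u v) (sum-select (λ v → 𝟙 (below u v) * 𝟙 (u == p)) q)) (sum-select (λ u → 𝟙 (below u q)) p)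
    where
    h : ∀ u v → 𝟙 (below u v) * 𝟙 ((u == p) ∧ (v == q)) ≡ 𝟙 (below u v) * 𝟙 (u == p) * 𝟙 (v == q)
    h u v with u == p
    ... | true = cong (_* 𝟙 (v == q)) (sym (*-identityʳ (𝟙 (below u v))))
    ... | false = trans (*-zeroʳ (𝟙 (below u v))) (sym (cong (_* 𝟙 (v == q)) (*-zeroʳ (𝟙 (below u v)))))

  edges-between : ∀ p q → between edges p q ≡ 𝟙 (adj p q)
  edges-between p q = trans (sum-edges (joins p q)) (trans (sum-cong-≗ λ u → trans (sum-cong-≗ λ v → *-distribˡ-+ (𝟙 (below u v)) _ _)
      (∑-distrib-+ (λ v → 𝟙 (below u v) * 𝟙 ((u == p) ∧ (v == q))) (λ v → 𝟙 (below u v) * 𝟙 ((u == q) ∧ (v == p)))))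
    (trans (∑-distrib-+ (λ u → sum (λ v → 𝟙 (below u v) * 𝟙 ((u == p) ∧ (v == q)))) (λ u → sum (λ v → 𝟙 (below u v) * 𝟙 ((u == q) ∧ (v == p)))))
      (trans (cong₂ _+_ (select₂ p q) (select₂ q p)) (below-one p q))))

  edges-proper : Proper edges
  edges-proper = AllP.concat⁺ (AllP.map⁺ {f = λ u → concatMap (pick u) (allFin M)} (All.tabulate {xs = allFin M} λ {u} _ →
    AllP.concat⁺ (AllP.map⁺ {f = pick u} (All.tabulate {xs = allFin M} λ {v} _ → h u v))))
    where
    h : ∀ u v → Proper (pick u v)
    h u v with below u v in eq
    ... | false = []
    ... | true = (λ { refl → case trans (sym (proj₂ (∧-true eq))) (irrefl u) of λ () }) ∷ []

  -- For a degree of at most 2b, balance gives twice the out-degree ≤ 2b + 1, and parity removes the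
  -- 1; the same holds for the in-degree. So b free slots of colour 1 and b others suffice at a
  -- vertex of degree 2b.
  record Oriented : Set where
    field
      arcs : List (Edge M)
      arcs-proper : Proper arcs
      arcs-between : ∀ p q → between arcs p q ≡ 𝟙 (adj p q)
      arcs-out : ∀ x b → sum (λ v → 𝟙 (adj x v)) ≤ 2 * b → outdeg arcs x ≤ b
      arcs-in : ∀ x b → sum (λ v → 𝟙 (adj x v)) ≤ 2 * b → indeg arcs x ≤ b
      arcs-length : sum (λ x → sum (λ v → 𝟙 (adj x v))) ≡ 2 * length arcs

  oriented : Oriented
  oriented with orientAll edges
  ... | A , L , bal = record
    { arcs = A
    ; arcs-proper = Like.keepProper L edges-proper
    ; arcs-between = λ p q → trans (Like.joined L p q) (edges-between p q)
    ; arcs-out = λ x b le → lin 4 (λ o i d b → o :+ i := d ∷ o :≤ K 1 :+ i ∷ d :≤ 2 :* b ∷ [] ⊢ o :≤ b) (outdeg A x) (indeg A x) _ b (degs x) (proj₁ (bal x)) le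
    ; arcs-in = λ x b le → lin 4 (λ o i d b → o :+ i := d ∷ i :≤ K 1 :+ o ∷ d :≤ 2 :* b ∷ [] ⊢ i :≤ b) (outdeg A x) (indeg A x) _ b (degs x) (proj₂ (bal x)) le
    ; arcs-length = trans (sum-cong-≗ (λ x → sym (degs x))) (degree-sum A)
    }
    where
    degs : ∀ x → degree A x ≡ sum (λ v → 𝟙 (adj x v))
    degs x = trans (Like.degrees L x) (edges-degree x)

-- Points as partial functions on slots

at : ∀ {N} → Maybe (Fin N) → Fin N → Bool
at nothing p = false
at (just q) p = q == p

at-true : ∀ {N} {m : Maybe (Fin N)} {p} → at m p ≡ true → m ≡ just p
at-true {m = just q} e = cong just (==-≡ e)

at-just : ∀ {N} {m : Maybe (Fin N)} {p} → m ≡ just p → at m p ≡ true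
at-just {p = p} refl = ==-refl p

sum-tight : ∀ {n} {f g : Fin n → ℕ} → (∀ i → f i ≤ g i) → sum f ≡ sum g → ∀ i → f i ≡ g i
sum-tight {suc n} {f} {g} le e zero = ≤-antisym (le zero)
  (lin 4 (λ a b c d → a :+ b := c :+ d ∷ b :≤ d ∷ [] ⊢ c :≤ a) (f zero) (sum (f ∘ suc)) (g zero) (sum (g ∘ suc)) e (sum-mono (le ∘ suc)))
sum-tight {suc n} {f} {g} le e (suc i) = sum-tight (le ∘ suc)
  (≤-antisym (sum-mono (le ∘ suc)) (lin 4 (λ a b c d → a :+ b := c :+ d ∷ a :≤ c ∷ [] ⊢ d :≤ b) (f zero) (sum (f ∘ suc)) (g zero) (sum (g ∘ suc)) e (le zero))) i

-- A partial linear space with coloured incidences: slot σ of v lies on the point `pt v σ` or is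
-- free. A colour occurs several times at each vertex, which is why incidences are indexed by slots.
-- For the columns made from points, `proper` and `linear` are the two halves of `Disjoint`.
module Incidence {M k W N : ℕ} (col : Fin W → Fin (suc k)) (pt : Fin M → Fin W → Maybe (Fin N))
  (inj : ∀ {v σ σ′ p} → pt v σ ≡ just p → pt v σ′ ≡ just p → σ ≡ σ′)
  (proper : ∀ {u v σ σ′ p} → u ≢ v → pt u σ ≡ just p → pt v σ′ ≡ just p → col σ ≢ col σ′)
  (linear : ∀ {u v σ₁ σ₁′ σ₂ σ₂′ p q} → u ≢ v → pt u σ₁ ≡ just p → pt v σ₁′ ≡ just p →
            pt u σ₂ ≡ just q → pt v σ₂′ ≡ just q → p ≡ q)
  where

  on? : ∀ v p → Dec (∃ λ σ → pt v σ ≡ just p)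
  on? v p = FinP.any? (λ σ → MaybeP.≡-dec FinP._≟_ (pt v σ) (just p))

  on : Fin M → Fin N → Bool
  on v p = Relation.Nullary.does (on? v p)

  on-true : ∀ {v p} → on v p ≡ true → ∃ λ σ → pt v σ ≡ just p
  on-true {v} {p} e with on? v p
  ... | yes h = h

  column : Fin N → Column M (suc k)
  column p v with on? v p
  ... | yes (σ , _) = suc (col σ)
  ... | no _ = zero

  column-nz : ∀ p v → nz (column p v) ≡ on v p
  column-nz p v with on? v p
  ... | yes _ = refl
  ... | no _ = refl

  used free : Fin M → ℕ
  used v = sum (λ σ → 𝟙 (is-just (pt v σ)))
  free v = sum (λ σ → 𝟙 (is-nothing (pt v σ)))

  used+free : ∀ v → used v + free v ≡ W
  used+free v = trans (sym (∑-distrib-+ (λ σ → 𝟙 (is-just (pt v σ))) (λ σ → 𝟙 (is-nothing (pt v σ)))))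
    (trans (sum-cong-≗ h) (trans (sum-const W 1) (*-identityʳ W)))
    where
    h : ∀ σ → 𝟙 (is-just (pt v σ)) + 𝟙 (is-nothing (pt v σ)) ≡ 1
    h σ with pt v σ
    ... | just _ = refl
    ... | nothing = refl

  sum-at-point : ∀ (m : Maybe (Fin N)) → sum (λ p → 𝟙 (at m p)) ≡ 𝟙 (is-just m)
  sum-at-point nothing = sum-0 {N} λ _ → refl
  sum-at-point (just q) = sum-one q

  on-sum : ∀ v p → 𝟙 (on v p) ≡ sum (λ σ → 𝟙 (at (pt v σ) p))
  on-sum v p with on? v p
  ... | yes (σ , e) = sym (trans (sum-at _ σ λ τ ne → other τ ne) (cong 𝟙 (at-just e)))
    where
    other : ∀ τ → τ ≢ σ → 𝟙 (at (pt v τ) p) ≡ 0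
    other τ ne with at (pt v τ) p in eq
    ... | false = refl
    ... | true = ⊥-elim (ne (inj (at-true eq) e))
  ... | no h = sym (sum-0 none)
    where
    none : ∀ σ → 𝟙 (at (pt v σ) p) ≡ 0
    none σ with at (pt v σ) p in eq
    ... | false = refl
    ... | true = ⊥-elim (h (σ , at-true eq))

  column-occ : ∀ p v a → 𝟙 (column p v == suc a) ≡ sum (λ σ → 𝟙 (col σ == a) * 𝟙 (at (pt v σ) p))
  column-occ p v a with on? v p
  ... | yes (σ , e) = sym (trans (sum-at _ σ λ τ ne → other τ ne)
        (trans (cong (λ b → 𝟙 (col σ == a) * 𝟙 b) (at-just e)) (trans (*-identityʳ _) (sym (cong 𝟙 (==-suc (col σ) a))))))
    where
    other : ∀ τ → τ ≢ σ → 𝟙 (col τ == a) * 𝟙 (at (pt v τ) p) ≡ 0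
    other τ ne with at (pt v τ) p in eq
    ... | false = *-zeroʳ (𝟙 (col τ == a))
    ... | true = ⊥-elim (ne (inj (at-true eq) e))
  ... | no h = sym (sum-0 none)
    where
    none : ∀ σ → 𝟙 (col σ == a) * 𝟙 (at (pt v σ) p) ≡ 0
    none σ with at (pt v σ) p in eq
    ... | false = *-zeroʳ (𝟙 (col σ == a))
    ... | true = ⊥-elim (h (σ , at-true eq))

  used-occ : ∀ v a → sum (λ p → 𝟙 (column p v == suc a)) ≡ sum (λ σ → 𝟙 (col σ == a) * 𝟙 (is-just (pt v σ)))
  used-occ v a = trans (sum-cong-≗ (λ p → column-occ p v a))
    (trans (∑-comm (λ p σ → 𝟙 (col σ == a) * 𝟙 (at (pt v σ) p)))
      (sum-cong-≗ (λ σ → trans (sym (*-distribˡ-sum (𝟙 (col σ == a)) (λ p → 𝟙 (at (pt v σ) p))))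
        (cong (𝟙 (col σ == a) *_) (sum-at-point (pt v σ))))))

  shared : Fin M → Fin M → ℕ
  shared u v = sum (λ p → 𝟙 (on u p ∧ on v p))

  shared≤1 : ∀ u v → u ≢ v → shared u v ≤ 1
  shared≤1 u v ne = sum-at-most-1 _ λ p q hp hq →
    let (a , b) = ∧-true hp ; (c , d) = ∧-true hq
        (_ , ea) = on-true {u} {p} a ; (_ , eb) = on-true {v} {p} b ; (_ , ec) = on-true {u} {q} c ; (_ , ed) = on-true {v} {q} d
    in linear ne ea eb ec ed

  freeMain : Fin M → ℕ
  freeMain v = sum (λ σ → 𝟙 (zero == col σ) * 𝟙 (is-nothing (pt v σ)))

  isOther : Fin M → Fin W → Bool
  isOther v σ = nz (col σ) ∧ is-nothing (pt v σ)

  collect : Fin M → List (Fin W) → List (Fin (suc k))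
  collect v [] = []
  collect v (σ ∷ σs) = if isOther v σ then col σ ∷ collect v σs else collect v σs

  freeOther : Fin M → List (Fin (suc k))
  freeOther v = collect v (allFin W)

  nz-zero : ∀ {c : Fin (suc k)} → nz c ≡ true → c ≢ zero
  nz-zero {suc c} _ ()

  collect-nz : ∀ v σs → All (_≢ zero) (collect v σs)
  collect-nz v [] = []
  collect-nz v (σ ∷ σs) with isOther v σ in eq
  ... | true = nz-zero (proj₁ (∧-true {nz (col σ)} eq)) ∷ collect-nz v σs
  ... | false = collect-nz v σs

  sumL-collect : ∀ v (f : Fin (suc k) → ℕ) σs → sumL f (collect v σs) ≡ sumL (λ σ → f (col σ) * 𝟙 (isOther v σ)) σs
  sumL-collect v f [] = refl
  sumL-collect v f (σ ∷ σs) with isOther v σ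
  ... | true = cong₂ _+_ (sym (*-identityʳ _)) (sumL-collect v f σs)
  ... | false = trans (sumL-collect v f σs) (cong (_+ sumL (λ τ → f (col τ) * 𝟙 (isOther v τ)) σs) (sym (*-zeroʳ (f (col σ)))))

  sum-freeOther : ∀ v f → sumL f (freeOther v) ≡ sum (λ σ → f (col σ) * 𝟙 (isOther v σ))
  sum-freeOther v f = trans (sumL-collect v f (allFin W)) (sumL-tabulate (λ σ → f (col σ) * 𝟙 (isOther v σ)) (λ σ → σ))

  free-split : ∀ v → freeMain v + length (freeOther v) ≡ free v
  free-split v = trans (cong (freeMain v +_) (trans (sumL-length (freeOther v)) (sum-freeOther v (λ _ → 1))))
    (trans (sym (∑-distrib-+ (λ σ → 𝟙 (zero == col σ) * 𝟙 (is-nothing (pt v σ))) (λ σ → 1 * 𝟙 (isOther v σ)))) (sum-cong-≗ h))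
    where
    h : ∀ σ → 𝟙 (zero == col σ) * 𝟙 (is-nothing (pt v σ)) + 1 * 𝟙 (isOther v σ) ≡ 𝟙 (is-nothing (pt v σ))
    h σ with col σ | is-nothing (pt v σ)
    ... | zero | true = refl
    ... | zero | false = refl
    ... | suc _ | true = refl
    ... | suc _ | false = refl

  module E = Edges {M} {k}

  occ-total : ∀ v a → sum (λ p → 𝟙 (column p v == suc a)) + E.avail freeMain freeOther v a ≡ sum (λ σ → 𝟙 (col σ == a))
  occ-total v a = begin
    sum (λ p → 𝟙 (column p v == suc a)) + (freeMain v * 𝟙 (zero == a) + E.count a (freeOther v))
      ≡⟨ cong₂ _+_ (used-occ v a) (cong₂ _+_ (trans (*-comm (freeMain v) _) (*-distribˡ-sum (𝟙 (zero == a)) (λ σ → 𝟙 (zero == col σ) * 𝟙 (is-nothing (pt v σ)))))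
                     (sum-freeOther v (λ c → 𝟙 (c == a)))) ⟩
    sum A + (sum B + sum C) ≡⟨ cong (sum A +_) (sym (∑-distrib-+ B C)) ⟩
    sum A + sum (λ σ → B σ + C σ) ≡⟨ sym (∑-distrib-+ A (λ σ → B σ + C σ)) ⟩
    sum (λ σ → A σ + (B σ + C σ)) ≡⟨ sum-cong-≗ h ⟩
    sum (λ σ → 𝟙 (col σ == a)) ∎
    where
    open ≡-Reasoning
    A B C : Fin W → ℕ
    A σ = 𝟙 (col σ == a) * 𝟙 (is-just (pt v σ))
    B σ = 𝟙 (zero == a) * (𝟙 (zero == col σ) * 𝟙 (is-nothing (pt v σ)))
    C σ = 𝟙 (col σ == a) * 𝟙 (isOther v σ)
    h : ∀ σ → A σ + (B σ + C σ) ≡ 𝟙 (col σ == a)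
    h σ with col σ | pt v σ
    h σ | zero | just _ with zero == a
    ... | true = refl
    ... | false = refl
    h σ | zero | nothing with zero == a
    ... | true = refl
    ... | false = refl
    h σ | suc c | just _ with suc c == a | zero == a
    ... | true | true = refl
    ... | true | false = refl
    ... | false | true = refl
    ... | false | false = refl
    h σ | suc c | nothing with suc c == a | zero == a
    ... | true | true = refl
    ... | true | false = refl
    ... | false | true = refl
    ... | false | false = refl

  -- Points, edges and leftover slots become columns. N + `sum free` counts one column for every
  -- free slot, and each edge saves one of them.
  complete : ∀ {n} (w : Vec ℕ (suc k)) → (∀ a → sum (λ σ → 𝟙 (col σ == a)) ≡ Vec.lookup w a) →
    (edges : List (Edge M)) → All (λ e → proj₁ e ≢ proj₂ e) edges →
    (∀ v → outdeg edges v ≤ freeMain v) → (∀ v → indeg edges v ≤ length (freeOther v)) →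
    (∀ u v → u ≢ v → shared u v + between edges u v ≤ 1) →
    N + sum free ≤ n + length edges → Columns w M n
  complete {n} w colours edges noloop outs ins fresh room = record
    { columns = points ++ rest
    ; columns-length = ≤-trans (≤-reflexive (trans (ListP.length-++ points) (cong (_+ length rest) (ListP.length-tabulate column))))
        (lin 5 (λ N r e f n → r :+ e := f ∷ N :+ f :≤ n :+ e ∷ [] ⊢ N :+ r :≤ n) N (length rest) (length edges) (sum free) n
          (trans (E.length-edges edges freeMain freeOther ft) (sum-cong-≗ free-split)) room)
    ; columns-occ = λ v a → trans (sumL-++ (λ c → 𝟙 (c v == suc a)) points rest)
        (trans (cong₂ _+_ (sumL-tabulate (λ c → 𝟙 (c v == suc a)) column) (E.occ-edges edges freeMain freeOther ft v a))
          (trans (occ-total v a) (colours a)))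
    ; columns-both = λ u v ne → ≤-trans (≤-reflexive (sumL-++ (λ c → 𝟙 (nz (c u) ∧ nz (c v))) points rest))
        (≤-trans (+-mono-≤ (≤-reflexive (trans (sumL-tabulate (λ c → 𝟙 (nz (c u) ∧ nz (c v))) column)
            (sum-cong-≗ (λ p → cong₂ (λ a b → 𝟙 (a ∧ b)) (column-nz p u) (column-nz p v)))))
          (E.both-edges edges freeMain freeOther ft u v ne)) (fresh u v ne))
    ; columns-agree = λ u v ne → AllP.++⁺ (AllP.tabulate⁺ (λ p → h u v ne p)) (E.agree-edges edges freeMain freeOther ft u v ne)
    }
    where
    points = List.tabulate column
    ft : E.Fits edges freeMain freeOther
    ft = E.fits noloop outs ins (λ x → collect-nz x (allFin W))
    rest = E.edgeColumns edges freeMain freeOther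
    h : ∀ u v → u ≢ v → ∀ p → nz (column p u) ≡ true → column p u ≢ column p v
    h u v ne p t e with on? u p | on? v p
    ... | yes (σ , eu) | yes (τ , ev) = proper ne eu ev (FinP.suc-injective e)
    ... | yes _ | no _ = case e of λ ()
    ... | no _ | _ = case t of λ ()

  complete-none : ∀ {n} (w : Vec ℕ (suc k)) → (∀ a → sum (λ σ → 𝟙 (col σ == a)) ≡ Vec.lookup w a) →
    N + sum free ≤ n → Columns w M n
  complete-none w colours room = complete w colours [] [] (λ _ → z≤n) (λ _ → z≤n)
    (λ u v ne → ≤-trans (≤-reflexive (+-identityʳ _)) (shared≤1 u v ne)) (≤-trans room (≤-reflexive (sym (+-identityʳ _))))

  size : Fin N → ℕ
  size p = sum (λ v → 𝟙 (on v p))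

  incidences : sum size ≡ sum used
  incidences = trans (∑-comm (λ p v → 𝟙 (on v p))) (sum-cong-≗ λ v → trans (sum-cong-≗ (λ p → on-sum v p))
    (trans (∑-comm (λ p σ → 𝟙 (at (pt v σ) p))) (sum-cong-≗ λ σ → sum-at-point (pt v σ))))

  -- Shared points counted from one vertex: every used slot σ of v contributes the other
  -- members of its point.
  neighbours : ∀ v → sum (λ u → shared u v) ≡ sum (λ p → 𝟙 (on v p) * size p)
  neighbours v = trans (∑-comm (λ u p → 𝟙 (on u p ∧ on v p))) (sum-cong-≗ λ p →
    trans (sum-cong-≗ (λ u → h u p)) (sym (*-distribˡ-sum (𝟙 (on v p)) (λ u → 𝟙 (on u p)))))
    where
    h : ∀ u p → 𝟙 (on u p ∧ on v p) ≡ 𝟙 (on v p) * 𝟙 (on u p)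
    h u p with on u p | on v p
    ... | true | true = refl
    ... | true | false = refl
    ... | false | true = refl
    ... | false | false = refl

  shared-sym : ∀ u v → shared u v ≡ shared v u
  shared-sym u v = sum-cong-≗ λ p → cong 𝟙 (∧-comm (on u p) (on v p))

  used-on : ∀ v → sum (λ p → 𝟙 (on v p)) ≡ used v
  used-on v = trans (sum-cong-≗ (on-sum v)) (trans (∑-comm (λ p σ → 𝟙 (at (pt v σ) p))) (sum-cong-≗ λ σ → sum-at-point (pt v σ)))

  shared-self : ∀ v → shared v v ≡ used v
  shared-self v = trans (sum-cong-≗ λ p → cong 𝟙 (∧-idem (on v p))) (used-on v)

  -- The leave of the packing, as it is called for designs. Turning it into edges makes every two
  -- words meet exactly once.
  leave : Fin M → Fin M → Bool
  leave u v = not (u == v) ∧ (shared u v ≡ᵇ 0)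

  leave-sym : ∀ u v → leave u v ≡ leave v u
  leave-sym u v = cong₂ _∧_ (cong not h) (cong (_≡ᵇ 0) (shared-sym u v))
    where
    h : (u == v) ≡ (v == u)
    h with u FinP.≟ v
    ... | yes refl = sym (==-refl u)
    ... | no ne = sym (==-≢ (ne ∘ sym))

  leave-irrefl : ∀ u → leave u u ≡ false
  leave-irrefl u = cong (λ b → not b ∧ (shared u u ≡ᵇ 0)) (==-refl u)

  leave-cover : ∀ u v → u ≢ v → shared u v + 𝟙 (leave u v) ≡ 1
  leave-cover u v ne rewrite ==-≢ ne with shared u v | shared≤1 u v ne
  ... | 0 | _ = refl
  ... | 1 | _ = refl
  ... | 2+ _ | s≤s ()

  leaveDegree : Fin M → ℕ
  leaveDegree v = sum (λ u → 𝟙 (leave v u))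

  -- Each u ≠ v contributes 1, through a shared point or through the leave; u = v contributes
  -- `shared v v`, which is `used v`.
  leave-count : ∀ v → leaveDegree v + sum (λ u → shared u v) + 1 ≡ M + used v
  leave-count v = begin
    leaveDegree v + sum (λ u → shared u v) + 1
      ≡⟨ cong₂ _+_ (sym (∑-distrib-+ (λ u → 𝟙 (leave v u)) (λ u → shared u v))) (sym one) ⟩
    sum (λ u → 𝟙 (leave v u) + shared u v) + sum (λ u → 𝟙 (u == v))
      ≡⟨ sym (∑-distrib-+ (λ u → 𝟙 (leave v u) + shared u v) (λ u → 𝟙 (u == v))) ⟩
    sum (λ u → 𝟙 (leave v u) + shared u v + 𝟙 (u == v)) ≡⟨ sum-cong-≗ h ⟩
    sum (λ u → 1 + used v * 𝟙 (u == v)) ≡⟨ ∑-distrib-+ (λ _ → 1) (λ u → used v * 𝟙 (u == v)) ⟩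
    sum {M} (λ _ → 1) + sum (λ u → used v * 𝟙 (u == v))
      ≡⟨ cong₂ _+_ (trans (sum-const M 1) (*-identityʳ M)) (trans (sym (*-distribˡ-sum (used v) (λ u → 𝟙 (u == v)))) (trans (cong (used v *_) one) (*-identityʳ (used v)))) ⟩
    M + used v ∎
    where
    open ≡-Reasoning
    one : sum (λ u → 𝟙 (u == v)) ≡ 1
    one = trans (sum-at _ v λ u ne → cong 𝟙 (==-≢ ne)) (cong 𝟙 (==-refl v))
    h : ∀ u → 𝟙 (leave v u) + shared u v + 𝟙 (u == v) ≡ 1 + used v * 𝟙 (u == v)
    h u with u FinP.≟ v
    ... | yes refl rewrite leave-irrefl u | shared-self u | *-identityʳ (used u) = +-comm (used u) 1
    ... | no ne rewrite *-zeroʳ (used v) = trans (+-identityʳ _) (trans (+-comm (𝟙 (leave v u)) _)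
            (trans (cong (λ b → shared u v + 𝟙 b) (leave-sym v u)) (leave-cover u v ne)))

  slotWeight : (Fin N → ℕ) → Maybe (Fin N) → ℕ
  slotWeight c nothing = 0
  slotWeight c (just p) = c p

  sum-slotWeight : ∀ c v → sum (λ p → 𝟙 (on v p) * c p) ≡ sum (λ σ → slotWeight c (pt v σ))
  sum-slotWeight c v = trans (sum-cong-≗ (λ p → trans (cong (_* c p) (on-sum v p)) (trans (*-comm _ (c p)) (*-distribˡ-sum (c p) (λ σ → 𝟙 (at (pt v σ) p))))))
    (trans (∑-comm (λ p σ → c p * 𝟙 (at (pt v σ) p))) (sum-cong-≗ λ σ → h (pt v σ)))
    where
    h : ∀ m → sum (λ p → c p * 𝟙 (at m p)) ≡ slotWeight c m
    h nothing = sum-0 λ p → *-zeroʳ (c p)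
    h (just q) = trans (sum-at _ q λ p ne → trans (cong (λ b → c p * 𝟙 b) (==-≢ (ne ∘ sym))) (*-zeroʳ (c p)))
      (trans (cong (λ b → c q * 𝟙 b) (==-refl q)) (*-identityʳ (c q)))

  -- Upper bounds c on the sizes of the points whose sum is the number of incidences are exact, by
  -- `sum-tight`; this replaces an enumeration of the members of each point. The neighbours of v are
  -- then counted by its slots, and d v is what remains for the leave. The factors 2 come from
  -- counting edges by degrees.
  complete-leave : ∀ {n} (w : Vec ℕ (suc k)) → (∀ a → sum (λ σ → 𝟙 (col σ == a)) ≡ Vec.lookup w a) →
    (c : Fin N → ℕ) → (∀ p → size p ≤ c p) → sum c ≡ sum used →
    (d : Fin M → ℕ) → (∀ v → M + used v ≡ suc (d v + sum (λ σ → slotWeight c (pt v σ)))) →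
    (∀ v → d v ≤ 2 * freeMain v) → (∀ v → d v ≤ 2 * length (freeOther v)) →
    2 * (N + sum free) ≤ 2 * n + sum d → Columns w M n
  complete-leave {n} w colours c small total d count dMain dOther room =
    complete w colours arcs arcs-proper
      (λ v → arcs-out v (freeMain v) (≤-trans (≤-reflexive (deg v)) (dMain v)))
      (λ v → arcs-in v (length (freeOther v)) (≤-trans (≤-reflexive (deg v)) (dOther v)))
      (λ u v ne → ≤-reflexive (trans (cong (shared u v +_) (arcs-between u v)) (leave-cover u v ne)))
      (lin 4 (λ X n D l → 2 :* X :≤ 2 :* n :+ D ∷ D := 2 :* l ∷ [] ⊢ X :≤ n :+ l) (N + sum free) n (sum d) (length arcs) room
        (trans (sum-cong-≗ (λ v → sym (deg v))) arcs-length))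
    where
    open Graph leave leave-sym leave-irrefl
    open Oriented oriented
    exact : ∀ p → size p ≡ c p
    exact = sum-tight small (trans incidences (sym total))
    deg : ∀ v → leaveDegree v ≡ d v
    deg v = lin 5 (λ L S A D u → L :+ S :+ K 1 := A ∷ A := K 1 :+ (D :+ S) ∷ [] ⊢ L := D) (leaveDegree v) (sum (λ u → shared u v)) (M + used v) (d v) 0
      (leave-count v) (trans (count v) (cong (λ z → suc (d v + z)) (sym (trans (neighbours v)
        (trans (sum-cong-≗ (λ p → cong (𝟙 (on v p) *_) (exact p))) (sum-slotWeight c v))))))

-- Coloured slots

sum-splitAt : ∀ m {n} (f : Fin (m + n) → ℕ) → sum f ≡ sum (λ i → f (i ↑ˡ n)) + sum (λ j → f (m ↑ʳ j))
sum-splitAt zero f = refl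
sum-splitAt (suc m) f = trans (cong (f zero +_) (sum-splitAt m (f ∘ suc))) (sym (+-assoc (f zero) _ _))

colour : ∀ {k} (w : Vec ℕ k) → Fin (Vec.sum w) → Fin k
colour (x ∷ w) i with splitAt x i
... | inj₁ _ = zero
... | inj₂ j = suc (colour w j)

colour-count : ∀ {k} (w : Vec ℕ k) a → sum (λ i → 𝟙 (colour w i == a)) ≡ lookup w a
colour-count (x ∷ w) a = trans (sum-splitAt x (λ i → 𝟙 (colour (x ∷ w) i == a))) (trans (cong₂ _+_ (sum-cong-≗ l) (sum-cong-≗ r)) (total a))
  where
  l : ∀ i → 𝟙 (colour (x ∷ w) (i ↑ˡ Vec.sum w) == a) ≡ 𝟙 (zero == a)
  l i rewrite FinP.splitAt-↑ˡ x i (Vec.sum w) = refl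
  r : ∀ j → 𝟙 (colour (x ∷ w) (x ↑ʳ j) == a) ≡ 𝟙 (suc (colour w j) == a)
  r j rewrite FinP.splitAt-↑ʳ x (Vec.sum w) j = refl
  total : ∀ a → sum {x} (λ _ → 𝟙 (zero == a)) + sum (λ j → 𝟙 (suc (colour w j) == a)) ≡ lookup (x ∷ w) a
  total zero = trans (cong₂ _+_ (trans (sum-const x 1) (*-identityʳ x)) (sum-0 {Vec.sum w} λ _ → refl)) (+-identityʳ x)
  total (suc a) = trans (cong₂ _+_ (sum-0 {x} λ _ → refl) (sum-cong-≗ λ j → cong 𝟙 (==-suc (colour w j) a))) (colour-count w a)

start : ∀ {k} → Vec ℕ k → Fin k → ℕ
start (x ∷ w) zero = 0
start (x ∷ w) (suc c) = x + start w c

colour-position : ∀ {k} (w : Vec ℕ k) i → start w (colour w i) ≤ toℕ i × toℕ i < start w (colour w i) + lookup w (colour w i)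
colour-position (x ∷ w) i with splitAt x i in eq
... | inj₁ j = z≤n , subst (_< x) (trans (sym (FinP.toℕ-↑ˡ j _)) (cong toℕ (FinP.splitAt⁻¹-↑ˡ eq))) (FinP.toℕ<n j)
... | inj₂ j with colour-position w j | trans (sym (FinP.toℕ-↑ʳ x j)) (cong toℕ (FinP.splitAt⁻¹-↑ʳ eq))
...   | p , q | e = ≤-trans (+-monoʳ-≤ x p) (≤-reflexive e) ,
          ≤-trans (≤-reflexive (cong suc (sym e))) (≤-trans (≤-reflexive (sym (+-suc x _))) (≤-trans (+-monoʳ-≤ x q) (≤-reflexive (sym (+-assoc x _ _)))))

Sorted : ∀ {k} → Vec ℕ k → Set
Sorted {k} w = ∀ (i j : Fin k) → toℕ i ≤ toℕ j → lookup w j ≤ lookup w i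

colour-main : ∀ {k} (w : Vec ℕ (suc k)) i → toℕ i < Vec.head w → colour w i ≡ zero
colour-main (x ∷ w) i lt with splitAt x i in eq
... | inj₁ _ = refl
... | inj₂ j = ⊥-elim (<-irrefl refl (<-≤-trans lt (≤-trans (m≤m+n x (toℕ j)) (≤-reflexive (trans (sym (FinP.toℕ-↑ʳ x j)) (cong toℕ (FinP.splitAt⁻¹-↑ʳ eq)))))))

colour-other : ∀ {k} (w : Vec ℕ (suc k)) i → Vec.head w ≤ toℕ i → colour w i ≢ zero
colour-other (x ∷ w) i le e = <-irrefl refl (<-≤-trans (proj₂ (subst (λ c → start (x ∷ w) c ≤ toℕ i × toℕ i < start (x ∷ w) c + lookup (x ∷ w) c) e (colour-position (x ∷ w) i))) le)

-- A colour class is an interval of length at most x. Beyond 2 x it is shorter than x, unless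
-- the second class has length x, and then no class crosses 2 x.
colour-far : ∀ {k} x (w : Vec ℕ (suc k)) → Sorted (x ∷ w) → ∀ i j →
  x ≤ toℕ i → toℕ i < x + x → x + x ≤ toℕ j → toℕ i + x ≤ suc (toℕ j) → colour (x ∷ w) i ≢ colour (x ∷ w) j
colour-far x (y ∷ w) sorted i j p q r s e with colour (x ∷ y ∷ w) i | colour (x ∷ y ∷ w) j | colour-position (x ∷ y ∷ w) i | colour-position (x ∷ y ∷ w) j
colour-far x (y ∷ w) sorted i j p q r s refl | zero | _ | _ , a | _ , b = <-irrefl refl (<-≤-trans a p)
colour-far x (y ∷ w) sorted i j p q r s refl | suc zero | _ | _ , a | _ , b =
  lin 3 (λ x y j → j :< x :+ K 0 :+ y ∷ y :≤ x ∷ x :+ x :≤ j ∷ [] ⊢ absurd) x y (toℕ j) b (sorted zero (suc zero) z≤n) r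
colour-far x (y ∷ w) sorted i j p q r s refl | suc (suc c) | _ | a , _ | _ , b =
  lin 6 (λ x y i j s l → x :+ (y :+ s) :≤ i ∷ j :< x :+ (y :+ s) :+ l ∷ l :≤ y ∷ y :≤ x ∷ i :< x :+ x ∷ i :+ x :≤ K 1 :+ j ∷ [] ⊢ absurd)
    x y (toℕ i) (toℕ j) (start w c) (lookup w c) a b (sorted (suc zero) (suc (suc c)) (s≤s z≤n)) (sorted zero (suc zero) z≤n) q s

-- Consecutive blocks of slots: A will hold colour 1, while B and C hold all the other colours in
-- their order.
data Slot (a b c : ℕ) : Set where
  A : Fin a → Slot a b c
  B : Fin b → Slot a b c
  C : Fin c → Slot a b c

viewBC : ∀ a b c → Fin b ⊎ Fin c → Slot a b c
viewBC a b c (inj₁ i) = B i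
viewBC a b c (inj₂ i) = C i

viewA : ∀ a b c → Fin a ⊎ Fin (b + c) → Slot a b c
viewA a b c (inj₁ i) = A i
viewA a b c (inj₂ i) = viewBC a b c (splitAt b i)

view : ∀ a b c → Fin (a + (b + c)) → Slot a b c
view a b c i = viewA a b c (splitAt a i)

place : ∀ a b c → Slot a b c → Fin (a + (b + c))
place a b c (A i) = i ↑ˡ (b + c)
place a b c (B i) = a ↑ʳ (i ↑ˡ c)
place a b c (C i) = a ↑ʳ (b ↑ʳ i)

place-view : ∀ a b c i → place a b c (view a b c i) ≡ i
place-view a b c i with splitAt a i in eq
... | inj₁ j = FinP.splitAt⁻¹-↑ˡ eq
... | inj₂ j with splitAt b j in eq′
...   | inj₁ l = trans (cong (a ↑ʳ_) (FinP.splitAt⁻¹-↑ˡ eq′)) (FinP.splitAt⁻¹-↑ʳ eq)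
...   | inj₂ l = trans (cong (a ↑ʳ_) (FinP.splitAt⁻¹-↑ʳ eq′)) (FinP.splitAt⁻¹-↑ʳ eq)

view-place : ∀ {a b c} (s : Slot a b c) → view a b c (place a b c s) ≡ s
view-place {a} {b} {c} (A i) rewrite FinP.splitAt-↑ˡ a i (b + c) = refl
view-place {a} {b} {c} (B i) rewrite FinP.splitAt-↑ʳ a (b + c) (i ↑ˡ c) | FinP.splitAt-↑ˡ b i c = refl
view-place {a} {b} {c} (C i) rewrite FinP.splitAt-↑ʳ a (b + c) (b ↑ʳ i) | FinP.splitAt-↑ʳ b c i = refl

sumSlots : ∀ {a b c} → (Slot a b c → ℕ) → ℕ
sumSlots f = sum (f ∘ A) + (sum (f ∘ B) + sum (f ∘ C))

sum-view : ∀ a b c (f : Fin (a + (b + c)) → ℕ) → sum f ≡ sumSlots {a} {b} {c} (λ s → f (place a b c s))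
sum-view a b c f = trans (sum-splitAt a {b + c} f) (cong (sum {a} (λ i → f (i ↑ˡ (b + c))) +_) (sum-splitAt b {c} (λ j → f (a ↑ʳ j))))

sum-cast : ∀ {m n} (eq : m ≡ n) (f : Fin n → ℕ) → sum (λ i → f (cast eq i)) ≡ sum f
sum-cast refl f = sum-cong-≗ λ i → cong f (FinP.cast-is-id refl i)

-- Slots whose colours differ whatever the components after the first are. B i and C j stand at
-- positions a + i and 2a + j if a = b, and i ≤ j + 1 puts them at least a - 1 apart, which is
-- enough for `colour-far`.
data Compatible {a b c} : Slot a b c → Slot a b c → Set where
  AB : ∀ {i j} → Compatible (A i) (B j)
  BA : ∀ {i j} → Compatible (B i) (A j)
  AC : ∀ {i j} → Compatible (A i) (C j)
  CA : ∀ {i j} → Compatible (C i) (A j)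
  BC : ∀ {i j} → a ≡ b → toℕ i ≤ suc (toℕ j) → Compatible (B i) (C j)
  CB : ∀ {i j} → a ≡ b → toℕ i ≤ suc (toℕ j) → Compatible (C j) (B i)

module Scheme {m} (w : Vec ℕ (2 + m)) (sorted : Sorted w) {a b c : ℕ} (main : Vec.head w ≡ a) (b≤a : b ≤ a)
  (total : a + (b + c) ≡ Vec.sum w) {M N : ℕ} (pt : Fin M → Slot a b c → Maybe (Fin N))
  (inj : ∀ v s s′ p → pt v s ≡ just p → pt v s′ ≡ just p → s ≡ s′)
  (compatible : ∀ u v s s′ p → u ≢ v → pt u s ≡ just p → pt v s′ ≡ just p → Compatible s s′)
  (linear : ∀ u v s₁ s₁′ s₂ s₂′ p q → u ≢ v → pt u s₁ ≡ just p → pt v s₁′ ≡ just p →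
            pt u s₂ ≡ just q → pt v s₂′ ≡ just q → p ≡ q)
  where

  col : Fin (a + (b + c)) → Fin (2 + m)
  col σ = colour w (cast total σ)

  pl : Slot a b c → Fin (a + (b + c))
  pl = place a b c

  colours : ∀ x → sum (λ σ → 𝟙 (col σ == x)) ≡ lookup w x
  colours x = trans (sum-cast total (λ σ → 𝟙 (colour w σ == x))) (colour-count w x)

  pos : Slot a b c → ℕ
  pos (A i) = toℕ i
  pos (B i) = a + toℕ i
  pos (C i) = a + (b + toℕ i)

  toℕ-place : ∀ s → toℕ (cast total (pl s)) ≡ pos s
  toℕ-place (A i) = trans (FinP.toℕ-cast total _) (FinP.toℕ-↑ˡ i _)
  toℕ-place (B i) = trans (FinP.toℕ-cast total _) (trans (FinP.toℕ-↑ʳ a _) (cong (a +_) (FinP.toℕ-↑ˡ i c)))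
  toℕ-place (C i) = trans (FinP.toℕ-cast total _) (trans (FinP.toℕ-↑ʳ a _) (cong (a +_) (FinP.toℕ-↑ʳ b i)))

  col-A : ∀ i → col (pl (A i)) ≡ zero
  col-A i = colour-main w _ (subst₂ _<_ (sym (toℕ-place (A i))) (sym main) (FinP.toℕ<n i))
  col-B : ∀ i → col (pl (B i)) ≢ zero
  col-B i = colour-other w _ (subst₂ _≤_ (sym main) (sym (toℕ-place (B i))) (m≤m+n a _))
  col-C : ∀ i → col (pl (C i)) ≢ zero
  col-C i = colour-other w _ (subst₂ _≤_ (sym main) (sym (toℕ-place (C i))) (m≤m+n a _))

  col-BC : ∀ i j → a ≡ b → toℕ i ≤ suc (toℕ j) → col (pl (B i)) ≢ col (pl (C j))
  col-BC i j ab le = far w main sorted (cast total (pl (B i))) (cast total (pl (C j)))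
      (subst (a ≤_) (sym (toℕ-place (B i))) (m≤m+n a _))
      (subst (_< a + a) (sym (toℕ-place (B i))) (+-monoʳ-< a (subst (toℕ i <_) (sym ab) (FinP.toℕ<n i))))
      (subst (a + a ≤_) (sym (toℕ-place (C j))) (+-monoʳ-≤ a (≤-trans (≤-reflexive ab) (m≤m+n b _))))
      (subst₂ (λ x y → x + a ≤ suc y) (sym (toℕ-place (B i))) (sym (toℕ-place (C j)))
        (lin 4 (λ a b i j → a := b ∷ i :≤ K 1 :+ j ∷ [] ⊢ a :+ i :+ a :≤ K 1 :+ (a :+ (b :+ j))) a b (toℕ i) (toℕ j) ab le))
    where
    far : ∀ (w : Vec ℕ (2 + m)) → Vec.head w ≡ a → Sorted w → ∀ i j → a ≤ toℕ i → toℕ i < a + a → a + a ≤ toℕ j →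
      toℕ i + a ≤ suc (toℕ j) → colour w i ≢ colour w j
    far (x ∷ w) refl = colour-far x w

  compatible-col : ∀ {s s′} → Compatible s s′ → col (pl s) ≢ col (pl s′)
  compatible-col (AB {i} {j}) e = col-B j (trans (sym e) (col-A i))
  compatible-col (BA {i} {j}) e = col-B i (trans e (col-A j))
  compatible-col (AC {i} {j}) e = col-C j (trans (sym e) (col-A i))
  compatible-col (CA {i} {j}) e = col-C i (trans e (col-A j))
  compatible-col (BC {i} {j} ab le) e = col-BC i j ab le e
  compatible-col (CB {i} {j} ab le) e = col-BC i j ab le (sym e)

  pt′ : Fin M → Fin (a + (b + c)) → Maybe (Fin N)
  pt′ v σ = pt v (view a b c σ)

  open Incidence {M} {suc m} {a + (b + c)} {N} col pt′
    (λ {v} {σ} {σ′} {p} e e′ → trans (sym (place-view a b c σ)) (trans (cong pl (inj v _ _ p e e′)) (place-view a b c σ′)))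
    (λ {u} {v} {σ} {σ′} {p} ne e e′ → subst₂ (λ x y → col x ≢ col y) (place-view a b c σ) (place-view a b c σ′) (compatible-col (compatible u v _ _ p ne e e′)))
    (λ {u} {v} {σ₁} {σ₁′} {σ₂} {σ₂′} {p} {q} ne e e′ f f′ → linear u v _ _ _ _ p q ne e e′ f f′)
    public

  sum-pt : ∀ (f : Maybe (Fin N) → ℕ) v → sum (λ σ → f (pt′ v σ)) ≡ sumSlots (λ s → f (pt v s))
  sum-pt f v = trans (sum-view a b c (λ σ → f (pt′ v σ)))
    (cong₂ _+_ (sum-cong-≗ λ i → cong (f ∘ pt v) (view-place (A i)))
      (cong₂ _+_ (sum-cong-≗ λ i → cong (f ∘ pt v) (view-place (B i))) (sum-cong-≗ λ i → cong (f ∘ pt v) (view-place (C i)))))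

  freeA freeB freeC : Fin M → ℕ
  freeA v = sum (λ i → 𝟙 (is-nothing (pt v (A i))))
  freeB v = sum (λ i → 𝟙 (is-nothing (pt v (B i))))
  freeC v = sum (λ i → 𝟙 (is-nothing (pt v (C i))))

  free-slots : ∀ v → free v ≡ freeA v + (freeB v + freeC v)
  free-slots v = sum-pt (λ x → 𝟙 (is-nothing x)) v

  freeMain-slots : ∀ v → freeMain v ≡ freeA v
  freeMain-slots v = trans (sum-view a b c (λ σ → 𝟙 (zero == col σ) * 𝟙 (is-nothing (pt′ v σ))))
    (trans (cong₂ _+_ (sum-cong-≗ hA) (cong₂ _+_ (sum-0 hB) (sum-0 hC))) (+-identityʳ _))
    where
    hA : ∀ i → 𝟙 (zero == col (pl (A i))) * 𝟙 (is-nothing (pt′ v (pl (A i)))) ≡ 𝟙 (is-nothing (pt v (A i)))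
    hA i rewrite col-A i | view-place {a} {b} {c} (A i) = *-identityˡ _
    hB : ∀ i → 𝟙 (zero == col (pl (B i))) * 𝟙 (is-nothing (pt′ v (pl (B i)))) ≡ 0
    hB i rewrite ==-≢ (col-B i ∘ sym) = refl
    hC : ∀ i → 𝟙 (zero == col (pl (C i))) * 𝟙 (is-nothing (pt′ v (pl (C i)))) ≡ 0
    hC i rewrite ==-≢ (col-C i ∘ sym) = refl

  freeOther-slots : ∀ v → length (freeOther v) ≡ freeB v + freeC v
  freeOther-slots v = +-cancelˡ-≡ (freeMain v) _ _ (trans (free-split v) (trans (free-slots v) (cong (_+ (freeB v + freeC v)) (sym (freeMain-slots v)))))

-- Residues and starters

-- Residues are moved by natural numbers instead of being added to each other: the differences of a
-- design are then numbers that `lin` can compare. The operation is abstract, so it is accessible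
-- only through `toℕ-⊕`.
module Shift (μ : ℕ) .{{_ : NonZero μ}} where

  infixl 6 _⊕_
  abstract
    _⊕_ : Fin μ → ℕ → Fin μ
    x ⊕ n = fromℕ< (m%n<n (toℕ x + n) μ)

    toℕ-⊕ : ∀ x n → toℕ (x ⊕ n) ≡ (toℕ x + n) % μ
    toℕ-⊕ x n = FinP.toℕ-fromℕ< (m%n<n (toℕ x + n) μ)

  ⊕-natural : ∀ {x y d} → toℕ y ≡ toℕ x + d → y ≡ x ⊕ d
  ⊕-natural {x} {y} {d} e = FinP.toℕ-injective (trans (sym (m<n⇒m%n≡m (FinP.toℕ<n y))) (trans (cong (_% μ) e) (sym (toℕ-⊕ x d))))

  ⊕-0 : ∀ x → x ⊕ 0 ≡ x
  ⊕-0 x = sym (⊕-natural {x} {x} {0} (sym (+-identityʳ (toℕ x))))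

  ⊕-assoc : ∀ x m n → x ⊕ m ⊕ n ≡ x ⊕ (m + n)
  ⊕-assoc x m n = FinP.toℕ-injective (begin
    toℕ (x ⊕ m ⊕ n) ≡⟨ toℕ-⊕ (x ⊕ m) n ⟩
    (toℕ (x ⊕ m) + n) % μ ≡⟨ cong (λ z → (z + n) % μ) (toℕ-⊕ x m) ⟩
    ((toℕ x + m) % μ + n) % μ ≡⟨ %-distribˡ-+ ((toℕ x + m) % μ) n μ ⟩
    ((toℕ x + m) % μ % μ + n % μ) % μ ≡⟨ cong (λ z → (z + n % μ) % μ) (m%n%n≡m%n (toℕ x + m) μ) ⟩
    ((toℕ x + m) % μ + n % μ) % μ ≡⟨ sym (%-distribˡ-+ (toℕ x + m) n μ) ⟩
    (toℕ x + m + n) % μ ≡⟨ cong (_% μ) (+-assoc (toℕ x) m n) ⟩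
    (toℕ x + (m + n)) % μ ≡⟨ sym (toℕ-⊕ x (m + n)) ⟩
    toℕ (x ⊕ (m + n)) ∎)
    where open ≡-Reasoning

  ⊕-comm : ∀ x m n → x ⊕ m ⊕ n ≡ x ⊕ n ⊕ m
  ⊕-comm x m n = trans (⊕-assoc x m n) (trans (cong (x ⊕_) (+-comm m n)) (sym (⊕-assoc x n m)))

  ⊕-multiple : ∀ x k → x ⊕ (k * μ) ≡ x
  ⊕-multiple x k = FinP.toℕ-injective (trans (toℕ-⊕ x (k * μ)) (trans ([m+kn]%n≡m%n (toℕ x) k μ) (m<n⇒m%n≡m (FinP.toℕ<n x))))

  ⊕-full : ∀ x → x ⊕ μ ≡ x
  ⊕-full x = trans (cong (x ⊕_) (sym (+-identityʳ μ))) (⊕-multiple x 1)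

  ⊕-injective : ∀ {x y} n → x ⊕ n ≡ y ⊕ n → x ≡ y
  -- The step n may exceed μ, so its inverse is n μ - n rather than μ - n.
  ⊕-injective {x} {y} n e = trans (sym (h x)) (trans (cong (_⊕ (n * μ ∸ n)) e) (h y))
    where
    h : ∀ z → z ⊕ n ⊕ (n * μ ∸ n) ≡ z
    h z = trans (⊕-assoc z n _) (trans (cong (z ⊕_) (m+[n∸m]≡n (m≤m*n n μ))) (⊕-multiple z n))

  origin : Fin μ
  origin = fromℕ< (m%n<n 0 μ)

  toℕ-origin : toℕ origin ≡ 0
  toℕ-origin = trans (FinP.toℕ-fromℕ< (m%n<n 0 μ)) (m<n⇒m%n≡m (>-nonZero⁻¹ μ))

  from-origin : ∀ x → origin ⊕ toℕ x ≡ x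
  from-origin x = sym (⊕-natural {origin} {x} {toℕ x} (cong (_+ toℕ x) (sym toℕ-origin)))

  ⊕-cancel : ∀ {x m n} → m < μ → n < μ → x ⊕ m ≡ x ⊕ n → m ≡ n
  ⊕-cancel {x} {m} {n} m< n< e = trans (sym (value m<)) (trans (cong toℕ same) (value n<))
    where
    value : ∀ {k} → k < μ → toℕ (origin ⊕ k) ≡ k
    value {k} k< = trans (toℕ-⊕ origin k) (trans (cong (λ z → (z + k) % μ) toℕ-origin) (m<n⇒m%n≡m k<))
    same : origin ⊕ m ≡ origin ⊕ n
    same = ⊕-injective (toℕ x) (trans (⊕-comm origin m (toℕ x)) (trans (cong (_⊕ m) (from-origin x))
      (trans e (trans (cong (_⊕ n) (sym (from-origin x))) (⊕-comm origin (toℕ x) n)))))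

  ⊖-⊕ : ∀ x {n} → n ≤ μ → x ⊕ (μ ∸ n) ⊕ n ≡ x
  ⊖-⊕ x {n} le = trans (⊕-assoc x (μ ∸ n) n) (trans (cong (x ⊕_) (m∸n+n≡m le)) (⊕-full x))

  ⊕-⊖ : ∀ x {n} → n ≤ μ → x ⊕ n ⊕ (μ ∸ n) ≡ x
  ⊕-⊖ x {n} le = trans (⊕-comm x n (μ ∸ n)) (⊖-⊕ x le)

  ⊕-loop : ∀ {x n} → x ⊕ n ≡ x → n < μ → n ≡ 0
  ⊕-loop {x} e lt = ⊕-cancel lt (>-nonZero⁻¹ μ) (trans e (sym (⊕-0 x)))

  -- Opposite steps add up to a full turn.
  ⊕-round : ∀ {x y m n} → y ≡ x ⊕ m → x ≡ y ⊕ n → m < μ → n < μ → (m ≡ 0 × n ≡ 0) ⊎ m + n ≡ μ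
  ⊕-round {x} {y} {m} {n} e f m< n< with m + n <? μ
  ... | yes lt = inj₁ (m+n≡0⇒m≡0 m z , m+n≡0⇒n≡0 m z)
    where
    z : m + n ≡ 0
    z = ⊕-loop {x} (trans (sym (⊕-assoc x m n)) (trans (cong (_⊕ n) (sym e)) (sym f))) lt
  ... | no ge = inj₂ (trans (sym (m∸n+n≡m (≮⇒≥ ge))) (cong (_+ μ) z))
    where
    z : m + n ∸ μ ≡ 0
    z = ⊕-loop {x} (trans (sym (⊕-full (x ⊕ (m + n ∸ μ)))) (trans (⊕-assoc x _ μ) (trans (cong (x ⊕_) (m∸n+n≡m (≮⇒≥ ge)))
          (trans (sym (⊕-assoc x m n)) (trans (cong (_⊕ n) (sym e)) (sym f))))))
          (lin 4 (λ d m n u → d :+ u := m :+ n ∷ m :< u ∷ n :< u ∷ [] ⊢ d :< u) (m + n ∸ μ) m n μ (m∸n+n≡m (≮⇒≥ ge)) m< n<)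

data Parity : ℕ → Set where
  even : ∀ k → Parity (2 * k)
  odd : ∀ k → Parity (suc (2 * k))

parity : ∀ n → Parity n
parity zero = even 0
parity (suc n) with parity n
... | even k = odd k
... | odd k = subst Parity (cong suc (+-suc k (k + 0))) (even (suc k))

-- Nested pairs: the even differences around the hole, the odd ones next to them.
module Starter (n : ℕ) where

  hole rest : ℕ
  hole = ⌊ n /2⌋
  rest = n ∸ hole

  halves : hole + rest ≡ n
  halves = m+[n∸m]≡n (⌊n/2⌋≤n n)

  near : hole ≤ rest × rest ≤ suc hole
  near = ≤-trans (⌊n/2⌋≤⌈n/2⌉ n) (≤-reflexive rest≡) , ≤-trans (≤-reflexive (sym rest≡)) (h n)
    where
    rest≡ : ⌈ n /2⌉ ≡ rest
    rest≡ = +-cancelˡ-≡ hole _ _ (trans (⌊n/2⌋+⌈n/2⌉≡n n) (sym halves))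
    h : ∀ n → ⌈ n /2⌉ ≤ suc ⌊ n /2⌋
    h zero = z≤n
    h (suc zero) = s≤s z≤n
    h (suc (suc n)) = s≤s (h n)

  leftOf : ∀ {p} → Parity p → ℕ
  leftOf (even k) = hole ∸ k
  leftOf (odd k) = hole + hole + rest ∸ k

  left right : ℕ → ℕ
  left p = leftOf (parity p)
  right p = left p + p

  -- Replaces the truncated subtractions of `left` by equations, the form that `lin` can use.
  data Spec (p c : ℕ) : Set where
    evenS : ∀ k → p ≡ 2 * k → 1 ≤ k → k ≤ hole → c + k ≡ hole → Spec p c
    oddS : ∀ k → p ≡ 2 * k + 1 → k + 1 ≤ rest → c + k ≡ hole + hole + rest → Spec p c

  spec : ∀ p → 1 ≤ p → p ≤ n → Spec p (left p)
  spec p 1≤p p≤n with parity p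
  ... | even k = evenS k refl (lin 1 (λ k → K 1 :≤ 2 :* k ∷ [] ⊢ K 1 :≤ k) k 1≤p) k≤ (m∸n+n≡m k≤)
    where
    k≤ : k ≤ hole
    k≤ = lin 4 (λ k n h r → 2 :* k :≤ n ∷ h :+ r := n ∷ r :≤ K 1 :+ h ∷ [] ⊢ k :≤ h) k n hole rest p≤n halves (proj₂ near)
  ... | odd k = oddS k (sym (+-comm (2 * k) 1)) k≤ (m∸n+n≡m (lin 3 (λ k h r → k :+ K 1 :≤ r ∷ [] ⊢ k :≤ h :+ h :+ r) k hole rest k≤))
    where
    k≤ : k + 1 ≤ rest
    k≤ = lin 4 (λ k n h r → K 1 :+ 2 :* k :≤ n ∷ h :+ r := n ∷ h :≤ r ∷ [] ⊢ k :+ K 1 :≤ r) k n hole rest p≤n halves (proj₁ near)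

  right-bound : ∀ {p} → 1 ≤ p → p ≤ n → right p ≤ 2 * n
  right-bound {p} a b with left p | spec p a b
  ... | c | evenS k e _ k≤ s = lin 6 (λ p c k h r n → p := 2 :* k ∷ k :≤ h ∷ c :+ k := h ∷ h :+ r := n ∷ [] ⊢ c :+ p :≤ 2 :* n) p c k hole rest n e k≤ s halves
  ... | c | oddS k e k≤ s = lin 6 (λ p c k h r n → p := 2 :* k :+ K 1 ∷ k :+ K 1 :≤ r ∷ c :+ k := h :+ h :+ r ∷ h :+ r := n ∷ [] ⊢ c :+ p :≤ 2 :* n) p c k hole rest n e k≤ s halves

  left-hole : ∀ {p} → 1 ≤ p → p ≤ n → left p ≢ hole
  left-hole {p} a b z with left p | spec p a b
  ... | c | evenS k e 1≤k k≤ s = lin 3 (λ c k h → c :+ k := h ∷ K 1 :≤ k ∷ c := h ∷ [] ⊢ absurd) c k hole s 1≤k z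
  ... | c | oddS k e k≤ s = lin 4 (λ c k h r → c :+ k := h :+ h :+ r ∷ k :+ K 1 :≤ r ∷ c := h ∷ [] ⊢ absurd) c k hole rest s k≤ z

  right-hole : ∀ {p} → 1 ≤ p → p ≤ n → right p ≢ hole
  right-hole {p} a b z with left p | spec p a b
  ... | c | evenS k e 1≤k k≤ s = lin 4 (λ c k h p → c :+ k := h ∷ K 1 :≤ k ∷ p := 2 :* k ∷ c :+ p := h ∷ [] ⊢ absurd) c k hole p s 1≤k e z
  ... | c | oddS k e k≤ s = lin 5 (λ c k h r p → c :+ k := h :+ h :+ r ∷ k :+ K 1 :≤ r ∷ c :+ p := h ∷ [] ⊢ absurd) c k hole rest p s k≤ z

  left-injective : ∀ {p q} → 1 ≤ p → p ≤ n → 1 ≤ q → q ≤ n → left p ≡ left q → p ≡ q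
  left-injective {p} {q} a b a′ b′ z with left p | spec p a b | left q | spec q a′ b′
  ... | c | evenS k e 1≤k k≤ s | d | evenS l e′ 1≤l l≤ s′ = lin 7 (λ p q c d k l h → p := 2 :* k ∷ q := 2 :* l ∷ c :+ k := h ∷ d :+ l := h ∷ c := d ∷ [] ⊢ p := q) p q c d k l hole e e′ s s′ z
  ... | c | oddS k e k≤ s | d | oddS l e′ l≤ s′ = lin 7 (λ p q c d k l h → p := 2 :* k :+ K 1 ∷ q := 2 :* l :+ K 1 ∷ c :+ k := h ∷ d :+ l := h ∷ c := d ∷ [] ⊢ p := q) p q c d k l (hole + hole + rest) e e′ s s′ z
  ... | c | evenS k e 1≤k k≤ s | d | oddS l e′ l≤ s′ = ⊥-elim (lin 6 (λ c d k l h r → K 1 :≤ k ∷ c :+ k := h ∷ d :+ l := h :+ h :+ r ∷ l :+ K 1 :≤ r ∷ c := d ∷ [] ⊢ absurd) c d k l hole rest 1≤k s s′ l≤ z)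
  ... | c | oddS k e k≤ s | d | evenS l e′ 1≤l l≤ s′ = ⊥-elim (lin 6 (λ c d k l h r → K 1 :≤ k ∷ c :+ k := h ∷ d :+ l := h :+ h :+ r ∷ l :+ K 1 :≤ r ∷ c := d ∷ [] ⊢ absurd) d c l k hole rest 1≤l s′ s k≤ (sym z))

  right-injective : ∀ {p q} → 1 ≤ p → p ≤ n → 1 ≤ q → q ≤ n → right p ≡ right q → p ≡ q
  right-injective {p} {q} a b a′ b′ z with left p | spec p a b | left q | spec q a′ b′
  ... | c | evenS k e 1≤k k≤ s | d | evenS l e′ 1≤l l≤ s′ = lin 7 (λ p q c d k l h → p := 2 :* k ∷ q := 2 :* l ∷ c :+ k := h ∷ d :+ l := h ∷ c :+ p := d :+ q ∷ [] ⊢ p := q) p q c d k l hole e e′ s s′ z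
  ... | c | oddS k e k≤ s | d | oddS l e′ l≤ s′ = lin 7 (λ p q c d k l h → p := 2 :* k :+ K 1 ∷ q := 2 :* l :+ K 1 ∷ c :+ k := h ∷ d :+ l := h ∷ c :+ p := d :+ q ∷ [] ⊢ p := q) p q c d k l (hole + hole + rest) e e′ s s′ z
  ... | c | evenS k e 1≤k k≤ s | d | oddS l e′ l≤ s′ = ⊥-elim (lin 8 (λ c d k l h r p q → k :≤ h ∷ p := 2 :* k ∷ q := 2 :* l :+ K 1 ∷ c :+ k := h ∷ d :+ l := h :+ h :+ r ∷ l :+ K 1 :≤ r ∷ c :+ p := d :+ q ∷ [] ⊢ absurd) c d k l hole rest p q k≤ e e′ s s′ l≤ z)
  ... | c | oddS k e k≤ s | d | evenS l e′ 1≤l l≤ s′ = ⊥-elim (lin 8 (λ c d k l h r p q → k :≤ h ∷ p := 2 :* k ∷ q := 2 :* l :+ K 1 ∷ c :+ k := h ∷ d :+ l := h :+ h :+ r ∷ l :+ K 1 :≤ r ∷ c :+ p := d :+ q ∷ [] ⊢ absurd) d c l k hole rest q p l≤ e′ e s′ s k≤ (sym z))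

  -- The even differences 2k sit at hole ± k and fill [0, 2 hole] except for the hole; the odd ones
  -- 2k + 1 are nested around the middle of [2 hole + 1, 2n]. Such a placement is an extended Skolem
  -- sequence.
  left≢right : ∀ {p q} → 1 ≤ p → p ≤ n → 1 ≤ q → q ≤ n → left p ≢ right q
  left≢right {p} {q} a b a′ b′ z with left p | spec p a b | left q | spec q a′ b′
  ... | c | evenS k e 1≤k k≤ s | d | evenS l e′ 1≤l l≤ s′ = lin 7 (λ p q c d k l h → K 1 :≤ k ∷ q := 2 :* l ∷ c :+ k := h ∷ d :+ l := h ∷ c := d :+ q ∷ [] ⊢ absurd) p q c d k l hole 1≤k e′ s s′ z
  ... | c | oddS k e k≤ s | d | oddS l e′ l≤ s′ = lin 7 (λ p q c d k l h → q := 2 :* l :+ K 1 ∷ c :+ k := h ∷ d :+ l := h ∷ c := d :+ q ∷ [] ⊢ absurd) p q c d k l (hole + hole + rest) e′ s s′ z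
  ... | c | evenS k e 1≤k k≤ s | d | oddS l e′ l≤ s′ = lin 8 (λ c d k l h r p q → K 1 :≤ k ∷ c :+ k := h ∷ d :+ l := h :+ h :+ r ∷ l :+ K 1 :≤ r ∷ c := d :+ q ∷ [] ⊢ absurd) c d k l hole rest p q 1≤k s s′ l≤ z
  ... | c | oddS k e k≤ s | d | evenS l e′ 1≤l l≤ s′ = lin 8 (λ c d k l h r p q → k :+ K 1 :≤ r ∷ l :≤ h ∷ q := 2 :* l ∷ c :+ k := h :+ h :+ r ∷ d :+ l := h ∷ c := d :+ q ∷ [] ⊢ absurd) c d k l hole rest p q k≤ l≤ e′ s s′ z

-- Cyclic difference packing on Fin M: t triple orbits {0, p, right p + t + 1} and s orbits of pairs.
-- With s = 0 the differences reach 3t + 1, hence the extra hypothesis on M.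
module CyclicDesign (t s M : ℕ) (M≥ : 6 * t + 2 * s + 1 ≤ M) (spare : 1 ≤ s ⊎ 6 * t + 3 ≤ M) where

  instance
    M-nonZero : NonZero M
    M-nonZero = >-nonZero (lin 3 (λ t s M → 6 :* t :+ 2 :* s :+ K 1 :≤ M ∷ [] ⊢ K 0 :< M) t s M M≥)

  open Shift M
  open Starter t

  -- The first pair orbit takes the difference that the starter leaves out, and the others continue
  -- beyond 3t + 1. So for s ≥ 1 the differences are exactly 1, ..., 3t + s.
  pairStep : ℕ → ℕ
  pairStep zero = hole + suc t
  pairStep (suc j) = 3 * t + 1 + suc j

  -- The differences of an orbit, named after the slots of the two members: `bc` leads from the
  -- B-member to the C-member, and so on; `pair` leads from B to A.
  data Kind : Set where
    bc ba ca : Fin t → Kind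
    pair : Fin s → Kind

  val : Kind → ℕ
  val (bc i) = suc (toℕ i)
  val (ba i) = right (suc (toℕ i)) + suc t
  val (ca i) = left (suc (toℕ i)) + suc t
  val (pair j) = pairStep (toℕ j)

  small : ∀ (i : Fin t) → 1 ≤ suc (toℕ i) × suc (toℕ i) ≤ t
  small i = s≤s z≤n , FinP.toℕ<n i

  right≤ : ∀ i → right (suc (toℕ i)) ≤ 2 * t
  right≤ i = right-bound (s≤s z≤n) (FinP.toℕ<n i)

  left≤ : ∀ i → left (suc (toℕ i)) ≤ 2 * t
  left≤ i = ≤-trans (m≤m+n _ _) (right≤ i)

  hole≤ : hole ≤ t
  hole≤ = ≤-trans (m≤m+n hole rest) (≤-reflexive halves)

  val≥1 : ∀ κ → 1 ≤ val κ
  val≥1 (bc i) = s≤s z≤n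
  val≥1 (ba i) = ≤-trans (s≤s z≤n) (m≤n+m (suc t) _)
  val≥1 (ca i) = ≤-trans (s≤s z≤n) (m≤n+m (suc t) _)
  val≥1 (pair j) with toℕ j
  ... | zero = ≤-trans (s≤s z≤n) (m≤n+m (suc t) hole)
  ... | suc _ = ≤-trans (s≤s z≤n) (m≤n+m _ (3 * t + 1))

  reach : 6 * t + 3 ≤ M
  reach = [ lin 3 (λ t s M → 6 :* t :+ 2 :* s :+ K 1 :≤ M ∷ K 1 :≤ s ∷ [] ⊢ 6 :* t :+ K 3 :≤ M) t s M M≥ , (λ le → le) ]′ spare

  -- A difference below M / 2 is never the negative of another one, so that an unordered pair of
  -- vertices realises at most one of them.
  val-half : ∀ κ → 2 * val κ < M
  val-half (bc i) = lin 3 (λ i t M → i :< t ∷ 6 :* t :+ K 3 :≤ M ∷ [] ⊢ 2 :* (K 1 :+ i) :< M) (toℕ i) t M (FinP.toℕ<n i) reach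
  val-half (ba i) = lin 3 (λ r t M → r :≤ 2 :* t ∷ 6 :* t :+ K 3 :≤ M ∷ [] ⊢ 2 :* (r :+ (K 1 :+ t)) :< M) _ t M (right≤ i) reach
  val-half (ca i) = lin 3 (λ r t M → r :≤ 2 :* t ∷ 6 :* t :+ K 3 :≤ M ∷ [] ⊢ 2 :* (r :+ (K 1 :+ t)) :< M) _ t M (left≤ i) reach
  val-half (pair j) with toℕ j | FinP.toℕ<n j
  ... | zero | _ = lin 3 (λ h t M → h :≤ t ∷ 6 :* t :+ K 3 :≤ M ∷ [] ⊢ 2 :* (h :+ (K 1 :+ t)) :< M) hole t M hole≤ reach
  ... | suc l | lt = lin 4 (λ l t s M → K 1 :+ l :< s ∷ 6 :* t :+ 2 :* s :+ K 1 :≤ M ∷ [] ⊢ 2 :* (3 :* t :+ K 1 :+ (K 1 :+ l)) :< M) l t s M lt M≥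

  private
    up : ∀ x {y} → x + suc t ≡ y + suc t → x ≡ y
    up x = +-cancelʳ-≡ (suc t) x _

  -- Shifted by t + 1, the starter fills [t + 1, 3t + 1] without the hole; 1, ..., t lie below, and
  -- `pairStep` supplies the hole and values above.
  val-injective : ∀ κ κ′ → val κ ≡ val κ′ → κ ≡ κ′
  val-injective (bc i) (bc j) e = cong bc (FinP.toℕ-injective (suc-injective e))
  val-injective (bc i) (ba j) e = ⊥-elim (lin 3 (λ i t r → i :< t ∷ K 1 :+ i := r :+ (K 1 :+ t) ∷ [] ⊢ absurd) (toℕ i) t _ (FinP.toℕ<n i) e)
  val-injective (bc i) (ca j) e = ⊥-elim (lin 3 (λ i t r → i :< t ∷ K 1 :+ i := r :+ (K 1 :+ t) ∷ [] ⊢ absurd) (toℕ i) t _ (FinP.toℕ<n i) e)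
  val-injective (ba i) (bc j) e = ⊥-elim (lin 3 (λ i t r → i :< t ∷ r :+ (K 1 :+ t) := K 1 :+ i ∷ [] ⊢ absurd) (toℕ j) t _ (FinP.toℕ<n j) e)
  val-injective (ca i) (bc j) e = ⊥-elim (lin 3 (λ i t r → i :< t ∷ r :+ (K 1 :+ t) := K 1 :+ i ∷ [] ⊢ absurd) (toℕ j) t _ (FinP.toℕ<n j) e)
  val-injective (ba i) (ba j) e = cong ba (FinP.toℕ-injective (suc-injective (right-injective (s≤s z≤n) (FinP.toℕ<n i) (s≤s z≤n) (FinP.toℕ<n j) (up _ e))))
  val-injective (ca i) (ca j) e = cong ca (FinP.toℕ-injective (suc-injective (left-injective (s≤s z≤n) (FinP.toℕ<n i) (s≤s z≤n) (FinP.toℕ<n j) (up _ e))))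
  val-injective (ba i) (ca j) e = ⊥-elim (left≢right (s≤s z≤n) (FinP.toℕ<n j) (s≤s z≤n) (FinP.toℕ<n i) (up _ (sym e)))
  val-injective (ca i) (ba j) e = ⊥-elim (left≢right (s≤s z≤n) (FinP.toℕ<n i) (s≤s z≤n) (FinP.toℕ<n j) (up _ e))
  val-injective (pair i) (pair j) e = cong pair (FinP.toℕ-injective (h (toℕ i) (toℕ j) e))
    where
    h : ∀ i j → pairStep i ≡ pairStep j → i ≡ j
    h zero zero _ = refl
    h zero (suc j) e = ⊥-elim (lin 3 (λ h t j → h :≤ t ∷ h :+ (K 1 :+ t) := 3 :* t :+ K 1 :+ (K 1 :+ j) ∷ [] ⊢ absurd) hole t j hole≤ e)
    h (suc i) zero e = ⊥-elim (lin 3 (λ h t j → h :≤ t ∷ 3 :* t :+ K 1 :+ (K 1 :+ j) := h :+ (K 1 :+ t) ∷ [] ⊢ absurd) hole t i hole≤ e)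
    h (suc i) (suc j) e = +-cancelˡ-≡ (3 * t + 1) _ _ e
  val-injective (bc i) (pair j) e with toℕ j
  ... | zero = ⊥-elim (lin 3 (λ i t r → i :< t ∷ K 1 :+ i := r :+ (K 1 :+ t) ∷ [] ⊢ absurd) (toℕ i) t _ (FinP.toℕ<n i) e)
  ... | suc l = ⊥-elim (lin 3 (λ i t l → i :< t ∷ K 1 :+ i := 3 :* t :+ K 1 :+ (K 1 :+ l) ∷ [] ⊢ absurd) (toℕ i) t l (FinP.toℕ<n i) e)
  val-injective (pair j) (bc i) e with toℕ j
  ... | zero = ⊥-elim (lin 3 (λ i t r → i :< t ∷ r :+ (K 1 :+ t) := K 1 :+ i ∷ [] ⊢ absurd) (toℕ i) t _ (FinP.toℕ<n i) e)
  ... | suc l = ⊥-elim (lin 3 (λ i t l → i :< t ∷ 3 :* t :+ K 1 :+ (K 1 :+ l) := K 1 :+ i ∷ [] ⊢ absurd) (toℕ i) t l (FinP.toℕ<n i) e)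
  val-injective (ba i) (pair j) e with toℕ j
  ... | zero = ⊥-elim (right-hole (s≤s z≤n) (FinP.toℕ<n i) (up _ e))
  ... | suc l = ⊥-elim (lin 3 (λ r t l → r :≤ 2 :* t ∷ r :+ (K 1 :+ t) := 3 :* t :+ K 1 :+ (K 1 :+ l) ∷ [] ⊢ absurd) _ t l (right≤ i) e)
  val-injective (pair j) (ba i) e with toℕ j
  ... | zero = ⊥-elim (right-hole (s≤s z≤n) (FinP.toℕ<n i) (up _ (sym e)))
  ... | suc l = ⊥-elim (lin 3 (λ r t l → r :≤ 2 :* t ∷ 3 :* t :+ K 1 :+ (K 1 :+ l) := r :+ (K 1 :+ t) ∷ [] ⊢ absurd) _ t l (right≤ i) e)
  val-injective (ca i) (pair j) e with toℕ j
  ... | zero = ⊥-elim (left-hole (s≤s z≤n) (FinP.toℕ<n i) (up _ e))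
  ... | suc l = ⊥-elim (lin 3 (λ r t l → r :≤ 2 :* t ∷ r :+ (K 1 :+ t) := 3 :* t :+ K 1 :+ (K 1 :+ l) ∷ [] ⊢ absurd) _ t l (left≤ i) e)
  val-injective (pair j) (ca i) e with toℕ j
  ... | zero = ⊥-elim (left-hole (s≤s z≤n) (FinP.toℕ<n i) (up _ (sym e)))
  ... | suc l = ⊥-elim (lin 3 (λ r t l → r :≤ 2 :* t ∷ 3 :* t :+ K 1 :+ (K 1 :+ l) := r :+ (K 1 :+ t) ∷ [] ⊢ absurd) _ t l (left≤ i) e)

  val<M : ∀ κ → val κ < M
  val<M κ = ≤-<-trans (m≤m+n (val κ) _) (val-half κ)

  step : Fin (t + s) → ℕ
  step o with splitAt t o
  ... | inj₁ i = val (ba i)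
  ... | inj₂ j = val (pair j)

  stepKind : Fin (t + s) → Kind
  stepKind o with splitAt t o
  ... | inj₁ i = ba i
  ... | inj₂ j = pair j

  step-val : ∀ o → step o ≡ val (stepKind o)
  step-val o with splitAt t o
  ... | inj₁ i = refl
  ... | inj₂ j = refl

  step-left : ∀ i → step (i ↑ˡ s) ≡ val (ba i)
  step-left i rewrite FinP.splitAt-↑ˡ t i s = refl

  -- `base` is the distance from the base vertex of a point to the vertex where the difference
  -- starts. Only `ca` starts elsewhere than at the B-member, which is the base vertex.
  orbit base : Kind → ℕ
  orbit (bc i) = toℕ i
  orbit (ba i) = toℕ i
  orbit (ca i) = toℕ i
  orbit (pair j) = t + toℕ j
  base (ca i) = suc (toℕ i)
  base _ = 0

  data Member (v : Fin M) (o : Fin (t + s)) (x : Fin M) {r : ℕ} : Slot (t + s + r) (t + s) t → Set where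
    isA : v ≡ x ⊕ step o → Member v o x (A (o ↑ˡ r))
    isB : v ≡ x → Member v o x (B o)
    isC : ∀ i → o ≡ i ↑ˡ s → v ≡ x ⊕ suc (toℕ i) → Member v o x (C i)

  data Link (u v : Fin M) (o : Fin (t + s)) (x : Fin M) : Set where
    link : ∀ κ → orbit κ ≡ toℕ o → u ≡ x ⊕ base κ → v ≡ u ⊕ val κ → Link u v o x

  orbit-step : ∀ o → orbit (stepKind o) ≡ toℕ o
  orbit-step o with splitAt t o in eq
  ... | inj₁ i = trans (sym (FinP.toℕ-↑ˡ i s)) (cong toℕ (FinP.splitAt⁻¹-↑ˡ eq))
  ... | inj₂ j = trans (sym (FinP.toℕ-↑ʳ t j)) (cong toℕ (FinP.splitAt⁻¹-↑ʳ eq))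

  base-step : ∀ o → base (stepKind o) ≡ 0
  base-step o with splitAt t o
  ... | inj₁ i = refl
  ... | inj₂ j = refl

  linkBA : ∀ {u v o x} → u ≡ x → v ≡ x ⊕ step o → Link u v o x
  linkBA {u} {v} {o} {x} p q = link (stepKind o) (orbit-step o) (trans p (trans (sym (⊕-0 x)) (cong (x ⊕_) (sym (base-step o)))))
    (trans q (cong₂ _⊕_ (sym p) (step-val o)))

  linkBC : ∀ {u v o x} i → o ≡ i ↑ˡ s → u ≡ x → v ≡ x ⊕ suc (toℕ i) → Link u v o x
  linkBC {x = x} i e p q = link (bc i) (sym (trans (cong toℕ e) (FinP.toℕ-↑ˡ i s))) (trans p (sym (⊕-0 x))) (trans q (cong (_⊕ suc (toℕ i)) (sym p)))

  linkCA : ∀ {u v o x} i → o ≡ i ↑ˡ s → u ≡ x ⊕ suc (toℕ i) → v ≡ x ⊕ step o → Link u v o x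
  linkCA {u} {x = x} i refl p q = link (ca i) (sym (FinP.toℕ-↑ˡ i s)) p (trans q (trans (cong (x ⊕_) (trans (step-left i)
      (lin 3 (λ l i t → [] ⊢ l :+ (K 1 :+ i) :+ (K 1 :+ t) := (K 1 :+ i) :+ (l :+ (K 1 :+ t))) (left (suc (toℕ i))) (toℕ i) t)))
    (trans (sym (⊕-assoc x (suc (toℕ i)) _)) (cong (_⊕ val (ca i)) (sym p)))))

  links : ∀ {u v o x r} {p q : Slot (t + s + r) (t + s) t} → u ≢ v → Member u o x p → Member v o x q → Link u v o x ⊎ Link v u o x
  links ne (isA e) (isA e′) = ⊥-elim (ne (trans e (sym e′)))
  links ne (isA e) (isB e′) = inj₂ (linkBA e′ e)
  links ne (isA e) (isC i f e′) = inj₂ (linkCA i f e′ e)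
  links ne (isB e) (isA e′) = inj₁ (linkBA e e′)
  links ne (isB e) (isB e′) = ⊥-elim (ne (trans e (sym e′)))
  links ne (isB e) (isC i f e′) = inj₁ (linkBC i f e e′)
  links ne (isC i f e) (isA e′) = inj₁ (linkCA i f e e′)
  links ne (isC i f e) (isB e′) = inj₂ (linkBC i f e′ e)
  links ne (isC i f e) (isC j g e′) with FinP.↑ˡ-injective s i j (trans (sym f) g)
  ... | refl = ⊥-elim (ne (trans e (sym e′)))

  -- The difference v - u determines the kind, hence the orbit; with the kind known, u determines
  -- the base vertex.
  link-unique : ∀ {u v o x o′ x′} → Link u v o x → Link u v o′ x′ → o ≡ o′ × x ≡ x′
  link-unique (link κ a b c) (link κ′ a′ b′ c′) with val-injective κ κ′ (⊕-cancel (val<M κ) (val<M κ′) (trans (sym c) c′))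
  ... | refl = FinP.toℕ-injective (trans (sym a) a′) , ⊕-injective (base κ) (trans (sym b) b′)

  link-opposite : ∀ {u v o x o′ x′} → Link u v o x → Link v u o′ x′ → ⊥
  link-opposite (link κ a b c) (link κ′ a′ b′ c′) with ⊕-round c c′ (val<M κ) (val<M κ′)
  ... | inj₁ (z , _) = <-irrefl (sym z) (val≥1 κ)
  ... | inj₂ e = lin 3 (λ x y M → x :+ y := M ∷ 2 :* x :< M ∷ 2 :* y :< M ∷ [] ⊢ absurd) (val κ) (val κ′) M e (val-half κ) (val-half κ′)

  -- For λ = 2 there are no triples (t = 0), and r slots of colour 1 at each vertex remain single;
  -- for λ = 3 there are triples and r = 0. `full` admits both: A and B must have the same size only
  -- if some triple has a C-slot.
  module _ {m} (w : Vec ℕ (2 + m)) (sorted : Sorted w) (r : ℕ) (main : Vec.head w ≡ t + s + r)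
    (total : t + s + r + (t + s + t) ≡ Vec.sum w) (full : Fin t → t + s + r ≡ t + s) where

    pt : Fin M → Slot (t + s + r) (t + s) t → Maybe (Fin ((t + s) * M))
    pt v (A i) with splitAt (t + s) i
    ... | inj₁ o = just (combine o (v ⊕ (M ∸ step o)))
    ... | inj₂ _ = nothing
    pt v (B o) = just (combine o v)
    pt v (C i) = just (combine (i ↑ˡ s) (v ⊕ (M ∸ suc (toℕ i))))

    toMember : ∀ {v o x p} → pt v p ≡ just (combine o x) → Member v o x p
    toMember {v} {o} {x} {A i} e with splitAt (t + s) i in eq
    ... | inj₁ o′ with FinP.combine-injective o′ _ o x (just-injective e)
    ...   | refl , refl = subst (λ z → Member v o x (A z)) (FinP.splitAt⁻¹-↑ˡ eq)
              (isA (sym (⊖-⊕ v (≤-trans (≤-reflexive (step-val o)) (<⇒≤ (val<M (stepKind o)))))))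
    toMember {v} {o} {x} {B i} e with FinP.combine-injective i _ o x (just-injective e)
    ... | refl , refl = isB refl
    toMember {v} {o} {x} {C i} e with FinP.combine-injective (i ↑ˡ s) _ o x (just-injective e)
    ... | refl , refl = isC i refl (sym (⊖-⊕ v (<⇒≤ (val<M (bc i)))))

    split-point : ∀ v p q → pt v p ≡ just q → Member v (proj₁ (remQuot {t + s} M q)) (proj₂ (remQuot {t + s} M q)) p
    split-point v p q e = toMember (trans e (cong just (sym (FinP.combine-remQuot {t + s} M q))))

    columns : ∀ {n} → (t + s + r) * M ≤ n → Columns w M n
    columns {n} room = complete-none w colours (≤-trans (≤-reflexive size-eq) room)
      where
      inj : ∀ v p p′ q → pt v p ≡ just q → pt v p′ ≡ just q → p ≡ p′
      inj v p p′ q e e′ = h (split-point v p q e) (split-point v p′ q e′)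
        where
        h : ∀ {o x p p′} → Member v o x p → Member v o x p′ → p ≡ p′
        h (isA _) (isA _) = refl
        h (isB _) (isB _) = refl
        h (isC i f _) (isC j g _) = cong C (FinP.↑ˡ-injective s i j (trans (sym f) g))
        h {o} {x} (isA f) (isB g) = ⊥-elim (<-irrefl (sym (⊕-loop (sym (trans (trans (sym g) f) (cong (x ⊕_) (step-val o)))) (val<M (stepKind o)))) (val≥1 (stepKind o)))
        h {o} {x} (isB g) (isA f) = ⊥-elim (<-irrefl (sym (⊕-loop (sym (trans (trans (sym g) f) (cong (x ⊕_) (step-val o)))) (val<M (stepKind o)))) (val≥1 (stepKind o)))
        h (isB f) (isC i _ g) = case ⊕-loop (sym (trans (sym f) g)) (val<M (bc i)) of λ ()
        h (isC i _ g) (isB f) = case ⊕-loop (sym (trans (sym f) g)) (val<M (bc i)) of λ ()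
        h {x = x} (isA f) (isC i refl g) = case val-injective (bc i) (ba i) (⊕-cancel (val<M (bc i)) (val<M (ba i)) (trans (trans (sym g) f) (cong (x ⊕_) (step-left i)))) of λ ()
        h {x = x} (isC i refl g) (isA f) = case val-injective (bc i) (ba i) (⊕-cancel (val<M (bc i)) (val<M (ba i)) (trans (trans (sym g) f) (cong (x ⊕_) (step-left i)))) of λ ()
      compatible : ∀ u v p p′ q → u ≢ v → pt u p ≡ just q → pt v p′ ≡ just q → Compatible p p′
      compatible u v p p′ q ne e e′ = h (split-point u p q e) (split-point v p′ q e′)
        where
        le : ∀ {o} i → o ≡ i ↑ˡ s → toℕ o ≤ suc (toℕ i)
        le i refl = ≤-trans (≤-reflexive (FinP.toℕ-↑ˡ i s)) (n≤1+n _)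
        h : ∀ {o x p p′} → Member u o x p → Member v o x p′ → Compatible p p′
        h (isA f) (isA g) = ⊥-elim (ne (trans f (sym g)))
        h (isB f) (isB g) = ⊥-elim (ne (trans f (sym g)))
        h (isC i f e) (isC j g e′) with FinP.↑ˡ-injective s i j (trans (sym f) g)
        ... | refl = ⊥-elim (ne (trans e (sym e′)))
        h (isA _) (isB _) = AB
        h (isB _) (isA _) = BA
        h (isA _) (isC _ _ _) = AC
        h (isC _ _ _) (isA _) = CA
        h (isB _) (isC i f _) = BC (full i) (le i f)
        h (isC i f _) (isB _) = CB (full i) (le i f)
      linear : ∀ u v p₁ p₁′ p₂ p₂′ q q′ → u ≢ v → pt u p₁ ≡ just q → pt v p₁′ ≡ just q → pt u p₂ ≡ just q′ → pt v p₂′ ≡ just q′ → q ≡ q′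
      linear u v p₁ p₁′ p₂ p₂′ q q′ ne a b c d with links ne (split-point u p₁ q a) (split-point v p₁′ q b) | links ne (split-point u p₂ q′ c) (split-point v p₂′ q′ d)
      ... | inj₁ l | inj₂ l′ = ⊥-elim (link-opposite l l′)
      ... | inj₂ l | inj₁ l′ = ⊥-elim (link-opposite l l′)
      ... | inj₁ l | inj₁ l′ = let o , x = link-unique l l′ in
              trans (sym (FinP.combine-remQuot {t + s} M q)) (trans (cong₂ combine o x) (FinP.combine-remQuot {t + s} M q′))
      ... | inj₂ l | inj₂ l′ = let o , x = link-unique l l′ in
              trans (sym (FinP.combine-remQuot {t + s} M q)) (trans (cong₂ combine o x) (FinP.combine-remQuot {t + s} M q′))
      open Scheme w sorted main (m≤m+n (t + s) r) total pt inj compatible linear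
      freeA-r : ∀ v → freeA v ≡ r
      freeA-r v = trans (sum-splitAt (t + s) (λ i → 𝟙 (is-nothing (pt v (A i))))) (trans (cong₂ _+_ (sum-0 h₁) (trans (sum-cong-≗ h₂) (trans (sum-const r 1) (*-identityʳ r)))) refl)
        where
        h₁ : ∀ o → 𝟙 (is-nothing (pt v (A (o ↑ˡ r)))) ≡ 0
        h₁ o rewrite FinP.splitAt-↑ˡ (t + s) o r = refl
        h₂ : ∀ o → 𝟙 (is-nothing (pt v (A ((t + s) ↑ʳ o)))) ≡ 1
        h₂ o rewrite FinP.splitAt-↑ʳ (t + s) r o = refl
      size-eq : (t + s) * M + sum free ≡ (t + s + r) * M
      size-eq = trans (cong ((t + s) * M +_) (trans (sum-cong-≗ λ v → trans (free-slots v)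
          (trans (cong₂ _+_ (freeA-r v) (cong₂ _+_ (sum-0 {t + s} λ _ → refl) (sum-0 {t} λ _ → refl))) (+-identityʳ r)))
          (trans (sum-const M r) (*-comm M r)))) (sym (*-distribʳ-+ M (t + s) r))

-- Two codewords of an even number 2 b share exactly one point each: the complete graph.
module PairDesign {m} (w : Vec ℕ (2 + m)) (sorted : Sorted w) {a b : ℕ} (main : Vec.head w ≡ a) (1≤b : 1 ≤ b) (b≤a : b ≤ a)
  (total : a + (b + 0) ≡ Vec.sum w) where

  pt : Fin (2 * b) → Slot a b 0 → Maybe (Fin 0)
  pt _ _ = nothing

  open Scheme w sorted main b≤a total pt (λ _ _ _ _ ()) (λ _ _ _ _ _ _ ()) (λ _ _ _ _ _ _ _ _ _ ())

  ones : ∀ n → sum {n} (λ _ → 1) ≡ n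
  ones n = trans (sum-const n 1) (*-identityʳ n)

  -- The 2b(a + b) slots, less one for each of the b(2b - 1) edges, make 2ba + b columns. The degree
  -- 2b - 1 is below 2b, so b slots on either side carry the orientation.
  columns : ∀ {n} → 2 * b * a + b ≤ n → Columns w (2 * b) n
  columns {n} room = complete-leave w colours (λ ()) (λ ()) (sym (trans (sum-cong-≗ unused) (sum-0 {2 * b} λ _ → refl)))
    (λ _ → 2 * b ∸ 1) count
    (λ v → ≤-trans (m∸n≤m (2 * b) 1) (*-monoʳ-≤ 2 (≤-trans b≤a (≤-reflexive (sym (trans (freeMain-slots v) (ones a)))))))
    (λ v → ≤-trans (m∸n≤m (2 * b) 1) (*-monoʳ-≤ 2 (≤-reflexive (sym (trans (freeOther-slots v) (trans (cong (_+ 0) (ones b)) (+-identityʳ b)))))))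
    room-bound
    where
    unused : ∀ v → used v ≡ 0
    unused v = sum-0 {a + (b + 0)} λ _ → refl
    1≤2b : 1 ≤ 2 * b
    1≤2b = ≤-trans 1≤b (m≤m+n b _)
    count : ∀ v → 2 * b + used v ≡ suc (2 * b ∸ 1 + sum (λ σ → slotWeight (λ ()) (pt′ v σ)))
    count v = trans (cong (2 * b +_) (unused v)) (trans (+-identityʳ _) (trans (sym (m+[n∸m]≡n 1≤2b))
      (cong suc (sym (trans (cong (2 * b ∸ 1 +_) (sum-0 {a + (b + 0)} λ _ → refl)) (+-identityʳ _))))))
    frees : sum free ≡ 2 * b * (a + b)
    frees = trans (sum-cong-≗ λ v → trans (free-slots v) (cong₂ _+_ (ones a) (trans (cong (_+ 0) (ones b)) (+-identityʳ b)))) (sum-const (2 * b) (a + b))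
    lem : ∀ b a → 2 * (0 + 2 * b * (a + b)) + 2 * b ≡ 2 * (2 * b * a + b) + 2 * b * (2 * b)
    lem = solve-∀
    lem2 : ∀ b d → 2 * b * (1 + d) ≡ 2 * b * d + 2 * b
    lem2 = solve-∀
    room-bound : 2 * (0 + sum free) ≤ 2 * n + sum {2 * b} (λ _ → 2 * b ∸ 1)
    room-bound = subst₂ (λ x y → 2 * (0 + x) ≤ 2 * n + y) (sym frees) (sym (sum-const (2 * b) (2 * b ∸ 1)))
      (lin 6 (λ X c Y S n D → X :+ 2 :* c := 2 :* Y :+ S ∷ S := D :+ 2 :* c ∷ Y :≤ n ∷ [] ⊢ X :≤ 2 :* n :+ D)
        (2 * (0 + 2 * b * (a + b))) b (2 * b * a + b) (2 * b * (2 * b)) n (2 * b * (2 * b ∸ 1))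
        (lem b a) (trans (cong (2 * b *_) (sym (m+[n∸m]≡n 1≤2b))) (lem2 b (2 * b ∸ 1))) room)

next prev : Fin 3 → Fin 3
next zero = suc zero
next (suc zero) = suc (suc zero)
next (suc (suc zero)) = zero
prev i = next (next i)

next-prev : ∀ i → next (prev i) ≡ i
next-prev zero = refl
next-prev (suc zero) = refl
next-prev (suc (suc zero)) = refl

next-injective : ∀ {i j} → next i ≡ next j → i ≡ j
next-injective {i} {j} e = trans (sym (next-prev i)) (trans (cong (next ∘ next) e) (next-prev j))

next≢ : ∀ i → i ≢ next i
next≢ zero ()
next≢ (suc zero) ()
next≢ (suc (suc zero)) ()

next-next≢ : ∀ i → i ≢ next (next i)
next-next≢ zero ()
next-next≢ (suc zero) ()
next-next≢ (suc (suc zero)) ()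

module ShiftSum (μ : ℕ) .{{_ : NonZero μ}} where
  open Shift μ

  toℕ-⊕-small : ∀ x {n} → toℕ x + n < μ → toℕ (x ⊕ n) ≡ toℕ x + n
  toℕ-⊕-small x {n} lt = trans (toℕ-⊕ x n) (m<n⇒m%n≡m lt)

  ⊕-swap : ∀ x y → x ⊕ toℕ y ≡ y ⊕ toℕ x
  ⊕-swap x y = trans (cong (_⊕ toℕ y) (sym (from-origin x))) (trans (⊕-comm origin (toℕ x) (toℕ y)) (cong (_⊕ toℕ x) (from-origin y)))

  ⊕-toℕ : ∀ x y n → x ⊕ toℕ (y ⊕ n) ≡ x ⊕ toℕ y ⊕ n
  ⊕-toℕ x y n = trans (⊕-swap x (y ⊕ n)) (trans (⊕-comm y n (toℕ x)) (cong (_⊕ n) (⊕-swap y x)))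

  ⊕-double : ∀ x → x ⊕ toℕ x ≡ origin ⊕ (toℕ x + toℕ x)
  ⊕-double x = trans (cong (_⊕ toℕ x) (sym (from-origin x))) (⊕-assoc origin (toℕ x) (toℕ x))

-- For every ℓ < t the complete graph on Fin (2 t) contains the zigzag path from ℓ to ℓ + t, with
-- arcs of sum 2ℓ and 2ℓ + 1. On three layers, the paths of level ℓ are closed to a directed
-- cycle through ∞ (layer 0 reversed); arcs of sum 2ℓ + 1 and 2ℓ get the third point ℓ + t and ℓ
-- of the next layer. A point of level ℓ carries the colours B ℓ and C ℓ at the ends of its arc.
module ZigzagDesign (t : ℕ) .{{_ : NonZero t}} where

  m : ℕ
  m = 2 * t

  instance
    m-nonZero : NonZero m
    m-nonZero = m*n≢0 2 t

  open Shift m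
  open ShiftSum m

  0<t : 0 < t
  0<t = >-nonZero⁻¹ t

  data V : Set where
    ∞ : V
    fin : Fin 3 → Fin m → V

  fin-injective : ∀ {i j x y} → fin i x ≡ fin j y → i ≡ j × x ≡ y
  fin-injective refl = refl , refl

  M : ℕ
  M = suc (3 * m)

  toV : Fin M → V
  toV zero = ∞
  toV (suc k) = fin (proj₁ (remQuot {3} m k)) (proj₂ (remQuot {3} m k))

  fromV : V → Fin M
  fromV ∞ = zero
  fromV (fin i x) = suc (combine i x)

  fromV-toV : ∀ k → fromV (toV k) ≡ k
  fromV-toV zero = refl
  fromV-toV (suc k) = cong suc (FinP.combine-remQuot {3} m k)

  toV-fromV : ∀ v → toV (fromV v) ≡ v
  toV-fromV ∞ = refl
  toV-fromV (fin i x) = cong (λ p → fin (proj₁ p) (proj₂ p)) (FinP.remQuot-combine i x)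

  low : Fin t → Fin m
  low ℓ = inject≤ ℓ (m≤m+n t _)

  toℕ-low : ∀ ℓ → toℕ (low ℓ) ≡ toℕ ℓ
  toℕ-low ℓ = FinP.toℕ-inject≤ ℓ _

  -- The odd arcs ℓ - κ → ℓ + κ + 1 for κ < t and the even arcs ℓ + k → ℓ - k for κ = t + k make up
  -- the path ℓ, ℓ + 1, ℓ - 1, ℓ + 2, ..., ℓ + t, one of Walecki's Hamiltonian paths. The number κ =
  -- t labels no arc; it is kept for a triple through ∞.
  data Tail (x : Fin m) (ℓ : Fin t) (κ : Fin m) : Set where
    odd : toℕ κ < t → x ⊕ toℕ κ ≡ low ℓ → Tail x ℓ κ
    even : ∀ k → 1 ≤ k → k < t → toℕ κ ≡ t + k → x ≡ low ℓ ⊕ k → Tail x ℓ κ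

  data Head (x : Fin m) (ℓ : Fin t) (κ : Fin m) : Set where
    odd : toℕ κ < t → x ≡ low ℓ ⊕ suc (toℕ κ) → Head x ℓ κ
    even : ∀ k → 1 ≤ k → k < t → toℕ κ ≡ t + k → x ⊕ k ≡ low ℓ → Head x ℓ κ

  Odd Even : Fin m → Set
  Odd κ = toℕ κ < t
  Even κ = t < toℕ κ

  data End (x : Fin m) (ℓ : Fin t) (κ : Fin m) : Set where
    tail : Tail x ℓ κ → End x ℓ κ
    head : Head x ℓ κ → End x ℓ κ

  k<m : ∀ {k} → k < t → k < m
  k<m lt = <-≤-trans lt (m≤m+n t _)

  suc<m : ∀ {k} → k < t → suc k < m
  suc<m {k} = lin 2 (λ k t → k :< t ∷ [] ⊢ K 1 :+ k :< 2 :* t) k t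

  t+<m : ∀ {k} → k < t → t + k < m
  t+<m {k} = lin 2 (λ k t → k :< t ∷ [] ⊢ t :+ k :< 2 :* t) k t

  loop : ∀ {x y : Fin m} {a b} → x ⊕ a ≡ y → x ≡ y ⊕ b → a + b < m → a ≡ 0 × b ≡ 0
  loop {x} {y} {a} {b} e f lt = m+n≡0⇒m≡0 a z , m+n≡0⇒n≡0 a z
    where
    z : a + b ≡ 0
    z = ⊕-loop {x} (trans (sym (⊕-assoc x a b)) (trans (cong (_⊕ b) e) (sym f))) lt

  two : ∀ {a b} → a < t → b < t → a + suc b < m
  two {a} {b} p q = lin 3 (λ a b t → a :< t ∷ b :< t ∷ [] ⊢ a :+ (K 1 :+ b) :< 2 :* t) a b t p q

  two′ : ∀ {a b} → a < t → b < t → a + b < m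
  two′ {a} {b} p q = lin 3 (λ a b t → a :< t ∷ b :< t ∷ [] ⊢ a :+ b :< 2 :* t) a b t p q

  -- A vertex that is a tail and a head within one parity would return to itself by a positive total
  -- step below 2t. The last two hypotheses exclude mixed parities.
  tail-head : ∀ {x ℓ κ κ′} → Tail x ℓ κ → Head x ℓ κ′ → (Odd κ → Even κ′ → ⊥) → (Even κ → Odd κ′ → ⊥) → ⊥
  tail-head {κ′ = κ′} (odd p e) (odd q f) _ _ = case proj₂ (loop e f (two p q)) of λ ()
  tail-head (even k 1≤k p g e) (even k′ 1≤k′ q h f) _ _ = case subst (1 ≤_) (proj₂ (loop f e (two′ q p))) 1≤k of λ ()
  tail-head (odd p e) (even k 1≤k k< g f) h _ = h p (subst (t <_) (sym g) (m<m+n t 1≤k))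
  tail-head (even k 1≤k k< g f) (odd p e) _ h = h (subst (t <_) (sym g) (m<m+n t 1≤k)) p

  tail-tail : ∀ {x ℓ κ κ′} → Tail x ℓ κ → Tail x ℓ κ′ → (Odd κ → Even κ′ → ⊥) → (Even κ → Odd κ′ → ⊥) → κ ≡ κ′
  tail-tail {κ = κ} {κ′} (odd p e) (odd q f) _ _ = FinP.toℕ-injective (⊕-cancel (k<m p) (k<m q) (trans e (sym f)))
  tail-tail (even k _ p g e) (even k′ _ q h f) _ _ = FinP.toℕ-injective (trans g (trans (cong (t +_) (⊕-cancel (k<m p) (k<m q) (trans (sym e) f))) (sym h)))
  tail-tail (odd p e) (even k 1≤k k< g f) h _ = ⊥-elim (h p (subst (t <_) (sym g) (m<m+n t 1≤k)))
  tail-tail (even k 1≤k k< g f) (odd p e) _ h = ⊥-elim (h (subst (t <_) (sym g) (m<m+n t 1≤k)) p)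

  head-head : ∀ {x ℓ κ κ′} → Head x ℓ κ → Head x ℓ κ′ → (Odd κ → Even κ′ → ⊥) → (Even κ → Odd κ′ → ⊥) → κ ≡ κ′
  head-head (odd p e) (odd q f) _ _ = FinP.toℕ-injective (suc-injective (⊕-cancel (suc<m p) (suc<m q) (trans (sym e) f)))
  head-head (even k _ p g e) (even k′ _ q h f) _ _ = FinP.toℕ-injective (trans g (trans (cong (t +_) (⊕-cancel (k<m p) (k<m q) (trans e (sym f)))) (sym h)))
  head-head (odd p e) (even k 1≤k k< g f) h _ = ⊥-elim (h p (subst (t <_) (sym g) (m<m+n t 1≤k)))
  head-head (even k 1≤k k< g f) (odd p e) _ h = ⊥-elim (h (subst (t <_) (sym g) (m<m+n t 1≤k)) p)

  end-end : ∀ {x ℓ κ κ′} → End x ℓ κ → End x ℓ κ′ → (Odd κ → Even κ′ → ⊥) → (Even κ → Odd κ′ → ⊥) → κ ≡ κ′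
  end-end (tail a) (tail b) p q = tail-tail a b p q
  end-end (head a) (head b) p q = head-head a b p q
  end-end (tail a) (head b) p q = ⊥-elim (tail-head a b p q)
  end-end (head a) (tail b) p q = ⊥-elim (tail-head b a (λ o e → q e o) (λ e o → p o e))

  -- The sum of its two ends tells the level and the parity of an arc, so arcs of different levels
  -- never join the same vertices.
  data ArcSum (x y : Fin m) (ℓ : Fin t) (κ : Fin m) : Set where
    odd : Odd κ → x ⊕ toℕ y ≡ origin ⊕ suc (2 * toℕ ℓ) → ArcSum x y ℓ κ
    even : Even κ → x ⊕ toℕ y ≡ origin ⊕ (2 * toℕ ℓ) → ArcSum x y ℓ κ

  low-low : ∀ ℓ → low ℓ ⊕ toℕ (low ℓ) ≡ origin ⊕ (2 * toℕ ℓ)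
  low-low ℓ = trans (⊕-double (low ℓ)) (cong (origin ⊕_) (trans (cong (λ z → z + z) (toℕ-low ℓ)) (cong (toℕ ℓ +_) (sym (+-identityʳ _)))))

  arc-sum : ∀ {x y ℓ κ} → Tail x ℓ κ → Head y ℓ κ → ArcSum x y ℓ κ
  arc-sum {x} {y} {ℓ} {κ} (odd p e) (odd _ f) = odd p (begin
    x ⊕ toℕ y ≡⟨ cong (λ z → x ⊕ toℕ z) f ⟩
    x ⊕ toℕ (low ℓ ⊕ suc (toℕ κ)) ≡⟨ ⊕-toℕ x (low ℓ) (suc (toℕ κ)) ⟩
    x ⊕ toℕ (low ℓ) ⊕ suc (toℕ κ) ≡⟨ ⊕-comm x (toℕ (low ℓ)) (suc (toℕ κ)) ⟩
    x ⊕ suc (toℕ κ) ⊕ toℕ (low ℓ) ≡⟨ cong (λ z → x ⊕ z ⊕ toℕ (low ℓ)) (+-comm 1 (toℕ κ)) ⟩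
    x ⊕ (toℕ κ + 1) ⊕ toℕ (low ℓ) ≡⟨ cong (_⊕ toℕ (low ℓ)) (sym (⊕-assoc x (toℕ κ) 1)) ⟩
    x ⊕ toℕ κ ⊕ 1 ⊕ toℕ (low ℓ) ≡⟨ cong (λ z → z ⊕ 1 ⊕ toℕ (low ℓ)) e ⟩
    low ℓ ⊕ 1 ⊕ toℕ (low ℓ) ≡⟨ ⊕-comm (low ℓ) 1 (toℕ (low ℓ)) ⟩
    low ℓ ⊕ toℕ (low ℓ) ⊕ 1 ≡⟨ cong (_⊕ 1) (low-low ℓ) ⟩
    origin ⊕ (2 * toℕ ℓ) ⊕ 1 ≡⟨ ⊕-assoc origin (2 * toℕ ℓ) 1 ⟩
    origin ⊕ (2 * toℕ ℓ + 1) ≡⟨ cong (origin ⊕_) (+-comm _ 1) ⟩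
    origin ⊕ suc (2 * toℕ ℓ) ∎)
    where open ≡-Reasoning
  arc-sum {x} {y} {ℓ} {κ} (even k 1≤k k< g e) (even k′ _ _ g′ f) = even (subst (t <_) (sym g) (m<m+n t 1≤k)) (begin
    x ⊕ toℕ y ≡⟨ ⊕-swap x y ⟩
    y ⊕ toℕ x ≡⟨ cong (λ z → y ⊕ toℕ z) e ⟩
    y ⊕ toℕ (low ℓ ⊕ k) ≡⟨ ⊕-toℕ y (low ℓ) k ⟩
    y ⊕ toℕ (low ℓ) ⊕ k ≡⟨ ⊕-comm y (toℕ (low ℓ)) k ⟩
    y ⊕ k ⊕ toℕ (low ℓ) ≡⟨ cong (λ z → y ⊕ z ⊕ toℕ (low ℓ)) (+-cancelˡ-≡ t k k′ (trans (sym g) g′)) ⟩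
    y ⊕ k′ ⊕ toℕ (low ℓ) ≡⟨ cong (_⊕ toℕ (low ℓ)) f ⟩
    low ℓ ⊕ toℕ (low ℓ) ≡⟨ low-low ℓ ⟩
    origin ⊕ (2 * toℕ ℓ) ∎)
    where open ≡-Reasoning
  arc-sum (odd p e) (even k _ _ g f) = ⊥-elim (lin 3 (λ κ t k → κ :< t ∷ κ := t :+ k ∷ [] ⊢ absurd) _ t k p g)
  arc-sum (even k _ _ g f) (odd p e) = ⊥-elim (lin 3 (λ κ t k → κ :< t ∷ κ := t :+ k ∷ [] ⊢ absurd) _ t k p g)

  sum-sym : ∀ {x y ℓ κ} → ArcSum x y ℓ κ → ArcSum y x ℓ κ
  sum-sym {x} {y} (odd p e) = odd p (trans (⊕-swap y x) e)
  sum-sym {x} {y} (even p e) = even p (trans (⊕-swap y x) e)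

  odd< : ∀ (ℓ : Fin t) → suc (2 * toℕ ℓ) < m
  odd< ℓ = lin 2 (λ l t → l :< t ∷ [] ⊢ K 1 :+ 2 :* l :< 2 :* t) (toℕ ℓ) t (FinP.toℕ<n ℓ)

  even< : ∀ (ℓ : Fin t) → 2 * toℕ ℓ < m
  even< ℓ = <-trans (n<1+n _) (odd< ℓ)

  sum-unique : ∀ {x y ℓ ℓ′ κ κ′} → ArcSum x y ℓ κ → ArcSum x y ℓ′ κ′ → ℓ ≡ ℓ′ × (Odd κ → Even κ′ → ⊥) × (Even κ → Odd κ′ → ⊥)
  sum-unique {ℓ = ℓ} {ℓ′} (odd p e) (odd q f) =
    FinP.toℕ-injective (*-cancelˡ-≡ _ _ 2 (suc-injective (⊕-cancel {origin} (odd< ℓ) (odd< ℓ′) (trans (sym e) f)))) , (λ _ h → <-asym q h) , (λ h _ → <-asym p h)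
  sum-unique {ℓ = ℓ} {ℓ′} (even p e) (even q f) =
    FinP.toℕ-injective (*-cancelˡ-≡ _ _ 2 (⊕-cancel {origin} (even< ℓ) (even< ℓ′) (trans (sym e) f))) , (λ h _ → <-asym p h) , (λ _ h → <-asym q h)
  sum-unique {ℓ = ℓ} {ℓ′} (odd p e) (even q f) = ⊥-elim (lin 2 (λ a b → K 1 :+ 2 :* a := 2 :* b ∷ [] ⊢ absurd) (toℕ ℓ) (toℕ ℓ′) (⊕-cancel {origin} (odd< ℓ) (even< ℓ′) (trans (sym e) f)))
  sum-unique {ℓ = ℓ} {ℓ′} (even p e) (odd q f) = ⊥-elim (lin 2 (λ a b → 2 :* a := K 1 :+ 2 :* b ∷ [] ⊢ absurd) (toℕ ℓ) (toℕ ℓ′) (⊕-cancel {origin} (even< ℓ) (odd< ℓ′) (trans (sym e) f)))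

  -- Local points of level ℓ: node i κ is an arc of layer i, except that node i with κ = t is
  -- the i-th point through ∞, and ∞ stands for the column of ℓ.
  tailSlot headSlot : Fin 3 → Fin t → Slot t t t
  tailSlot zero ℓ = C ℓ
  tailSlot (suc _) ℓ = B ℓ
  headSlot zero ℓ = B ℓ
  headSlot (suc _) ℓ = C ℓ

  -- At (ℓ, i) the slot of a head and A 0 remain, one for the column of ℓ and one for a triple
  -- through ∞. The column needs three letters: layer 0, being reversed, offers B and layer 1 offers
  -- C, so layer 2 gives A 0 and puts its C into the triple through ∞.
  lastSlot : Fin 3 → Fin t → Fin t → Slot t t t
  lastSlot (suc zero) ℓ a = headSlot (suc (suc zero)) ℓ
  lastSlot _ ℓ a = A a
  infSlot : Fin 3 → Fin t → Slot t t t
  infSlot zero ℓ = B ℓ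
  infSlot (suc zero) ℓ = A ℓ
  infSlot (suc (suc zero)) ℓ = C ℓ

  columnSlot : Fin 3 → Fin t → Fin t → Slot t t t
  columnSlot (suc (suc zero)) ℓ a = A a
  columnSlot i ℓ a = headSlot i ℓ

  -- These are the triples of Skolem's system of order 6t + 1, for the half-idempotent quasigroup
  -- that sends x, y to ℓ if x + y = 2ℓ and to ℓ + t if x + y = 2ℓ + 1. The apex of an arc uses the
  -- A-slot numbered like the arc within its parity.
  data Member (ℓ : Fin t) : V → V → Slot t t t → Set where
    tailM : ∀ {i κ x} → Tail x ℓ κ → Member ℓ (fin i κ) (fin i x) (tailSlot i ℓ)
    headM : ∀ {i κ x} → Head x ℓ κ → Member ℓ (fin i κ) (fin i x) (headSlot i ℓ)
    oddM : ∀ {i κ x a} → Odd κ → toℕ x ≡ toℕ ℓ + t → toℕ κ ≡ toℕ a → Member ℓ (fin i κ) (fin (next i) x) (A a)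
    evenM : ∀ {i κ x a} → Even κ → toℕ x ≡ toℕ ℓ → toℕ κ ≡ t + toℕ a → Member ℓ (fin i κ) (fin (next i) x) (A a)
    highM : ∀ {i κ x} → toℕ κ ≡ t → toℕ x ≡ toℕ ℓ + t → Member ℓ (fin i κ) (fin i x) (tailSlot i ℓ)
    lowM : ∀ {i κ x a} → toℕ κ ≡ t → toℕ x ≡ toℕ ℓ → toℕ a ≡ 0 → Member ℓ (fin i κ) (fin (next i) x) (lastSlot i ℓ a)
    infM : ∀ {i κ} → toℕ κ ≡ t → Member ℓ (fin i κ) ∞ (infSlot i ℓ)
    columnM : ∀ {i x a} → toℕ x ≡ toℕ ℓ → toℕ a ≡ 0 → Member ℓ ∞ (fin i x) (columnSlot i ℓ a)

  data Forward (x z : Fin m) (ℓ : Fin t) (i : Fin 3) : V → Set where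
    odd : ∀ {κ} → Odd κ → End x ℓ κ → toℕ z ≡ toℕ ℓ + t → Forward x z ℓ i (fin i κ)
    even : ∀ {κ} → Even κ → End x ℓ κ → toℕ z ≡ toℕ ℓ → Forward x z ℓ i (fin i κ)
    inf : ∀ {κ} → toℕ κ ≡ t → toℕ x ≡ toℕ ℓ + t → toℕ z ≡ toℕ ℓ → Forward x z ℓ i (fin i κ)
    column : toℕ x ≡ toℕ ℓ → toℕ z ≡ toℕ ℓ → Forward x z ℓ i ∞

  data Link (ℓ : Fin t) (q : V) : V → V → Set where
    arc : ∀ {i κ x y} → q ≡ fin i κ → Tail x ℓ κ → Head y ℓ κ → Link ℓ q (fin i x) (fin i y)
    fwd : ∀ {i x z} → Forward x z ℓ i q → Link ℓ q (fin i x) (fin (next i) z)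
    high : ∀ {i κ x} → q ≡ fin i κ → toℕ κ ≡ t → toℕ x ≡ toℕ ℓ + t → Link ℓ q ∞ (fin i x)
    lowL : ∀ {i κ x} → q ≡ fin i κ → toℕ κ ≡ t → toℕ x ≡ toℕ ℓ → Link ℓ q ∞ (fin (next i) x)

  not-special-tail : ∀ {x ℓ κ} → Tail x ℓ κ → toℕ κ ≢ t
  not-special-tail (odd p _) e = <-irrefl e p
  not-special-tail (even k 1≤k _ g _) e = lin 2 (λ t k → t := t :+ k ∷ K 1 :≤ k ∷ [] ⊢ absurd) t k (trans (sym e) g) 1≤k

  not-special-head : ∀ {x ℓ κ} → Head x ℓ κ → toℕ κ ≢ t
  not-special-head (odd p _) e = <-irrefl e p
  not-special-head (even k 1≤k _ g _) e = lin 2 (λ t k → t := t :+ k ∷ K 1 :≤ k ∷ [] ⊢ absurd) t k (trans (sym e) g) 1≤k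

  same : ∀ {x y : Fin m} {n} → toℕ x ≡ n → toℕ y ≡ n → x ≡ y
  same e f = FinP.toℕ-injective (trans e (sym f))

  tail-unique : ∀ {x y ℓ κ} → Tail x ℓ κ → Tail y ℓ κ → x ≡ y
  tail-unique {κ = κ} (odd _ e) (odd _ f) = ⊕-injective (toℕ κ) (trans e (sym f))
  tail-unique (even k _ _ g e) (even k′ _ _ g′ f) with +-cancelˡ-≡ t k k′ (trans (sym g) g′)
  ... | refl = trans e (sym f)
  tail-unique (odd p e) (even k _ _ g f) = ⊥-elim (lin 3 (λ κ t k → κ :< t ∷ κ := t :+ k ∷ [] ⊢ absurd) _ t k p g)
  tail-unique (even k _ _ g f) (odd p e) = ⊥-elim (lin 3 (λ κ t k → κ :< t ∷ κ := t :+ k ∷ [] ⊢ absurd) _ t k p g)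

  head-unique : ∀ {x y ℓ κ} → Head x ℓ κ → Head y ℓ κ → x ≡ y
  head-unique (odd _ e) (odd _ f) = trans e (sym f)
  head-unique (even k _ _ g e) (even k′ _ _ g′ f) with +-cancelˡ-≡ t k k′ (trans (sym g) g′)
  ... | refl = ⊕-injective k (trans e (sym f))
  head-unique (odd p e) (even k _ _ g f) = ⊥-elim (lin 3 (λ κ t k → κ :< t ∷ κ := t :+ k ∷ [] ⊢ absurd) _ t k p g)
  head-unique (even k _ _ g f) (odd p e) = ⊥-elim (lin 3 (λ κ t k → κ :< t ∷ κ := t :+ k ∷ [] ⊢ absurd) _ t k p g)

  columns-linked : ∀ i j {x y ℓ} → i ≢ j → toℕ x ≡ toℕ ℓ → toℕ y ≡ toℕ ℓ → Link ℓ ∞ (fin i x) (fin j y) ⊎ Link ℓ ∞ (fin j y) (fin i x)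
  columns-linked zero zero ne e f = ⊥-elim (ne refl)
  columns-linked zero (suc zero) ne e f = inj₁ (fwd (column e f))
  columns-linked zero (suc (suc zero)) ne e f = inj₂ (fwd (column f e))
  columns-linked (suc zero) zero ne e f = inj₂ (fwd (column f e))
  columns-linked (suc zero) (suc zero) ne e f = ⊥-elim (ne refl)
  columns-linked (suc zero) (suc (suc zero)) ne e f = inj₁ (fwd (column e f))
  columns-linked (suc (suc zero)) zero ne e f = inj₁ (fwd (column e f))
  columns-linked (suc (suc zero)) (suc zero) ne e f = inj₂ (fwd (column f e))
  columns-linked (suc (suc zero)) (suc (suc zero)) ne e f = ⊥-elim (ne refl)

  links : ∀ {ℓ q u v s s′} → u ≢ v → Member ℓ q u s → Member ℓ q v s′ → Link ℓ q u v ⊎ Link ℓ q v u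
  links ne (tailM a) (tailM b) = ⊥-elim (ne (cong (fin _) (tail-unique a b)))
  links ne (tailM a) (headM b) = inj₁ (arc refl a b)
  links ne (tailM a) (oddM p e _) = inj₁ (fwd (odd p (tail a) e))
  links ne (tailM a) (evenM p e _) = inj₁ (fwd (even p (tail a) e))
  links ne (tailM a) (highM p _) = ⊥-elim (not-special-tail a p)
  links ne (tailM a) (lowM p _ _) = ⊥-elim (not-special-tail a p)
  links ne (tailM a) (infM p) = ⊥-elim (not-special-tail a p)
  links ne (headM a) (tailM b) = inj₂ (arc refl b a)
  links ne (headM a) (headM b) = ⊥-elim (ne (cong (fin _) (head-unique a b)))
  links ne (headM a) (oddM p e _) = inj₁ (fwd (odd p (head a) e))
  links ne (headM a) (evenM p e _) = inj₁ (fwd (even p (head a) e))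
  links ne (headM a) (highM p _) = ⊥-elim (not-special-head a p)
  links ne (headM a) (lowM p _ _) = ⊥-elim (not-special-head a p)
  links ne (headM a) (infM p) = ⊥-elim (not-special-head a p)
  links ne (oddM p e _) (tailM a) = inj₂ (fwd (odd p (tail a) e))
  links ne (oddM p e _) (headM a) = inj₂ (fwd (odd p (head a) e))
  links ne (oddM _ e _) (oddM _ f _) = ⊥-elim (ne (cong (fin _) (same e f)))
  links ne (oddM p _ _) (evenM q _ _) = ⊥-elim (<-asym p q)
  links ne (oddM p _ _) (highM q _) = ⊥-elim (<-irrefl q p)
  links ne (oddM p _ _) (lowM q _ _) = ⊥-elim (<-irrefl q p)
  links ne (oddM p _ _) (infM q) = ⊥-elim (<-irrefl q p)
  links ne (evenM p e _) (tailM a) = inj₂ (fwd (even p (tail a) e))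
  links ne (evenM p e _) (headM a) = inj₂ (fwd (even p (head a) e))
  links ne (evenM p _ _) (oddM q _ _) = ⊥-elim (<-asym p q)
  links ne (evenM _ e _) (evenM _ f _) = ⊥-elim (ne (cong (fin _) (same e f)))
  links ne (evenM p _ _) (highM q _) = ⊥-elim (<-irrefl (sym q) p)
  links ne (evenM p _ _) (lowM q _ _) = ⊥-elim (<-irrefl (sym q) p)
  links ne (evenM p _ _) (infM q) = ⊥-elim (<-irrefl (sym q) p)
  links ne (highM q _) (tailM a) = ⊥-elim (not-special-tail a q)
  links ne (highM q _) (headM a) = ⊥-elim (not-special-head a q)
  links ne (highM q _) (oddM p _ _) = ⊥-elim (<-irrefl q p)
  links ne (highM q _) (evenM p _ _) = ⊥-elim (<-irrefl (sym q) p)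
  links ne (highM _ e) (highM _ f) = ⊥-elim (ne (cong (fin _) (same e f)))
  links ne (highM q e) (lowM _ f _) = inj₁ (fwd (inf q e f))
  links ne (highM q e) (infM _) = inj₂ (high refl q e)
  links ne (lowM q _ _) (tailM a) = ⊥-elim (not-special-tail a q)
  links ne (lowM q _ _) (headM a) = ⊥-elim (not-special-head a q)
  links ne (lowM q _ _) (oddM p _ _) = ⊥-elim (<-irrefl q p)
  links ne (lowM q _ _) (evenM p _ _) = ⊥-elim (<-irrefl (sym q) p)
  links ne (lowM q f _) (highM _ e) = inj₂ (fwd (inf q e f))
  links ne (lowM _ e _) (lowM _ f _) = ⊥-elim (ne (cong (fin _) (same e f)))
  links ne (lowM q e _) (infM _) = inj₂ (lowL refl q e)
  links ne (infM q) (tailM a) = ⊥-elim (not-special-tail a q)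
  links ne (infM q) (headM a) = ⊥-elim (not-special-head a q)
  links ne (infM q) (oddM p _ _) = ⊥-elim (<-irrefl q p)
  links ne (infM q) (evenM p _ _) = ⊥-elim (<-irrefl (sym q) p)
  links ne (infM q) (highM _ e) = inj₁ (high refl q e)
  links ne (infM q) (lowM _ e _) = inj₁ (lowL refl q e)
  links ne (infM _) (infM _) = ⊥-elim (ne refl)
  links {ℓ = ℓ} ne (columnM {i} {x} e _) (columnM {j} {y} f _) = columns-linked i j {x} {y} {ℓ}
    (λ i≡j → ne (cong₂ fin i≡j (same e f))) e f

  clash : ∀ {ℓ ℓ′ : Fin t} {n} → n ≡ toℕ ℓ + t → n ≡ toℕ ℓ′ → ⊥
  clash {ℓ} {ℓ′} e f = lin 3 (λ a b t → a :+ t := b ∷ b :< t ∷ [] ⊢ absurd) (toℕ ℓ) (toℕ ℓ′) t (trans (sym e) f) (FinP.toℕ<n ℓ′)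

  same-high : ∀ {ℓ ℓ′ : Fin t} {n} → n ≡ toℕ ℓ + t → n ≡ toℕ ℓ′ + t → ℓ ≡ ℓ′
  same-high e f = FinP.toℕ-injective (+-cancelʳ-≡ t _ _ (trans (sym e) f))

  same-low : ∀ {ℓ ℓ′ : Fin t} {n} → n ≡ toℕ ℓ → n ≡ toℕ ℓ′ → ℓ ≡ ℓ′
  same-low e f = FinP.toℕ-injective (trans (sym e) f)

  -- An even arc of level ℓ joins ℓ + k and ℓ - k with 0 < k < t. So it misses ℓ and ℓ + t, the two
  -- vertices that meet (ℓ, i + 1) in the column of ℓ and in a triple through ∞.
  end-low : ∀ {x ℓ κ} → Even κ → End x ℓ κ → toℕ x ≢ toℕ ℓ
  end-low p (tail (odd q _)) _ = <-asym p q
  end-low p (head (odd q _)) _ = <-asym p q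
  end-low {x} {ℓ} p (tail (even k 1≤k k< _ e)) f = <-irrefl (sym (⊕-loop {low ℓ} (trans (sym e) (same f (toℕ-low ℓ))) (k<m k<))) 1≤k
  end-low {x} {ℓ} p (head (even k 1≤k k< _ e)) f = <-irrefl (sym (⊕-loop {low ℓ} (trans (cong (_⊕ k) (sym (same f (toℕ-low ℓ)))) e) (k<m k<))) 1≤k

  end-high : ∀ {x ℓ κ} → Even κ → End x ℓ κ → toℕ x ≢ toℕ ℓ + t
  end-high p (tail (odd q _)) _ = <-asym p q
  end-high p (head (odd q _)) _ = <-asym p q
  end-high {x} {ℓ} p (tail (even k 1≤k k< _ e)) f = <-irrefl (⊕-cancel {low ℓ} (k<m k<) t<m
      (trans (sym e) (⊕-natural {low ℓ} {x} {t} (trans f (cong (_+ t) (sym (toℕ-low ℓ))))))) k<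
    where
    t<m : t < m
    t<m = lin 2 (λ k t → k :< t ∷ [] ⊢ t :< 2 :* t) k t k<
  end-high {x} {ℓ} p (head (even k 1≤k k< _ e)) f = case ⊕-loop {low ℓ} {t + k} (trans (sym (⊕-assoc (low ℓ) t k))
      (trans (cong (_⊕ k) (sym (⊕-natural {low ℓ} {x} {t} (trans f (cong (_+ t) (sym (toℕ-low ℓ))))))) e)) (t+<m k<) of λ z →
        <-irrefl (sym (m+n≡0⇒n≡0 t z)) 1≤k

  -- The vertex z of the next layer fixes level and parity: ℓ + t is the apex of odd arcs, and ℓ
  -- belongs to everything else. Then x lies on one arc of that parity, or it is the vertex reserved
  -- for ∞ or for the column.
  forward-unique : ∀ {x z ℓ ℓ′ i q q′} → Forward x z ℓ i q → Forward x z ℓ′ i q′ → ℓ ≡ ℓ′ × q ≡ q′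
  forward-unique (odd p a e) (odd q b f) with same-high e f
  ... | refl = refl , cong (fin _) (end-end a b (λ _ h → <-asym q h) (λ h _ → <-asym p h))
  forward-unique (odd _ _ e) (even _ _ f) = ⊥-elim (clash e f)
  forward-unique (odd _ _ e) (inf _ _ f) = ⊥-elim (clash e f)
  forward-unique (odd _ _ e) (column _ f) = ⊥-elim (clash e f)
  forward-unique (even _ _ f) (odd _ _ e) = ⊥-elim (clash e f)
  forward-unique (inf _ _ f) (odd _ _ e) = ⊥-elim (clash e f)
  forward-unique (column _ f) (odd _ _ e) = ⊥-elim (clash e f)
  forward-unique (even p a e) (even q b f) with same-low e f
  ... | refl = refl , cong (fin _) (end-end a b (λ h _ → <-asym p h) (λ _ h → <-asym q h))
  forward-unique (even p a e) (inf _ h f) with same-low e f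
  ... | refl = ⊥-elim (end-high p a h)
  forward-unique (inf _ h f) (even p a e) with same-low e f
  ... | refl = ⊥-elim (end-high p a h)
  forward-unique (even p a e) (column h f) with same-low e f
  ... | refl = ⊥-elim (end-low p a h)
  forward-unique (column h f) (even p a e) with same-low e f
  ... | refl = ⊥-elim (end-low p a h)
  forward-unique (inf p _ e) (inf q _ f) = same-low e f , cong (fin _) (same p q)
  forward-unique (inf _ e _) (column f _) = ⊥-elim (clash e f)
  forward-unique (column f _) (inf _ e _) = ⊥-elim (clash e f)
  forward-unique (column _ e) (column _ f) = same-low e f , refl

  arc-arc : ∀ {x y ℓ ℓ′ κ κ′} → Tail x ℓ κ → Head y ℓ κ → Tail x ℓ′ κ′ → Head y ℓ′ κ′ → ℓ ≡ ℓ′ × κ ≡ κ′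
  arc-arc a b c d with sum-unique (arc-sum a b) (arc-sum c d)
  ... | refl , p , q = refl , tail-tail a c p q

  arc-reverse : ∀ {x y ℓ ℓ′ κ κ′} → Tail x ℓ κ → Head y ℓ κ → Tail y ℓ′ κ′ → Head x ℓ′ κ′ → ⊥
  arc-reverse a b c d with sum-unique (arc-sum a b) (sum-sym (arc-sum c d))
  ... | refl , p , q = tail-head a d p q

  unique : ∀ {ℓ ℓ′ q q′ u v u′ v′} → Link ℓ q u v → Link ℓ′ q′ u′ v′ → u ≡ u′ → v ≡ v′ → ℓ ≡ ℓ′ × q ≡ q′
  unique (arc refl a b) (arc refl c d) refl refl with arc-arc a b c d
  ... | p , r = p , cong (fin _) r
  unique (arc _ _ _) (fwd _) e f = ⊥-elim (next≢ _ (trans (sym (proj₁ (fin-injective e))) (proj₁ (fin-injective f))))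
  unique (fwd _) (arc _ _ _) e f = ⊥-elim (next≢ _ (trans (proj₁ (fin-injective e)) (sym (proj₁ (fin-injective f)))))
  unique (fwd a) (fwd b) e f with fin-injective e | fin-injective f
  ... | refl , refl | _ , refl = forward-unique a b
  unique (high refl p e) (high refl q f) _ g with fin-injective g
  ... | refl , refl = same-high e f , cong (fin _) (same p q)
  unique (high _ _ e) (lowL _ _ f) _ g with fin-injective g
  ... | _ , refl = ⊥-elim (clash e f)
  unique (lowL _ _ f) (high _ _ e) _ g with fin-injective g
  ... | _ , refl = ⊥-elim (clash e f)
  unique (lowL refl p e) (lowL refl q f) _ g with fin-injective g
  ... | a , refl = same-low e f , cong₂ fin (next-injective a) (same p q)
  unique (arc _ _ _) (high _ _ _) () _
  unique (arc _ _ _) (lowL _ _ _) () _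
  unique (fwd _) (high _ _ _) () _
  unique (fwd _) (lowL _ _ _) () _
  unique (high _ _ _) (arc _ _ _) () _
  unique (high _ _ _) (fwd _) () _
  unique (lowL _ _ _) (arc _ _ _) () _
  unique (lowL _ _ _) (fwd _) () _

  opposite : ∀ {ℓ ℓ′ q q′ u v u′ v′} → Link ℓ q u v → Link ℓ′ q′ u′ v′ → u ≡ v′ → v ≡ u′ → ⊥
  opposite (arc refl a b) (arc refl c d) refl refl = arc-reverse a b c d
  opposite (arc _ _ _) (fwd _) e f = next≢ _ (trans (sym (proj₁ (fin-injective f))) (proj₁ (fin-injective e)))
  opposite (fwd _) (arc _ _ _) e f = next≢ _ (trans (proj₁ (fin-injective e)) (sym (proj₁ (fin-injective f))))
  opposite (fwd _) (fwd _) e f = next-next≢ _ (trans (proj₁ (fin-injective e)) (cong next (sym (proj₁ (fin-injective f)))))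
  opposite (arc _ _ _) (high _ _ _) _ ()
  opposite (arc _ _ _) (lowL _ _ _) _ ()
  opposite (fwd _) (high _ _ _) _ ()
  opposite (fwd _) (lowL _ _ _) _ ()
  opposite (high _ _ _) (arc _ _ _) () _
  opposite (high _ _ _) (fwd _) () _
  opposite (high _ _ _) (high _ _ _) () _
  opposite (high _ _ _) (lowL _ _ _) () _
  opposite (lowL _ _ _) (arc _ _ _) () _
  opposite (lowL _ _ _) (fwd _) () _
  opposite (lowL _ _ _) (high _ _ _) () _
  opposite (lowL _ _ _) (lowL _ _ _) () _

  tail-head-slots : ∀ i ℓ → Compatible (tailSlot i ℓ) (headSlot i ℓ) × Compatible (headSlot i ℓ) (tailSlot i ℓ)
  tail-head-slots zero ℓ = CB refl (n≤1+n _) , BC refl (n≤1+n _)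
  tail-head-slots (suc i) ℓ = BC refl (n≤1+n _) , CB refl (n≤1+n _)

  arc-apex-slots : ∀ i ℓ a → Compatible (tailSlot i ℓ) (A a) × Compatible (A a) (tailSlot i ℓ) × Compatible (headSlot i ℓ) (A a) × Compatible (A a) (headSlot i ℓ)
  arc-apex-slots zero ℓ a = CA , AC , BA , AB
  arc-apex-slots (suc i) ℓ a = BA , AB , CA , AC

  high-low-slots : ∀ i ℓ a → Compatible (tailSlot i ℓ) (lastSlot i ℓ a) × Compatible (lastSlot i ℓ a) (tailSlot i ℓ)
  high-low-slots zero ℓ a = CA , AC
  high-low-slots (suc zero) ℓ a = BC refl (n≤1+n _) , CB refl (n≤1+n _)
  high-low-slots (suc (suc zero)) ℓ a = BA , AB

  high-inf-slots : ∀ i ℓ → Compatible (tailSlot i ℓ) (infSlot i ℓ) × Compatible (infSlot i ℓ) (tailSlot i ℓ)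
  high-inf-slots zero ℓ = CB refl (n≤1+n _) , BC refl (n≤1+n _)
  high-inf-slots (suc zero) ℓ = BA , AB
  high-inf-slots (suc (suc zero)) ℓ = BC refl (n≤1+n _) , CB refl (n≤1+n _)

  low-inf-slots : ∀ i ℓ a → Compatible (lastSlot i ℓ a) (infSlot i ℓ) × Compatible (infSlot i ℓ) (lastSlot i ℓ a)
  low-inf-slots zero ℓ a = AB , BA
  low-inf-slots (suc zero) ℓ a = CA , AC
  low-inf-slots (suc (suc zero)) ℓ a = AC , CA

  column-slots : ∀ i j ℓ a b → i ≢ j → Compatible (columnSlot i ℓ a) (columnSlot j ℓ b)
  column-slots zero zero ℓ a b ne = ⊥-elim (ne refl)
  column-slots zero (suc zero) ℓ a b ne = BC refl (n≤1+n _)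
  column-slots zero (suc (suc zero)) ℓ a b ne = BA
  column-slots (suc zero) zero ℓ a b ne = CB refl (n≤1+n _)
  column-slots (suc zero) (suc zero) ℓ a b ne = ⊥-elim (ne refl)
  column-slots (suc zero) (suc (suc zero)) ℓ a b ne = CA
  column-slots (suc (suc zero)) zero ℓ a b ne = AB
  column-slots (suc (suc zero)) (suc zero) ℓ a b ne = AC
  column-slots (suc (suc zero)) (suc (suc zero)) ℓ a b ne = ⊥-elim (ne refl)

  layer≢ : ∀ {i x y} → fin i x ≡ fin (next i) y → ⊥
  layer≢ e = next≢ _ (proj₁ (fin-injective e))

  Slots≈ : V → V → Slot t t t → Slot t t t → Set
  Slots≈ u v s s′ = (u ≡ v → s ≡ s′) × (u ≢ v → Compatible s s′)

  apart : ∀ {u v s s′} → (u ≢ v) → Compatible s s′ → Slots≈ u v s s′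
  apart ne c = (λ e → ⊥-elim (ne e)) , λ _ → c

  alike : ∀ {u v s s′} → u ≡ v → s ≡ s′ → Slots≈ u v s s′
  alike e f = (λ _ → f) , λ ne → ⊥-elim (ne e)

  tail≢head : ∀ {i x y ℓ κ} → Tail x ℓ κ → Head y ℓ κ → fin i x ≢ fin i y
  tail≢head a b e with proj₂ (fin-injective e)
  ... | refl = tail-head a b (λ p q → <-asym p q) (λ p q → <-asym p q)

  slots : ∀ {ℓ q u v s s′} → Member ℓ q u s → Member ℓ q v s′ → Slots≈ u v s s′
  slots (tailM a) (tailM b) = alike (cong (fin _) (tail-unique a b)) refl
  slots {ℓ} (tailM {i} a) (headM b) = apart (tail≢head a b) (proj₁ (tail-head-slots i ℓ))
  slots {ℓ} (tailM {i} a) (oddM {a = k} _ _ _) = apart layer≢ (proj₁ (arc-apex-slots i ℓ k))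
  slots {ℓ} (tailM {i} a) (evenM {a = k} _ _ _) = apart layer≢ (proj₁ (arc-apex-slots i ℓ k))
  slots (tailM a) (highM p _) = ⊥-elim (not-special-tail a p)
  slots (tailM a) (lowM p _ _) = ⊥-elim (not-special-tail a p)
  slots (tailM a) (infM p) = ⊥-elim (not-special-tail a p)
  slots {ℓ} (headM {i} a) (tailM b) = apart (tail≢head b a ∘ sym) (proj₂ (tail-head-slots i ℓ))
  slots (headM a) (headM b) = alike (cong (fin _) (head-unique a b)) refl
  slots {ℓ} (headM {i} a) (oddM {a = k} _ _ _) = apart layer≢ (proj₁ (proj₂ (proj₂ (arc-apex-slots i ℓ k))))
  slots {ℓ} (headM {i} a) (evenM {a = k} _ _ _) = apart layer≢ (proj₁ (proj₂ (proj₂ (arc-apex-slots i ℓ k))))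
  slots (headM a) (highM p _) = ⊥-elim (not-special-head a p)
  slots (headM a) (lowM p _ _) = ⊥-elim (not-special-head a p)
  slots (headM a) (infM p) = ⊥-elim (not-special-head a p)
  slots {ℓ} (oddM {i} {a = k} _ _ _) (tailM a) = apart (layer≢ ∘ sym) (proj₁ (proj₂ (arc-apex-slots i ℓ k)))
  slots {ℓ} (oddM {i} {a = k} _ _ _) (headM a) = apart (layer≢ ∘ sym) (proj₂ (proj₂ (proj₂ (arc-apex-slots i ℓ k))))
  slots (oddM _ e f) (oddM _ g h) = alike (cong (fin _) (same e g)) (cong A (FinP.toℕ-injective (trans (sym f) h)))
  slots (oddM p _ _) (evenM q _ _) = ⊥-elim (<-asym p q)
  slots (oddM p _ _) (highM q _) = ⊥-elim (<-irrefl q p)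
  slots (oddM p _ _) (lowM q _ _) = ⊥-elim (<-irrefl q p)
  slots (oddM p _ _) (infM q) = ⊥-elim (<-irrefl q p)
  slots {ℓ} (evenM {i} {a = k} _ _ _) (tailM a) = apart (layer≢ ∘ sym) (proj₁ (proj₂ (arc-apex-slots i ℓ k)))
  slots {ℓ} (evenM {i} {a = k} _ _ _) (headM a) = apart (layer≢ ∘ sym) (proj₂ (proj₂ (proj₂ (arc-apex-slots i ℓ k))))
  slots (evenM p _ _) (oddM q _ _) = ⊥-elim (<-asym p q)
  slots (evenM _ e f) (evenM _ g h) = alike (cong (fin _) (same e g)) (cong A (FinP.toℕ-injective (+-cancelˡ-≡ t _ _ (trans (sym f) h))))
  slots (evenM p _ _) (highM q _) = ⊥-elim (<-irrefl (sym q) p)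
  slots (evenM p _ _) (lowM q _ _) = ⊥-elim (<-irrefl (sym q) p)
  slots (evenM p _ _) (infM q) = ⊥-elim (<-irrefl (sym q) p)
  slots (highM q _) (tailM a) = ⊥-elim (not-special-tail a q)
  slots (highM q _) (headM a) = ⊥-elim (not-special-head a q)
  slots (highM q _) (oddM p _ _) = ⊥-elim (<-irrefl q p)
  slots (highM q _) (evenM p _ _) = ⊥-elim (<-irrefl (sym q) p)
  slots (highM _ e) (highM _ f) = alike (cong (fin _) (same e f)) refl
  slots {ℓ} (highM {i} q e) (lowM {a = k} _ f _) = apart layer≢ (proj₁ (high-low-slots i ℓ k))
  slots {ℓ} (highM {i} q e) (infM _) = apart (λ ()) (proj₁ (high-inf-slots i ℓ))
  slots (lowM q _ _) (tailM a) = ⊥-elim (not-special-tail a q)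
  slots (lowM q _ _) (headM a) = ⊥-elim (not-special-head a q)
  slots (lowM q _ _) (oddM p _ _) = ⊥-elim (<-irrefl q p)
  slots (lowM q _ _) (evenM p _ _) = ⊥-elim (<-irrefl (sym q) p)
  slots {ℓ} (lowM {i} {a = k} q f _) (highM _ e) = apart (layer≢ ∘ sym) (proj₂ (high-low-slots i ℓ k))
  slots {ℓ} (lowM {i} _ e f) (lowM _ g h) = alike (cong (fin _) (same e g)) (cong (lastSlot i ℓ) (FinP.toℕ-injective (trans f (sym h))))
  slots {ℓ} (lowM {i} {a = k} q e _) (infM _) = apart (λ ()) (proj₁ (low-inf-slots i ℓ k))
  slots (infM q) (tailM a) = ⊥-elim (not-special-tail a q)
  slots (infM q) (headM a) = ⊥-elim (not-special-head a q)
  slots (infM q) (oddM p _ _) = ⊥-elim (<-irrefl q p)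
  slots (infM q) (evenM p _ _) = ⊥-elim (<-irrefl (sym q) p)
  slots {ℓ} (infM {i} q) (highM _ e) = apart (λ ()) (proj₂ (high-inf-slots i ℓ))
  slots {ℓ} (infM {i} q) (lowM {a = k} _ e _) = apart (λ ()) (proj₂ (low-inf-slots i ℓ k))
  slots (infM _) (infM _) = alike refl refl
  slots {ℓ} (columnM {i} {x} {a} e f) (columnM {j} {y} {b} g h) with i FinP.≟ j
  ... | yes refl = alike (cong (fin i) (same e g)) (cong (columnSlot i ℓ) (FinP.toℕ-injective (trans f (sym h))))
  ... | no ne = apart (ne ∘ proj₁ ∘ fin-injective) (column-slots i j ℓ a b ne)

  offset : Fin m → Fin t → Fin m
  offset x ℓ = x ⊕ (m ∸ toℕ ℓ)

  offset-spec : ∀ x ℓ → x ≡ low ℓ ⊕ toℕ (offset x ℓ)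
  offset-spec x ℓ = sym (trans (⊕-swap (low ℓ) (offset x ℓ)) (trans (cong (offset x ℓ ⊕_) (toℕ-low ℓ)) (⊖-⊕ x (<⇒≤ (k<m (FinP.toℕ<n ℓ))))))

  low+t : ∀ ℓ → toℕ (low ℓ ⊕ t) ≡ toℕ ℓ + t
  low+t ℓ = trans (toℕ-⊕-small (low ℓ) (lin 3 (λ x l t → x := l ∷ l :< t ∷ [] ⊢ x :+ t :< 2 :* t) (toℕ (low ℓ)) (toℕ ℓ) t (toℕ-low ℓ) (FinP.toℕ<n ℓ)))
    (cong (_+ t) (toℕ-low ℓ))

  back : ∀ {x ℓ d} → x ≡ low ℓ ⊕ d → d < m → x ⊕ (m ∸ d) ≡ low ℓ
  back {x} {ℓ} {d} e lt = trans (cong (_⊕ (m ∸ d)) e) (⊕-⊖ (low ℓ) (<⇒≤ lt))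

  -- Only the end ℓ + t of the path is not a tail. The distance d from ℓ decides: 0 < d < t belongs
  -- to an even arc, d = 0 and d > t to an odd one.
  tailAt : ∀ x ℓ → Σ (Fin m) λ κ → Tail x ℓ κ ⊎ (toℕ κ ≡ t × toℕ x ≡ toℕ ℓ + t)
  tailAt x ℓ = go (toℕ (offset x ℓ)) (offset-spec x ℓ) (FinP.toℕ<n (offset x ℓ))
    where
    go : ∀ d → x ≡ low ℓ ⊕ d → d < m → Σ (Fin m) λ κ → Tail x ℓ κ ⊎ (toℕ κ ≡ t × toℕ x ≡ toℕ ℓ + t)
    go zero e lt = fromℕ< lt , inj₁ (odd (subst (_< t) (sym (FinP.toℕ-fromℕ< lt)) 0<t)
      (trans (cong (x ⊕_) (FinP.toℕ-fromℕ< lt)) (trans (⊕-0 x) (trans e (⊕-0 (low ℓ))))))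
    go d@(suc _) e lt with <-cmp d t
    ... | tri< d<t _ _ = fromℕ< (t+<m d<t) , inj₁ (even d (s≤s z≤n) d<t (FinP.toℕ-fromℕ< _) e)
    ... | tri≈ _ d≡t _ = fromℕ< lt , inj₂ (trans (FinP.toℕ-fromℕ< lt) d≡t , trans (cong toℕ (trans e (cong (low ℓ ⊕_) d≡t))) (low+t ℓ))
    ... | tri> _ _ t<d = fromℕ< {m ∸ d} k< , inj₁ (odd (subst (_< t) (sym (FinP.toℕ-fromℕ< k<)) small)
          (trans (cong (x ⊕_) (FinP.toℕ-fromℕ< k<)) (back e lt)))
      where
      small : m ∸ d < t
      small = lin 3 (λ k d t → k :+ d := 2 :* t ∷ t :< d ∷ [] ⊢ k :< t) (m ∸ d) d t (m∸n+n≡m (<⇒≤ lt)) t<d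
      k< : m ∸ d < m
      k< = k<m small

  headAt : ∀ x ℓ → Σ (Fin m) (Head x ℓ) ⊎ toℕ x ≡ toℕ ℓ
  headAt x ℓ = go (toℕ (offset x ℓ)) (offset-spec x ℓ) (FinP.toℕ<n (offset x ℓ))
    where
    go : ∀ d → x ≡ low ℓ ⊕ d → d < m → Σ (Fin m) (Head x ℓ) ⊎ toℕ x ≡ toℕ ℓ
    go zero e lt = inj₂ (trans (cong toℕ (trans e (⊕-0 (low ℓ)))) (toℕ-low ℓ))
    go (suc d) e lt with d <? t
    ... | yes d<t = inj₁ (fromℕ< (k<m d<t) , odd (subst (_< t) (sym (FinP.toℕ-fromℕ< (k<m d<t))) d<t)
          (trans e (cong (λ z → low ℓ ⊕ suc z) (sym (FinP.toℕ-fromℕ< (k<m d<t))))))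
    ... | no d≮t = inj₁ (fromℕ< k< , even k (m<n⇒0<n∸m lt) small (FinP.toℕ-fromℕ< k<) (back e lt))
      where
      k = m ∸ suc d
      small : k < t
      small = lin 3 (λ k d t → k :+ (K 1 :+ d) := 2 :* t ∷ t :≤ d ∷ [] ⊢ k :< t) k d t (m∸n+n≡m (<⇒≤ lt)) (≮⇒≥ d≮t)
      k< : t + k < m
      k< = t+<m small

  middle : Fin m
  middle = fromℕ< {t} (lin 1 (λ t → K 0 :< t ∷ [] ⊢ t :< 2 :* t) t 0<t)

  toℕ-middle : toℕ middle ≡ t
  toℕ-middle = FinP.toℕ-fromℕ< _

  At : V → Slot t t t → Set
  At v s = Σ (Fin t × V) λ (ℓ , q) → Member ℓ q v s

  tailPoint : ∀ i x ℓ → At (fin i x) (tailSlot i ℓ)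
  tailPoint i x ℓ with tailAt x ℓ
  ... | κ , inj₁ a = (ℓ , fin i κ) , tailM a
  ... | κ , inj₂ (p , e) = (ℓ , fin i κ) , highM p e

  headPoint : ∀ i x ℓ → At (fin i x) (headSlot i ℓ)
  headPoint i x ℓ with headAt x ℓ
  headPoint i x ℓ | inj₁ (κ , a) = (ℓ , fin i κ) , headM a
  headPoint zero x ℓ | inj₂ e = (ℓ , ∞) , columnM {a = fromℕ< 0<t} e (FinP.toℕ-fromℕ< 0<t)
  headPoint (suc zero) x ℓ | inj₂ e = (ℓ , ∞) , columnM {a = fromℕ< 0<t} e (FinP.toℕ-fromℕ< 0<t)
  headPoint (suc (suc zero)) x ℓ | inj₂ e = (ℓ , fin (suc zero) middle) , lowM {a = fromℕ< 0<t} toℕ-middle e (FinP.toℕ-fromℕ< 0<t)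

  firstPoint : ∀ i x (ℓ : Fin t) a → toℕ x ≡ toℕ ℓ → toℕ a ≡ 0 → At (fin i x) (A a)
  firstPoint zero x ℓ a e z = (ℓ , fin (suc (suc zero)) middle) , lowM toℕ-middle e z
  firstPoint (suc zero) x ℓ a e z = (ℓ , fin zero middle) , lowM toℕ-middle e z
  firstPoint (suc (suc zero)) x ℓ a e z = (ℓ , ∞) , columnM e z

  -- A vertex x ≥ t is the apex of the odd arcs of level x - t, and a vertex x < t of the even arcs
  -- of level x. There are only t - 1 even arcs, so A 0 at x < t goes to `firstPoint`.
  apexPoint : ∀ i x a → At (fin i x) (A a)
  apexPoint i x a with toℕ x <? t
  apexPoint i x a | yes x<t with toℕ a in eq
  ... | zero = firstPoint i x (fromℕ< x<t) a (sym (FinP.toℕ-fromℕ< x<t)) eq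
  ... | suc k with prev i | next-prev i
  ...   | j | refl = (fromℕ< x<t , fin j (fromℕ< {t + toℕ a} lt)) , evenM (subst (t <_) (sym (FinP.toℕ-fromℕ< lt)) (m<m+n t (subst (0 <_) (sym eq) (s≤s z≤n))))
              (sym (FinP.toℕ-fromℕ< x<t)) (FinP.toℕ-fromℕ< lt)
    where
    lt : t + toℕ a < m
    lt = t+<m (FinP.toℕ<n a)
  apexPoint i x a | no x≮t with prev i | next-prev i
  ... | j | refl = (fromℕ< {toℕ x ∸ t} lt , fin j (fromℕ< (k<m (FinP.toℕ<n a)))) ,
          oddM (subst (_< t) (sym (FinP.toℕ-fromℕ< (k<m (FinP.toℕ<n a)))) (FinP.toℕ<n a))
            (trans (sym (m∸n+n≡m (≮⇒≥ x≮t))) (cong (_+ t) (sym (FinP.toℕ-fromℕ< lt)))) (FinP.toℕ-fromℕ< (k<m (FinP.toℕ<n a)))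
    where
    lt : toℕ x ∸ t < t
    lt = lin 3 (λ d x t → d :+ t := x ∷ x :< 2 :* t ∷ [] ⊢ d :< t) (toℕ x ∸ t) (toℕ x) t (m∸n+n≡m (≮⇒≥ x≮t)) (FinP.toℕ<n x)

  point : ∀ v s → At v s
  point ∞ (A ℓ) = (ℓ , fin (suc zero) middle) , infM toℕ-middle
  point ∞ (B ℓ) = (ℓ , fin zero middle) , infM toℕ-middle
  point ∞ (C ℓ) = (ℓ , fin (suc (suc zero)) middle) , infM toℕ-middle
  point (fin i x) (A a) = apexPoint i x a
  point (fin zero x) (B ℓ) = headPoint zero x ℓ
  point (fin zero x) (C ℓ) = tailPoint zero x ℓ
  point (fin (suc i) x) (B ℓ) = tailPoint (suc i) x ℓ
  point (fin (suc i) x) (C ℓ) = headPoint (suc i) x ℓ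

  toV-injective : ∀ {u v} → toV u ≡ toV v → u ≡ v
  toV-injective {u} {v} e = trans (sym (fromV-toV u)) (trans (cong fromV e) (fromV-toV v))

  encode : Fin t × V → Fin (t * M)
  encode (ℓ , q) = combine ℓ (fromV q)

  encode-injective : ∀ p q → encode p ≡ encode q → p ≡ q
  encode-injective (ℓ , p) (ℓ′ , q) e with FinP.combine-injective ℓ (fromV p) ℓ′ (fromV q) e
  ... | refl , f = cong (ℓ ,_) (trans (sym (toV-fromV p)) (trans (cong toV f) (toV-fromV q)))

  pt : Fin M → Slot t t t → Maybe (Fin (t * M))
  pt v s = just (encode (proj₁ (point (toV v) s)))

  samePoint : ∀ u v s s′ p → pt u s ≡ just p → pt v s′ ≡ just p → proj₁ (point (toV u) s) ≡ proj₁ (point (toV v) s′)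
  samePoint u v s s′ p e f = encode-injective _ _ (just-injective (trans e (sym f)))

  pairSlots : ∀ {u v s s′} (a : At u s) (b : At v s′) → proj₁ a ≡ proj₁ b → Slots≈ u v s s′
  pairSlots (p , a) (.p , b) refl = slots a b

  pairLinks : ∀ {u v s s′} → u ≢ v → (a : At u s) (b : At v s′) → proj₁ a ≡ proj₁ b →
    Link (proj₁ (proj₁ a)) (proj₂ (proj₁ a)) u v ⊎ Link (proj₁ (proj₁ a)) (proj₂ (proj₁ a)) v u
  pairLinks ne (p , a) (.p , b) refl = links ne a b

  module _ {k} (w : Vec ℕ (2 + k)) (sorted : Sorted w) (main : Vec.head w ≡ t) (total : t + (t + t) ≡ Vec.sum w) where

    columns : ∀ {n} → t * M ≤ n → Columns w M n
    columns {n} room = complete-none w colours (≤-trans (≤-reflexive (trans (cong (t * M +_) (trans (sum-cong-≗ none) (sum-0 {M} λ _ → refl))) (+-identityʳ _))) room)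
      where
      inj : ∀ v s s′ p → pt v s ≡ just p → pt v s′ ≡ just p → s ≡ s′
      inj v s s′ p e f = proj₁ (pairSlots (point (toV v) s) (point (toV v) s′) (samePoint v v s s′ p e f)) refl
      compatible : ∀ u v s s′ p → u ≢ v → pt u s ≡ just p → pt v s′ ≡ just p → Compatible s s′
      compatible u v s s′ p ne e f = proj₂ (pairSlots (point (toV u) s) (point (toV v) s′) (samePoint u v s s′ p e f)) (ne ∘ toV-injective)
      linear : ∀ u v s₁ s₁′ s₂ s₂′ p q → u ≢ v → pt u s₁ ≡ just p → pt v s₁′ ≡ just p → pt u s₂ ≡ just q → pt v s₂′ ≡ just q → p ≡ q
      linear u v s₁ s₁′ s₂ s₂′ p q ne a b c d = trans (sym (just-injective a)) (trans (cong encode (h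
          (pairLinks (ne ∘ toV-injective) (point (toV u) s₁) (point (toV v) s₁′) (samePoint u v s₁ s₁′ p a b))
          (pairLinks (ne ∘ toV-injective) (point (toV u) s₂) (point (toV v) s₂′) (samePoint u v s₂ s₂′ q c d)))) (just-injective c))
        where
        h : ∀ {ℓ ℓ′ q q′ u v} → Link ℓ q u v ⊎ Link ℓ q v u → Link ℓ′ q′ u v ⊎ Link ℓ′ q′ v u → (ℓ , q) ≡ (ℓ′ , q′)
        h (inj₁ a) (inj₁ b) = let x , y = unique a b refl refl in cong₂ _,_ x y
        h (inj₂ a) (inj₂ b) = let x , y = unique a b refl refl in cong₂ _,_ x y
        h (inj₁ a) (inj₂ b) = ⊥-elim (opposite a b refl refl)
        h (inj₂ a) (inj₁ b) = ⊥-elim (opposite a b refl refl)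
      open Scheme w sorted main ≤-refl total pt inj compatible linear
      none : ∀ v → free v ≡ 0
      none v = trans (free-slots v) (cong₂ _+_ (sum-0 {t} λ _ → refl) (cong₂ _+_ (sum-0 {t} λ _ → refl) (sum-0 {t} λ _ → refl)))

↑-apart : ∀ {m n} {i : Fin m} {j : Fin n} → i ↑ˡ n ≢ m ↑ʳ j
↑-apart {m} {n} {i} {j} p = case trans (sym (FinP.splitAt-↑ˡ m i n)) (trans (cong (splitAt m) p) (FinP.splitAt-↑ʳ m n j)) of λ ()

-- Bose's triple system on three copies of ℤ/(2t+1), without the point (0,0). In the triples of
-- level d that lose (0,0), the pair {(2d,0),(d,1)} is replaced by the column of 2d, and
-- similarly for -2d.
module Bose (t : ℕ) where

  μ : ℕ
  μ = suc (2 * t)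

  open Shift μ
  open ShiftSum μ

  data V : Set where
    fin : Fin 3 → Fin μ → V

  fin-injective : ∀ {i j x y} → fin i x ≡ fin j y → i ≡ j × x ≡ y
  fin-injective refl = refl , refl

  Good : V → Set
  Good v = v ≢ fin zero zero

  D : Fin t → ℕ
  D d = suc (toℕ d)

  D≤ : ∀ d → D d ≤ t
  D≤ d = FinP.toℕ<n d

  D-injective : ∀ {d e} → D d ≡ D e → d ≡ e
  D-injective p = FinP.toℕ-injective (suc-injective p)

  -- Here y = 2x with x = ± d: the triple of level d with midpoint x contained (0,0), and the column
  -- of y takes its place.
  data Half (d : Fin t) (x y : Fin μ) : Set where
    plus : toℕ x ≡ D d → toℕ y ≡ D d + D d → Half d x y
    minus : toℕ x + D d ≡ μ → toℕ y + (D d + D d) ≡ μ → Half d x y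

  Side : Fin t → Fin μ → Set
  Side a y = toℕ y ≡ D a ⊎ toℕ y + D a ≡ μ

  -- The column of y uses just the slots that the loss of (0,0) sets free: (y,0) stays in its broken
  -- triple, (y,1) with y = ± a is no longer the apex in slot A a, and (y,2) has lost the triple
  -- with apex (0,0).
  data Member (d : Fin t) : Fin 3 → Fin μ → V → Slot t t t → Set where
    B0 : ∀ {x} y → Good (fin zero y) → y ⊕ D d ≡ x → Member d zero x (fin zero y) (B d)
    C0 : ∀ {x} y → Good (fin zero y) → y ≡ x ⊕ D d → Member d zero x (fin zero y) (C d)
    A0 : ∀ {x} → (Side d x → ⊥) → Member d zero x (fin (suc zero) x) (A d)
    VA : ∀ {x y a} → Half d x y → Side a y → Member d zero x (fin (suc zero) y) (A a)
    VB : ∀ {x} y → toℕ x ≡ D d → toℕ y ≡ D d + D d → Member d zero x (fin (suc (suc zero)) y) (B d)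
    VC : ∀ {x} y → toℕ x + D d ≡ μ → toℕ y + (D d + D d) ≡ μ → Member d zero x (fin (suc (suc zero)) y) (C d)
    B1 : ∀ {x y} → y ⊕ D d ≡ x → Member d (suc zero) x (fin (suc zero) y) (B d)
    C1 : ∀ {x y} → y ≡ x ⊕ D d → Member d (suc zero) x (fin (suc zero) y) (C d)
    A1 : ∀ {x} → Member d (suc zero) x (fin (suc (suc zero)) x) (A d)
    B2 : ∀ {x y} → y ≡ x ⊕ (D d + D d) → Member d (suc (suc zero)) x (fin (suc (suc zero)) y) (B d)
    C2 : ∀ {x y} → y ⊕ (D d + D d) ≡ x → Member d (suc (suc zero)) x (fin (suc (suc zero)) y) (C d)
    A2 : ∀ {x} → Member d (suc (suc zero)) x (fin zero x) (A d)

  -- Layer 2 lists its half differences as doubles 2d, a permutation up to sign because μ is odd. So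
  -- (± 2d, 2) loses a slot of index d, the index that (± 2d, 0) has in the same column, and B and C
  -- are compatible there.
  e : Fin 3 → Fin t → ℕ
  e zero d = D d
  e (suc zero) d = D d
  e (suc (suc zero)) d = D d + D d

  data Link (d : Fin t) (i : Fin 3) (x : Fin μ) : V → V → Set where
    par : ∀ {y z} → y ⊕ e i d ≡ x → z ≡ x ⊕ e i d → Link d i x (fin i y) (fin i z)
    up : ∀ {y} → x ≡ y ⊕ e i d → Link d i x (fin i y) (fin (next i) x)
    down : ∀ {y} → y ≡ x ⊕ e i d → Link d i x (fin i y) (fin (next i) x)
    column : ∀ {j y} → i ≡ zero → Half d x y → Link d i x (fin j y) (fin (next j) y)

  e-bounds : ∀ i d → 1 ≤ e i d × e i d ≤ 2 * t
  e-bounds zero d = s≤s z≤n , lin 2 (λ d t → d :≤ t ∷ [] ⊢ d :≤ 2 :* t) (D d) t (D≤ d)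
  e-bounds (suc zero) d = s≤s z≤n , lin 2 (λ d t → d :≤ t ∷ [] ⊢ d :≤ 2 :* t) (D d) t (D≤ d)
  e-bounds (suc (suc zero)) d = s≤s z≤n , lin 2 (λ d t → d :≤ t ∷ [] ⊢ d :+ d :≤ 2 :* t) (D d) t (D≤ d)

  e<μ : ∀ i d → e i d < μ
  e<μ i d = s≤s (proj₂ (e-bounds i d))

  e-injective : ∀ i {d d′} → e i d ≡ e i d′ → d ≡ d′
  e-injective zero p = D-injective p
  e-injective (suc zero) p = D-injective p
  e-injective (suc (suc zero)) {d} {d′} p = D-injective (lin 2 (λ a b → a :+ a := b :+ b ∷ [] ⊢ a := b) (D d) (D d′) p)

  -- In layers 0 and 1 the sum is at most 2t; in layer 2 it is even, but μ is odd.
  e-sum : ∀ i d d′ → e i d + e i d′ ≢ μ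
  e-sum zero d d′ p = lin 3 (λ a b t → a :≤ t ∷ b :≤ t ∷ a :+ b := K 1 :+ 2 :* t ∷ [] ⊢ absurd) (D d) (D d′) t (D≤ d) (D≤ d′) p
  e-sum (suc zero) d d′ p = lin 3 (λ a b t → a :≤ t ∷ b :≤ t ∷ a :+ b := K 1 :+ 2 :* t ∷ [] ⊢ absurd) (D d) (D d′) t (D≤ d) (D≤ d′) p
  e-sum (suc (suc zero)) d d′ p = lin 3 (λ a b t → a :+ a :+ (b :+ b) := K 1 :+ 2 :* t ∷ [] ⊢ absurd) (D d) (D d′) t p

  no-loop : ∀ {x : Fin μ} i d → x ⊕ e i d ≢ x
  no-loop i d p = <-irrefl (sym (⊕-loop p (e<μ i d))) (proj₁ (e-bounds i d))

  opposite-steps : ∀ {x y : Fin μ} i d d′ → y ≡ x ⊕ e i d → x ≡ y ⊕ e i d′ → ⊥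
  opposite-steps i d d′ p q with ⊕-round p q (e<μ i d) (e<μ i d′)
  ... | inj₁ (z , _) = <-irrefl (sym z) (proj₁ (e-bounds i d))
  ... | inj₂ s = e-sum i d d′ s

  half-unique : ∀ {d d′ x x′ y} → Half d x y → Half d′ x′ y → d ≡ d′ × x ≡ x′
  half-unique {d} {d′} (plus p q) (plus p′ q′) with D-injective {d} {d′} (lin 2 (λ a b → a :+ a := b :+ b ∷ [] ⊢ a := b) (D d) (D d′) (trans (sym q) q′))
  ... | refl = refl , FinP.toℕ-injective (trans p (sym p′))
  half-unique {d} {d′} {x} {x′} {y} (minus p q) (minus p′ q′) with D-injective {d} {d′} (lin 4 (λ a b y u → y :+ (a :+ a) := u ∷ y :+ (b :+ b) := u ∷ [] ⊢ a := b) (D d) (D d′) (toℕ y) μ q q′)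
  ... | refl = refl , FinP.toℕ-injective (+-cancelʳ-≡ (D d) _ _ (trans p (sym p′)))
  half-unique {d} {d′} {y = y} (plus p q) (minus p′ q′) = ⊥-elim (lin 4 (λ y a b t → y := a :+ a ∷ y :+ (b :+ b) := K 1 :+ 2 :* t ∷ [] ⊢ absurd) (toℕ y) (D d) (D d′) t q q′)
  half-unique {d} {d′} {y = y} (minus p′ q′) (plus p q) = ⊥-elim (lin 4 (λ y a b t → y := a :+ a ∷ y :+ (b :+ b) := K 1 :+ 2 :* t ∷ [] ⊢ absurd) (toℕ y) (D d′) (D d) t q q′)

  half-same : ∀ {d x y y′} → Half d x y → Half d x y′ → y ≡ y′
  half-same (plus _ q) (plus _ q′) = FinP.toℕ-injective (trans q (sym q′))
  half-same {d} (minus _ q) (minus _ q′) = FinP.toℕ-injective (+-cancelʳ-≡ (D d + D d) _ _ (trans q (sym q′)))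
  half-same {d} (plus p _) (minus p′ _) = ⊥-elim (e-sum zero d d (trans (cong (_+ D d) (sym p)) p′))
  half-same {d} (minus p′ _) (plus p _) = ⊥-elim (e-sum zero d d (trans (cong (_+ D d) (sym p)) p′))

  half-side : ∀ {d x y} → Half d x y → Side d x
  half-side (plus p _) = inj₁ p
  half-side (minus p _) = inj₂ p

  side-unique : ∀ {a b y} → Side a y → Side b y → a ≡ b
  side-unique (inj₁ p) (inj₁ q) = D-injective (trans (sym p) q)
  side-unique {a} {b} {y} (inj₂ p) (inj₂ q) = D-injective (+-cancelˡ-≡ (toℕ y) _ _ (trans p (sym q)))
  side-unique {a} {b} (inj₁ p) (inj₂ q) = ⊥-elim (e-sum zero a b (trans (cong (_+ D b) (sym p)) q))
  side-unique {a} {b} (inj₂ q) (inj₁ p) = ⊥-elim (e-sum zero b a (trans (cong (_+ D a) (sym p)) q))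

  -- The member (x - d, 0) of a broken triple is (0,0) for x = d, and (x + d, 0) is for x = - d.
  lost-left : ∀ d x y → toℕ x ≡ D d → y ⊕ D d ≡ x → y ≡ zero
  lost-left d x y p q = ⊕-injective (D d) (trans q (⊕-natural {zero} {x} {D d} p))

  lost-right : ∀ d x y → toℕ x + D d ≡ μ → y ≡ x ⊕ D d → y ≡ zero
  lost-right d x y p q = trans q (⊕-injective {x ⊕ D d} {zero} (toℕ x)
    (trans (⊕-comm x (D d) (toℕ x)) (trans (cong (_⊕ D d) (trans (⊕-double x) (sym (⊕-assoc origin (toℕ x) (toℕ x)))))
      (trans (⊕-comm (origin ⊕ toℕ x) (toℕ x) (D d)) (trans (cong (_⊕ toℕ x) (trans (⊕-assoc origin (toℕ x) (D d)) (trans (cong (origin ⊕_) p) (⊕-full origin)))) refl)))))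

  column-left : ∀ d x y z → toℕ x + D d ≡ μ → toℕ z + (D d + D d) ≡ μ → y ⊕ D d ≡ x → y ≡ z
  column-left d x y z p q r = ⊕-injective (D d) (trans r (⊕-natural {z} {x} {D d} (lin 4 (λ x z d u → x :+ d := u ∷ z :+ (d :+ d) := u ∷ [] ⊢ x := z :+ d) (toℕ x) (toℕ z) (D d) μ p q)))

  column-right : ∀ d x y z → toℕ x ≡ D d → toℕ z ≡ D d + D d → y ≡ x ⊕ D d → y ≡ z
  column-right d x y z p q r = trans r (sym (⊕-natural {x} {z} {D d} (trans q (cong (_+ D d) (sym p)))))

  Linked : Fin t → Fin 3 → Fin μ → V → V → Set
  Linked d i x u v = Link d i x u v ⊎ Link d i x v u

  swap : ∀ {d i x u v} → Linked d i x u v → Linked d i x v u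
  swap (inj₁ l) = inj₂ l
  swap (inj₂ l) = inj₁ l

  linkBV : ∀ d x y z → Good (fin zero y) → y ⊕ D d ≡ x → Half d x z → Linked d zero x (fin zero y) (fin (suc zero) z)
  linkBV d x y z g p (plus q _) = ⊥-elim (g (cong (fin zero) (lost-left d x y q p)))
  linkBV d x y z g p h@(minus q r) with column-left d x y z q r p
  ... | refl = inj₁ (column refl h)

  linkCV : ∀ d x y z → Good (fin zero y) → y ≡ x ⊕ D d → Half d x z → Linked d zero x (fin zero y) (fin (suc zero) z)
  linkCV d x y z g p (minus q _) = ⊥-elim (g (cong (fin zero) (lost-right d x y q p)))
  linkCV d x y z g p h@(plus q r) with column-right d x y z q r p
  ... | refl = inj₁ (column refl h)

  links : ∀ {d i x u v s s′} → u ≢ v → Member d i x u s → Member d i x v s′ → Linked d i x u v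
  links {d} {x = x} ne (B0 y _ p) (B0 y′ _ q) = ⊥-elim (ne (cong (fin zero) (⊕-injective (D d) (trans p (sym q)))))
  links {d} {x = x} ne (B0 y _ p) (C0 y′ _ q) = inj₁ (par p q)
  links {d} {x = x} ne (B0 y _ p) (A0 _) = inj₁ (up (sym p))
  links {d} {x = x} ne (B0 y g p) (VA h _) = linkBV d x y _ g p h
  links {d} {x = x} ne (B0 y g p) (VB z q _) = ⊥-elim (g (cong (fin zero) (lost-left d x y q p)))
  links {d} {x = x} ne (B0 y g p) (VC z q r) with column-left d x y z q r p
  ... | refl = inj₂ (column refl (minus q r))
  links {d} {x = x} ne (C0 y _ p) (B0 y′ _ q) = inj₂ (par q p)
  links {d} {x = x} ne (C0 y _ p) (C0 y′ _ q) = ⊥-elim (ne (cong (fin zero) (trans p (sym q))))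
  links {d} {x = x} ne (C0 y _ p) (A0 _) = inj₁ (down p)
  links {d} {x = x} ne (C0 y g p) (VA h _) = linkCV d x y _ g p h
  links {d} {x = x} ne (C0 y g p) (VB z q r) with column-right d x y z q r p
  ... | refl = inj₂ (column refl (plus q r))
  links {d} {x = x} ne (C0 y g p) (VC z q _) = ⊥-elim (g (cong (fin zero) (lost-right d x y q p)))
  links {d} {x = x} ne (A0 _) (B0 y _ p) = inj₂ (up (sym p))
  links {d} {x = x} ne (A0 _) (C0 y _ p) = inj₂ (down p)
  links ne (A0 _) (A0 _) = ⊥-elim (ne refl)
  links ne (A0 n) (VA h _) = ⊥-elim (n (half-side h))
  links {d} {x = x} ne (A0 n) (VB z p _) = ⊥-elim (n (inj₁ p))
  links {d} {x = x} ne (A0 n) (VC z p _) = ⊥-elim (n (inj₂ p))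
  links {d} {x = x} ne (VA h _) (B0 y g p) = swap (linkBV d x y _ g p h)
  links {d} {x = x} ne (VA h _) (C0 y g p) = swap (linkCV d x y _ g p h)
  links ne (VA h _) (A0 n) = ⊥-elim (n (half-side h))
  links ne (VA h _) (VA h′ _) = ⊥-elim (ne (cong (fin (suc zero)) (half-same h h′)))
  links {d} {x = x} ne (VA h _) (VB z p q) with half-same h (plus p q)
  ... | refl = inj₁ (column refl h)
  links {d} {x = x} ne (VA h _) (VC z p q) with half-same h (minus p q)
  ... | refl = inj₁ (column refl h)
  links {d} {x = x} ne (VB z q _) (B0 y g p) = ⊥-elim (g (cong (fin zero) (lost-left d x y q p)))
  links {d} {x = x} ne (VB z q r) (C0 y g p) with column-right d x y z q r p
  ... | refl = inj₁ (column refl (plus q r))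
  links {d} {x = x} ne (VB z p _) (A0 n) = ⊥-elim (n (inj₁ p))
  links {d} {x = x} ne (VB z p q) (VA h _) with half-same h (plus p q)
  ... | refl = inj₂ (column refl h)
  links {d} {x = x} ne (VB z p q) (VB z′ p′ q′) = ⊥-elim (ne (cong (fin (suc (suc zero))) (half-same (plus p q) (plus p′ q′))))
  links {d} {x = x} ne (VB z p q) (VC z′ p′ q′) = ⊥-elim (ne (cong (fin (suc (suc zero))) (half-same (plus p q) (minus p′ q′))))
  links {d} {x = x} ne (VC z q r) (B0 y g p) with column-left d x y z q r p
  ... | refl = inj₁ (column refl (minus q r))
  links {d} {x = x} ne (VC z q _) (C0 y g p) = ⊥-elim (g (cong (fin zero) (lost-right d x y q p)))
  links {d} {x = x} ne (VC z p _) (A0 n) = ⊥-elim (n (inj₂ p))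
  links {d} {x = x} ne (VC z p q) (VA h _) with half-same h (minus p q)
  ... | refl = inj₂ (column refl h)
  links {d} {x = x} ne (VC z p q) (VB z′ p′ q′) = ⊥-elim (ne (cong (fin (suc (suc zero))) (half-same (minus p q) (plus p′ q′))))
  links {d} {x = x} ne (VC z p q) (VC z′ p′ q′) = ⊥-elim (ne (cong (fin (suc (suc zero))) (half-same (minus p q) (minus p′ q′))))
  links {d} ne (B1 p) (B1 q) = ⊥-elim (ne (cong (fin (suc zero)) (⊕-injective (D d) (trans p (sym q)))))
  links ne (B1 p) (C1 q) = inj₁ (par p q)
  links ne (B1 p) A1 = inj₁ (up (sym p))
  links ne (C1 p) (B1 q) = inj₂ (par q p)
  links ne (C1 p) (C1 q) = ⊥-elim (ne (cong (fin (suc zero)) (trans p (sym q))))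
  links ne (C1 p) A1 = inj₁ (down p)
  links ne A1 (B1 p) = inj₂ (up (sym p))
  links ne A1 (C1 p) = inj₂ (down p)
  links ne A1 A1 = ⊥-elim (ne refl)
  links ne (B2 p) (B2 q) = ⊥-elim (ne (cong (fin (suc (suc zero))) (trans p (sym q))))
  links ne (B2 p) (C2 q) = inj₂ (par q p)
  links ne (B2 p) A2 = inj₁ (down p)
  links ne (C2 p) (B2 q) = inj₁ (par p q)
  links {d} ne (C2 p) (C2 q) = ⊥-elim (ne (cong (fin (suc (suc zero))) (⊕-injective (D d + D d) (trans p (sym q)))))
  links ne (C2 p) A2 = inj₁ (up (sym p))
  links ne A2 (B2 p) = inj₂ (down p)
  links ne A2 (C2 p) = inj₂ (up (sym p))
  links ne A2 A2 = ⊥-elim (ne refl)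

  Slots≈ : V → V → Slot t t t → Slot t t t → Set
  Slots≈ u v s s′ = (u ≡ v → s ≡ s′) × (u ≢ v → Compatible s s′)

  apart : ∀ {u v s s′} → u ≢ v → Compatible s s′ → Slots≈ u v s s′
  apart ne c = (λ p → ⊥-elim (ne p)) , λ _ → c

  alike : ∀ {u v s s′} → u ≡ v → s ≡ s′ → Slots≈ u v s s′
  alike p q = (λ _ → q) , λ ne → ⊥-elim (ne p)

  par≢ : ∀ {i d x y z} → y ⊕ e i d ≡ x → z ≡ x ⊕ e i d → fin i y ≢ fin i z
  par≢ {i} {d} p q r with proj₂ (fin-injective r)
  ... | refl = opposite-steps i d d (sym p) q

  slots : ∀ {d i x u v s s′} → Member d i x u s → Member d i x v s′ → Slots≈ u v s s′
  slots {d} {x = x} (B0 y _ p) (B0 y′ _ q) = alike (cong (fin zero) (⊕-injective (D d) (trans p (sym q)))) refl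
  slots {d} {x = x} (B0 y _ p) (C0 y′ _ q) = apart (par≢ p q) (BC refl (n≤1+n _))
  slots {d} {x = x} (B0 y _ p) (A0 _) = apart (λ ()) BA
  slots {d} {x = x} (B0 y g p) (VA h _) = apart (λ ()) BA
  slots {d} {x = x} (B0 y g p) (VB z q _) = ⊥-elim (g (cong (fin zero) (lost-left d x y q p)))
  slots {d} {x = x} (B0 y g p) (VC z q r) = apart (λ ()) (BC refl (n≤1+n _))
  slots {d} {x = x} (C0 y _ p) (B0 y′ _ q) = apart (par≢ q p ∘ sym) (CB refl (n≤1+n _))
  slots {d} {x = x} (C0 y _ p) (C0 y′ _ q) = alike (cong (fin zero) (trans p (sym q))) refl
  slots {d} {x = x} (C0 y _ p) (A0 _) = apart (λ ()) CA
  slots {d} {x = x} (C0 y g p) (VA h _) = apart (λ ()) CA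
  slots {d} {x = x} (C0 y g p) (VB z q r) = apart (λ ()) (CB refl (n≤1+n _))
  slots {d} {x = x} (C0 y g p) (VC z q _) = ⊥-elim (g (cong (fin zero) (lost-right d x y q p)))
  slots {d} {x = x} (A0 _) (B0 y _ p) = apart (λ ()) AB
  slots {d} {x = x} (A0 _) (C0 y _ p) = apart (λ ()) AC
  slots (A0 _) (A0 _) = alike refl refl
  slots (A0 n) (VA h _) = ⊥-elim (n (half-side h))
  slots {d} {x = x} (A0 n) (VB z p _) = ⊥-elim (n (inj₁ p))
  slots {d} {x = x} (A0 n) (VC z p _) = ⊥-elim (n (inj₂ p))
  slots {d} {x = x} (VA h _) (B0 y g p) = apart (λ ()) AB
  slots {d} {x = x} (VA h _) (C0 y g p) = apart (λ ()) AC
  slots (VA h _) (A0 n) = ⊥-elim (n (half-side h))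
  slots (VA h a) (VA h′ b) with half-same h h′
  ... | refl = alike refl (cong A (side-unique a b))
  slots {d} {x = x} (VA h _) (VB z p q) = apart (λ ()) AB
  slots {d} {x = x} (VA h _) (VC z p q) = apart (λ ()) AC
  slots {d} {x = x} (VB z q _) (B0 y g p) = ⊥-elim (g (cong (fin zero) (lost-left d x y q p)))
  slots {d} {x = x} (VB z q r) (C0 y g p) = apart (λ ()) (BC refl (n≤1+n _))
  slots {d} {x = x} (VB z p _) (A0 n) = ⊥-elim (n (inj₁ p))
  slots {d} {x = x} (VB z p q) (VA h _) = apart (λ ()) BA
  slots {d} {x = x} (VB z p q) (VB z′ p′ q′) = alike (cong (fin (suc (suc zero))) (half-same (plus p q) (plus p′ q′))) refl
  slots {d} {x = x} (VB z p q) (VC z′ p′ q′) = ⊥-elim (e-sum zero d d (trans (cong (_+ D d) (sym p)) p′))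
  slots {d} {x = x} (VC z q r) (B0 y g p) = apart (λ ()) (CB refl (n≤1+n _))
  slots {d} {x = x} (VC z q _) (C0 y g p) = ⊥-elim (g (cong (fin zero) (lost-right d x y q p)))
  slots {d} {x = x} (VC z p _) (A0 n) = ⊥-elim (n (inj₂ p))
  slots {d} {x = x} (VC z p q) (VA h _) = apart (λ ()) CA
  slots {d} {x = x} (VC z p′ q) (VB z′ p q′) = ⊥-elim (e-sum zero d d (trans (cong (_+ D d) (sym p)) p′))
  slots {d} {x = x} (VC z p q) (VC z′ p′ q′) = alike (cong (fin (suc (suc zero))) (half-same (minus p q) (minus p′ q′))) refl
  slots {d} (B1 p) (B1 q) = alike (cong (fin (suc zero)) (⊕-injective (D d) (trans p (sym q)))) refl
  slots (B1 p) (C1 q) = apart (par≢ p q) (BC refl (n≤1+n _))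
  slots (B1 p) A1 = apart (λ ()) BA
  slots (C1 p) (B1 q) = apart (par≢ q p ∘ sym) (CB refl (n≤1+n _))
  slots (C1 p) (C1 q) = alike (cong (fin (suc zero)) (trans p (sym q))) refl
  slots (C1 p) A1 = apart (λ ()) CA
  slots A1 (B1 p) = apart (λ ()) AB
  slots A1 (C1 p) = apart (λ ()) AC
  slots A1 A1 = alike refl refl
  slots (B2 p) (B2 q) = alike (cong (fin (suc (suc zero))) (trans p (sym q))) refl
  slots (B2 p) (C2 q) = apart (par≢ q p ∘ sym) (BC refl (n≤1+n _))
  slots (B2 p) A2 = apart (λ ()) BA
  slots (C2 p) (B2 q) = apart (par≢ p q) (CB refl (n≤1+n _))
  slots {d} (C2 p) (C2 q) = alike (cong (fin (suc (suc zero))) (⊕-injective (D d + D d) (trans p (sym q)))) refl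
  slots (C2 p) A2 = apart (λ ()) CA
  slots A2 (B2 p) = apart (λ ()) AB
  slots A2 (C2 p) = apart (λ ()) AC
  slots A2 A2 = alike refl refl

  turn : ∀ {y : Fin μ} {n} k → y ⊕ n ≡ y → k * μ ≤ n → n < suc k * μ → n ≡ k * μ
  turn {y} {n} k p le lt = trans (sym (m∸n+n≡m le)) (cong (_+ k * μ)
    (⊕-loop {y} (trans (sym (⊕-multiple (y ⊕ (n ∸ k * μ)) k)) (trans (⊕-assoc y _ (k * μ)) (trans (cong (y ⊕_) (m∸n+n≡m le)) p)))
      (lin 4 (λ d n u ku → d :+ ku := n ∷ n :< u :+ ku ∷ [] ⊢ d :< u) (n ∸ k * μ) n μ (k * μ) (m∸n+n≡m le) lt)))

  around : ∀ {y : Fin μ} n → y ⊕ n ≡ y → n < 4 * μ → n ≡ 0 * μ ⊎ n ≡ 1 * μ ⊎ n ≡ 2 * μ ⊎ n ≡ 3 * μ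
  around n p lt with n <? 1 * μ | n <? 2 * μ | n <? 3 * μ
  ... | yes a | _ | _ = inj₁ (turn 0 p z≤n a)
  ... | no a | yes b | _ = inj₂ (inj₁ (turn 1 p (≮⇒≥ a) b))
  ... | no a | no b | yes c = inj₂ (inj₂ (inj₁ (turn 2 p (≮⇒≥ b) c)))
  ... | no a | no b | no c = inj₂ (inj₂ (inj₂ (turn 3 p (≮⇒≥ c) lt)))

  par-step : ∀ {i d x y z} → y ⊕ e i d ≡ x → z ≡ x ⊕ e i d → z ≡ y ⊕ (e i d + e i d)
  par-step {i} {d} {y = y} p q = trans q (trans (cong (_⊕ e i d) (sym p)) (⊕-assoc y (e i d) (e i d)))

  e+e<4μ : ∀ {a b} → a ≤ 2 * t → b ≤ 2 * t → a + a + (b + b) < 4 * μ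
  e+e<4μ {a} {b} = lin 3 (λ a b t → a :≤ 2 :* t ∷ b :≤ 2 :* t ∷ [] ⊢ a :+ a :+ (b :+ b) :< 4 :* (K 1 :+ 2 :* t)) a b t

  e-cases : ∀ i d d′ → e i d + e i d + (e i d′ + e i d′) ≢ 2 * μ
  e-cases i d d′ p = e-sum i d d′ (lin 3 (λ a b u → a :+ a :+ (b :+ b) := 2 :* u ∷ [] ⊢ a :+ b := u) (e i d) (e i d′) μ p)

  -- Going from y to z and back makes twice the sum of the two half differences a multiple of μ
  -- below 4μ. Odd multiples fail by parity, 0 by positivity, and 2μ by `e-sum`.
  par-opposite : ∀ {i d d′ x x′ y z} → y ⊕ e i d ≡ x → z ≡ x ⊕ e i d → z ⊕ e i d′ ≡ x′ → y ≡ x′ ⊕ e i d′ → ⊥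
  par-opposite {i} {d} {d′} {y = y} {z} p q p′ q′
    with around {y} (e i d + e i d + (e i d′ + e i d′))
           (trans (sym (⊕-assoc y (e i d + e i d) _)) (trans (cong (_⊕ (e i d′ + e i d′)) (sym (par-step {i} p q))) (sym (par-step {i} p′ q′))))
           (e+e<4μ (proj₂ (e-bounds i d)) (proj₂ (e-bounds i d′)))
  ... | inj₁ z = lin 2 (λ a b → a :+ a :+ (b :+ b) := K 0 ∷ K 1 :≤ a ∷ [] ⊢ absurd) (e i d) (e i d′) z (proj₁ (e-bounds i d))
  ... | inj₂ (inj₁ z) = lin 3 (λ a b t → a :+ a :+ (b :+ b) := 1 :* (K 1 :+ 2 :* t) ∷ [] ⊢ absurd) (e i d) (e i d′) t z
  ... | inj₂ (inj₂ (inj₁ z)) = e-cases i d d′ z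
  ... | inj₂ (inj₂ (inj₂ z)) = lin 3 (λ a b t → a :+ a :+ (b :+ b) := 3 :* (K 1 :+ 2 :* t) ∷ [] ⊢ absurd) (e i d) (e i d′) t z

  -- 2(b - a) is an even multiple of the odd number μ, and it is below 2μ.
  double-cancel : ∀ {y : Fin μ} {a b} → a ≤ b → b ≤ 2 * t → y ⊕ (b + b) ≡ y ⊕ (a + a) → b ≡ a
  double-cancel {y} {a} {b} le bt q with around {y ⊕ (a + a)} (b ∸ a + (b ∸ a)) (trans (⊕-assoc y (a + a) _)
      (trans (cong (y ⊕_) (lin 3 (λ a b c → c :+ a := b ∷ [] ⊢ (a :+ a) :+ (c :+ c) := b :+ b) a b (b ∸ a) (m∸n+n≡m le))) q))
      (lin 4 (λ c a b t → c :+ a := b ∷ b :≤ 2 :* t ∷ [] ⊢ c :+ c :< 4 :* (K 1 :+ 2 :* t)) (b ∸ a) a b t (m∸n+n≡m le) bt)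
  ... | inj₁ z = lin 3 (λ c a b → c :+ c := K 0 ∷ c :+ a := b ∷ [] ⊢ b := a) (b ∸ a) a b z (m∸n+n≡m le)
  ... | inj₂ (inj₁ z) = ⊥-elim (lin 2 (λ c t → c :+ c := 1 :* (K 1 :+ 2 :* t) ∷ [] ⊢ absurd) (b ∸ a) t z)
  ... | inj₂ (inj₂ (inj₁ z)) = ⊥-elim (lin 4 (λ c t a b → c :+ c := 2 :* (K 1 :+ 2 :* t) ∷ c :+ a := b ∷ b :≤ 2 :* t ∷ [] ⊢ absurd) (b ∸ a) t a b z (m∸n+n≡m le) bt)
  ... | inj₂ (inj₂ (inj₂ z)) = ⊥-elim (lin 2 (λ c t → c :+ c := 3 :* (K 1 :+ 2 :* t) ∷ [] ⊢ absurd) (b ∸ a) t z)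

  par-unique : ∀ {i d d′ x x′ y z} → y ⊕ e i d ≡ x → z ≡ x ⊕ e i d → y ⊕ e i d′ ≡ x′ → z ≡ x′ ⊕ e i d′ → d ≡ d′
  par-unique {i} {d} {d′} p q p′ q′ with ≤-total (e i d) (e i d′) | trans (sym (par-step {i} p q)) (par-step {i} p′ q′)
  ... | inj₁ le | r = sym (e-injective i (double-cancel le (proj₂ (e-bounds i d′)) (sym r)))
  ... | inj₂ le | r = e-injective i (double-cancel le (proj₂ (e-bounds i d)) r)

  Index : Set
  Index = Fin t × Fin 3 × Fin μ

  unique : ∀ {d i x d′ i′ x′ u v u′ v′} → Link d i x u v → Link d′ i′ x′ u′ v′ → u ≡ u′ → v ≡ v′ → (d , i , x) ≡ (d′ , i′ , x′)
  unique {i = i} (par p q) (par p′ q′) refl refl with par-unique {i} p q p′ q′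
  ... | refl = cong (λ z → _ , i , z) (trans (sym p) p′)
  unique {i = i} (up p) (up q) a b with fin-injective a | fin-injective b
  ... | refl , refl | _ , refl = cong (_, i , _) (e-injective i (⊕-cancel (e<μ i _) (e<μ i _) (trans (sym p) q)))
  unique {i = i} (down p) (down q) a b with fin-injective a | fin-injective b
  ... | refl , refl | _ , refl = cong (_, i , _) (e-injective i (⊕-cancel (e<μ i _) (e<μ i _) (trans (sym p) q)))
  unique {d} {i} {d′ = d′} (up p) (down q) a b with fin-injective a | fin-injective b
  ... | refl , refl | _ , refl = ⊥-elim (opposite-steps i d d′ p q)
  unique {d} {i} {d′ = d′} (down q) (up p) a b with fin-injective a | fin-injective b
  ... | refl , refl | _ , refl = ⊥-elim (opposite-steps i d′ d p q)
  unique {d} {i} (up p) (column _ _) a b with fin-injective a | fin-injective b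
  ... | refl , refl | _ , refl = ⊥-elim (no-loop i d (sym p))
  unique {d′ = d′} {i′} (column _ _) (up p) a b with fin-injective a | fin-injective b
  ... | refl , refl | _ , refl = ⊥-elim (no-loop i′ d′ (sym p))
  unique {d} {i} (down p) (column _ _) a b with fin-injective a | fin-injective b
  ... | refl , refl | _ , refl = ⊥-elim (no-loop i d (sym p))
  unique {d′ = d′} {i′} (column _ _) (down p) a b with fin-injective a | fin-injective b
  ... | refl , refl | _ , refl = ⊥-elim (no-loop i′ d′ (sym p))
  unique (column refl h) (column refl h′) a b with fin-injective a
  ... | refl , refl with half-unique h h′
  ...   | refl , refl = refl
  unique (par _ _) (up _) a b = ⊥-elim (next≢ _ (trans (sym (proj₁ (fin-injective a))) (proj₁ (fin-injective b))))
  unique (par _ _) (down _) a b = ⊥-elim (next≢ _ (trans (sym (proj₁ (fin-injective a))) (proj₁ (fin-injective b))))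
  unique (par _ _) (column _ _) a b = ⊥-elim (next≢ _ (trans (sym (proj₁ (fin-injective a))) (proj₁ (fin-injective b))))
  unique (up _) (par _ _) a b = ⊥-elim (next≢ _ (trans (proj₁ (fin-injective a)) (sym (proj₁ (fin-injective b)))))
  unique (down _) (par _ _) a b = ⊥-elim (next≢ _ (trans (proj₁ (fin-injective a)) (sym (proj₁ (fin-injective b)))))
  unique (column _ _) (par _ _) a b = ⊥-elim (next≢ _ (trans (proj₁ (fin-injective a)) (sym (proj₁ (fin-injective b)))))

  opposite : ∀ {d i x d′ i′ x′ u v u′ v′} → Link d i x u v → Link d′ i′ x′ u′ v′ → u ≡ v′ → v ≡ u′ → ⊥
  opposite {i = i} (par p q) (par p′ q′) refl refl = par-opposite {i} p q p′ q′
  opposite (par _ _) (up _) a b = next≢ _ (trans (sym (proj₁ (fin-injective b))) (proj₁ (fin-injective a)))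
  opposite (par _ _) (down _) a b = next≢ _ (trans (sym (proj₁ (fin-injective b))) (proj₁ (fin-injective a)))
  opposite (par _ _) (column _ _) a b = next≢ _ (trans (sym (proj₁ (fin-injective b))) (proj₁ (fin-injective a)))
  opposite (up _) (par _ _) a b = next≢ _ (trans (proj₁ (fin-injective a)) (sym (proj₁ (fin-injective b))))
  opposite (down _) (par _ _) a b = next≢ _ (trans (proj₁ (fin-injective a)) (sym (proj₁ (fin-injective b))))
  opposite (column _ _) (par _ _) a b = next≢ _ (trans (proj₁ (fin-injective a)) (sym (proj₁ (fin-injective b))))
  opposite (up _) (up _) a b = next-next≢ _ (trans (proj₁ (fin-injective a)) (cong next (sym (proj₁ (fin-injective b)))))
  opposite (up _) (down _) a b = next-next≢ _ (trans (proj₁ (fin-injective a)) (cong next (sym (proj₁ (fin-injective b)))))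
  opposite (up _) (column _ _) a b = next-next≢ _ (trans (proj₁ (fin-injective a)) (cong next (sym (proj₁ (fin-injective b)))))
  opposite (down _) (up _) a b = next-next≢ _ (trans (proj₁ (fin-injective a)) (cong next (sym (proj₁ (fin-injective b)))))
  opposite (down _) (down _) a b = next-next≢ _ (trans (proj₁ (fin-injective a)) (cong next (sym (proj₁ (fin-injective b)))))
  opposite (down _) (column _ _) a b = next-next≢ _ (trans (proj₁ (fin-injective a)) (cong next (sym (proj₁ (fin-injective b)))))
  opposite (column _ _) (up _) a b = next-next≢ _ (trans (proj₁ (fin-injective a)) (cong next (sym (proj₁ (fin-injective b)))))
  opposite (column _ _) (down _) a b = next-next≢ _ (trans (proj₁ (fin-injective a)) (cong next (sym (proj₁ (fin-injective b)))))
  opposite (column _ _) (column _ _) a b = next-next≢ _ (trans (proj₁ (fin-injective a)) (cong next (sym (proj₁ (fin-injective b)))))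

  -- The triples of layer 2 with midpoint 0 have the apex (0,0) and are dropped, which leaves t(6t +
  -- 2) points.
  data Point : Set where
    p0 p1 : Fin t → Fin μ → Point
    p2 : Fin t → Fin (2 * t) → Point

  index : Point → Index
  index (p0 d x) = d , zero , x
  index (p1 d x) = d , suc zero , x
  index (p2 d x) = d , suc (suc zero) , suc x

  index-injective : ∀ {p q} → index p ≡ index q → p ≡ q
  index-injective {p0 d x} {p0 .d .x} refl = refl
  index-injective {p1 d x} {p1 .d .x} refl = refl
  index-injective {p2 d x} {p2 .d .x} refl = refl

  N : ℕ
  N = t * μ + (t * μ + t * (2 * t))

  encode : Point → Fin N
  encode (p0 d x) = combine d x ↑ˡ _
  encode (p1 d x) = t * μ ↑ʳ (combine d x ↑ˡ _)
  encode (p2 d x) = t * μ ↑ʳ (t * μ ↑ʳ combine d x)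

  encode-injective : ∀ p q → encode p ≡ encode q → p ≡ q
  encode-injective (p0 d x) (p0 d′ x′) r = let a , b = FinP.combine-injective d x d′ x′ (FinP.↑ˡ-injective _ _ _ r) in cong₂ p0 a b
  encode-injective (p0 d x) (p1 d′ x′) r = ⊥-elim (↑-apart r)
  encode-injective (p0 d x) (p2 d′ x′) r = ⊥-elim (↑-apart r)
  encode-injective (p1 d x) (p0 d′ x′) r = ⊥-elim (↑-apart (sym r))
  encode-injective (p2 d x) (p0 d′ x′) r = ⊥-elim (↑-apart (sym r))
  encode-injective (p1 d x) (p1 d′ x′) r = let a , b = FinP.combine-injective d x d′ x′ (FinP.↑ˡ-injective _ _ _ (FinP.↑ʳ-injective (t * μ) _ _ r)) in cong₂ p1 a b
  encode-injective (p1 d x) (p2 d′ x′) r = ⊥-elim (↑-apart (FinP.↑ʳ-injective (t * μ) _ _ r))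
  encode-injective (p2 d x) (p1 d′ x′) r = ⊥-elim (↑-apart (sym (FinP.↑ʳ-injective (t * μ) _ _ r)))
  encode-injective (p2 d x) (p2 d′ x′) r = let a , b = FinP.combine-injective d x d′ x′ (FinP.↑ʳ-injective (t * μ) _ _ (FinP.↑ʳ-injective (t * μ) _ _ r)) in cong₂ p2 a b

  MemberAt : Index → V → Slot t t t → Set
  MemberAt (d , i , x) = Member d i x

  At : V → Slot t t t → Set
  At v s = Σ Point λ p → MemberAt (index p) v s

  -- Modulo 2t + 1 the half of 2k is k, and the half of 2k + 1 is t + k + 1, the negative of t - k.
  half : ∀ y → y ≢ zero → Σ (Fin t × Fin μ) λ (d , x) → Half d x y
  half y ne = go (toℕ y) refl (parity (toℕ y))
    where
    go : ∀ n → toℕ y ≡ n → Parity n → Σ (Fin t × Fin μ) λ (d , x) → Half d x y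
    go .(2 * k) p (even k) = go′ k p
      where
      go′ : ∀ k → toℕ y ≡ 2 * k → Σ (Fin t × Fin μ) λ (d , x) → Half d x y
      go′ zero p = ⊥-elim (ne (FinP.toℕ-injective p))
      go′ (suc k) p = (fromℕ< k<t , fromℕ< k<μ) , plus (trans (FinP.toℕ-fromℕ< k<μ) (cong suc (sym (FinP.toℕ-fromℕ< k<t))))
          (trans p (trans (lin 1 (λ k → [] ⊢ 2 :* (K 1 :+ k) := (K 1 :+ k) :+ (K 1 :+ k)) k) (cong (λ z → suc z + suc z) (sym (FinP.toℕ-fromℕ< k<t)))))
        where
        k<t : k < t
        k<t = lin 3 (λ y k t → y := 2 :* (K 1 :+ k) ∷ y :< K 1 :+ 2 :* t ∷ [] ⊢ k :< t) (toℕ y) k t p (FinP.toℕ<n y)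
        k<μ : suc k < μ
        k<μ = lin 2 (λ k t → k :< t ∷ [] ⊢ K 1 :+ k :< K 1 :+ 2 :* t) k t k<t
    go .(suc (2 * k)) p (odd k) = (fromℕ< k<t , fromℕ< k<μ) , minus
        (trans (cong₂ _+_ (FinP.toℕ-fromℕ< k<μ) (cong suc (FinP.toℕ-fromℕ< k<t)))
          (lin 3 (λ c k t → c :+ (K 1 :+ k) := t ∷ [] ⊢ K 1 :+ (t :+ k) :+ (K 1 :+ c) := K 1 :+ 2 :* t) (t ∸ suc k) k t c+k))
        (trans (cong₂ _+_ p (cong (λ z → suc z + suc z) (FinP.toℕ-fromℕ< k<t)))
          (lin 3 (λ c k t → c :+ (K 1 :+ k) := t ∷ [] ⊢ K 1 :+ 2 :* k :+ ((K 1 :+ c) :+ (K 1 :+ c)) := K 1 :+ 2 :* t) (t ∸ suc k) k t c+k))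
      where
      k< : suc k ≤ t
      k< = lin 3 (λ y k t → y := K 1 :+ 2 :* k ∷ y :< K 1 :+ 2 :* t ∷ [] ⊢ K 1 :+ k :≤ t) (toℕ y) k t p (FinP.toℕ<n y)
      c+k : t ∸ suc k + suc k ≡ t
      c+k = m∸n+n≡m k<
      k<t : t ∸ suc k < t
      k<t = lin 3 (λ c k t → c :+ (K 1 :+ k) := t ∷ [] ⊢ c :< t) (t ∸ suc k) k t c+k
      k<μ : suc (t + k) < μ
      k<μ = lin 2 (λ k t → K 1 :+ k :≤ t ∷ [] ⊢ K 1 :+ (t :+ k) :< K 1 :+ 2 :* t) k t k<

  side≢0 : ∀ {a y} → Side a y → y ≢ zero
  side≢0 (inj₁ ()) refl
  side≢0 {a} (inj₂ p) refl = lin 2 (λ a t → a :≤ t ∷ a := K 1 :+ 2 :* t ∷ [] ⊢ absurd) (D a) t (D≤ a) p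

  nonzero : ∀ {x : Fin μ} → x ≢ zero → ∃ λ k → x ≡ suc k
  nonzero {zero} ne = ⊥-elim (ne refl)
  nonzero {suc k} ne = k , refl

  D2≤ : ∀ d → D d + D d ≤ μ
  D2≤ d = lin 2 (λ d t → d :≤ t ∷ [] ⊢ d :+ d :≤ K 1 :+ 2 :* t) (D d) t (D≤ d)

  D≤μ : ∀ d → D d ≤ μ
  D≤μ d = ≤-trans (m≤m+n (D d) (D d)) (D2≤ d)

  fromPos : ∀ n → n < μ → Σ (Fin μ) λ x → toℕ x ≡ n
  fromPos n lt = fromℕ< lt , FinP.toℕ-fromℕ< lt

  point : ∀ v s → Good v → At v s
  point (fin zero y) (A a) g with nonzero {y} (λ { refl → g refl })
  ... | k , refl = p2 a k , A2
  point (fin zero y) (B d) g = p0 d (y ⊕ D d) , B0 y g refl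
  point (fin zero y) (C d) g = p0 d (y ⊕ (μ ∸ D d)) , C0 y g (sym (⊖-⊕ y (D≤μ d)))
  point (fin (suc zero) y) (A a) g with toℕ y ≟ D a | toℕ y + D a ≟ μ
  ... | no n | no n′ = p0 a y , A0 λ { (inj₁ p) → n p ; (inj₂ p) → n′ p }
  ... | yes p | _ = let (d , x) , h = half y (side≢0 (inj₁ p)) in p0 d x , VA h (inj₁ p)
  ... | no _ | yes p = let (d , x) , h = half y (side≢0 (inj₂ p)) in p0 d x , VA h (inj₂ p)
  point (fin (suc zero) y) (B d) g = p1 d (y ⊕ D d) , B1 refl
  point (fin (suc zero) y) (C d) g = p1 d (y ⊕ (μ ∸ D d)) , C1 (sym (⊖-⊕ y (D≤μ d)))
  point (fin (suc (suc zero)) y) (A a) g = p1 a y , A1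
  point (fin (suc (suc zero)) y) (B d) g with toℕ y ≟ D d + D d
  ... | yes p = let x , q = fromPos (D d) (s≤s (≤-trans (D≤ d) (m≤m+n t _))) in p0 d x , VB y q p
  ... | no n with nonzero {y ⊕ (μ ∸ (D d + D d))} (λ z → n (trans (cong toℕ (sym (⊖-⊕ y (D2≤ d)))) (trans (cong (λ w → toℕ (w ⊕ (D d + D d))) z)
                    (toℕ-⊕-small zero (e<μ (suc (suc zero)) d)))))
  ...   | k , r = p2 d k , B2 (trans (sym (⊖-⊕ y (D2≤ d))) (cong (_⊕ (D d + D d)) r))
  point (fin (suc (suc zero)) y) (C d) g with toℕ y + (D d + D d) ≟ μ
  ... | yes p = let x , q = fromPos (μ ∸ D d) (s≤s (m∸n≤m (2 * t) (toℕ d))) in p0 d x , VC y (trans (cong (_+ D d) q) (m∸n+n≡m (D≤μ d))) p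
  ... | no n with nonzero {y ⊕ (D d + D d)} (λ z → n (wrap z))
    where
    wrap : y ⊕ (D d + D d) ≡ zero → toℕ y + (D d + D d) ≡ μ
    wrap z with toℕ y + (D d + D d) <? μ
    ... | yes lt = case trans (sym (toℕ-⊕-small y lt)) (cong toℕ z) of λ p → case m+n≡0⇒n≡0 (toℕ y) p of λ ()
    ... | no ge with ⊕-round {y} {y ⊕ (D d + D d)} {D d + D d} {toℕ y} refl (trans (sym (from-origin y)) (cong (_⊕ toℕ y) (sym (trans z refl)))) (e<μ (suc (suc zero)) d) (FinP.toℕ<n y)
    ...   | inj₂ p = trans (+-comm (toℕ y) _) p
  ...   | k , r = p2 d k , C2 r

  M : ℕ
  M = 2 * t + (μ + μ)

  toV′ : Fin (2 * t) ⊎ Fin (μ + μ) → V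
  toV′ (inj₁ k) = fin zero (suc k)
  toV′ (inj₂ j) with splitAt μ j
  ... | inj₁ y = fin (suc zero) y
  ... | inj₂ y = fin (suc (suc zero)) y

  toV : Fin M → V
  toV k = toV′ (splitAt (2 * t) k)

  good′ : ∀ k → Good (toV′ k)
  good′ (inj₁ k) ()
  good′ (inj₂ j) with splitAt μ j
  ... | inj₁ y = λ ()
  ... | inj₂ y = λ ()

  good : ∀ k → Good (toV k)
  good k = good′ (splitAt (2 * t) k)

  fromV : V → Fin M
  fromV (fin zero zero) = 2 * t ↑ʳ zero
  fromV (fin zero (suc k)) = k ↑ˡ _
  fromV (fin (suc zero) y) = 2 * t ↑ʳ (y ↑ˡ μ)
  fromV (fin (suc (suc zero)) y) = 2 * t ↑ʳ (μ ↑ʳ y)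

  fromV-toV : ∀ k → fromV (toV k) ≡ k
  fromV-toV k with splitAt (2 * t) k in p
  ... | inj₁ j = FinP.splitAt⁻¹-↑ˡ p
  ... | inj₂ j with splitAt μ j in q
  ...   | inj₁ y = trans (cong (2 * t ↑ʳ_) (FinP.splitAt⁻¹-↑ˡ q)) (FinP.splitAt⁻¹-↑ʳ p)
  ...   | inj₂ y = trans (cong (2 * t ↑ʳ_) (FinP.splitAt⁻¹-↑ʳ q)) (FinP.splitAt⁻¹-↑ʳ p)

  toV-injective : ∀ {u v} → toV u ≡ toV v → u ≡ v
  toV-injective {u} {v} p = trans (sym (fromV-toV u)) (trans (cong fromV p) (fromV-toV v))

  pointOf : ∀ v s → At (toV v) s
  pointOf v s = point (toV v) s (good v)

  pt : Fin M → Slot t t t → Maybe (Fin N)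
  pt v s = just (encode (proj₁ (pointOf v s)))

  samePoint : ∀ u v s s′ p → pt u s ≡ just p → pt v s′ ≡ just p → proj₁ (pointOf u s) ≡ proj₁ (pointOf v s′)
  samePoint u v s s′ p q r = encode-injective _ _ (just-injective (trans q (sym r)))

  pairSlots : ∀ {u v s s′} (a : At u s) (b : At v s′) → proj₁ a ≡ proj₁ b → Slots≈ u v s s′
  pairSlots (p , a) (.p , b) refl = slots a b

  LinkedAt : Index → V → V → Set
  LinkedAt (d , i , x) = Linked d i x

  pairLinks : ∀ {u v s s′} → u ≢ v → (a : At u s) (b : At v s′) → proj₁ a ≡ proj₁ b → LinkedAt (index (proj₁ a)) u v
  pairLinks ne (p , a) (.p , b) refl = links ne a b

  linked-unique : ∀ {d i x d′ i′ x′ u v} → Linked d i x u v → Linked d′ i′ x′ u v → (d , i , x) ≡ (d′ , i′ , x′)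
  linked-unique (inj₁ a) (inj₁ b) = unique a b refl refl
  linked-unique (inj₂ a) (inj₂ b) = unique a b refl refl
  linked-unique (inj₁ a) (inj₂ b) = ⊥-elim (opposite a b refl refl)
  linked-unique (inj₂ a) (inj₁ b) = ⊥-elim (opposite a b refl refl)

  module _ {k} (w : Vec ℕ (2 + k)) (sorted : Sorted w) (main : Vec.head w ≡ t) (total : t + (t + t) ≡ Vec.sum w) where

    columns : ∀ {n} → t * (6 * t + 2) ≤ n → Columns w M n
    columns {n} room = complete-none w colours (≤-trans (≤-reflexive (trans (cong (N +_) (trans (sum-cong-≗ none) (sum-0 {M} λ _ → refl))) (trans (+-identityʳ _) (total-points t)))) room)
      where
      total-points : ∀ t → t * suc (2 * t) + (t * suc (2 * t) + t * (2 * t)) ≡ t * (6 * t + 2)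
      total-points = solve-∀
      inj : ∀ v s s′ p → pt v s ≡ just p → pt v s′ ≡ just p → s ≡ s′
      inj v s s′ p q r = proj₁ (pairSlots (pointOf v s) (pointOf v s′) (samePoint v v s s′ p q r)) refl
      compatible : ∀ u v s s′ p → u ≢ v → pt u s ≡ just p → pt v s′ ≡ just p → Compatible s s′
      compatible u v s s′ p ne q r = proj₂ (pairSlots (pointOf u s) (pointOf v s′) (samePoint u v s s′ p q r)) (ne ∘ toV-injective)
      linear : ∀ u v s₁ s₁′ s₂ s₂′ p q → u ≢ v → pt u s₁ ≡ just p → pt v s₁′ ≡ just p → pt u s₂ ≡ just q → pt v s₂′ ≡ just q → p ≡ q
      linear u v s₁ s₁′ s₂ s₂′ p q ne a b c d = trans (sym (just-injective a)) (trans (cong encode (index-injective {proj₁ (pointOf u s₁)} {proj₁ (pointOf u s₂)} (linked-unique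
          (pairLinks (ne ∘ toV-injective) (pointOf u s₁) (pointOf v s₁′) (samePoint u v s₁ s₁′ p a b))
          (pairLinks (ne ∘ toV-injective) (pointOf u s₂) (pointOf v s₂′) (samePoint u v s₂ s₂′ q c d))))) (just-injective c))
      open Scheme w sorted main ≤-refl total pt inj compatible linear
      none : ∀ v → free v ≡ 0
      none v = trans (free-slots v) (cong₂ _+_ (sum-0 {t} λ _ → refl) (cong₂ _+_ (sum-0 {t} λ _ → refl) (sum-0 {t} λ _ → refl)))

-- Layered systems

-- Double counting over the fibres of f.
image-bound : ∀ {M} k (P : Fin M → Bool) (f : Fin M → Fin k) →
  (∀ u v → P u ≡ true → P v ≡ true → f u ≡ f v → u ≡ v) → sum (λ v → 𝟙 (P v)) ≤ k
image-bound {M} k P f inj = begin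
  sum (λ v → 𝟙 (P v)) ≡⟨ sum-cong-≗ (λ v → sym (row v)) ⟩
  sum (λ v → sum λ j → 𝟙 (P v ∧ (f v == j))) ≡⟨ ∑-comm (λ v j → 𝟙 (P v ∧ (f v == j))) ⟩
  sum (λ j → sum λ v → 𝟙 (P v ∧ (f v == j))) ≤⟨ sum-mono (λ j → sum-at-most-1 (λ v → P v ∧ (f v == j)) λ u v p q →
      let (a , b) = ∧-true {P u} p ; (c , d) = ∧-true {P v} q in inj u v a c (trans (==-≡ b) (sym (==-≡ d)))) ⟩
  sum {k} (λ _ → 1) ≡⟨ trans (sum-const k 1) (*-identityʳ k) ⟩
  k ∎
  where
  open ≤-Reasoning
  row : ∀ v → sum (λ j → 𝟙 (P v ∧ (f v == j))) ≡ 𝟙 (P v)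
  row v with P v
  ... | true = sum-one (f v)
  ... | false = sum-0 {k} λ _ → refl

sum-last : ∀ n (f : Fin (suc n) → ℕ) c → (∀ p → f (inject₁ p) ≡ c) → sum f ≡ n * c + f (fromℕ n)
sum-last zero f c h = +-identityʳ (f zero)
sum-last (suc n) f c h = trans (cong₂ _+_ (h zero) (sum-last n (f ∘ suc) c (h ∘ suc))) (sym (+-assoc c (n * c) _))

sum-all : ∀ {n} {f : Fin n → ℕ} c → (∀ i → f i ≡ c) → sum f ≡ n * c
sum-all {n} c h = trans (sum-cong-≗ h) (sum-const n c)

-- Three layers of Fin μ with n levels of triples (x,i), (x+p,i), (x + right p - β i, i+1), and
-- e further vertices. One more special level consists of two triples and one pair at every
-- vertex of a layer.
module Frame (n s μ e : ℕ) .{{_ : NonZero μ}} (2n<μ : 2 * n < μ) (β : Fin 3 → ℕ) where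

  open Shift μ
  open Starter n

  a : ℕ
  a = suc n + s

  Slot′ : Set
  Slot′ = Slot a a (suc n)

  data V : Set where
    fin : Fin 3 → Fin μ → V
    inf : Fin e → V

  -- Level p takes A (p + 1), B (p + 1) and C p, just within the bound `toℕ i ≤ suc (toℕ j)` of
  -- `BC`. What remains is A 0, B 0 and the last C-slot; B 0 is compatible with every C.
  special : Fin 3 → Slot′
  special zero = A zero
  special (suc zero) = B zero
  special (suc (suc zero)) = C (fromℕ n)

  -- At a vertex of layer i the A-triple takes the i-th special slot. The B-triple and the pair take
  -- the other two, in the order decided by the Boolean type of the vertex.
  letterB letterP : Fin 3 → Bool → Fin 3
  letterB i false = next i
  letterB i true = prev i
  letterP i false = prev i
  letterP i true = next i

  Free : ℕ → Set
  Free m = ∀ p → 1 ≤ p → p ≤ n → m ≢ left p × m ≢ right p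

  -- Pairs that no level covers: within a layer the levels use only the differences ± 1, ..., ± n,
  -- and from layer i to the next, after the shift by β i, only starter values.
  data Far (i : Fin 3) (x : Fin μ) (j : Fin 3) (y : Fin μ) : Set where
    level : i ≡ j → ∀ d → n < d → d + n < μ → y ≡ x ⊕ d → Far i x j y
    rise : j ≡ next i → ∀ m → m < μ → Free m → y ⊕ β i ≡ x ⊕ m → Far i x j y
    fall : i ≡ next j → ∀ m → m < μ → Free m → x ⊕ β j ≡ y ⊕ m → Far i x j y

  _≈_ : (p q : Fin 3 × Fin μ) → Set
  (i , x) ≈ (j , y) = i ≡ j × x ≡ y

  multiplicity : ∀ {X Y Z : Set} → X ⊎ (Y ⊎ Z) → ℕ
  multiplicity (inj₁ _) = 3
  multiplicity (inj₂ (inj₁ _)) = 3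
  multiplicity (inj₂ (inj₂ _)) = 2

  multiplicity? : ∀ {X Y Z : Set} → Maybe (X ⊎ (Y ⊎ Z)) → ℕ
  multiplicity? nothing = 0
  multiplicity? (just q) = multiplicity q

  -- What the special level must provide. Vertices with equal `partA` lie in one triple, likewise
  -- for B and P; `star` gives the points of the further vertices, and `side` tells the ends of a
  -- pair apart. A further vertex is in 3(n + 1) triples and in `extra` pairs.
  record Special (extra : ℕ) : Set where
    field
      sizeA sizeB sizeP : ℕ
      partA : Fin 3 → Fin μ → Fin sizeA
      partB : Fin 3 → Fin μ → Fin sizeB
      partP : Fin 3 → Fin μ → Fin sizeP
      type : Fin 3 → Fin μ → Bool
      side : Fin 3 → Fin μ → Fin 2
      star : Fin e → Slot′ → Maybe (Fin sizeA ⊎ (Fin sizeB ⊎ Fin sizeP))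
      same-A : ∀ i x j y → partA i x ≡ partA j y → (i , x) ≈ (j , y) ⊎ (i ≢ j × Far i x j y)
      same-B : ∀ i x j y → partB i x ≡ partB j y → (i , x) ≈ (j , y) ⊎ (letterB i (type i x) ≢ letterB j (type j y) × Far i x j y)
      same-P : ∀ i x j y → partP i x ≡ partP j y → (i , x) ≈ (j , y) ⊎ (letterP i (type i x) ≢ letterP j (type j y) × Far i x j y)
      once-AB : ∀ i x j y → partA i x ≡ partA j y → partB i x ≡ partB j y → (i , x) ≈ (j , y)
      once-AP : ∀ i x j y → partA i x ≡ partA j y → partP i x ≡ partP j y → (i , x) ≈ (j , y)
      once-BP : ∀ i x j y → partB i x ≡ partB j y → partP i x ≡ partP j y → (i , x) ≈ (j , y)
      two-P : ∀ i x j y → partP i x ≡ partP j y → side i x ≡ side j y → (i , x) ≈ (j , y)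
      star-injective : ∀ o s s′ q → star o s ≡ just q → star o s′ ≡ just q → s ≡ s′
      star-A : ∀ o s i x → star o s ≡ just (inj₁ (partA i x)) → Compatible s (special i) × Compatible (special i) s
      star-B : ∀ o s i x → star o s ≡ just (inj₂ (inj₁ (partB i x))) →
               Compatible s (special (letterB i (type i x))) × Compatible (special (letterB i (type i x))) s
      star-P : ∀ o s i x → star o s ≡ just (inj₂ (inj₂ (partP i x))) →
               Compatible s (special (letterP i (type i x))) × Compatible (special (letterP i (type i x))) s × side i x ≡ zero
      star-AB : ∀ o s s′ i x → star o s ≡ just (inj₁ (partA i x)) → star o s′ ≡ just (inj₂ (inj₁ (partB i x))) → ⊥
      star-AP : ∀ o s s′ i x → star o s ≡ just (inj₁ (partA i x)) → star o s′ ≡ just (inj₂ (inj₂ (partP i x))) → ⊥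
      star-BP : ∀ o s s′ i x → star o s ≡ just (inj₂ (inj₁ (partB i x))) → star o s′ ≡ just (inj₂ (inj₂ (partP i x))) → ⊥
      star-apart : ∀ o o′ s s′ q → star o s ≡ just q → star o′ s′ ≡ just q → o ≡ o′
      star-freeA : ∀ o → sum (λ k → 𝟙 (is-nothing (star o (A k)))) + extra ≡ s
      star-freeB : ∀ o → sum (λ k → 𝟙 (is-nothing (star o (B k)))) ≡ s
      star-freeC : ∀ o → sum (λ k → 𝟙 (is-nothing (star o (C k)))) ≡ 0
      star-weight : ∀ o → sumSlots (λ z → multiplicity? (star o z)) ≡ 9 * suc n + 2 * extra

  P : Fin n → ℕ
  P p = suc (toℕ p)

  P≤ : ∀ p → P p ≤ n
  P≤ p = FinP.toℕ<n p

  n<μ : n < μ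
  n<μ = ≤-<-trans (m≤m+n n _) 2n<μ

  P<μ : ∀ p → P p < μ
  P<μ p = ≤-<-trans (P≤ p) n<μ

  right<μ : ∀ p → right (P p) < μ
  right<μ p = ≤-<-trans (right-bound (s≤s z≤n) (P≤ p)) 2n<μ

  left<μ : ∀ p → left (P p) < μ
  left<μ p = ≤-<-trans (m≤m+n (left (P p)) (P p)) (right<μ p)

  data Link (p : Fin n) (i : Fin 3) (x : Fin μ) : Fin 3 → Fin μ → Fin 3 → Fin μ → Set where
    pure : ∀ {y} → y ≡ x ⊕ P p → Link p i x i x i y
    upB : ∀ {z} → z ⊕ β i ≡ x ⊕ right (P p) → Link p i x i x (next i) z
    upC : ∀ {y z} → y ≡ x ⊕ P p → z ⊕ β i ≡ y ⊕ left (P p) → Link p i x i y (next i) z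

  P-injective : ∀ {p q} → P p ≡ P q → p ≡ q
  P-injective r = FinP.toℕ-injective (suc-injective r)

  link-unique : ∀ {p i x p′ i′ x′ j y k z j′ y′ k′ z′} → Link p i x j y k z → Link p′ i′ x′ j′ y′ k′ z′ →
    j ≡ j′ → y ≡ y′ → k ≡ k′ → z ≡ z′ → (p , i , x) ≡ (p′ , i′ , x′)
  link-unique {p} {p′ = p′} (pure a) (pure b) refl refl _ refl with P-injective {p} {p′} (⊕-cancel (P<μ p) (P<μ p′) (trans (sym a) b))
  ... | refl = refl
  link-unique {p} {p′ = p′} (upB a) (upB b) refl refl _ refl
    with P-injective {p} {p′} (right-injective (s≤s z≤n) (P≤ p) (s≤s z≤n) (P≤ p′) (⊕-cancel (right<μ p) (right<μ p′) (trans (sym a) b)))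
  ... | refl = refl
  link-unique {p} {p′ = p′} (upC c a) (upC d b) refl refl _ refl
    with P-injective {p} {p′} (left-injective (s≤s z≤n) (P≤ p) (s≤s z≤n) (P≤ p′) (⊕-cancel (left<μ p) (left<μ p′) (trans (sym a) b)))
  ... | refl = cong (λ w → p , _ , w) (⊕-injective (P p) (trans (sym c) d))
  link-unique {p} {p′ = p′} (upB a) (upC d b) refl refl _ refl =
    ⊥-elim (left≢right (s≤s z≤n) (P≤ p′) (s≤s z≤n) (P≤ p) (⊕-cancel (left<μ p′) (right<μ p) (trans (sym b) a)))
  link-unique {p} {p′ = p′} (upC d b) (upB a) refl refl _ refl =
    ⊥-elim (left≢right (s≤s z≤n) (P≤ p) (s≤s z≤n) (P≤ p′) (⊕-cancel (left<μ p) (right<μ p′) (trans (sym b) a)))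
  link-unique (pure _) (upB _) refl _ f _ = ⊥-elim (next≢ _ f)
  link-unique (pure _) (upC _ _) refl _ f _ = ⊥-elim (next≢ _ f)
  link-unique (upB _) (pure _) refl _ f _ = ⊥-elim (next≢ _ (sym f))
  link-unique (upC _ _) (pure _) refl _ f _ = ⊥-elim (next≢ _ (sym f))

  -- Within a layer, two steps of at most n do not add up to μ > 2n; between layers, two steps
  -- upwards do not return because there are three layers.
  link-opposite : ∀ {p i x p′ i′ x′ j y k z j′ y′ k′ z′} → Link p i x j y k z → Link p′ i′ x′ j′ y′ k′ z′ →
    j ≡ k′ → y ≡ z′ → k ≡ j′ → z ≡ y′ → ⊥
  link-opposite {p} {p′ = p′} (pure a) (pure b) refl refl _ refl with ⊕-round a b (P<μ p) (P<μ p′)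
  ... | inj₁ (() , _)
  ... | inj₂ r = lin 4 (λ a b n u → a :≤ n ∷ b :≤ n ∷ a :+ b := u ∷ 2 :* n :< u ∷ [] ⊢ absurd) (P p) (P p′) n μ (P≤ p) (P≤ p′) r 2n<μ
  link-opposite (pure _) (upB _) refl _ f _ = next≢ _ (sym f)
  link-opposite (pure _) (upC _ _) refl _ f _ = next≢ _ (sym f)
  link-opposite (upB _) (pure _) refl _ f _ = next≢ _ (sym f)
  link-opposite (upC _ _) (pure _) refl _ f _ = next≢ _ (sym f)
  link-opposite (upB _) (upB _) refl _ f _ = next-next≢ _ (sym f)
  link-opposite (upB _) (upC _ _) refl _ f _ = next-next≢ _ (sym f)
  link-opposite (upC _ _) (upB _) refl _ f _ = next-next≢ _ (sym f)
  link-opposite (upC _ _) (upC _ _) refl _ f _ = next-next≢ _ (sym f)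

  link-far : ∀ {p i x j y k z} → Link p i x j y k z → Far j y k z → ⊥
  link-far {p} (pure a) (level _ d n<d d< b) = <-irrefl refl (≤-trans n<d (≤-trans (≤-reflexive (⊕-cancel (≤-<-trans (m≤m+n d n) d<) (P<μ p) (trans (sym b) a))) (P≤ p)))
  link-far (pure _) (rise f _ _ _ _) = next≢ _ f
  link-far (pure _) (fall f _ _ _ _) = next≢ _ f
  link-far (upB _) (level f _ _ _ _) = next≢ _ f
  link-far (upC _ _) (level f _ _ _ _) = next≢ _ f
  link-far (upB _) (fall f _ _ _ _) = next-next≢ _ f
  link-far (upC _ _) (fall f _ _ _ _) = next-next≢ _ f
  link-far {p} (upB a) (rise _ m m< free b) = proj₂ (free (P p) (s≤s z≤n) (P≤ p)) (⊕-cancel m< (right<μ p) (trans (sym b) a))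
  link-far {p} (upC _ a) (rise _ m m< free b) = proj₁ (free (P p) (s≤s z≤n) (P≤ p)) (⊕-cancel m< (left<μ p) (trans (sym b) a))

  link-far′ : ∀ {p i x j y k z} → Link p i x j y k z → Far k z j y → ⊥
  link-far′ {p} (pure a) (level _ d n<d d< b) with ⊕-round a b (P<μ p) (≤-<-trans (m≤m+n d n) d<)
  ... | inj₁ (() , _)
  ... | inj₂ r = lin 4 (λ P d n u → P :+ d := u ∷ P :≤ n ∷ d :+ n :< u ∷ [] ⊢ absurd) (P p) d n μ r (P≤ p) d<
  link-far′ (pure _) (rise f _ _ _ _) = next≢ _ f
  link-far′ (pure _) (fall f _ _ _ _) = next≢ _ f
  link-far′ (upB _) (level f _ _ _ _) = next≢ _ (sym f)
  link-far′ (upC _ _) (level f _ _ _ _) = next≢ _ (sym f)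
  link-far′ (upB _) (rise f _ _ _ _) = next-next≢ _ f
  link-far′ (upC _ _) (rise f _ _ _ _) = next-next≢ _ f
  link-far′ {p} (upB a) (fall _ m m< free b) = proj₂ (free (P p) (s≤s z≤n) (P≤ p)) (⊕-cancel m< (right<μ p) (trans (sym b) a))
  link-far′ {p} (upC _ a) (fall _ m m< free b) = proj₁ (free (P p) (s≤s z≤n) (P≤ p)) (⊕-cancel m< (left<μ p) (trans (sym b) a))

  special-compatible : ∀ i j → i ≢ j → Compatible (special i) (special j)
  special-compatible zero zero ne = ⊥-elim (ne refl)
  special-compatible zero (suc zero) ne = AB
  special-compatible zero (suc (suc zero)) ne = AC
  special-compatible (suc zero) zero ne = BA
  special-compatible (suc zero) (suc zero) ne = ⊥-elim (ne refl)
  special-compatible (suc zero) (suc (suc zero)) ne = BC refl z≤n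
  special-compatible (suc (suc zero)) zero ne = CA
  special-compatible (suc (suc zero)) (suc zero) ne = CB refl z≤n
  special-compatible (suc (suc zero)) (suc (suc zero)) ne = ⊥-elim (ne refl)

  data Part : Set where
    isA isB isP : Part

  letter : Part → Fin 3 → Bool → Fin 3
  letter isA i T = i
  letter isB i T = letterB i T
  letter isP i T = letterP i T

  partOf : ∀ i T ℓ → Σ Part λ r → letter r i T ≡ ℓ
  partOf zero T zero = isA , refl
  partOf zero false (suc zero) = isB , refl
  partOf zero true (suc zero) = isP , refl
  partOf zero false (suc (suc zero)) = isP , refl
  partOf zero true (suc (suc zero)) = isB , refl
  partOf (suc zero) false zero = isP , refl
  partOf (suc zero) true zero = isB , refl
  partOf (suc zero) T (suc zero) = isA , refl
  partOf (suc zero) false (suc (suc zero)) = isB , refl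
  partOf (suc zero) true (suc (suc zero)) = isP , refl
  partOf (suc (suc zero)) false zero = isB , refl
  partOf (suc (suc zero)) true zero = isP , refl
  partOf (suc (suc zero)) false (suc zero) = isP , refl
  partOf (suc (suc zero)) true (suc zero) = isB , refl
  partOf (suc (suc zero)) T (suc (suc zero)) = isA , refl

  partWeight : Part → ℕ
  partWeight isP = 2
  partWeight _ = 3

  part-weights : ∀ i T → partWeight (proj₁ (partOf i T zero)) + (partWeight (proj₁ (partOf i T (suc zero))) + partWeight (proj₁ (partOf i T (suc (suc zero))))) ≡ 8
  part-weights zero false = refl
  part-weights zero true = refl
  part-weights (suc zero) false = refl
  part-weights (suc zero) true = refl
  part-weights (suc (suc zero)) false = refl
  part-weights (suc (suc zero)) true = refl

  module Build {extra : ℕ} (S : Special extra) where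

    open Special S

    data Point : Set where
      lev : Fin n → Fin 3 → Fin μ → Point
      pA : Fin sizeA → Point
      pB : Fin sizeB → Point
      pP : Fin sizeP → Point

    data Member : Point → V → Slot′ → Set where
      lB : ∀ {p i x} → Member (lev p i x) (fin i x) (B (suc (p ↑ˡ s)))
      lC : ∀ {p i x y} → y ≡ x ⊕ P p → Member (lev p i x) (fin i y) (C (inject₁ p))
      lA : ∀ {p i x z} → z ⊕ β i ≡ x ⊕ right (P p) → Member (lev p i x) (fin (next i) z) (A (suc (p ↑ˡ s)))
      sA : ∀ {q i x} → partA i x ≡ q → Member (pA q) (fin i x) (special i)
      sB : ∀ {q i x} → partB i x ≡ q → Member (pB q) (fin i x) (special (letterB i (type i x)))
      sP : ∀ {q i x} → partP i x ≡ q → Member (pP q) (fin i x) (special (letterP i (type i x)))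
      iA : ∀ {q o z} → star o z ≡ just (inj₁ q) → Member (pA q) (inf o) z
      iB : ∀ {q o z} → star o z ≡ just (inj₂ (inj₁ q)) → Member (pB q) (inf o) z
      iP : ∀ {q o z} → star o z ≡ just (inj₂ (inj₂ q)) → Member (pP q) (inf o) z

    fin-injective : ∀ {i j x y} → fin i x ≡ fin j y → i ≡ j × x ≡ y
    fin-injective refl = refl , refl

    data Rel : V → V → Point → Set where
      forth : ∀ {p i x j y k z} → Link p i x j y k z → Rel (fin j y) (fin k z) (lev p i x)
      back : ∀ {p i x j y k z} → Link p i x k z j y → Rel (fin j y) (fin k z) (lev p i x)
      relA : ∀ {q i x j y} → partA i x ≡ q → partA j y ≡ q → Rel (fin i x) (fin j y) (pA q)
      relB : ∀ {q i x j y} → partB i x ≡ q → partB j y ≡ q → Rel (fin i x) (fin j y) (pB q)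
      relP : ∀ {q i x j y} → partP i x ≡ q → partP j y ≡ q → Rel (fin i x) (fin j y) (pP q)
      infA : ∀ {q o z i x} → star o z ≡ just (inj₁ q) → partA i x ≡ q → Rel (inf o) (fin i x) (pA q)
      infB : ∀ {q o z i x} → star o z ≡ just (inj₂ (inj₁ q)) → partB i x ≡ q → Rel (inf o) (fin i x) (pB q)
      infP : ∀ {q o z i x} → star o z ≡ just (inj₂ (inj₂ q)) → partP i x ≡ q → Rel (inf o) (fin i x) (pP q)
      finA : ∀ {q o z i x} → star o z ≡ just (inj₁ q) → partA i x ≡ q → Rel (fin i x) (inf o) (pA q)
      finB : ∀ {q o z i x} → star o z ≡ just (inj₂ (inj₁ q)) → partB i x ≡ q → Rel (fin i x) (inf o) (pB q)
      finP : ∀ {q o z i x} → star o z ≡ just (inj₂ (inj₂ q)) → partP i x ≡ q → Rel (fin i x) (inf o) (pP q)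

    apex-C : ∀ {p i x y z} → y ≡ x ⊕ P p → z ⊕ β i ≡ x ⊕ right (P p) → z ⊕ β i ≡ y ⊕ left (P p)
    apex-C {p} {i} {x} {y} {z} c a′ = trans a′ (trans (cong (x ⊕_) (+-comm (left (P p)) (P p))) (trans (sym (⊕-assoc x (P p) (left (P p)))) (cong (_⊕ left (P p)) (sym c))))

    rel : ∀ {p u v z z′} → u ≢ v → Member p u z → Member p v z′ → Rel u v p
    rel ne lB lB = ⊥-elim (ne refl)
    rel ne lB (lC c) = forth (pure c)
    rel ne lB (lA r) = forth (upB r)
    rel ne (lC c) lB = back (pure c)
    rel ne (lC c) (lC d) = ⊥-elim (ne (cong (fin _) (trans c (sym d))))
    rel ne (lC c) (lA r) = forth (upC c (apex-C c r))
    rel ne (lA r) lB = back (upB r)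
    rel ne (lA r) (lC c) = back (upC c (apex-C c r))
    rel {lev p i x} ne (lA r) (lA r′) = ⊥-elim (ne (cong (fin _) (⊕-injective (β i) (trans r (sym r′)))))
    rel ne (sA e₁) (sA e₂) = relA e₁ e₂
    rel ne (sA e₁) (iA e₂) = finA e₂ e₁
    rel ne (iA e₁) (sA e₂) = infA e₁ e₂
    rel ne (iA {o = o} e₁) (iA {o = o′} e₂) = ⊥-elim (ne (cong inf (star-apart o o′ _ _ _ e₁ e₂)))
    rel ne (sB e₁) (sB e₂) = relB e₁ e₂
    rel ne (sB e₁) (iB e₂) = finB e₂ e₁
    rel ne (iB e₁) (sB e₂) = infB e₁ e₂
    rel ne (iB {o = o} e₁) (iB {o = o′} e₂) = ⊥-elim (ne (cong inf (star-apart o o′ _ _ _ e₁ e₂)))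
    rel ne (sP e₁) (sP e₂) = relP e₁ e₂
    rel ne (sP e₁) (iP e₂) = finP e₂ e₁
    rel ne (iP e₁) (sP e₂) = infP e₁ e₂
    rel ne (iP {o = o} e₁) (iP {o = o′} e₂) = ⊥-elim (ne (cong inf (star-apart o o′ _ _ _ e₁ e₂)))

    Distinct : Fin 3 → Fin μ → Fin 3 → Fin μ → Set
    Distinct i x j y = (i , x) ≈ (j , y) → ⊥

    farA : ∀ {q} i x j y → Distinct i x j y → partA i x ≡ q → partA j y ≡ q → Far i x j y
    farA i x j y ne e₁ e₂ with same-A i x j y (trans e₁ (sym e₂))
    ... | inj₁ r = ⊥-elim (ne r)
    ... | inj₂ (_ , f) = f

    farB : ∀ {q} i x j y → Distinct i x j y → partB i x ≡ q → partB j y ≡ q → Far i x j y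
    farB i x j y ne e₁ e₂ with same-B i x j y (trans e₁ (sym e₂))
    ... | inj₁ r = ⊥-elim (ne r)
    ... | inj₂ (_ , f) = f

    farP : ∀ {q} i x j y → Distinct i x j y → partP i x ≡ q → partP j y ≡ q → Far i x j y
    farP i x j y ne e₁ e₂ with same-P i x j y (trans e₁ (sym e₂))
    ... | inj₁ r = ⊥-elim (ne r)
    ... | inj₂ (_ , f) = f

    level-index : ∀ {p i x p′ i′ x′} → (p , i , x) ≡ (p′ , i′ , x′) → lev p i x ≡ lev p′ i′ x′
    level-index refl = refl

    distinct : ∀ {i x j y} → fin i x ≢ fin j y → Distinct i x j y
    distinct ne (r , t) = ne (cong₂ fin r t)

    unique : ∀ {u v p q} → u ≢ v → Rel u v p → Rel u v q → p ≡ q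
    unique ne (forth l) (forth l′) = level-index (link-unique l l′ refl refl refl refl)
    unique ne (back l) (back l′) = level-index (link-unique l l′ refl refl refl refl)
    unique ne (forth l) (back l′) = ⊥-elim (link-opposite l l′ refl refl refl refl)
    unique ne (back l) (forth l′) = ⊥-elim (link-opposite l l′ refl refl refl refl)
    unique ne (forth l) (relA e₁ e₂) = ⊥-elim (link-far l (farA _ _ _ _ (distinct ne) e₁ e₂))
    unique ne (forth l) (relB e₁ e₂) = ⊥-elim (link-far l (farB _ _ _ _ (distinct ne) e₁ e₂))
    unique ne (forth l) (relP e₁ e₂) = ⊥-elim (link-far l (farP _ _ _ _ (distinct ne) e₁ e₂))
    unique ne (back l) (relA e₁ e₂) = ⊥-elim (link-far′ l (farA _ _ _ _ (distinct ne) e₁ e₂))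
    unique ne (back l) (relB e₁ e₂) = ⊥-elim (link-far′ l (farB _ _ _ _ (distinct ne) e₁ e₂))
    unique ne (back l) (relP e₁ e₂) = ⊥-elim (link-far′ l (farP _ _ _ _ (distinct ne) e₁ e₂))
    unique ne (relA e₁ e₂) (forth l) = ⊥-elim (link-far l (farA _ _ _ _ (distinct ne) e₁ e₂))
    unique ne (relB e₁ e₂) (forth l) = ⊥-elim (link-far l (farB _ _ _ _ (distinct ne) e₁ e₂))
    unique ne (relP e₁ e₂) (forth l) = ⊥-elim (link-far l (farP _ _ _ _ (distinct ne) e₁ e₂))
    unique ne (relA e₁ e₂) (back l) = ⊥-elim (link-far′ l (farA _ _ _ _ (distinct ne) e₁ e₂))
    unique ne (relB e₁ e₂) (back l) = ⊥-elim (link-far′ l (farB _ _ _ _ (distinct ne) e₁ e₂))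
    unique ne (relP e₁ e₂) (back l) = ⊥-elim (link-far′ l (farP _ _ _ _ (distinct ne) e₁ e₂))
    unique ne (relA e₁ e₂) (relA e₃ e₄) = cong pA (trans (sym e₁) e₃)
    unique ne (relB e₁ e₂) (relB e₃ e₄) = cong pB (trans (sym e₁) e₃)
    unique ne (relP e₁ e₂) (relP e₃ e₄) = cong pP (trans (sym e₁) e₃)
    unique ne (relA e₁ e₂) (relB e₃ e₄) = ⊥-elim (distinct ne (once-AB _ _ _ _ (trans e₁ (sym e₂)) (trans e₃ (sym e₄))))
    unique ne (relB e₃ e₄) (relA e₁ e₂) = ⊥-elim (distinct ne (once-AB _ _ _ _ (trans e₁ (sym e₂)) (trans e₃ (sym e₄))))
    unique ne (relA e₁ e₂) (relP e₃ e₄) = ⊥-elim (distinct ne (once-AP _ _ _ _ (trans e₁ (sym e₂)) (trans e₃ (sym e₄))))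
    unique ne (relP e₃ e₄) (relA e₁ e₂) = ⊥-elim (distinct ne (once-AP _ _ _ _ (trans e₁ (sym e₂)) (trans e₃ (sym e₄))))
    unique ne (relB e₁ e₂) (relP e₃ e₄) = ⊥-elim (distinct ne (once-BP _ _ _ _ (trans e₁ (sym e₂)) (trans e₃ (sym e₄))))
    unique ne (relP e₃ e₄) (relB e₁ e₂) = ⊥-elim (distinct ne (once-BP _ _ _ _ (trans e₁ (sym e₂)) (trans e₃ (sym e₄))))
    unique ne (infA r₁ e₁) (infA r₂ e₂) = cong pA (trans (sym e₁) e₂)
    unique ne (infB r₁ e₁) (infB r₂ e₂) = cong pB (trans (sym e₁) e₂)
    unique ne (infP r₁ e₁) (infP r₂ e₂) = cong pP (trans (sym e₁) e₂)
    unique ne (infA r₁ refl) (infB r₂ refl) = ⊥-elim (star-AB _ _ _ _ _ r₁ r₂)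
    unique ne (infB r₂ refl) (infA r₁ refl) = ⊥-elim (star-AB _ _ _ _ _ r₁ r₂)
    unique ne (infA r₁ refl) (infP r₂ refl) = ⊥-elim (star-AP _ _ _ _ _ r₁ r₂)
    unique ne (infP r₂ refl) (infA r₁ refl) = ⊥-elim (star-AP _ _ _ _ _ r₁ r₂)
    unique ne (infB r₁ refl) (infP r₂ refl) = ⊥-elim (star-BP _ _ _ _ _ r₁ r₂)
    unique ne (infP r₂ refl) (infB r₁ refl) = ⊥-elim (star-BP _ _ _ _ _ r₁ r₂)
    unique ne (finA r₁ e₁) (finA r₂ e₂) = cong pA (trans (sym e₁) e₂)
    unique ne (finB r₁ e₁) (finB r₂ e₂) = cong pB (trans (sym e₁) e₂)
    unique ne (finP r₁ e₁) (finP r₂ e₂) = cong pP (trans (sym e₁) e₂)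
    unique ne (finA r₁ refl) (finB r₂ refl) = ⊥-elim (star-AB _ _ _ _ _ r₁ r₂)
    unique ne (finB r₂ refl) (finA r₁ refl) = ⊥-elim (star-AB _ _ _ _ _ r₁ r₂)
    unique ne (finA r₁ refl) (finP r₂ refl) = ⊥-elim (star-AP _ _ _ _ _ r₁ r₂)
    unique ne (finP r₂ refl) (finA r₁ refl) = ⊥-elim (star-AP _ _ _ _ _ r₁ r₂)
    unique ne (finB r₁ refl) (finP r₂ refl) = ⊥-elim (star-BP _ _ _ _ _ r₁ r₂)
    unique ne (finP r₂ refl) (finB r₁ refl) = ⊥-elim (star-BP _ _ _ _ _ r₁ r₂)

    Slots≈ : V → V → Slot′ → Slot′ → Set
    Slots≈ u v z z′ = (u ≡ v → z ≡ z′) × (u ≢ v → Compatible z z′)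

    apart : ∀ {u v z z′} → u ≢ v → Compatible z z′ → Slots≈ u v z z′
    apart ne c = (λ r → ⊥-elim (ne r)) , λ _ → c

    alike : ∀ {u v z z′} → u ≡ v → z ≡ z′ → Slots≈ u v z z′
    alike r t = (λ _ → t) , λ ne → ⊥-elim (ne r)

    pure≢ : ∀ {p i x y} → y ≡ x ⊕ P p → fin i x ≢ fin i y
    pure≢ {p} c r = case ⊕-loop (trans (sym c) (sym (proj₂ (fin-injective r)))) (P<μ p) of λ ()

    layer≢ : ∀ {i x y} → fin i x ≢ fin (next i) y
    layer≢ r = next≢ _ (proj₁ (fin-injective r))

    low : ∀ (p : Fin n) → toℕ (p ↑ˡ s) ≤ toℕ (inject₁ p)
    low p = ≤-reflexive (trans (FinP.toℕ-↑ˡ p s) (sym (FinP.toℕ-inject₁ p)))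

    same-slot : ∀ {i j x y} (f : Fin 3 → Fin μ → Fin 3) → (i , x) ≈ (j , y) → special (f i x) ≡ special (f j y)
    same-slot f (refl , refl) = refl

    slots : ∀ {p u v z z′} → Member p u z → Member p v z′ → Slots≈ u v z z′
    slots lB lB = alike refl refl
    slots (lB {p}) (lC c) = apart (pure≢ c) (BC refl (s≤s (low p)))
    slots lB (lA r) = apart layer≢ BA
    slots (lC {p} c) lB = apart (pure≢ c ∘ sym) (CB refl (s≤s (low p)))
    slots (lC c) (lC d) = alike (cong (fin _) (trans c (sym d))) refl
    slots (lC c) (lA r) = apart layer≢ CA
    slots (lA r) lB = apart (layer≢ ∘ sym) AB
    slots (lA r) (lC c) = apart (layer≢ ∘ sym) AC
    slots {lev p i x} (lA r) (lA r′) = alike (cong (fin _) (⊕-injective (β i) (trans r (sym r′)))) refl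
    slots (sA {i = i} {x} e₁) (sA {i = j} {y} e₂) with same-A i x j y (trans e₁ (sym e₂))
    ... | inj₁ r = alike (cong₂ fin (proj₁ r) (proj₂ r)) (same-slot (λ i _ → i) r)
    ... | inj₂ (ne , _) = apart (ne ∘ proj₁ ∘ fin-injective) (special-compatible i j ne)
    slots (sA {i = i} {x} refl) (iA {o = o} {z} r) = apart (λ ()) (proj₂ (star-A o z i x r))
    slots (iA {o = o} {z} r) (sA {i = i} {x} refl) = apart (λ ()) (proj₁ (star-A o z i x r))
    slots (iA {o = o} r) (iA {o = o′} r′) with star-apart o o′ _ _ _ r r′
    ... | refl = alike refl (star-injective o _ _ _ r r′)
    slots (sB {i = i} {x} e₁) (sB {i = j} {y} e₂) with same-B i x j y (trans e₁ (sym e₂))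
    ... | inj₁ r = alike (cong₂ fin (proj₁ r) (proj₂ r)) (same-slot (λ i x → letterB i (type i x)) r)
    ... | inj₂ (ne , _) = apart (λ r → ne (cong₂ (λ i x → letterB i (type i x)) (proj₁ (fin-injective r)) (proj₂ (fin-injective r)))) (special-compatible _ _ ne)
    slots (sB {i = i} {x} refl) (iB {o = o} {z} r) = apart (λ ()) (proj₂ (star-B o z i x r))
    slots (iB {o = o} {z} r) (sB {i = i} {x} refl) = apart (λ ()) (proj₁ (star-B o z i x r))
    slots (iB {o = o} r) (iB {o = o′} r′) with star-apart o o′ _ _ _ r r′
    ... | refl = alike refl (star-injective o _ _ _ r r′)
    slots (sP {i = i} {x} e₁) (sP {i = j} {y} e₂) with same-P i x j y (trans e₁ (sym e₂))
    ... | inj₁ r = alike (cong₂ fin (proj₁ r) (proj₂ r)) (same-slot (λ i x → letterP i (type i x)) r)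
    ... | inj₂ (ne , _) = apart (λ r → ne (cong₂ (λ i x → letterP i (type i x)) (proj₁ (fin-injective r)) (proj₂ (fin-injective r)))) (special-compatible _ _ ne)
    slots (sP {i = i} {x} refl) (iP {o = o} {z} r) = apart (λ ()) (proj₁ (proj₂ (star-P o z i x r)))
    slots (iP {o = o} {z} r) (sP {i = i} {x} refl) = apart (λ ()) (proj₁ (star-P o z i x r))
    slots (iP {o = o} r) (iP {o = o′} r′) with star-apart o o′ _ _ _ r r′
    ... | refl = alike refl (star-injective o _ _ _ r r′)

    At : V → Slot′ → Set
    At v z = Σ Point λ p → Member p v z

    specialPoint : ∀ i x ℓ → At (fin i x) (special ℓ)
    specialPoint i x ℓ with partOf i (type i x) ℓ
    ... | isA , refl = pA (partA i x) , sA refl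
    ... | isB , refl = pB (partB i x) , sB refl
    ... | isP , refl = pP (partP i x) , sP refl

    apexPoint : ∀ i x p → At (fin i x) (A (suc (p ↑ˡ s)))
    apexPoint i x p with prev i | next-prev i
    ... | j | refl = lev p j (x ⊕ β j ⊕ (μ ∸ right (P p))) , lA (sym (⊖-⊕ (x ⊕ β j) (<⇒≤ (right<μ p))))

    headPoint : ∀ i x p → At (fin i x) (C (inject₁ p))
    headPoint i x p = lev p i (x ⊕ (μ ∸ P p)) , lC (sym (⊖-⊕ x (<⇒≤ (P<μ p))))

    laterA : ∀ i x {k} (r : Fin n ⊎ Fin s) → join n s r ≡ k → Maybe (At (fin i x) (A (suc k)))
    laterA i x (inj₁ p) refl = just (apexPoint i x p)
    laterA i x (inj₂ _) _ = nothing

    laterB : ∀ i x {k} (r : Fin n ⊎ Fin s) → join n s r ≡ k → Maybe (At (fin i x) (B (suc k)))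
    laterB i x (inj₁ p) refl = just (lev p i x , lB)
    laterB i x (inj₂ _) _ = nothing

    pointC : ∀ i x k → At (fin i x) (C k)
    pointC i x k with top k
    ... | ‵fromℕ = specialPoint i x (suc (suc zero))
    ... | ‵inject₁ p = headPoint i x p

    toPoint : Fin sizeA ⊎ (Fin sizeB ⊎ Fin sizeP) → Point
    toPoint (inj₁ q) = pA q
    toPoint (inj₂ (inj₁ q)) = pB q
    toPoint (inj₂ (inj₂ q)) = pP q

    starMember : ∀ o z q → star o z ≡ just q → Member (toPoint q) (inf o) z
    starMember o z (inj₁ q) r = iA r
    starMember o z (inj₂ (inj₁ q)) r = iB r
    starMember o z (inj₂ (inj₂ q)) r = iP r

    starPoint : ∀ o z m → star o z ≡ m → Maybe (At (inf o) z)
    starPoint o z nothing r = nothing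
    starPoint o z (just q) r = just (toPoint q , starMember o z q r)

    point : ∀ v z → Maybe (At v z)
    point (fin i x) (A zero) = just (specialPoint i x zero)
    point (fin i x) (A (suc k)) = laterA i x (splitAt n k) (FinP.join-splitAt n s k)
    point (fin i x) (B zero) = just (specialPoint i x (suc zero))
    point (fin i x) (B (suc k)) = laterB i x (splitAt n k) (FinP.join-splitAt n s k)
    point (fin i x) (C k) = just (pointC i x k)
    point (inf o) z = starPoint o z (star o z) refl

    levels N M : ℕ
    levels = n * (3 * μ)
    N = levels + (sizeA + (sizeB + sizeP))
    M = 3 * μ + e

    encode : Point → Fin N
    encode (lev p i x) = combine p (combine i x) ↑ˡ _
    encode (pA q) = levels ↑ʳ (q ↑ˡ _)
    encode (pB q) = levels ↑ʳ (sizeA ↑ʳ (q ↑ˡ _))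
    encode (pP q) = levels ↑ʳ (sizeA ↑ʳ (sizeB ↑ʳ q))

    encode-injective : ∀ p q → encode p ≡ encode q → p ≡ q
    encode-injective (lev p i x) (lev p′ i′ x′) r
      with FinP.combine-injective p (combine i x) p′ (combine i′ x′) (FinP.↑ˡ-injective _ _ _ r)
    ... | refl , r′ with FinP.combine-injective i x i′ x′ r′
    ...   | refl , refl = refl
    encode-injective (pA q) (pA q′) r = cong pA (FinP.↑ˡ-injective _ _ _ (FinP.↑ʳ-injective levels _ _ r))
    encode-injective (pB q) (pB q′) r = cong pB (FinP.↑ˡ-injective _ _ _ (FinP.↑ʳ-injective sizeA _ _ (FinP.↑ʳ-injective levels _ _ r)))
    encode-injective (pP q) (pP q′) r = cong pP (FinP.↑ʳ-injective sizeB _ _ (FinP.↑ʳ-injective sizeA _ _ (FinP.↑ʳ-injective levels _ _ r)))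
    encode-injective (lev _ _ _) (pA _) r = ⊥-elim (↑-apart r)
    encode-injective (lev _ _ _) (pB _) r = ⊥-elim (↑-apart r)
    encode-injective (lev _ _ _) (pP _) r = ⊥-elim (↑-apart r)
    encode-injective (pA _) (lev _ _ _) r = ⊥-elim (↑-apart (sym r))
    encode-injective (pB _) (lev _ _ _) r = ⊥-elim (↑-apart (sym r))
    encode-injective (pP _) (lev _ _ _) r = ⊥-elim (↑-apart (sym r))
    encode-injective (pA _) (pB _) r = ⊥-elim (↑-apart (FinP.↑ʳ-injective levels _ _ r))
    encode-injective (pA _) (pP _) r = ⊥-elim (↑-apart (FinP.↑ʳ-injective levels _ _ r))
    encode-injective (pB _) (pA _) r = ⊥-elim (↑-apart (sym (FinP.↑ʳ-injective levels _ _ r)))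
    encode-injective (pP _) (pA _) r = ⊥-elim (↑-apart (sym (FinP.↑ʳ-injective levels _ _ r)))
    encode-injective (pB _) (pP _) r = ⊥-elim (↑-apart (FinP.↑ʳ-injective sizeA _ _ (FinP.↑ʳ-injective levels _ _ r)))
    encode-injective (pP _) (pB _) r = ⊥-elim (↑-apart (sym (FinP.↑ʳ-injective sizeA _ _ (FinP.↑ʳ-injective levels _ _ r))))

    decodeP : Fin sizeB ⊎ Fin sizeP → Point
    decodeP (inj₁ q) = pB q
    decodeP (inj₂ q) = pP q

    decodeA : Fin sizeA ⊎ Fin (sizeB + sizeP) → Point
    decodeA (inj₁ q) = pA q
    decodeA (inj₂ q) = decodeP (splitAt sizeB q)

    decodeL : Fin levels ⊎ Fin (sizeA + (sizeB + sizeP)) → Point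
    decodeL (inj₁ k) = lev (proj₁ (remQuot {n} (3 * μ) k)) (proj₁ (remQuot {3} μ (proj₂ (remQuot {n} (3 * μ) k)))) (proj₂ (remQuot {3} μ (proj₂ (remQuot {n} (3 * μ) k))))
    decodeL (inj₂ k) = decodeA (splitAt sizeA k)

    decode : Fin N → Point
    decode k = decodeL (splitAt levels k)

    encode-decode : ∀ k → encode (decode k) ≡ k
    encode-decode k with splitAt levels k in eq
    ... | inj₁ j = trans (cong (_↑ˡ _) (trans (cong (combine (proj₁ (remQuot {n} (3 * μ) j))) (FinP.combine-remQuot {3} μ (proj₂ (remQuot {n} (3 * μ) j))))
            (FinP.combine-remQuot {n} (3 * μ) j))) (FinP.splitAt⁻¹-↑ˡ eq)
    ... | inj₂ j with splitAt sizeA j in eq′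
    ...   | inj₁ q = trans (cong (levels ↑ʳ_) (FinP.splitAt⁻¹-↑ˡ eq′)) (FinP.splitAt⁻¹-↑ʳ eq)
    ...   | inj₂ l with splitAt sizeB l in eq″
    ...     | inj₁ q = trans (cong (levels ↑ʳ_) (trans (cong (sizeA ↑ʳ_) (FinP.splitAt⁻¹-↑ˡ eq″)) (FinP.splitAt⁻¹-↑ʳ eq′))) (FinP.splitAt⁻¹-↑ʳ eq)
    ...     | inj₂ q = trans (cong (levels ↑ʳ_) (trans (cong (sizeA ↑ʳ_) (FinP.splitAt⁻¹-↑ʳ eq″)) (FinP.splitAt⁻¹-↑ʳ eq′))) (FinP.splitAt⁻¹-↑ʳ eq)

    decode-encode : ∀ p → decode (encode p) ≡ p
    decode-encode p = encode-injective _ _ (encode-decode (encode p))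

    -- The intended sizes. They are checked as upper bounds by `small3` and `small2`, and the
    -- hypothesis `count` then makes them exact through `complete-leave`.
    pointWeight : Point → ℕ
    pointWeight (pP _) = 2
    pointWeight _ = 3

    cap : Fin N → ℕ
    cap k = pointWeight (decode k)

    cap-encode : ∀ p → cap (encode p) ≡ pointWeight p
    cap-encode p = cong pointWeight (decode-encode p)

    cap-sum : sum cap ≡ levels * 3 + (sizeA * 3 + (sizeB * 3 + sizeP * 2))
    cap-sum = trans (sum-splitAt levels cap) (cong₂ _+_ (sum-all 3 h)
      (trans (sum-splitAt sizeA (cap ∘ (levels ↑ʳ_))) (cong₂ _+_ (sum-all 3 (cap-encode ∘ pA))
        (trans (sum-splitAt sizeB (cap ∘ (levels ↑ʳ_) ∘ (sizeA ↑ʳ_))) (cong₂ _+_ (sum-all 3 (cap-encode ∘ pB)) (sum-all 2 (cap-encode ∘ pP)))))))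
      where
      h : ∀ (j : Fin levels) → cap (j ↑ˡ _) ≡ 3
      h j rewrite FinP.splitAt-↑ˡ levels j (sizeA + (sizeB + sizeP)) = refl

    toV′ : Fin (3 * μ) ⊎ Fin e → V
    toV′ (inj₁ k) = fin (proj₁ (remQuot {3} μ k)) (proj₂ (remQuot {3} μ k))
    toV′ (inj₂ o) = inf o

    toV : Fin M → V
    toV k = toV′ (splitAt (3 * μ) k)

    fromV : V → Fin M
    fromV (fin i x) = combine i x ↑ˡ e
    fromV (inf o) = 3 * μ ↑ʳ o

    fromV-toV : ∀ k → fromV (toV k) ≡ k
    fromV-toV k with splitAt (3 * μ) k in eq
    ... | inj₁ j = trans (cong (_↑ˡ e) (FinP.combine-remQuot {3} μ j)) (FinP.splitAt⁻¹-↑ˡ eq)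
    ... | inj₂ o = FinP.splitAt⁻¹-↑ʳ eq

    toV-injective : ∀ {u v} → toV u ≡ toV v → u ≡ v
    toV-injective {u} {v} r = trans (sym (fromV-toV u)) (trans (cong fromV r) (fromV-toV v))

    sum-V : ∀ (f : V → ℕ) b c → (∀ i x → f (fin i x) ≡ b) → (∀ o → f (inf o) ≡ c) → sum (λ k → f (toV k)) ≡ 3 * μ * b + e * c
    sum-V f b c hf hi = trans (sum-splitAt (3 * μ) (f ∘ toV)) (cong₂ _+_ (sum-all b l) (sum-all c r))
      where
      l : ∀ k → f (toV (k ↑ˡ e)) ≡ b
      l k rewrite FinP.splitAt-↑ˡ (3 * μ) k e = hf _ _
      r : ∀ o → f (toV (3 * μ ↑ʳ o)) ≡ c
      r o rewrite FinP.splitAt-↑ʳ (3 * μ) e o = hi o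

    pt : Fin M → Slot′ → Maybe (Fin N)
    pt v z = Maybe.map (encode ∘ proj₁) (point (toV v) z)

    pt-at : ∀ v z {k} → pt v z ≡ just k → Member (decode k) (toV v) z
    pt-at v z r with point (toV v) z
    pt-at v z refl | just (p , m) = subst (λ q → Member q (toV v) z) (sym (decode-encode p)) m

    letterOf : Slot′ → Fin 3
    letterOf (A _) = zero
    letterOf (B _) = suc zero
    letterOf (C _) = suc (suc zero)

    letters-differ : ∀ {z z′} → Compatible z z′ → letterOf z ≢ letterOf z′
    letters-differ AB ()
    letters-differ BA ()
    letters-differ AC ()
    letters-differ CA ()
    letters-differ (BC _ _) ()
    letters-differ (CB _ _) ()

    sideV : V → Fin 2
    sideV (fin i x) = side i x
    sideV (inf o) = suc zero

    pair-side : ∀ {q u v z z′} → Member (pP q) u z → Member (pP q) v z′ → sideV u ≡ sideV v → u ≡ v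
    pair-side (sP {i = i} {x} r) (sP {i = j} {y} r′) t with two-P i x j y (trans r (sym r′)) t
    ... | refl , refl = refl
    pair-side (sP {i = i} {x} refl) (iP {o = o} {z} r) t = case trans (sym t) (proj₂ (proj₂ (star-P o z i x r))) of λ ()
    pair-side (iP {o = o} {z} r) (sP {i = i} {x} refl) t = case trans t (proj₂ (proj₂ (star-P o z i x r))) of λ ()
    pair-side (iP {o = o} r) (iP {o = o′} r′) t = cong inf (star-apart o o′ _ _ _ r r′)

    weightAt : ∀ {v z} → Maybe (At v z) → ℕ
    weightAt nothing = 0
    weightAt (just (p , _)) = pointWeight p

    beyond : Fin n ⊎ Fin s → ℕ
    beyond (inj₁ _) = 0
    beyond (inj₂ _) = 1

    sum-beyond : sum (λ k → beyond (splitAt n k)) ≡ s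
    sum-beyond = trans (sum-splitAt n (λ k → beyond (splitAt n {s} k))) (trans (cong₂ _+_ (sum-0 l) (sum-all 1 r)) (*-identityʳ s))
      where
      l : ∀ (p : Fin n) → beyond (splitAt n (p ↑ˡ s)) ≡ 0
      l p rewrite FinP.splitAt-↑ˡ n p s = refl
      r : ∀ (k : Fin s) → beyond (splitAt n (n ↑ʳ k)) ≡ 1
      r k rewrite FinP.splitAt-↑ʳ n s k = refl

    within : Fin n ⊎ Fin s → ℕ
    within (inj₁ _) = 3
    within (inj₂ _) = 0

    sum-within : sum (λ k → within (splitAt n k)) ≡ n * 3
    sum-within = trans (sum-splitAt n (λ k → within (splitAt n {s} k))) (trans (cong₂ _+_ (sum-all 3 l) (sum-0 r)) (+-identityʳ (n * 3)))
      where
      l : ∀ (p : Fin n) → within (splitAt n (p ↑ˡ s)) ≡ 3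
      l p rewrite FinP.splitAt-↑ˡ n p s = refl
      r : ∀ (k : Fin s) → within (splitAt n (n ↑ʳ k)) ≡ 0
      r k rewrite FinP.splitAt-↑ʳ n s k = refl

    isN : ∀ {X : Set} → Maybe X → ℕ
    isN m = 𝟙 (is-nothing m)

    isN-map : ∀ {X Y : Set} (f : X → Y) m → isN (Maybe.map f m) ≡ isN m
    isN-map f nothing = refl
    isN-map f (just _) = refl

    laterA-free : ∀ i x {k} r (t : join n s r ≡ k) → isN (laterA i x r t) ≡ beyond r
    laterA-free i x (inj₁ p) refl = refl
    laterA-free i x (inj₂ _) _ = refl

    laterB-free : ∀ i x {k} r (t : join n s r ≡ k) → isN (laterB i x r t) ≡ beyond r
    laterB-free i x (inj₁ p) refl = refl
    laterB-free i x (inj₂ _) _ = refl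

    apexPoint-weight : ∀ i x p → pointWeight (proj₁ (apexPoint i x p)) ≡ 3
    apexPoint-weight i x p with prev i | next-prev i
    ... | j | refl = refl

    laterA-weight : ∀ i x {k} r (t : join n s r ≡ k) → weightAt (laterA i x r t) ≡ within r
    laterA-weight i x (inj₁ p) refl = apexPoint-weight i x p
    laterA-weight i x (inj₂ _) _ = refl

    laterB-weight : ∀ i x {k} r (t : join n s r ≡ k) → weightAt (laterB i x r t) ≡ within r
    laterB-weight i x (inj₁ p) refl = refl
    laterB-weight i x (inj₂ _) _ = refl

    starPoint-free : ∀ o z m r → isN (starPoint o z m r) ≡ isN m
    starPoint-free o z nothing r = refl
    starPoint-free o z (just q) r = refl

    starPoint-weight : ∀ o z m r → weightAt (starPoint o z m r) ≡ multiplicity? m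
    starPoint-weight o z nothing r = refl
    starPoint-weight o z (just (inj₁ q)) r = refl
    starPoint-weight o z (just (inj₂ (inj₁ q))) r = refl
    starPoint-weight o z (just (inj₂ (inj₂ q))) r = refl

    specialPoint-weight : ∀ i x ℓ → pointWeight (proj₁ (specialPoint i x ℓ)) ≡ partWeight (proj₁ (partOf i (type i x) ℓ))
    specialPoint-weight i x ℓ with partOf i (type i x) ℓ
    ... | isA , refl = refl
    ... | isB , refl = refl
    ... | isP , refl = refl

    pointC-fromℕ : ∀ i x → pointWeight (proj₁ (pointC i x (fromℕ n))) ≡ pointWeight (proj₁ (specialPoint i x (suc (suc zero))))
    pointC-fromℕ i x rewrite TopP.view-fromℕ n = refl

    pointC-inject₁ : ∀ i x p → pointWeight (proj₁ (pointC i x (inject₁ p))) ≡ 3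
    pointC-inject₁ i x p rewrite TopP.view-inject₁ p = refl

    -- Each of the n levels puts three triples at a vertex, of weight 3 each; the special level adds
    -- 3 + 3 + 2.
    fin-weight : ∀ i x → sumSlots {a} {a} {suc n} (λ z → weightAt (point (fin i x) z)) ≡ 9 * n + 8
    fin-weight i x = trans (cong₂ _+_ (cong₂ _+_ (specialPoint-weight i x zero) (trans (sum-cong-≗ λ k → laterA-weight i x (splitAt n k) (FinP.join-splitAt n s k)) sum-within))
      (cong₂ _+_ (cong₂ _+_ (specialPoint-weight i x (suc zero)) (trans (sum-cong-≗ λ k → laterB-weight i x (splitAt n k) (FinP.join-splitAt n s k)) sum-within))
        (trans (sum-last n (λ k → pointWeight (proj₁ (pointC i x k))) 3 (pointC-inject₁ i x))
          (cong (n * 3 +_) (trans (pointC-fromℕ i x) (specialPoint-weight i x (suc (suc zero))))))))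
      (lin 5 (λ u v w q n → u :+ (v :+ w) := K 8 ∷ q := 3 :* n ∷ [] ⊢ u :+ q :+ (v :+ q :+ (q :+ w)) := 9 :* n :+ K 8)
        (pw zero) (pw (suc zero)) (pw (suc (suc zero))) (n * 3) n (part-weights i (type i x)) (*-comm n 3))
      where
      pw : Fin 3 → ℕ
      pw ℓ = partWeight (proj₁ (partOf i (type i x) ℓ))

    module _ {m} (w : Vec ℕ (2 + m)) (sorted : Sorted w) (main : Vec.head w ≡ a) (total : a + (a + suc n) ≡ Vec.sum w)
      (count : levels * 3 + (sizeA * 3 + (sizeB * 3 + sizeP * 2)) ≡ 3 * μ * (3 * suc n) + e * (3 * suc n + extra))
      (vertices : M ≡ 6 * suc n + 2 * s) (extra≤1 : extra ≤ 1) (1≤s : 1 ≤ s) where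

      columns : ∀ {l} → 2 * N + 6 * (μ * s) + e * (2 * s + 1) ≤ 2 * l + e * extra → Columns w M l
      columns {l} room = complete-leave w colours cap small total-cap d counts dMain dOther room-bound
        where
        inj : ∀ v z z′ k → pt v z ≡ just k → pt v z′ ≡ just k → z ≡ z′
        inj v z z′ k r t = proj₁ (slots (pt-at v z r) (pt-at v z′ t)) refl
        compatible : ∀ u v z z′ k → u ≢ v → pt u z ≡ just k → pt v z′ ≡ just k → Compatible z z′
        compatible u v z z′ k ne r t = proj₂ (slots (pt-at u z r) (pt-at v z′ t)) (ne ∘ toV-injective)
        linear : ∀ u v z₁ z₁′ z₂ z₂′ k k′ → u ≢ v → pt u z₁ ≡ just k → pt v z₁′ ≡ just k → pt u z₂ ≡ just k′ → pt v z₂′ ≡ just k′ → k ≡ k′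
        linear u v z₁ z₁′ z₂ z₂′ k k′ ne p q r t = trans (sym (encode-decode k)) (trans (cong encode (unique (ne ∘ toV-injective)
            (rel (ne ∘ toV-injective) (pt-at u z₁ p) (pt-at v z₁′ q)) (rel (ne ∘ toV-injective) (pt-at u z₂ r) (pt-at v z₂′ t)))) (encode-decode k′))
        open Scheme w sorted main ≤-refl total pt inj compatible linear

        fA fB fC : V → ℕ
        fA v = sum (λ k → isN (point v (A k)))
        fB v = sum (λ k → isN (point v (B k)))
        fC v = sum (λ k → isN (point v (C k)))

        freeA-V : ∀ v → freeA v ≡ fA (toV v)
        freeA-V v = sum-cong-≗ λ k → isN-map (encode ∘ proj₁) (point (toV v) (A k))
        freeB-V : ∀ v → freeB v ≡ fB (toV v)
        freeB-V v = sum-cong-≗ λ k → isN-map (encode ∘ proj₁) (point (toV v) (B k))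
        freeC-V : ∀ v → freeC v ≡ fC (toV v)
        freeC-V v = sum-cong-≗ λ k → isN-map (encode ∘ proj₁) (point (toV v) (C k))

        fA-fin : ∀ i x → fA (fin i x) ≡ s
        fA-fin i x = trans (sum-cong-≗ λ k → laterA-free i x (splitAt n k) (FinP.join-splitAt n s k)) sum-beyond
        fB-fin : ∀ i x → fB (fin i x) ≡ s
        fB-fin i x = trans (sum-cong-≗ λ k → laterB-free i x (splitAt n k) (FinP.join-splitAt n s k)) sum-beyond
        fC-fin : ∀ i x → fC (fin i x) ≡ 0
        fC-fin i x = sum-0 {suc n} λ _ → refl
        fA-inf : ∀ o → fA (inf o) + extra ≡ s
        fA-inf o = trans (cong (_+ extra) (sum-cong-≗ λ k → starPoint-free o (A k) (star o (A k)) refl)) (star-freeA o)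
        fB-inf : ∀ o → fB (inf o) ≡ s
        fB-inf o = trans (sum-cong-≗ λ k → starPoint-free o (B k) (star o (B k)) refl) (star-freeB o)
        fC-inf : ∀ o → fC (inf o) ≡ 0
        fC-inf o = trans (sum-cong-≗ λ k → starPoint-free o (C k) (star o (C k)) refl) (star-freeC o)

        fAll : V → ℕ
        fAll v = fA v + (fB v + fC v)

        free-V : ∀ v → free v ≡ fAll (toV v)
        free-V v = trans (free-slots v) (cong₂ _+_ (freeA-V v) (cong₂ _+_ (freeB-V v) (freeC-V v)))

        fAll-fin : ∀ i x → fAll (fin i x) ≡ 2 * s
        fAll-fin i x = trans (cong₂ _+_ (fA-fin i x) (cong₂ _+_ (fB-fin i x) (fC-fin i x))) (lin 1 (λ s → [] ⊢ s :+ (s :+ K 0) := 2 :* s) s)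

        fAll-inf : ∀ o → fAll (inf o) ≡ 2 * s ∸ extra
        fAll-inf o = trans (sym (m+n∸n≡m (fAll (inf o)) extra)) (cong (_∸ extra)
          (lin 5 (λ a b c x s → a :+ x := s ∷ b := s ∷ c := K 0 ∷ [] ⊢ a :+ (b :+ c) :+ x := 2 :* s) (fA (inf o)) (fB (inf o)) (fC (inf o)) extra s (fA-inf o) (fB-inf o) (fC-inf o)))

        uAll : V → ℕ
        uAll v = a + (a + suc n) ∸ fAll v

        used-V : ∀ v → used v ≡ uAll (toV v)
        used-V v = trans (sym (m+n∸n≡m (used v) (free v))) (cong₂ _∸_ (used+free v) (free-V v))

        W-eq : a + (a + suc n) ≡ 3 * suc n + 2 * s
        W-eq = lin 2 (λ n s → [] ⊢ (K 1 :+ n) :+ s :+ ((K 1 :+ n) :+ s :+ (K 1 :+ n)) := 3 :* (K 1 :+ n) :+ 2 :* s) n s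

        extra≤2s : extra ≤ 2 * s
        extra≤2s = lin 2 (λ x s → x :≤ K 1 ∷ K 1 :≤ s ∷ [] ⊢ x :≤ 2 :* s) extra s extra≤1 1≤s

        uAll-fin : ∀ i x → uAll (fin i x) ≡ 3 * suc n
        uAll-fin i x = trans (cong₂ _∸_ W-eq (fAll-fin i x)) (m+n∸n≡m (3 * suc n) (2 * s))

        uAll-inf : ∀ o → uAll (inf o) ≡ 3 * suc n + extra
        uAll-inf o = trans (cong₂ _∸_ W-eq (fAll-inf o)) (+-cancelʳ-≡ (2 * s ∸ extra) _ _
          (trans (m∸n+n≡m (≤-trans (m∸n≤m (2 * s) extra) (m≤n+m (2 * s) (3 * suc n))))
            (trans (cong (3 * suc n +_) (sym (m+[n∸m]≡n extra≤2s))) (sym (+-assoc (3 * suc n) extra _)))))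

        total-cap : sum cap ≡ sum used
        total-cap = trans cap-sum (trans count (sym (trans (sum-cong-≗ used-V) (sum-V uAll _ _ uAll-fin uAll-inf))))

        -- A vertex of a layer is in 3n + 2 triples and one pair, so that M - 1 - 2(3n + 2) - 1 = 2s
        -- pairs remain. A further vertex, in 3n + 3 triples, keeps 2s - 1 less its `extra` pairs.
        dV : V → ℕ
        dV (fin i x) = 2 * s
        dV (inf o) = 2 * s ∸ suc extra

        d : Fin M → ℕ
        d v = dV (toV v)

        wV : V → ℕ
        wV v = sumSlots {a} {a} {suc n} (λ z → weightAt (point v z))

        slot-weight : ∀ v z → slotWeight cap (pt v z) ≡ weightAt (point (toV v) z)
        slot-weight v z with point (toV v) z
        ... | nothing = refl
        ... | just (p , _) = cap-encode p

        weight-V : ∀ v → sum (λ σ → slotWeight cap (pt′ v σ)) ≡ wV (toV v)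
        weight-V v = trans (sum-pt (slotWeight cap) v) (cong₂ _+_ (sum-cong-≗ λ k → slot-weight v (A k))
          (cong₂ _+_ (sum-cong-≗ λ k → slot-weight v (B k)) (sum-cong-≗ λ k → slot-weight v (C k))))

        inf-weight : ∀ o → wV (inf o) ≡ 9 * suc n + 2 * extra
        inf-weight o = trans (cong₂ _+_ (sum-cong-≗ λ k → starPoint-weight o (A k) (star o (A k)) refl)
          (cong₂ _+_ (sum-cong-≗ λ k → starPoint-weight o (B k) (star o (B k)) refl) (sum-cong-≗ λ k → starPoint-weight o (C k) (star o (C k)) refl))) (star-weight o)

        suc-extra : suc extra ≤ 2 * s
        suc-extra = lin 2 (λ x s → x :≤ K 1 ∷ K 1 :≤ s ∷ [] ⊢ K 1 :+ x :≤ 2 :* s) extra s extra≤1 1≤s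

        counts-V : ∀ v → M + uAll v ≡ suc (dV v + wV v)
        counts-V (fin i x) = trans (cong₂ _+_ vertices (uAll-fin i x)) (trans
          (lin 2 (λ n s → [] ⊢ 6 :* (K 1 :+ n) :+ 2 :* s :+ 3 :* (K 1 :+ n) := K 1 :+ (2 :* s :+ (9 :* n :+ K 8))) n s)
          (cong (λ z → suc (2 * s + z)) (sym (fin-weight i x))))
        counts-V (inf o) = trans (cong₂ _+_ vertices (uAll-inf o)) (trans
          (lin 4 (λ n s x q → q :+ (K 1 :+ x) := 2 :* s ∷ [] ⊢ 6 :* (K 1 :+ n) :+ 2 :* s :+ (3 :* (K 1 :+ n) :+ x) := K 1 :+ (q :+ (9 :* (K 1 :+ n) :+ 2 :* x)))
            n s extra (2 * s ∸ suc extra) (m∸n+n≡m suc-extra))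
          (cong (λ z → suc (2 * s ∸ suc extra + z)) (sym (inf-weight o))))

        counts : ∀ v → M + used v ≡ suc (d v + sum (λ σ → slotWeight cap (pt′ v σ)))
        counts v = trans (cong (M +_) (used-V v)) (trans (counts-V (toV v)) (cong (λ z → suc (d v + z)) (sym (weight-V v))))

        dMain-V : ∀ v → dV v ≤ 2 * fA v
        dMain-V (fin i x) = ≤-reflexive (cong (2 *_) (sym (fA-fin i x)))
        dMain-V (inf o) = lin 4 (λ f x s q → f :+ x := s ∷ q :+ (K 1 :+ x) := 2 :* s ∷ x :≤ K 1 ∷ [] ⊢ q :≤ 2 :* f) (fA (inf o)) extra s _ (fA-inf o) (m∸n+n≡m suc-extra) extra≤1

        dMain : ∀ v → d v ≤ 2 * freeMain v
        dMain v = ≤-trans (dMain-V (toV v)) (≤-reflexive (cong (2 *_) (sym (trans (freeMain-slots v) (freeA-V v)))))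

        dOther-V : ∀ v → dV v ≤ 2 * (fB v + fC v)
        dOther-V (fin i x) = ≤-reflexive (cong (2 *_) (sym (trans (cong₂ _+_ (fB-fin i x) (fC-fin i x)) (+-identityʳ s))))
        dOther-V (inf o) = ≤-trans (m∸n≤m (2 * s) (suc extra)) (≤-reflexive (cong (2 *_) (sym (trans (cong₂ _+_ (fB-inf o) (fC-inf o)) (+-identityʳ s)))))

        dOther : ∀ v → d v ≤ 2 * length (freeOther v)
        dOther v = ≤-trans (dOther-V (toV v)) (≤-reflexive (cong (2 *_) (sym (trans (freeOther-slots v) (cong₂ _+_ (freeB-V v) (freeC-V v))))))

        -- Distinct members of a point sit in compatible slots, hence in slots of different letters.
        small3 : ∀ k → size k ≤ 3
        small3 k = image-bound 3 (λ v → on v k) f λ u v p q r → h u v p q r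
          where
          f : Fin M → Fin 3
          f v with on? v k
          ... | yes (σ , _) = letterOf (view a a (suc n) σ)
          ... | no _ = zero
          h : ∀ u v → on u k ≡ true → on v k ≡ true → f u ≡ f v → u ≡ v
          h u v p q r with u FinP.≟ v
          ... | yes same = same
          ... | no ne with on? u k | on? v k | on-true {u} {k} p | on-true {v} {k} q
          ...   | yes (σ , t) | yes (τ , t′) | _ | _ = ⊥-elim (letters-differ (compatible u v _ _ k ne t t′) r)
          ...   | no nh | _ | h′ | _ = ⊥-elim (nh h′)
          ...   | yes _ | no nh | _ | h′ = ⊥-elim (nh h′)

        small2 : ∀ k q → decode k ≡ pP q → size k ≤ 2
        small2 k q dec = image-bound 2 (λ v → on v k) (sideV ∘ toV) λ u v p p′ r →
          let (σ , t) = on-true {u} {k} p ; (τ , t′) = on-true {v} {k} p′ in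
          toV-injective (pair-side (subst (λ z → Member z (toV u) (view a a (suc n) σ)) dec (pt-at u _ t)) (subst (λ z → Member z (toV v) (view a a (suc n) τ)) dec (pt-at v _ t′)) r)

        small : ∀ k → size k ≤ cap k
        small k with decode k in dec
        ... | lev _ _ _ = small3 k
        ... | pA _ = small3 k
        ... | pB _ = small3 k
        ... | pP q = small2 k q dec

        room-bound : 2 * (N + sum free) ≤ 2 * l + sum d
        room-bound = subst₂ (λ x y → 2 * (N + x) ≤ 2 * l + y)
          (sym (trans (sum-cong-≗ free-V) (sum-V fAll _ _ fAll-fin fAll-inf)))
          (sym (sum-V dV _ _ (λ _ _ → refl) (λ _ → refl)))
          (lin 9 (λ N l us es e ex f1 d1 u2 → 2 :* N :+ 6 :* us :+ (2 :* es :+ e) :≤ 2 :* l :+ ex ∷ f1 :+ ex := 2 :* es ∷ d1 :+ (e :+ ex) := 2 :* es ∷ u2 := 6 :* us ∷ [] ⊢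
                  2 :* (N :+ (u2 :+ f1)) :≤ 2 :* l :+ (u2 :+ d1))
            N l (μ * s) (e * s) e (e * extra) (e * (2 * s ∸ extra)) (e * (2 * s ∸ suc extra)) (3 * μ * (2 * s))
            (≤-trans (≤-reflexive (cong (2 * N + 6 * (μ * s) +_) (sym (ee e s)))) room)
            (trans (sym (*-distribˡ-+ e (2 * s ∸ extra) extra)) (trans (cong (e *_) (m∸n+n≡m extra≤2s)) (e2 e s)))
            (trans (sym (trans (*-distribˡ-+ e (2 * s ∸ suc extra) (suc extra)) (cong (e * (2 * s ∸ suc extra) +_) (*-suc e extra))))
              (trans (cong (e *_) (m∸n+n≡m suc-extra)) (e2 e s)))
            (us μ s))
          where
          ee : ∀ e s → e * (2 * s + 1) ≡ 2 * (e * s) + e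
          ee = solve-∀
          e2 : ∀ e s → e * (2 * s) ≡ 2 * (e * s)
          e2 = solve-∀
          us : ∀ μ s → 3 * μ * (2 * s) ≡ 6 * (μ * s)
          us = solve-∀

-- Assembling the special level

↔-injective : ∀ {A B : Set} (f : A ↔ B) {x y} → Inverse.to f x ≡ Inverse.to f y → x ≡ y
↔-injective f {x} {y} r = trans (sym (Inverse.strictlyInverseʳ f x)) (trans (cong (Inverse.from f) r) (Inverse.strictlyInverseʳ f y))

neighbours : ∀ (i j : Fin 3) → i ≢ j → j ≡ next i ⊎ i ≡ next j
neighbours zero zero ne = ⊥-elim (ne refl)
neighbours zero (suc zero) ne = inj₁ refl
neighbours zero (suc (suc zero)) ne = inj₂ refl
neighbours (suc zero) zero ne = inj₂ refl
neighbours (suc zero) (suc zero) ne = ⊥-elim (ne refl)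
neighbours (suc zero) (suc (suc zero)) ne = inj₁ refl
neighbours (suc (suc zero)) zero ne = inj₁ refl
neighbours (suc (suc zero)) (suc zero) ne = inj₂ refl
neighbours (suc (suc zero)) (suc (suc zero)) ne = ⊥-elim (ne refl)

prev-injective : ∀ {i j} → prev i ≡ prev j → i ≡ j
prev-injective {i} {j} r = trans (sym (next-prev i)) (trans (cong next r) (next-prev j))

prev≢ : ∀ i → prev i ≢ i
prev≢ i r = next≢ i (trans (sym (next-prev i)) (cong next r))

next≢prev : ∀ i → next i ≢ prev i
next≢prev i r = next-next≢ i (sym (trans (cong next r) (next-prev i)))

-- A class of B is either a vertical column at position `pos c`, or a star: two vertices k and k + d
-- of one layer that are completed by a further vertex. There are q stars in each layer.
module Blocks (n s μ e : ℕ) .{{_ : NonZero μ}} (2n<μ : 2 * n < μ) (β : Fin 3 → ℕ)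
  (β< : ∀ i → β i < μ) (β-free : ∀ i → Frame.Free n s μ e 2n<μ β (β i))
  (q d : ℕ) (n<d : n < d) (d+n<μ : d + n < μ) {R : Set} {r : ℕ} (codeR : R ↔ Fin r) (pos : R → ℕ) (colType : R → Bool) (lowType : Fin 3 → Bool) where

  open Frame n s μ e 2n<μ β
  open Shift μ

  ClassB : Set
  ClassB = (Fin 3 × Fin q) ⊎ R

  data SpecB (i : Fin 3) (x : Fin μ) : ClassB → Bool → Set where
    low : ∀ k → toℕ x ≡ toℕ k → SpecB i x (inj₁ (i , k)) (lowType i)
    high : ∀ k → toℕ x ≡ toℕ k + d → SpecB i x (inj₁ (i , k)) (not (lowType i))
    column : ∀ c → toℕ x ≡ pos c → SpecB i x (inj₂ c) (colType c)

  Spot : Set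
  Spot = Fin 3 × ℕ × Bool

  -- The shapes allowed for a pair of P. The side conditions keep it out of the B-triples: it does
  -- not join the two ends of a star, nor two vertices of a column of B. `single` is the degenerate
  -- case in which the partner is a further vertex.
  data Pair : Spot → Spot → Set where
    level : ∀ {i x y T U} δ → y ≡ x + δ → n < δ → δ + n < μ → T ≢ U → δ ≢ d ⊎ q ≤ x → Pair (i , x , T) (i , y , U)
    vertical : ∀ {i j x y T U} → x ≡ y → i ≢ j → letterP i T ≢ letterP j U → (∀ c → x ≢ pos c) → Pair (i , x , T) (j , y , U)
    single : ∀ {i x y T U} → x ≡ y → Pair (i , x , T) (i , y , U)

  far-sym : ∀ {i x j y} → Far i x j y → Far j y i x
  far-sym {x = x} (level f δ a b g) = level (sym f) (μ ∸ δ)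
    (lin 4 (λ n d e u → e :+ d := u ∷ d :+ n :< u ∷ [] ⊢ n :< e) n δ (μ ∸ δ) μ c b)
    (lin 4 (λ n d e u → e :+ d := u ∷ n :< d ∷ [] ⊢ e :+ n :< u) n δ (μ ∸ δ) μ c a)
    (trans (sym (⊕-⊖ x δ≤)) (cong (_⊕ (μ ∸ δ)) (sym g)))
    where
    δ≤ : δ ≤ μ
    δ≤ = ≤-trans (m≤m+n δ n) (<⇒≤ b)
    c : μ ∸ δ + δ ≡ μ
    c = m∸n+n≡m δ≤
  far-sym (rise f m m< free g) = fall f m m< free g
  far-sym (fall f m m< free g) = rise f m m< free g

  -- A vertical pair has the cross difference β i, so the levels miss it because β i is free.
  far-vertical : ∀ i j x → i ≢ j → Far i x j x
  far-vertical i j x ne with neighbours i j ne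
  ... | inj₁ f = rise f (β i) (β< i) (β-free i) refl
  ... | inj₂ f = fall f (β j) (β< j) (β-free j) refl

  far-level : ∀ i {x y} δ → n < δ → δ + n < μ → toℕ y ≡ toℕ x + δ → Far i x i y
  far-level i δ a b f = level refl δ a b (⊕-natural f)

  letterB≢ : ∀ i T → i ≢ letterB i T
  letterB≢ i false = next≢ i
  letterB≢ i true = prev≢ i ∘ sym

  letterB-not : ∀ i T → letterB i T ≢ letterB i (not T)
  letterB-not i false = next≢prev i
  letterB-not i true = next≢prev i ∘ sym

  letterB-injective : ∀ {i j} T → letterB i T ≡ letterB j T → i ≡ j
  letterB-injective false f = next-injective f
  letterB-injective true f = prev-injective f

  letterP-differ : ∀ i {T U} → T ≢ U → letterP i T ≢ letterP i U
  letterP-differ i {false} {false} ne = ⊥-elim (ne refl)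
  letterP-differ i {false} {true} ne = next≢prev i ∘ sym
  letterP-differ i {true} {false} ne = next≢prev i
  letterP-differ i {true} {true} ne = ⊥-elim (ne refl)

  data SameB (i : Fin 3) (x : Fin μ) (j : Fin 3) (y : Fin μ) : Set where
    same : i ≡ j → x ≡ y → SameB i x j y
    up : i ≡ j → ∀ (k : Fin q) → toℕ x ≡ toℕ k → toℕ y ≡ toℕ k + d → SameB i x j y
    down : i ≡ j → ∀ (k : Fin q) → toℕ y ≡ toℕ k → toℕ x ≡ toℕ k + d → SameB i x j y
    across : i ≢ j → x ≡ y → ∀ c → toℕ x ≡ pos c → SameB i x j y

  sameB : ∀ {i x j y c T U} → SpecB i x c T → SpecB j y c U → SameB i x j y × (letterB i T ≢ letterB j U ⊎ (i , x) ≈ (j , y))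
  sameB (low k a) (low _ b) = same refl x≡y , inj₂ (refl , x≡y)
    where x≡y = FinP.toℕ-injective (trans a (sym b))
  sameB {i} (low k a) (high _ b) = up refl k a b , inj₁ (letterB-not i (lowType i))
  sameB {i} (high k a) (low _ b) = down refl k b a , inj₁ (letterB-not i (lowType i) ∘ sym)
  sameB (high k a) (high _ b) = same refl x≡y , inj₂ (refl , x≡y)
    where x≡y = FinP.toℕ-injective (trans a (sym b))
  sameB {i} {x} {j} {y} (column c a) (column _ b) with i FinP.≟ j | FinP.toℕ-injective {i = x} {j = y} (trans a (sym b))
  ... | yes i≡j | x≡y = same i≡j x≡y , inj₂ (i≡j , x≡y)
  ... | no i≢j | x≡y = across i≢j x≡y c a , inj₁ (i≢j ∘ letterB-injective (colType c))

  sameB-far : ∀ {i x j y} → SameB i x j y → (i , x) ≈ (j , y) ⊎ Far i x j y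
  sameB-far (same a b) = inj₁ (a , b)
  sameB-far {i} (up refl k a b) = inj₂ (far-level i d n<d d+n<μ (trans b (cong (_+ d) (sym a))))
  sameB-far {i} (down refl k a b) = inj₂ (far-sym (far-level i d n<d d+n<μ (trans b (cong (_+ d) (sym a)))))
  sameB-far {i} {x} {j} (across ne refl _ _) = inj₂ (far-vertical i j x ne)

  pair-far : ∀ {i x T j y U} → Pair (i , toℕ x , T) (j , toℕ y , U) → (i , x) ≈ (j , y) ⊎ (letterP i T ≢ letterP j U × Far i x j y)
  pair-far {i} (level δ a b c ne _) = inj₂ (letterP-differ i ne , far-level i δ b c a)
  pair-far {i} {x} {j = j} (vertical a ne ne′ _) with FinP.toℕ-injective a
  ... | refl = inj₂ (ne′ , far-vertical i j x ne)
  pair-far (single a) = inj₁ (refl , FinP.toℕ-injective a)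

  -- Two distinct vertices of a pair lie in one layer or in one column.
  Aligned : Fin 3 → Fin μ → Fin 3 → Fin μ → Set
  Aligned i x j y = i ≡ j ⊎ x ≡ y

  sameB-aligned : ∀ {i x j y} → SameB i x j y → Aligned i x j y
  sameB-aligned (same a _) = inj₁ a
  sameB-aligned (up a _ _ _) = inj₁ a
  sameB-aligned (down a _ _ _) = inj₁ a
  sameB-aligned (across _ b _ _) = inj₂ b

  pair-aligned : ∀ {i x T j y U} → Pair (i , toℕ x , T) (j , toℕ y , U) → Aligned i x j y
  pair-aligned (level _ _ _ _ _ _) = inj₁ refl
  pair-aligned (vertical a _ _ _) = inj₂ (FinP.toℕ-injective a)
  pair-aligned (single _) = inj₁ refl

  sameB-pair : ∀ {i x T j y U} → SameB i x j y → Pair (i , toℕ x , T) (j , toℕ y , U) → (i , x) ≈ (j , y)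
  sameB-pair (same a b) _ = a , b
  sameB-pair _ (single a) = refl , FinP.toℕ-injective a
  sameB-pair {x = x} {y = y} (up _ k a b) (level δ f _ _ _ (inj₁ ne)) =
    ⊥-elim (ne (lin 5 (λ x y k d e → x := k ∷ y := k :+ d ∷ y := x :+ e ∷ [] ⊢ e := d) (toℕ x) (toℕ y) (toℕ k) d δ a b f))
  sameB-pair (up _ k a b) (level δ f _ _ _ (inj₂ q≤)) = ⊥-elim (<-irrefl refl (<-≤-trans (FinP.toℕ<n k) (≤-trans q≤ (≤-reflexive a))))
  sameB-pair (up f _ _ _) (vertical _ ne _ _) = ⊥-elim (ne f)
  sameB-pair {x = x} {y = y} (down _ k a b) (level δ f n<δ _ _ _) =
    ⊥-elim (lin 6 (λ x y k d e n → y := k ∷ x := k :+ d ∷ y := x :+ e ∷ n :< e ∷ [] ⊢ absurd) (toℕ x) (toℕ y) (toℕ k) d δ n a b f n<δ)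
  sameB-pair (down f _ _ _) (vertical _ ne _ _) = ⊥-elim (ne f)
  sameB-pair (across ne _ _ _) (level _ _ _ _ _ _) = ⊥-elim (ne refl)
  sameB-pair (across _ _ c a) (vertical _ _ _ ne) = ⊥-elim (ne c a)

  sameB-sym : ∀ {i x j y} → SameB i x j y → SameB j y i x
  sameB-sym (same a b) = same (sym a) (sym b)
  sameB-sym (up f k a b) = down (sym f) k a b
  sameB-sym (down f k a b) = up (sym f) k a b
  sameB-sym (across ne refl c a) = across (ne ∘ sym) refl c a

  ≈-sym : ∀ {i x j y} → (i , x) ≈ (j , y) → (j , y) ≈ (i , x)
  ≈-sym (a , b) = sym a , sym b

  letterOf′ : Slot′ → Fin 3
  letterOf′ (A _) = zero
  letterOf′ (B _) = suc zero
  letterOf′ (C _) = suc (suc zero)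

  data Low : Slot′ → Fin (suc n) → Set where
    lowA : ∀ k → Low (A (k ↑ˡ s)) k
    lowB : ∀ k → Low (B (k ↑ˡ s)) k
    lowC : ∀ k → Low (C k) k

  low-unique : ∀ {z z′ k} → Low z k → Low z′ k → letterOf′ z ≡ letterOf′ z′ → z ≡ z′
  low-unique (lowA k) (lowA _) _ = refl
  low-unique (lowB k) (lowB _) _ = refl
  low-unique (lowC k) (lowC _) _ = refl

  special-low : ∀ {z k} ℓ → Low z k → letterOf′ z ≢ ℓ → Compatible z (special ℓ) × Compatible (special ℓ) z
  special-low zero (lowA k) ne = ⊥-elim (ne refl)
  special-low zero (lowB k) ne = BA , AB
  special-low zero (lowC k) ne = CA , AC
  special-low (suc zero) (lowA k) ne = AB , BA
  special-low (suc zero) (lowB k) ne = ⊥-elim (ne refl)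
  special-low (suc zero) (lowC k) ne = CB refl z≤n , BC refl z≤n
  special-low (suc (suc zero)) (lowA k) ne = AC , CA
  special-low (suc (suc zero)) (lowB k) ne = BC refl le , CB refl le
    where
    le : toℕ (k ↑ˡ s) ≤ suc (toℕ (fromℕ n))
    le = ≤-trans (≤-reflexive (FinP.toℕ-↑ˡ k s)) (≤-trans (<⇒≤ (FinP.toℕ<n k)) (≤-reflexive (cong suc (sym (FinP.toℕ-fromℕ n)))))
  special-low (suc (suc zero)) (lowC k) ne = ⊥-elim (ne refl)

  special-A : ∀ k ℓ → zero ≢ ℓ → Compatible (A k) (special ℓ) × Compatible (special ℓ) (A k)
  special-A k zero ne = ⊥-elim (ne refl)
  special-A k (suc zero) ne = AB , BA
  special-A k (suc (suc zero)) ne = AC , CA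

  -- The choices left to the residues. `viewB`, `viewP` and `classA` describe the special level on
  -- the layers; `f o ℓ k` is the triple at the slot of letter ℓ and index k of the further vertex
  -- o, and `g o r` the possible pair at one of its s remaining A-slots.
  module Glue {extra : ℕ} (type : Fin 3 → Fin μ → Bool) (viewB : ∀ i x → Σ ClassB λ c → SpecB i x c (type i x))
    {X : Set} {sizeP : ℕ} (codeP : X ↔ Fin sizeP) (member : X → Fin 2 → Spot)
    (viewP : ∀ i x → Σ X λ c → Σ (Fin 2) λ b → member c b ≡ (i , toℕ x , type i x))
    (pairs : ∀ c → Pair (member c zero) (member c (suc zero)))
    {Y : Set} {sizeA : ℕ} (codeA : Y ↔ Fin sizeA) (classA : Fin 3 → Fin μ → Y)
    (same-A : ∀ i x j y → classA i x ≡ classA j y → (i , x) ≈ (j , y) ⊎ (i ≢ j × x ≢ y × Far i x j y))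
    (f : Fin e → Fin 3 → Fin (suc n) → Y ⊎ ClassB) (g : Fin e → Fin s → Maybe X)
    (f-A : ∀ o ℓ k i x → f o ℓ k ≡ inj₁ (classA i x) → ℓ ≢ i)
    (f-B : ∀ o ℓ k c → f o ℓ k ≡ inj₂ c → Σ (Fin q) λ k′ → c ≡ inj₁ (ℓ , k′))
    (f-injective : ∀ o ℓ k o′ ℓ′ k′ → f o ℓ k ≡ f o′ ℓ′ k′ → o ≡ o′ × ℓ ≡ ℓ′ × k ≡ k′)
    (f-kind : ∀ o ℓ k ℓ′ k′ y c → f o ℓ k ≡ inj₁ y → f o ℓ′ k′ ≡ inj₂ c → ⊥)
    (g-injective : ∀ o r o′ r′ c → g o r ≡ just c → g o′ r′ ≡ just c → o ≡ o′ × r ≡ r′)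
    (g-P : ∀ o r i x → g o r ≡ just (proj₁ (viewP i x)) → zero ≢ letterP i (type i x) × proj₁ (proj₂ (viewP i x)) ≡ zero)
    (g-A : ∀ o r ℓ k y c → g o r ≡ just c → f o ℓ k ≢ inj₁ y)
    (g-B : ∀ o r k i x → g o r ≡ just (proj₁ (viewP i x)) → proj₁ (viewB i x) ≢ inj₁ k)
    (g-count : ∀ o → sum (λ r → 𝟙 (is-just (g o r))) ≡ extra) where

    Class : Set
    Class = Y ⊎ (ClassB ⊎ X)

    codeB : ClassB ↔ Fin (3 * q + r)
    codeB = ↔-trans (↔-sym FinP.*↔× ⊎-↔ codeR) (↔-sym FinP.+↔⊎)

    code : Class ↔ (Fin sizeA ⊎ (Fin (3 * q + r) ⊎ Fin sizeP))
    code = codeA ⊎-↔ (codeB ⊎-↔ codeP)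

    starClass : Fin e → Slot′ → Maybe Class
    starClass o (A k) = Sum.[ (λ k → just (Sum.map₂ inj₁ (f o zero k))) , (λ r → Maybe.map (inj₂ ∘ inj₂) (g o r)) ]′ (splitAt (suc n) k)
    starClass o (B k) = Sum.[ (λ k → just (Sum.map₂ inj₁ (f o (suc zero) k))) , (λ _ → nothing) ]′ (splitAt (suc n) k)
    starClass o (C k) = just (Sum.map₂ inj₁ (f o (suc (suc zero)) k))

    star : Fin e → Slot′ → Maybe (Fin sizeA ⊎ (Fin (3 * q + r) ⊎ Fin sizeP))
    star o z = Maybe.map (Inverse.to code) (starClass o z)

    uncode : ∀ (m : Maybe Class) c → Maybe.map (Inverse.to code) m ≡ just (Inverse.to code c) → m ≡ just c
    uncode (just _) c t = cong just (↔-injective code (just-injective t))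

    uncode′ : ∀ (m : Maybe Class) p → Maybe.map (Inverse.to code) m ≡ just p → m ≡ just (Inverse.from code p)
    uncode′ (just c) p refl = cong just (sym (Inverse.strictlyInverseʳ code c))

    -- Records whether a class at a further vertex comes from f or from g, so that the conditions on
    -- `star` are proved without unfolding `splitAt` again.
    data Inv (o : Fin e) (z : Slot′) : Class → Set where
      fromF : ∀ {k c} → Low z k → f o (letterOf′ z) k ≡ c → Inv o z (Sum.map₂ inj₁ c)
      fromG : ∀ {r c} → z ≡ A (suc n ↑ʳ r) → g o r ≡ just c → Inv o z (inj₂ (inj₂ c))

    invert : ∀ o z {c} → starClass o z ≡ just c → Inv o z c
    invert o (A k) t with splitAt (suc n) k in sp
    invert o (A k) refl | inj₁ k′ with FinP.splitAt⁻¹-↑ˡ {i = k} sp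
    ... | refl = fromF (lowA k′) refl
    invert o (A k) t | inj₂ r with FinP.splitAt⁻¹-↑ʳ {i = k} sp | g o r in gr
    invert o (A k) refl | inj₂ r | refl | just c = fromG refl gr
    invert o (B k) t with splitAt (suc n) k in sp
    invert o (B k) refl | inj₁ k′ with FinP.splitAt⁻¹-↑ˡ {i = k} sp
    ... | refl = fromF (lowB k′) refl
    invert o (C k) refl = fromF (lowC k) refl

    map₂-inj₁ : ∀ {c c′ : Y ⊎ ClassB} → Sum.map₂ (inj₁ {B = X}) c ≡ Sum.map₂ inj₁ c′ → c ≡ c′
    map₂-inj₁ {inj₁ _} {inj₁ _} refl = refl
    map₂-inj₁ {inj₂ _} {inj₂ _} refl = refl

    not-P : ∀ (c : Y ⊎ ClassB) {p : X} → Sum.map₂ inj₁ c ≢ inj₂ (inj₂ p)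
    not-P (inj₁ _) ()
    not-P (inj₂ _) ()

    is-A : ∀ {c : Y ⊎ ClassB} {y} → Sum.map₂ (inj₁ {B = X}) c ≡ inj₁ y → c ≡ inj₁ y
    is-A {inj₁ _} refl = refl

    is-B : ∀ {c : Y ⊎ ClassB} {y} → Sum.map₂ (inj₁ {B = X}) c ≡ inj₂ (inj₁ y) → c ≡ inj₂ y
    is-B {inj₂ _} refl = refl

    inv-unique : ∀ {o o′ z z′ c c′} → Inv o z c → Inv o′ z′ c′ → c ≡ c′ → o ≡ o′ × z ≡ z′
    inv-unique {o} {o′} {z} {z′} (fromF {k} a b) (fromF {k′} a′ b′) t with f-injective o (letterOf′ z) k o′ (letterOf′ z′) k′ (trans b (trans (map₂-inj₁ t) (sym b′)))
    ... | o≡ , ℓ≡ , refl = o≡ , low-unique a a′ ℓ≡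
    inv-unique (fromF {c = c} a b) (fromG a′ b′) t = ⊥-elim (not-P c t)
    inv-unique (fromG a b) (fromF {c = c} a′ b′) t = ⊥-elim (not-P c (sym t))
    inv-unique {o} {o′} (fromG {r} refl b) (fromG {r′} {c} refl b′) refl with g-injective o r o′ r′ c b b′
    ... | o≡ , refl = o≡ , refl

    partA : Fin 3 → Fin μ → Fin sizeA
    partA i x = Inverse.to codeA (classA i x)

    partB : Fin 3 → Fin μ → Fin (3 * q + r)
    partB i x = Inverse.to codeB (proj₁ (viewB i x))

    partP : Fin 3 → Fin μ → Fin sizeP
    partP i x = Inverse.to codeP (proj₁ (viewP i x))

    side : Fin 3 → Fin μ → Fin 2
    side i x = proj₁ (proj₂ (viewP i x))

    relB : ∀ i x j y → partB i x ≡ partB j y → SameB i x j y × (letterB i (type i x) ≢ letterB j (type j y) ⊎ (i , x) ≈ (j , y))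
    relB i x j y t = sameB (proj₂ (viewB i x)) (subst (λ c → SpecB j y c (type j y)) (sym (↔-injective codeB {proj₁ (viewB i x)} {proj₁ (viewB j y)} t)) (proj₂ (viewB j y)))

    data RelP (i : Fin 3) (x : Fin μ) (j : Fin 3) (y : Fin μ) : Set where
      same : side i x ≡ side j y → (i , x) ≈ (j , y) → RelP i x j y
      up : side i x ≢ side j y → Pair (i , toℕ x , type i x) (j , toℕ y , type j y) → RelP i x j y
      down : side i x ≢ side j y → Pair (j , toℕ y , type j y) (i , toℕ x , type i x) → RelP i x j y

    relP : ∀ i x j y → partP i x ≡ partP j y → RelP i x j y
    relP i x j y t = go (proj₁ (viewP i x)) _ _ refl refl (proj₂ (proj₂ (viewP i x)))
        (subst (λ c → member c (side j y) ≡ (j , toℕ y , type j y)) (sym (↔-injective codeP {proj₁ (viewP i x)} {proj₁ (viewP j y)} t)) (proj₂ (proj₂ (viewP j y))))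
      where
      spot-injective : (i , toℕ x , type i x) ≡ (j , toℕ y , type j y) → (i , x) ≈ (j , y)
      spot-injective h = ,-injectiveˡ h , FinP.toℕ-injective (cong (proj₁ ∘ proj₂) h)
      go : ∀ c b b′ → side i x ≡ b → side j y ≡ b′ → member c b ≡ (i , toℕ x , type i x) → member c b′ ≡ (j , toℕ y , type j y) → RelP i x j y
      go c zero zero l l′ m m′ = same (trans l (sym l′)) (spot-injective (trans (sym m) m′))
      go c (suc zero) (suc zero) l l′ m m′ = same (trans l (sym l′)) (spot-injective (trans (sym m) m′))
      go c zero (suc zero) l l′ m m′ = up (λ h → case trans (sym l) (trans h l′) of λ ()) (subst₂ Pair m m′ (pairs c))
      go c (suc zero) zero l l′ m m′ = down (λ h → case trans (sym l) (trans h l′) of λ ()) (subst₂ Pair m′ m (pairs c))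

    aligned-A : ∀ i x j y → partA i x ≡ partA j y → Aligned i x j y → (i , x) ≈ (j , y)
    aligned-A i x j y t al with same-A i x j y (↔-injective codeA t)
    ... | inj₁ eq = eq
    aligned-A i x j y t (inj₁ b) | inj₂ (i≢ , _ , _) = ⊥-elim (i≢ b)
    aligned-A i x j y t (inj₂ b) | inj₂ (_ , x≢ , _) = ⊥-elim (x≢ b)

    relP-aligned : ∀ {i x j y} → RelP i x j y → Aligned i x j y
    relP-aligned (same _ (a , _)) = inj₁ a
    relP-aligned (up _ p) = pair-aligned p
    relP-aligned (down _ p) = Sum.map sym sym (pair-aligned p)

    is-nothing-code : ∀ (m : Maybe Class) → is-nothing (Maybe.map (Inverse.to code) m) ≡ is-nothing m
    is-nothing-code nothing = refl
    is-nothing-code (just _) = refl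

    sum-low : ∀ (h : Fin (suc n) ⊎ Fin s → ℕ) c → (∀ k → h (inj₁ k) ≡ c) → sum (λ k → h (splitAt (suc n) k)) ≡ suc n * c + sum (λ r → h (inj₂ r))
    sum-low h c eq = trans (sum-splitAt (suc n) (λ k → h (splitAt (suc n) k)))
      (cong₂ _+_ (sum-all c λ k → trans (cong h (FinP.splitAt-↑ˡ (suc n) k s)) (eq k)) (sum-cong-≗ λ r → cong h (FinP.splitAt-↑ʳ (suc n) s r)))

    free-split : ∀ (h : Fin (suc n) ⊎ Fin s → Maybe Class) → (∀ k → is-nothing (h (inj₁ k)) ≡ false) →
      sum (λ k → 𝟙 (is-nothing (Maybe.map (Inverse.to code) (h (splitAt (suc n) k))))) ≡ sum (λ r → 𝟙 (is-nothing (h (inj₂ r))))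
    free-split h eq = trans (sum-cong-≗ λ k → cong 𝟙 (is-nothing-code (h (splitAt (suc n) k))))
      (trans (sum-low (λ z → 𝟙 (is-nothing (h z))) 0 (λ k → cong 𝟙 (eq k))) (cong (_+ sum (λ r → 𝟙 (is-nothing (h (inj₂ r))))) (*-zeroʳ (suc n))))

    codeWeight : Maybe Class → ℕ
    codeWeight m = multiplicity? (Maybe.map (Inverse.to code) m)

    weight-F : ∀ (c : Y ⊎ ClassB) → codeWeight (just (Sum.map₂ inj₁ c)) ≡ 3
    weight-F (inj₁ _) = refl
    weight-F (inj₂ _) = refl

    weight-G : ∀ (m : Maybe X) → codeWeight (Maybe.map (inj₂ ∘ inj₂) m) ≡ 𝟙 (is-just m) + 𝟙 (is-just m)
    weight-G nothing = refl
    weight-G (just _) = refl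

    nothing-just : ∀ (m : Maybe X) → 𝟙 (is-nothing (Maybe.map {B = Class} (inj₂ ∘ inj₂) m)) + 𝟙 (is-just m) ≡ 1
    nothing-just nothing = refl
    nothing-just (just _) = refl

    assembled : Special extra
    assembled = record
      { sizeA = sizeA
      ; sizeB = 3 * q + r
      ; sizeP = sizeP
      ; partA = partA
      ; partB = partB
      ; partP = partP
      ; type = type
      ; side = side
      ; star = star
      ; same-A = λ i x j y t → Sum.map₂ (λ p → proj₁ p , proj₂ (proj₂ p)) (same-A i x j y (↔-injective codeA t))
      ; same-B = same-B
      ; same-P = same-P
      ; once-AB = λ i x j y t t′ → aligned-A i x j y t (sameB-aligned (proj₁ (relB i x j y t′)))
      ; once-AP = λ i x j y t t′ → aligned-A i x j y t (relP-aligned (relP i x j y t′))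
      ; once-BP = once-BP
      ; two-P = two-P
      ; star-injective = λ o z z′ p t t′ → proj₂ (inv-unique (invert o z (uncode′ (starClass o z) p t)) (invert o z′ (uncode′ (starClass o z′) p t′)) refl)
      ; star-A = star-A
      ; star-B = star-B
      ; star-P = star-P
      ; star-AB = star-AB
      ; star-AP = star-AP
      ; star-BP = star-BP
      ; star-apart = λ o o′ z z′ p t t′ → proj₁ (inv-unique (invert o z (uncode′ (starClass o z) p t)) (invert o′ z′ (uncode′ (starClass o′ z′) p t′)) refl)
      ; star-freeA = star-freeA
      ; star-freeB = star-freeB
      ; star-freeC = λ o → sum-0 λ k → cong 𝟙 (is-nothing-code (starClass o (C k)))
      ; star-weight = star-weight
      }
      where
      same-B : ∀ i x j y → partB i x ≡ partB j y → (i , x) ≈ (j , y) ⊎ (letterB i (type i x) ≢ letterB j (type j y) × Far i x j y)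
      same-B i x j y t with relB i x j y t
      ... | _ , inj₂ eq = inj₁ eq
      ... | b , inj₁ ne = Sum.map₂ (ne ,_) (sameB-far b)

      same-P : ∀ i x j y → partP i x ≡ partP j y → (i , x) ≈ (j , y) ⊎ (letterP i (type i x) ≢ letterP j (type j y) × Far i x j y)
      same-P i x j y t with relP i x j y t
      ... | same _ eq = inj₁ eq
      ... | up _ p = pair-far p
      ... | down _ p = Sum.map ≈-sym (λ (ne , far) → ne ∘ sym , far-sym far) (pair-far p)

      two-P : ∀ i x j y → partP i x ≡ partP j y → side i x ≡ side j y → (i , x) ≈ (j , y)
      two-P i x j y t eq with relP i x j y t
      ... | same _ eq′ = eq′
      ... | up ne _ = ⊥-elim (ne eq)
      ... | down ne _ = ⊥-elim (ne eq)

      once-BP : ∀ i x j y → partB i x ≡ partB j y → partP i x ≡ partP j y → (i , x) ≈ (j , y)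
      once-BP i x j y t t′ with relB i x j y t | relP i x j y t′
      ... | _ | same _ eq = eq
      ... | b , _ | up _ p = sameB-pair b p
      ... | b , _ | down _ p = ≈-sym (sameB-pair (sameB-sym b) p)

      star-A : ∀ o z i x → star o z ≡ just (inj₁ (partA i x)) → Compatible z (special i) × Compatible (special i) z
      star-A o z i x t = go (invert o z (uncode (starClass o z) (inj₁ (classA i x)) t)) refl
        where
        go : ∀ {c} → Inv o z c → c ≡ inj₁ (classA i x) → Compatible z (special i) × Compatible (special i) z
        go (fromF {k} lw b) eq = special-low i lw (f-A o (letterOf′ z) k i x (trans b (is-A eq)))

      star-B : ∀ o z i x → star o z ≡ just (inj₂ (inj₁ (partB i x))) →
        Compatible z (special (letterB i (type i x))) × Compatible (special (letterB i (type i x))) z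
      star-B o z i x t = go (invert o z (uncode (starClass o z) (inj₂ (inj₁ (proj₁ (viewB i x)))) t)) refl
        where
        first : ∀ {c T ℓ k} → SpecB i x c T → c ≡ inj₁ (ℓ , k) → ℓ ≡ i
        first (low _ _) refl = refl
        first (high _ _) refl = refl
        go : ∀ {c} → Inv o z c → c ≡ inj₂ (inj₁ (proj₁ (viewB i x))) → Compatible z (special (letterB i (type i x))) × Compatible (special (letterB i (type i x))) z
        go (fromF {k} lw b) eq = special-low (letterB i (type i x)) lw
          (λ r → letterB≢ i (type i x) (trans (sym (first (proj₂ (viewB i x)) (proj₂ (f-B o (letterOf′ z) k _ (trans b (is-B eq)))))) r))

      star-P : ∀ o z i x → star o z ≡ just (inj₂ (inj₂ (partP i x))) →
        Compatible z (special (letterP i (type i x))) × Compatible (special (letterP i (type i x))) z × side i x ≡ zero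
      star-P o z i x t = go (invert o z (uncode (starClass o z) (inj₂ (inj₂ (proj₁ (viewP i x)))) t)) refl
        where
        go : ∀ {c} → Inv o z c → c ≡ inj₂ (inj₂ (proj₁ (viewP i x))) →
          Compatible z (special (letterP i (type i x))) × Compatible (special (letterP i (type i x))) z × side i x ≡ zero
        go (fromF {c = c} _ _) eq = ⊥-elim (not-P c eq)
        go (fromG {r} refl b) refl = let (ne , sd) = g-P o r i x b ; (l , l′) = special-A (suc n ↑ʳ r) (letterP i (type i x)) ne in l , l′ , sd

      star-AB : ∀ o z z′ i x → star o z ≡ just (inj₁ (partA i x)) → star o z′ ≡ just (inj₂ (inj₁ (partB i x))) → ⊥
      star-AB o z z′ i x t t′ = go (invert o z (uncode (starClass o z) (inj₁ (classA i x)) t)) (invert o z′ (uncode (starClass o z′) (inj₂ (inj₁ (proj₁ (viewB i x)))) t′)) refl refl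
        where
        go : ∀ {c c′} → Inv o z c → Inv o z′ c′ → c ≡ inj₁ (classA i x) → c′ ≡ inj₂ (inj₁ (proj₁ (viewB i x))) → ⊥
        go (fromF {k} _ b) (fromF {k′} _ b′) eq eq′ = f-kind o (letterOf′ z) k (letterOf′ z′) k′ _ _ (trans b (is-A eq)) (trans b′ (is-B eq′))

      star-AP : ∀ o z z′ i x → star o z ≡ just (inj₁ (partA i x)) → star o z′ ≡ just (inj₂ (inj₂ (partP i x))) → ⊥
      star-AP o z z′ i x t t′ = go (invert o z (uncode (starClass o z) (inj₁ (classA i x)) t)) (invert o z′ (uncode (starClass o z′) (inj₂ (inj₂ (proj₁ (viewP i x)))) t′)) refl refl
        where
        go : ∀ {c c′} → Inv o z c → Inv o z′ c′ → c ≡ inj₁ (classA i x) → c′ ≡ inj₂ (inj₂ (proj₁ (viewP i x))) → ⊥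
        go _ (fromF {c = c} _ _) eq eq′ = not-P c eq′
        go (fromF {k} _ b) (fromG {r} {c} _ b′) eq eq′ = g-A o r (letterOf′ z) k _ c b′ (trans b (is-A eq))

      star-BP : ∀ o z z′ i x → star o z ≡ just (inj₂ (inj₁ (partB i x))) → star o z′ ≡ just (inj₂ (inj₂ (partP i x))) → ⊥
      star-BP o z z′ i x t t′ = go (invert o z (uncode (starClass o z) (inj₂ (inj₁ (proj₁ (viewB i x)))) t)) (invert o z′ (uncode (starClass o z′) (inj₂ (inj₂ (proj₁ (viewP i x)))) t′)) refl refl
        where
        go : ∀ {c c′} → Inv o z c → Inv o z′ c′ → c ≡ inj₂ (inj₁ (proj₁ (viewB i x))) → c′ ≡ inj₂ (inj₂ (proj₁ (viewP i x))) → ⊥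
        go _ (fromF {c = c} _ _) eq eq′ = not-P c eq′
        go (fromF {k} _ b) (fromG {r} _ b′) eq refl = g-B o r _ i x b′ (proj₂ (f-B o (letterOf′ z) k _ (trans b (is-B eq))))

      star-freeA : ∀ o → sum (λ k → 𝟙 (is-nothing (star o (A k)))) + extra ≡ s
      star-freeA o = trans (cong₂ _+_ (free-split (Sum.[ (λ k → just (Sum.map₂ inj₁ (f o zero k))) , (λ r → Maybe.map (inj₂ ∘ inj₂) (g o r)) ]′) (λ _ → refl)) (sym (g-count o)))
        (trans (sym (∑-distrib-+ (λ r → 𝟙 (is-nothing (Maybe.map {B = Class} (inj₂ ∘ inj₂) (g o r)))) (λ r → 𝟙 (is-just (g o r)))))
          (trans (sum-all 1 λ r → nothing-just (g o r)) (*-identityʳ s)))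

      star-freeB : ∀ o → sum (λ k → 𝟙 (is-nothing (star o (B k)))) ≡ s
      star-freeB o = trans (free-split (Sum.[ (λ k → just (Sum.map₂ inj₁ (f o (suc zero) k))) , (λ _ → nothing) ]′) (λ _ → refl)) (trans (sum-all {s} 1 λ _ → refl) (*-identityʳ s))

      star-weight : ∀ o → sumSlots (λ z → multiplicity? (star o z)) ≡ 9 * suc n + 2 * extra
      star-weight o = trans (cong₂ _+_
          (trans (sum-low (λ z → codeWeight (Sum.[ (λ k → just (Sum.map₂ inj₁ (f o zero k))) , (λ r → Maybe.map (inj₂ ∘ inj₂) (g o r)) ]′ z)) 3 (λ k → weight-F (f o zero k)))
            (cong (suc n * 3 +_) (trans (sum-cong-≗ λ r → weight-G (g o r)) (trans (∑-distrib-+ (λ r → 𝟙 (is-just (g o r))) (λ r → 𝟙 (is-just (g o r)))) (cong₂ _+_ (g-count o) (g-count o))))))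
          (cong₂ _+_
            (trans (sum-low (λ z → codeWeight (Sum.[ (λ k → just (Sum.map₂ inj₁ (f o (suc zero) k))) , (λ _ → nothing) ]′ z)) 3 (λ k → weight-F (f o (suc zero) k)))
              (cong (suc n * 3 +_) (sum-0 {s} λ _ → refl)))
            (sum-all 3 λ k → weight-F (f o (suc (suc zero)) k))))
        (lin 3 (λ t3 x n → t3 := 3 :* n :+ K 3 ∷ [] ⊢ t3 :+ (x :+ x) :+ (t3 :+ K 0 :+ t3) := 9 :* (K 1 :+ n) :+ 2 :* x)
          (suc n * 3) extra n (trans (cong (3 +_) (*-comm n 3)) (+-comm 3 (3 * n))))

-- The special level for each residue of M modulo 3

index : ∀ m {k} → m < k → Σ (Fin k) λ i → toℕ i ≡ m
index m lt = fromℕ< lt , FinP.toℕ-fromℕ< lt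

infixr 2 _⊕-code_
_⊕-code_ : ∀ {A B : Set} {m n} → A ↔ Fin m → B ↔ Fin n → (A ⊎ B) ↔ Fin (m + n)
f ⊕-code g = ↔-trans (f ⊎-↔ g) (↔-sym FinP.+↔⊎)

module Transversal (n s μ e : ℕ) .{{_ : NonZero μ}} (2n<μ : 2 * n < μ) (β : Fin 3 → ℕ) where

  open Frame n s μ e 2n<μ β
  open Shift μ
  open Starter n

  big-free : ∀ {m} → 2 * n < m → Free m
  big-free lt p a b = (λ f → <-irrefl (sym f) (≤-<-trans (≤-trans (m≤m+n (left p) p) (right-bound a b)) lt)) ,
    λ f → <-irrefl (sym f) (≤-<-trans (right-bound a b) lt)

  hole-free : Free hole
  hole-free p a b = (left-hole a b ∘ sym) , (right-hole a b ∘ sym)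

  slide : ∀ {x y a b} c → x ⊕ a ≡ y ⊕ b → y ⊕ (b + c) ≡ x ⊕ (a + c)
  slide {x} {y} {a} {b} c f = trans (sym (⊕-assoc y b c)) (trans (cong (_⊕ c) (sym f)) (⊕-assoc x a c))

  -- The A-triples are translates of a transversal: the vertices (x, i) with x + η i = c for fixed
  -- c. By `steps`, α i = β i + η i - η (i + 1) modulo μ is their cross difference after the shift
  -- by β i; it has to be free. Distinct values of η keep them from being vertical like the columns
  -- of B.
  module Offset (η α : Fin 3 → ℕ) (η< : ∀ i → η i < μ)
    (steps : ∀ i {x y} → x ⊕ η i ≡ y ⊕ η (next i) → y ⊕ β i ≡ x ⊕ α i) where

    -- Within one translate c is 0; c = 1 serves triples that mix two consecutive translates.
    meet : ∀ i {x y} c → c + η i < μ → c + η i ≢ η (next i) → c + α i < μ → Free (c + α i) →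
      x ⊕ c ⊕ η i ≡ y ⊕ η (next i) → i ≢ next i × x ≢ y × Far i x (next i) y
    meet i {x} {y} c η<μ apart α< free f = next≢ i , x≢y , rise refl (c + α i) α< free (trans (steps i f) (⊕-assoc x c (α i)))
      where
      x≢y : x ≢ y
      x≢y refl = apart (⊕-cancel η<μ (η< (next i)) (trans (sym (⊕-assoc x c (η i))) f))

    flip : ∀ {i x j y} → i ≢ j × x ≢ y × Far i x j y → j ≢ i × y ≢ x × Far j y i x
    flip (a , b , rise f m m< free g) = a ∘ sym , b ∘ sym , fall f m m< free g
    flip (a , b , fall f m m< free g) = a ∘ sym , b ∘ sym , rise f m m< free g
    flip (a , _ , level f _ _ _ _) = ⊥-elim (a f)

    column-A : (∀ i → η i ≢ η (next i)) → (∀ i → α i < μ) → (∀ i → Free (α i)) →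
      ∀ i x j y → x ⊕ η i ≡ y ⊕ η j → (i , x) ≈ (j , y) ⊎ (i ≢ j × x ≢ y × Far i x j y)
    column-A apart α< free i x j y f with i FinP.≟ j
    ... | yes refl = inj₁ (refl , ⊕-injective (η i) f)
    ... | no ne with neighbours i j ne
    ...   | inj₁ refl = inj₂ (meet i 0 (η< i) (apart i) (α< i) (free i) (trans (cong (_⊕ η i) (⊕-0 x)) f))
    ...   | inj₂ refl = inj₂ (flip (meet j 0 (η< j) (apart j) (α< j) (free j) (trans (cong (_⊕ η j) (⊕-0 y)) (sym f))))

-- Residue e treats M = 6 t + 2 s ≡ e mod 3, where t = suc n. For e = 0 and e = 2 the layers have
-- even size 2 τ, and P joins x and x + τ.
module EvenLayers (n j s e : ℕ) where

  τ μ : ℕ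
  τ = suc (suc n + j)
  μ = τ + τ

  -- The numbers 2n + 1, 2n + 2 and 2n + 3 exceed all starter values and suffice for β, α and α + 1.
  -- The jump of η by 2 from layer 0 to layer 1 keeps adjacent offsets apart even after a shift by
  -- 1.
  β α η : Fin 3 → ℕ
  β zero = 2 + suc (2 * n)
  β (suc _) = suc (2 * n)
  α zero = suc (2 * n)
  α (suc _) = suc (suc (2 * n))
  η zero = 0
  η (suc zero) = 2
  η (suc (suc zero)) = 1

  2n<μ : 2 * n < μ
  2n<μ = lin 2 (λ n j → [] ⊢ 2 :* n :< K 1 :+ (K 1 :+ n :+ j) :+ (K 1 :+ (K 1 :+ n :+ j))) n j

  open Frame n s μ e 2n<μ β
  open Shift μ
  open Transversal n s μ e 2n<μ β

  β< : ∀ i → β i < μ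
  β< zero = lin 2 (λ n j → [] ⊢ K 2 :+ (K 1 :+ 2 :* n) :< K 1 :+ (K 1 :+ n :+ j) :+ (K 1 :+ (K 1 :+ n :+ j))) n j
  β< (suc _) = lin 2 (λ n j → [] ⊢ K 1 :+ 2 :* n :< K 1 :+ (K 1 :+ n :+ j) :+ (K 1 :+ (K 1 :+ n :+ j))) n j

  β-free : ∀ i → Free (β i)
  β-free zero = big-free (m<n+m (2 * n) {3} (s≤s z≤n))
  β-free (suc _) = big-free ≤-refl

  α< : ∀ i → suc (α i) < μ
  α< zero = lin 2 (λ n j → [] ⊢ K 2 :+ 2 :* n :< K 1 :+ (K 1 :+ n :+ j) :+ (K 1 :+ (K 1 :+ n :+ j))) n j
  α< (suc _) = lin 2 (λ n j → [] ⊢ K 3 :+ 2 :* n :< K 1 :+ (K 1 :+ n :+ j) :+ (K 1 :+ (K 1 :+ n :+ j))) n j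

  α-free : ∀ i c → Free (c + α i)
  α-free zero c = big-free (m≤n+m (suc (2 * n)) c)
  α-free (suc _) c = big-free (≤-trans (n≤1+n _) (m≤n+m (suc (suc (2 * n))) c))

  η< : ∀ i → suc (η i) < μ
  η< zero = lin 2 (λ n j → [] ⊢ K 1 :< K 1 :+ (K 1 :+ n :+ j) :+ (K 1 :+ (K 1 :+ n :+ j))) n j
  η< (suc zero) = lin 2 (λ n j → [] ⊢ K 3 :< K 1 :+ (K 1 :+ n :+ j) :+ (K 1 :+ (K 1 :+ n :+ j))) n j
  η< (suc (suc zero)) = lin 2 (λ n j → [] ⊢ K 2 :< K 1 :+ (K 1 :+ n :+ j) :+ (K 1 :+ (K 1 :+ n :+ j))) n j

  steps : ∀ i {x y} → x ⊕ η i ≡ y ⊕ η (next i) → y ⊕ β i ≡ x ⊕ α i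
  steps zero = slide (suc (2 * n))
  steps (suc zero) = slide (2 * n)
  steps (suc (suc zero)) = slide (suc (2 * n))

  n<τ : n < τ
  n<τ = s≤s (≤-trans (n≤1+n n) (m≤m+n (suc n) j))

  τ+n<μ : τ + n < μ
  τ+n<μ = +-monoʳ-< τ n<τ

  apart : ∀ i → η i ≢ η (next i)
  apart zero ()
  apart (suc zero) ()
  apart (suc (suc zero)) ()

  open Offset η α (<-trans (n<1+n _) ∘ η<) steps public

module Residue0 (n j : ℕ) where

  s : ℕ
  s = 3 * suc j

  open EvenLayers n j s 0
  open Frame n s μ 0 2n<μ β
  open Shift μ

  half : Fin μ → Bool
  half x = ⌊ τ ≤? toℕ x ⌋

  -- Without further vertices there are no stars, so q = 0 and all B-triples are columns. The type
  -- `half` is constant on columns and differs at antipodes.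
  open Blocks n s μ 0 2n<μ β β< β-free 0 τ n<τ τ+n<μ (↔-refl {A = Fin μ}) toℕ half (λ _ → false)

  member : Fin 3 × Fin τ → Fin 2 → Fin 3 × ℕ × Bool
  member (i , k) zero = i , toℕ k , false
  member (i , k) (suc zero) = i , toℕ k + τ , true

  viewP : ∀ i x → Σ (Fin 3 × Fin τ) λ c → Σ (Fin 2) λ b → member c b ≡ (i , toℕ x , half x)
  viewP i x with τ ≤? toℕ x
  ... | no lt = let (k , f) = index (toℕ x) (≰⇒> lt) in (i , k) , zero , cong (λ z → i , z , false) f
  ... | yes le = let (k , f) = index (toℕ x ∸ τ) (lin 3 (λ d x u → x :< u :+ u ∷ d :+ u := x ∷ [] ⊢ d :< u) (toℕ x ∸ τ) (toℕ x) τ (FinP.toℕ<n x) (m∸n+n≡m le)) in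
        (i , k) , suc zero , cong (λ z → i , z , true) (trans (cong (_+ τ) f) (m∸n+n≡m le))

  open Glue {0} (λ _ → half) (λ i x → inj₂ x , column x refl) (↔-sym FinP.*↔×) member viewP
    (λ c → level τ refl n<τ τ+n<μ (λ ()) (inj₂ z≤n))
    (↔-refl {A = Fin μ}) (λ i x → x ⊕ η i) (column-A apart (<-trans (n<1+n _) ∘ α<) (λ i → α-free i 0))
    (λ ()) (λ ()) (λ ()) (λ ()) (λ ()) (λ ()) (λ ()) (λ ()) (λ ()) (λ ()) (λ ())
  open Build assembled using (columns)

  residue0 : ∀ {m l} (w : Vec ℕ (2 + m)) → Sorted w → Vec.head w ≡ suc n + s → suc n + s + (suc n + s + suc n) ≡ Vec.sum w →
    (suc n + s) * (6 * suc n + 2 * s + 1) ≤ l + 2 * suc j → Columns w (3 * μ + 0) l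
  residue0 {l = l} w sorted main total room = columns w sorted main total (count n j) (vertices n j) z≤n (s≤s z≤n) (capacity room)
    where
    count : ∀ n j → n * (3 * (suc (suc n + j) + suc (suc n + j))) * 3 + ((suc (suc n + j) + suc (suc n + j)) * 3 + ((suc (suc n + j) + suc (suc n + j)) * 3 + 3 * suc (suc n + j) * 2)) ≡
      3 * (suc (suc n + j) + suc (suc n + j)) * (3 * suc n) + 0 * (3 * suc n + 0)
    count = solve-∀
    vertices : ∀ n j → 3 * (suc (suc n + j) + suc (suc n + j)) + 0 ≡ 6 * suc n + 2 * (3 * suc j)
    vertices = solve-∀
    capacity : (suc n + s) * (6 * suc n + 2 * s + 1) ≤ l + 2 * suc j →
      2 * (n * (3 * μ) + (μ + (μ + 3 * τ))) + 6 * (μ * s) + 0 * (2 * s + 1) ≤ 2 * l + 0 * 0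
    capacity h = +-cancelʳ-≤ (2 * (2 * suc j)) _ _ (≤-trans (≤-reflexive (e n j)) (≤-trans (*-monoʳ-≤ 2 h) (≤-reflexive (f l j))))
      where
      e : ∀ n j → 2 * (n * (3 * (suc (suc n + j) + suc (suc n + j))) + ((suc (suc n + j) + suc (suc n + j)) + ((suc (suc n + j) + suc (suc n + j)) + 3 * suc (suc n + j)))) +
        6 * ((suc (suc n + j) + suc (suc n + j)) * (3 * suc j)) + 0 * (2 * (3 * suc j) + 1) + 2 * (2 * suc j) ≡ 2 * ((suc n + 3 * suc j) * (6 * suc n + 2 * (3 * suc j) + 1))
      e = solve-∀
      f : ∀ l j → 2 * (l + 2 * suc j) ≡ 2 * l + 0 * 0 + 2 * (2 * suc j)
      f = solve-∀

module Residue2 (n j : ℕ) where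

  s : ℕ
  s = 3 * suc j + 1

  open EvenLayers n j s 2
  open Frame n s μ 2 2n<μ β
  open Shift μ

  -- The B-stars use differences d = τ - 1, so that the antipodal pairs remain for P.
  d : ℕ
  d = suc n + j

  n<d : n < d
  n<d = m≤m+n (suc n) j

  d+n<μ : d + n < μ
  d+n<μ = <-trans (+-monoˡ-< n (n<1+n d)) τ+n<μ

  -- The type must be constant on the columns of B, opposite at k and k + d for the stars, and
  -- opposite at x and x + τ for the pairs. As τ = d + 1, this is achieved by `false` below d and
  -- `true` from d on, except at the last position d + τ, whose antipode is d.
  data Region : ℕ → Set where
    r₁ : ∀ {x} (k : Fin (suc n)) → x ≡ toℕ k → Region x
    r₂ : ∀ {x} (c : Fin j) → x ≡ suc n + toℕ c → Region x
    r₃ : ∀ {x} (k : Fin (suc n)) → x ≡ toℕ k + d → Region x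
    r₄ : ∀ {x} (c : Fin (suc j)) → x ≡ d + suc n + toℕ c → Region x
    r₅ : ∀ {x} → x ≡ d + τ → Region x

  region : ∀ x → x < μ → Region x
  region x x< with x <? suc n
  ... | yes p = let (k , f) = index x p in r₁ k (sym f)
  ... | no p with x <? d
  ...   | yes q = let (c , f) = index (x ∸ suc n) (lin 4 (λ x t j c → c :+ t := x ∷ x :< t :+ j ∷ [] ⊢ c :< j) x (suc n) j (x ∸ suc n) (m∸n+n≡m (≮⇒≥ p)) q) in
                  r₂ c (trans (sym (m+[n∸m]≡n (≮⇒≥ p))) (cong (suc n +_) (sym f)))
  ...   | no q with x <? d + suc n
  ...     | yes u = let (k , f) = index (x ∸ d) (lin 4 (λ x t d c → c :+ d := x ∷ x :< d :+ t ∷ [] ⊢ c :< t) x (suc n) d (x ∸ d) (m∸n+n≡m (≮⇒≥ q)) u) in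
                    r₃ k (trans (sym (m∸n+n≡m (≮⇒≥ q))) (cong (_+ d) (sym f)))
  ...     | no u with x <? d + τ
  ...       | yes v = let (c , f) = index (x ∸ (d + suc n)) (lin 5 (λ x t d j c → c :+ (d :+ t) := x ∷ x :< d :+ (K 1 :+ (t :+ j)) ∷ [] ⊢ c :< K 1 :+ j) x (suc n) d j _ (m∸n+n≡m (≮⇒≥ u)) v) in
                      r₄ c (trans (sym (m+[n∸m]≡n (≮⇒≥ u))) (cong (d + suc n +_) (sym f)))
  ...       | no v = r₅ (lin 2 (λ x d → x :< K 1 :+ d :+ (K 1 :+ d) ∷ d :+ (K 1 :+ d) :≤ x ∷ [] ⊢ x := d :+ (K 1 :+ d)) x d x< (≮⇒≥ v))

  regionType : ∀ {x} → Region x → Bool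
  regionType (r₃ _ _) = true
  regionType (r₄ _ _) = true
  regionType _ = false

  type : Fin 3 → Fin μ → Bool
  type _ x = regionType (region (toℕ x) (FinP.toℕ<n x))

  Rest : Set
  Rest = Fin j ⊎ (Fin (suc j) ⊎ Fin 1)

  pos : Rest → ℕ
  pos (inj₁ c) = suc n + toℕ c
  pos (inj₂ (inj₁ c)) = d + suc n + toℕ c
  pos (inj₂ (inj₂ _)) = d + τ

  colType : Rest → Bool
  colType (inj₂ (inj₁ _)) = true
  colType _ = false

  open Blocks n s μ 2 2n<μ β β< β-free (suc n) d n<d d+n<μ (↔-refl {A = Fin j} ⊕-code (↔-refl {A = Fin (suc j)} ⊕-code ↔-refl {A = Fin 1})) pos colType (λ _ → false)

  regionB : ∀ i {x : Fin μ} (r : Region (toℕ x)) → Σ ClassB λ c → SpecB i x c (regionType r)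
  regionB i (r₁ k f) = inj₁ (i , k) , low k f
  regionB i (r₂ c f) = inj₂ (inj₁ c) , column (inj₁ c) f
  regionB i (r₃ k f) = inj₁ (i , k) , high k f
  regionB i (r₄ c f) = inj₂ (inj₂ (inj₁ c)) , column (inj₂ (inj₁ c)) f
  regionB i (r₅ f) = inj₂ (inj₂ (inj₂ zero)) , column (inj₂ (inj₂ zero)) f

  ClassP : Set
  ClassP = Fin 3 × (Fin d ⊎ Fin 1)

  member : ClassP → Fin 2 → Spot
  member (i , inj₁ k) zero = i , toℕ k , false
  member (i , inj₁ k) (suc zero) = i , toℕ k + τ , true
  member (i , inj₂ _) zero = i , d , true
  member (i , inj₂ _) (suc zero) = i , d + τ , false

  spot : ∀ i T {x y} → x ≡ y → _≡_ {A = Spot} (i , x , T) (i , y , T)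
  spot i T = cong (λ z → i , z , T)

  regionP : ∀ i {x} (r : Region x) → Σ ClassP λ c → Σ (Fin 2) λ b → member c b ≡ (i , x , regionType r)
  regionP i (r₁ k f) = (i , inj₁ (k ↑ˡ j)) , zero , spot i false (trans (FinP.toℕ-↑ˡ k j) (sym f))
  regionP i (r₂ c f) = (i , inj₁ (suc n ↑ʳ c)) , zero , spot i false (trans (FinP.toℕ-↑ʳ (suc n) c) (sym f))
  regionP i (r₃ zero f) = (i , inj₂ zero) , zero , spot i true (sym f)
  regionP i (r₃ (suc k) f) = let (h , g) = index (toℕ k) (<-trans (FinP.toℕ<n k) n<d) in
    (i , inj₁ h) , suc zero , spot i true (trans (cong (_+ τ) g) (trans (+-suc (toℕ k) d) (sym f)))
  regionP i (r₄ c f) = let (h , g) = index (n + toℕ c) (s≤s (+-monoʳ-≤ n (s≤s⁻¹ (FinP.toℕ<n c)))) in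
    (i , inj₁ h) , suc zero , spot i true (trans (cong (_+ τ) g) (trans
      (lin 3 (λ n c d → [] ⊢ n :+ c :+ (K 1 :+ d) := d :+ (K 1 :+ n) :+ c) n (toℕ c) d) (sym f)))
  regionP i (r₅ f) = (i , inj₂ zero) , suc zero , spot i false (sym f)

  τ≢d : τ ≢ d
  τ≢d = >⇒≢ (n<1+n d)

  pairs : ∀ c → Pair (member c zero) (member c (suc zero))
  pairs (i , inj₁ k) = level τ refl n<τ τ+n<μ (λ ()) (inj₁ τ≢d)
  pairs (i , inj₂ _) = level τ refl n<τ τ+n<μ (λ ()) (inj₁ τ≢d)

  ClassA : Set
  ClassA = (Fin 3 × Fin (suc n)) ⊎ Fin (suc j + suc j)

  -- The translates 2k and 2k + 1 are cut and regrouped into three pairs, from layer i in the first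
  -- to layer i + 1 in the second, and the second further vertex completes each pair in the missing
  -- letter. The translates from 2(n + 1) on stay whole.
  data SplitA (i : Fin 3) (c : ℕ) : ClassA → Set where
    first : ∀ k → c ≡ 2 * toℕ k → SplitA i c (inj₁ (i , k))
    second : ∀ k → c ≡ suc (2 * toℕ k) → SplitA i c (inj₁ (prev i , k))
    plain : ∀ r → c ≡ 2 * suc n + toℕ r → SplitA i c (inj₂ r)

  splitA : ∀ i c → c < μ → Σ ClassA (SplitA i c)
  splitA i c c< with c <? 2 * suc n
  splitA i c c< | no p = let (r , f) = index (c ∸ 2 * suc n) (lin 4 (λ c n j r → r :+ 2 :* (K 1 :+ n) := c ∷ c :< K 1 :+ (K 1 :+ n :+ j) :+ (K 1 :+ (K 1 :+ n :+ j)) ∷ [] ⊢ r :< K 1 :+ j :+ (K 1 :+ j)) c n j (c ∸ 2 * suc n) (m∸n+n≡m (≮⇒≥ p)) c<) in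
    inj₂ r , plain r (trans (sym (m+[n∸m]≡n (≮⇒≥ p))) (cong (2 * suc n +_) (sym f)))
  splitA i c c< | yes p with parity c
  ... | even k = let (h , f) = index k (*-cancelˡ-< 2 k (suc n) p) in inj₁ (i , h) , first h (cong (2 *_) (sym f))
  ... | odd k = let (h , f) = index k (*-cancelˡ-< 2 k (suc n) (<-trans (n<1+n _) p)) in inj₁ (prev i , h) , second h (cong (λ z → suc (2 * z)) (sym f))

  classA : Fin 3 → Fin μ → ClassA
  classA i x = proj₁ (splitA i (toℕ (x ⊕ η i)) (FinP.toℕ<n (x ⊕ η i)))

  base : ∀ i x j y → x ⊕ η i ≡ y ⊕ η j → (i , x) ≈ (j , y) ⊎ (i ≢ j × x ≢ y × Far i x j y)
  base = column-A apart (<-trans (n<1+n _) ∘ α<) (λ i → α-free i 0)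

  apart₁ : ∀ i → 1 + η i ≢ η (next i)
  apart₁ zero ()
  apart₁ (suc zero) ()
  apart₁ (suc (suc zero)) ()

  shifted : ∀ i x j y → i ≡ prev j → toℕ (y ⊕ η j) ≡ suc (toℕ (x ⊕ η i)) → i ≢ j × x ≢ y × Far i x j y
  shifted i x j y refl f = subst (λ j → i ≢ j × x ≢ y × Far i x j y) (next-prev j)
    (meet i 1 (η< i) (apart₁ i) (α< i) (α-free i 1) (trans (⊕-comm x 1 (η i)) (trans (sym (⊕-natural (trans f (+-comm 1 _)))) (cong (λ j → y ⊕ η j) (sym (next-prev j))))))

  same-A : ∀ i x j y → classA i x ≡ classA j y → (i , x) ≈ (j , y) ⊎ (i ≢ j × x ≢ y × Far i x j y)
  same-A i x j y t = go (proj₂ (splitA i (toℕ (x ⊕ η i)) (FinP.toℕ<n (x ⊕ η i)))) (proj₂ (splitA j (toℕ (y ⊕ η j)) (FinP.toℕ<n (y ⊕ η j)))) t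
    where
    go : ∀ {c c′} → SplitA i (toℕ (x ⊕ η i)) c → SplitA j (toℕ (y ⊕ η j)) c′ → c ≡ c′ → (i , x) ≈ (j , y) ⊎ (i ≢ j × x ≢ y × Far i x j y)
    go (first k f) (first _ g) refl = base i x j y (FinP.toℕ-injective (trans f (sym g)))
    go (second k f) (second _ g) eq with cong proj₂ (inj₁-injective eq)
    ... | refl = base i x j y (FinP.toℕ-injective (trans f (sym g)))
    go (plain r f) (plain _ g) refl = base i x j y (FinP.toℕ-injective (trans f (sym g)))
    go (first k f) (second _ g) refl = inj₂ (shifted i x j y refl (trans g (cong suc (sym f))))
    go (second k f) (first _ g) refl = inj₂ (flip (shifted j y i x refl (trans f (cong suc (sym g)))))

  -- The first further vertex completes the stars of B, the second the regrouped A-triples. The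
  -- class (ℓ + 1, k) has its members in the layers ℓ + 1 and ℓ + 2, so the letter ℓ is available.
  spokes : Fin 2 → Fin 3 → Fin (suc n) → ClassA ⊎ ClassB
  spokes zero ℓ k = inj₂ (inj₁ (ℓ , k))
  spokes (suc zero) ℓ k = inj₁ (inj₁ (next ℓ , k))

  spokes-A : ∀ o ℓ k i x → spokes o ℓ k ≡ inj₁ (classA i x) → ℓ ≢ i
  spokes-A (suc zero) ℓ k i x t = go (proj₂ (splitA i (toℕ (x ⊕ η i)) (FinP.toℕ<n (x ⊕ η i)))) (inj₁-injective t)
    where
    go : ∀ {c} → SplitA i (toℕ (x ⊕ η i)) c → inj₁ (next ℓ , k) ≡ c → ℓ ≢ i
    go (first _ _) refl = next≢ ℓ
    go (second _ _) eq f = next-next≢ i (trans (sym (next-prev i)) (cong next (trans (sym (cong proj₁ (inj₁-injective eq))) (cong next f))))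

  spokes-B : ∀ o ℓ k c → spokes o ℓ k ≡ inj₂ c → Σ (Fin (suc n)) λ k′ → c ≡ inj₁ (ℓ , k′)
  spokes-B zero ℓ k _ refl = k , refl
  spokes-B (suc zero) _ _ _ ()

  spokes-injective : ∀ o ℓ k o′ ℓ′ k′ → spokes o ℓ k ≡ spokes o′ ℓ′ k′ → o ≡ o′ × ℓ ≡ ℓ′ × k ≡ k′
  spokes-injective zero ℓ k zero ℓ′ k′ refl = refl , refl , refl
  spokes-injective zero _ _ (suc zero) _ _ ()
  spokes-injective (suc zero) _ _ zero _ _ ()
  spokes-injective (suc zero) ℓ k (suc zero) ℓ′ k′ t = let t′ = inj₁-injective (inj₁-injective t) in refl , next-injective (cong proj₁ t′) , cong proj₂ t′

  spokes-kind : ∀ o ℓ k ℓ′ k′ y c → spokes o ℓ k ≡ inj₁ y → spokes o ℓ′ k′ ≡ inj₂ c → ⊥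
  spokes-kind zero _ _ _ _ _ _ () _
  spokes-kind (suc zero) _ _ _ _ _ _ _ ()

  open Glue {0} type (λ i x → regionB i (region (toℕ x) (FinP.toℕ<n x))) (↔-trans (↔-refl {A = Fin 3} ×-↔ ↔-sym FinP.+↔⊎) (↔-sym FinP.*↔×)) member
    (λ i x → regionP i (region (toℕ x) (FinP.toℕ<n x))) pairs
    (↔-sym FinP.*↔× ⊕-code ↔-refl {A = Fin (suc j + suc j)}) classA same-A spokes (λ _ _ → nothing)
    spokes-A spokes-B spokes-injective spokes-kind (λ _ _ _ _ _ ()) (λ _ _ _ _ ()) (λ _ _ _ _ _ _ ()) (λ _ _ _ _ _ ()) (λ _ → sum-0 {s} (λ _ → refl))
  open Build assembled using (columns)

  residue2 : ∀ {m l} (w : Vec ℕ (2 + m)) → Sorted w → Vec.head w ≡ suc n + s → suc n + s + (suc n + s + suc n) ≡ Vec.sum w →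
    (suc n + s) * (6 * suc n + 2 * s + 1) ≤ l + 2 * suc j → Columns w (3 * μ + 2) l
  residue2 {l = l} w sorted main total room = columns w sorted main total (count n j) (vertices n j) z≤n (s≤s z≤n) (capacity room)
    where
    count : ∀ n j → n * (3 * (suc (suc n + j) + suc (suc n + j))) * 3 + ((3 * suc n + (suc j + suc j)) * 3 + ((3 * suc n + (j + (suc j + 1))) * 3 + 3 * (suc n + j + 1) * 2)) ≡
      3 * (suc (suc n + j) + suc (suc n + j)) * (3 * suc n) + 2 * (3 * suc n + 0)
    count = solve-∀
    vertices : ∀ n j → 3 * (suc (suc n + j) + suc (suc n + j)) + 2 ≡ 6 * suc n + 2 * (3 * suc j + 1)
    vertices = solve-∀
    capacity : (suc n + s) * (6 * suc n + 2 * s + 1) ≤ l + 2 * suc j →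
      2 * (n * (3 * μ) + ((3 * suc n + (suc j + suc j)) + ((3 * suc n + (j + (suc j + 1))) + 3 * (d + 1)))) + 6 * (μ * s) + 2 * (2 * s + 1) ≤ 2 * l + 2 * 0
    capacity h = +-cancelʳ-≤ (2 * (2 * suc j)) _ _ (≤-trans (≤-reflexive (e n j)) (≤-trans (*-monoʳ-≤ 2 h) (≤-reflexive (f l j))))
      where
      e : ∀ n j → 2 * (n * (3 * (suc (suc n + j) + suc (suc n + j))) + ((3 * suc n + (suc j + suc j)) + ((3 * suc n + (j + (suc j + 1))) + 3 * (suc n + j + 1)))) +
        6 * ((suc (suc n + j) + suc (suc n + j)) * (3 * suc j + 1)) + 2 * (2 * (3 * suc j + 1) + 1) + 2 * (2 * suc j) ≡ 2 * ((suc n + (3 * suc j + 1)) * (6 * suc n + 2 * (3 * suc j + 1) + 1))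
      e = solve-∀
      f : ∀ l j → 2 * (l + 2 * suc j) ≡ 2 * l + 2 * 0 + 2 * (2 * suc j)
      f = solve-∀

module Residue1 (n j : ℕ) where

  open Starter n using (hole; halves)

  s τ μ D : ℕ
  s = 2 + 3 * j
  τ = suc n + j
  μ = suc (τ + τ)
  D = suc (2 * n) ∸ hole

  hole≤n : hole ≤ n
  hole≤n = ≤-trans (m≤m+n hole _) (≤-reflexive halves)

  D+hole : D + hole ≡ suc (2 * n)
  D+hole = m∸n+n≡m (≤-trans hole≤n (≤-trans (m≤m+n n (n + 0)) (n≤1+n _)))

  -- For j = 0 the residues modulo μ = 2n + 3 that are not starter values are just the hole, 2n + 1
  -- and 2n + 2. So β runs through these three, and α is its cyclic shift; D is the distance from
  -- the hole to 2n + 1.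
  β α η : Fin 3 → ℕ
  β zero = hole
  β (suc zero) = suc (2 * n)
  β (suc (suc zero)) = suc (suc (2 * n))
  α zero = suc (2 * n)
  α (suc zero) = suc (suc (2 * n))
  α (suc (suc zero)) = hole
  η zero = suc D
  η (suc zero) = 1
  η (suc (suc zero)) = 0

  μ> : suc (suc (2 * n)) < μ
  μ> = lin 2 (λ n j → [] ⊢ K 2 :+ 2 :* n :< K 1 :+ (K 1 :+ n :+ j :+ (K 1 :+ n :+ j))) n j

  2n<μ : 2 * n < μ
  2n<μ = <-trans (n<1+n _) (<-trans (n<1+n _) μ>)

  hole<μ : hole < μ
  hole<μ = ≤-<-trans (≤-trans hole≤n (m≤m+n n (n + 0))) 2n<μ

  open Frame n s μ 1 2n<μ β
  open Shift μ
  open Transversal n s μ 1 2n<μ β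

  β< : ∀ i → β i < μ
  β< zero = hole<μ
  β< (suc zero) = <-trans (n<1+n _) μ>
  β< (suc (suc zero)) = μ>

  β-free : ∀ i → Free (β i)
  β-free zero = hole-free
  β-free (suc zero) = big-free ≤-refl
  β-free (suc (suc zero)) = big-free (n≤1+n _)

  α< : ∀ i → α i < μ
  α< zero = β< (suc zero)
  α< (suc zero) = μ>
  α< (suc (suc zero)) = hole<μ

  α-free : ∀ i → Free (α i)
  α-free zero = big-free ≤-refl
  α-free (suc zero) = big-free (n≤1+n _)
  α-free (suc (suc zero)) = hole-free

  η< : ∀ i → η i < μ
  η< zero = ≤-<-trans (s≤s (m∸n≤m (suc (2 * n)) hole)) μ>
  η< (suc zero) = ≤-<-trans (s≤s z≤n) μ>
  η< (suc (suc zero)) = ≤-<-trans z≤n μ>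

  apart : ∀ i → η i ≢ η (next i)
  apart zero f = <⇒≢ (m<n⇒0<n∸m (s≤s (≤-trans hole≤n (m≤m+n n (n + 0))))) (sym (suc-injective f))
  apart (suc zero) ()
  apart (suc (suc zero)) ()

  steps : ∀ i {x y} → x ⊕ η i ≡ y ⊕ η (next i) → y ⊕ β i ≡ x ⊕ α i
  steps zero {x} {y} f = trans (slide {x} {y} {D} {0} hole (⊕-injective 1 (trans (⊕-assoc x D 1) (trans (cong (x ⊕_) (+-comm D 1)) (trans f (sym (⊕-assoc y 0 1)))))))
    (cong (x ⊕_) D+hole)
  steps (suc zero) f = slide (suc (2 * n)) f
  steps (suc (suc zero)) {x} {y} f = trans (cong (y ⊕_) (sym (cong suc D+hole))) (slide hole f)

  open Offset η α η< steps

  n<τ : n < τ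
  n<τ = m≤m+n (suc n) j

  τ+n<μ : τ + n < μ
  τ+n<μ = s≤s (+-monoʳ-≤ τ (<⇒≤ n<τ))

  suc-τ+n<μ : suc τ + n < μ
  suc-τ+n<μ = s≤s (+-monoʳ-< τ n<τ)

  -- The pairs of P decide. `mid` joins (τ, 1) to a vertex of type `false`, which makes layer 1
  -- `false` below; `upper` forces `true` in layer 2, and then `turn` forces it in layer 0.
  lowType : Fin 3 → Bool
  lowType (suc zero) = false
  lowType _ = true

  Rest : Set
  Rest = Fin j ⊎ (Fin j ⊎ Fin 1)

  pos : Rest → ℕ
  pos (inj₁ c) = suc n + toℕ c
  pos (inj₂ (inj₁ c)) = τ + suc n + toℕ c
  pos (inj₂ (inj₂ _)) = τ + τ

  colType : Rest → Bool
  colType (inj₁ _) = true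
  colType (inj₂ _) = false

  open Blocks n s μ 1 2n<μ β β< β-free (suc n) τ n<τ τ+n<μ (↔-refl {A = Fin j} ⊕-code (↔-refl {A = Fin j} ⊕-code ↔-refl {A = Fin 1})) pos colType lowType

  -- The positions n, τ and 2τ stand alone because the exceptional pairs of P end there.
  data Region : ℕ → Set where
    r₁ : ∀ {x} (k : Fin n) → x ≡ toℕ k → Region x
    r₂ : ∀ {x} → x ≡ n → Region x
    r₃ : ∀ {x} (c : Fin j) → x ≡ suc n + toℕ c → Region x
    r₄ : ∀ {x} → x ≡ τ → Region x
    r₅ : ∀ {x} (k : Fin n) → x ≡ toℕ k + suc τ → Region x
    r₆ : ∀ {x} (c : Fin j) → x ≡ τ + suc n + toℕ c → Region x
    r₇ : ∀ {x} → x ≡ τ + τ → Region x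

  region : ∀ x → x < μ → Region x
  region x x< with <-cmp x n
  ... | tri< p _ _ = let (k , f) = index x p in r₁ k (sym f)
  ... | tri≈ _ p _ = r₂ p
  ... | tri> _ _ p with <-cmp x τ
  ...   | tri< q _ _ = let (c , f) = index (x ∸ suc n) (lin 4 (λ x t j c → c :+ t := x ∷ x :< t :+ j ∷ [] ⊢ c :< j) x (suc n) j (x ∸ suc n) (m∸n+n≡m p) q) in
                       r₃ c (trans (sym (m+[n∸m]≡n p)) (cong (suc n +_) (sym f)))
  ...   | tri≈ _ q _ = r₄ q
  ...   | tri> _ _ q with x <? τ + suc n
  ...     | yes u = let (k , f) = index (x ∸ suc τ) (lin 4 (λ x n t c → c :+ (K 1 :+ t) := x ∷ x :< t :+ (K 1 :+ n) ∷ [] ⊢ c :< n) x n τ (x ∸ suc τ) (m∸n+n≡m q) u) in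
                    r₅ k (trans (sym (m∸n+n≡m q)) (cong (_+ suc τ) (sym f)))
  ...     | no u with x <? τ + τ
  ...       | yes v = let (c , f) = index (x ∸ (τ + suc n)) (lin 5 (λ x n t j c → c :+ (t :+ (K 1 :+ n)) := x ∷ x :< t :+ (K 1 :+ n :+ j) ∷ [] ⊢ c :< j) x n τ j _ (m∸n+n≡m (≮⇒≥ u)) v) in
                      r₆ c (trans (sym (m+[n∸m]≡n (≮⇒≥ u))) (cong (τ + suc n +_) (sym f)))
  ...       | no v = r₇ (≤-antisym (s≤s⁻¹ x<) (≮⇒≥ v))

  regionType : Fin 3 → ∀ {x} → Region x → Bool
  regionType i (r₁ _ _) = lowType i
  regionType i (r₂ _) = lowType i
  regionType i (r₃ _ _) = true
  regionType i (r₄ _) = not (lowType i)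
  regionType i (r₅ _ _) = not (lowType i)
  regionType i (r₆ _ _) = false
  regionType i (r₇ _) = false

  regionB : ∀ i {x : Fin μ} (r : Region (toℕ x)) → Σ ClassB λ c → SpecB i x c (regionType i r)
  regionB i (r₁ k f) = let (h , g) = index (toℕ k) (<-trans (FinP.toℕ<n k) (n<1+n n)) in inj₁ (i , h) , low h (trans f (sym g))
  regionB i (r₂ f) = inj₁ (i , fromℕ n) , low (fromℕ n) (trans f (sym (FinP.toℕ-fromℕ n)))
  regionB i (r₃ c f) = inj₂ (inj₁ c) , column (inj₁ c) f
  regionB i (r₄ f) = inj₁ (i , zero) , high zero f
  regionB i (r₅ k f) = inj₁ (i , suc k) , high (suc k) (trans f (+-suc (toℕ k) τ))
  regionB i (r₆ c f) = inj₂ (inj₂ (inj₁ c)) , column (inj₂ (inj₁ c)) f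
  regionB i (r₇ f) = inj₂ (inj₂ (inj₂ zero)) , column (inj₂ (inj₂ zero)) f

  -- P joins x to x + τ or x + τ + 1. The vertices (τ,0), (τ,2) and (n,0), (n,1) left over are
  -- joined vertically, and (2 τ,0) is joined to the additional vertex.
  data Exception : Set where
    turn fork end mid : Exception

  exceptions : Exception ↔ Fin 4
  exceptions = mk↔ₛ′ to from to-from from-to
    where
    to : Exception → Fin 4
    to turn = zero
    to fork = suc zero
    to end = suc (suc zero)
    to mid = suc (suc (suc zero))
    from : Fin 4 → Exception
    from zero = turn
    from (suc zero) = fork
    from (suc (suc zero)) = end
    from (suc (suc (suc zero))) = mid
    to-from : ∀ i → to (from i) ≡ i
    to-from zero = refl
    to-from (suc zero) = refl
    to-from (suc (suc zero)) = refl
    to-from (suc (suc (suc zero))) = refl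
    from-to : ∀ i → from (to i) ≡ i
    from-to turn = refl
    from-to fork = refl
    from-to end = refl
    from-to mid = refl

  ClassP : Set
  ClassP = Exception ⊎ (Fin τ ⊎ ((Fin 2 × Fin n) ⊎ (Fin 2 × Fin j)))

  pattern except x = inj₁ x
  pattern upper k = inj₂ (inj₁ k)
  pattern near l k = inj₂ (inj₂ (inj₁ (l , k)))
  pattern far l c = inj₂ (inj₂ (inj₂ (l , c)))

  lower : Fin 2 → Fin 3
  lower zero = zero
  lower (suc zero) = suc zero

  member : ClassP → Fin 2 → Spot
  member (except turn) zero = zero , τ , false
  member (except turn) (suc zero) = suc (suc zero) , τ , false
  member (except fork) zero = suc zero , n , false
  member (except fork) (suc zero) = zero , n , true
  member (except end) _ = zero , τ + τ , false
  member (except mid) zero = suc zero , τ , true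
  member (except mid) (suc zero) = suc zero , τ + τ , false
  member (upper k) zero = suc (suc zero) , toℕ k , true
  member (upper k) (suc zero) = suc (suc zero) , toℕ k + suc τ , false
  member (near l k) zero = lower l , toℕ k , lowType (lower l)
  member (near l k) (suc zero) = lower l , toℕ k + suc τ , not (lowType (lower l))
  member (far l c) zero = lower l , suc n + toℕ c , true
  member (far l c) (suc zero) = lower l , suc n + toℕ c + τ , false

  spot : ∀ i T {x y} → x ≡ y → _≡_ {A = Spot} (i , x , T) (i , y , T)
  spot i T = cong (λ z → i , z , T)

  regionP : ∀ i {x} (r : Region x) → Σ ClassP λ c → Σ (Fin 2) λ b → member c b ≡ (i , x , regionType i r)
  regionP zero (r₁ k f) = near zero k , zero , spot zero true (sym f)
  regionP (suc zero) (r₁ k f) = near (suc zero) k , zero , spot (suc zero) false (sym f)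
  regionP (suc (suc zero)) (r₁ k f) = let (h , g) = index (toℕ k) (<-trans (FinP.toℕ<n k) n<τ) in upper h , zero , spot _ true (trans g (sym f))
  regionP zero (r₂ f) = except fork , suc zero , spot zero true (sym f)
  regionP (suc zero) (r₂ f) = except fork , zero , spot (suc zero) false (sym f)
  regionP (suc (suc zero)) (r₂ f) = let (h , g) = index n n<τ in upper h , zero , spot _ true (trans g (sym f))
  regionP zero (r₃ c f) = far zero c , zero , spot zero true (sym f)
  regionP (suc zero) (r₃ c f) = far (suc zero) c , zero , spot (suc zero) true (sym f)
  regionP (suc (suc zero)) (r₃ c f) = upper (suc n ↑ʳ c) , zero , spot _ true (trans (FinP.toℕ-↑ʳ (suc n) c) (sym f))
  regionP zero (r₄ f) = except turn , zero , spot zero false (sym f)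
  regionP (suc zero) (r₄ f) = except mid , zero , spot (suc zero) true (sym f)
  regionP (suc (suc zero)) (r₄ f) = except turn , suc zero , spot _ false (sym f)
  regionP zero (r₅ k f) = near zero k , suc zero , spot zero false (sym f)
  regionP (suc zero) (r₅ k f) = near (suc zero) k , suc zero , spot (suc zero) true (sym f)
  regionP (suc (suc zero)) (r₅ k f) = let (h , g) = index (toℕ k) (<-trans (FinP.toℕ<n k) n<τ) in upper h , suc zero , spot _ false (trans (cong (_+ suc τ) g) (sym f))
  regionP zero (r₆ c f) = far zero c , suc zero , spot zero false (trans (lin 3 (λ n c t → [] ⊢ K 1 :+ n :+ c :+ t := t :+ (K 1 :+ n) :+ c) n (toℕ c) τ) (sym f))
  regionP (suc zero) (r₆ c f) = far (suc zero) c , suc zero , spot (suc zero) false (trans (lin 3 (λ n c t → [] ⊢ K 1 :+ n :+ c :+ t := t :+ (K 1 :+ n) :+ c) n (toℕ c) τ) (sym f))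
  regionP (suc (suc zero)) (r₆ c f) = let (h , g) = index (n + toℕ c) (s≤s (+-monoʳ-≤ n (<⇒≤ (FinP.toℕ<n c)))) in
    upper h , suc zero , spot _ false (trans (cong (_+ suc τ) g) (trans (lin 3 (λ n c t → [] ⊢ n :+ c :+ (K 1 :+ t) := t :+ (K 1 :+ n) :+ c) n (toℕ c) τ) (sym f)))
  regionP zero (r₇ f) = except end , zero , spot zero false (sym f)
  regionP (suc zero) (r₇ f) = except mid , suc zero , spot (suc zero) false (sym f)
  regionP (suc (suc zero)) (r₇ f) = let (h , g) = index (n + j) ≤-refl in
    upper h , suc zero , spot _ false (trans (cong (_+ suc τ) g) (trans (+-suc (n + j) τ) (sym f)))

  beside : ∀ {x} → x ≡ n ⊎ x ≡ τ → ∀ c → x ≢ pos c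
  beside (inj₁ refl) (inj₁ c) f = lin 2 (λ n c → n := K 1 :+ n :+ c ∷ [] ⊢ absurd) n (toℕ c) f
  beside (inj₁ refl) (inj₂ (inj₁ c)) f = lin 3 (λ n t c → n := t :+ (K 1 :+ n) :+ c ∷ [] ⊢ absurd) n τ (toℕ c) f
  beside (inj₁ refl) (inj₂ (inj₂ _)) f = lin 2 (λ n t → n := t :+ t ∷ n :< t ∷ [] ⊢ absurd) n τ f n<τ
  beside (inj₂ refl) (inj₁ c) f = <-irrefl (sym (+-cancelˡ-≡ (suc n) _ _ f)) (FinP.toℕ<n c)
  beside (inj₂ refl) (inj₂ (inj₁ c)) f = lin 3 (λ n t c → t := t :+ (K 1 :+ n) :+ c ∷ [] ⊢ absurd) n τ (toℕ c) f
  beside (inj₂ refl) (inj₂ (inj₂ _)) f = lin 2 (λ n t → t := t :+ t ∷ n :< t ∷ [] ⊢ absurd) n τ f n<τ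

  opposite : ∀ T → T ≢ not T
  opposite false ()
  opposite true ()

  pairs : ∀ c → Pair (member c zero) (member c (suc zero))
  pairs (except turn) = vertical refl (λ ()) (λ ()) (beside (inj₂ refl))
  pairs (except fork) = vertical refl (λ ()) (λ ()) (beside (inj₁ refl))
  pairs (except end) = single refl
  pairs (except mid) = level τ refl n<τ τ+n<μ (λ ()) (inj₂ n<τ)
  pairs (upper k) = level (suc τ) refl (<-trans n<τ (n<1+n τ)) suc-τ+n<μ (λ ()) (inj₁ (>⇒≢ (n<1+n τ)))
  pairs (near l k) = level (suc τ) refl (<-trans n<τ (n<1+n τ)) suc-τ+n<μ (opposite (lowType (lower l))) (inj₁ (>⇒≢ (n<1+n τ)))
  pairs (far l c) = level τ refl n<τ τ+n<μ (λ ()) (inj₂ (m≤m+n (suc n) (toℕ c)))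

  spokes : Fin 1 → Fin 3 → Fin (suc n) → Fin μ ⊎ ClassB
  spokes _ ℓ k = inj₂ (inj₁ (ℓ , k))

  spokes-B : ∀ o ℓ k c → spokes o ℓ k ≡ inj₂ c → Σ (Fin (suc n)) λ k′ → c ≡ inj₁ (ℓ , k′)
  spokes-B _ ℓ k _ refl = k , refl

  spokes-injective : ∀ o ℓ k o′ ℓ′ k′ → spokes o ℓ k ≡ spokes o′ ℓ′ k′ → o ≡ o′ × ℓ ≡ ℓ′ × k ≡ k′
  spokes-injective zero ℓ k zero ℓ′ k′ refl = refl , refl , refl

  -- The pair of the further vertex with (2τ, 0) takes its first A-slot beyond the triples. So
  -- `extra` is 1, and the leave degree of this vertex is 2s - 2.
  tip : Fin 1 → Fin s → Maybe ClassP
  tip _ zero = just (except end)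
  tip _ (suc _) = nothing

  tip-injective : ∀ o r o′ r′ c → tip o r ≡ just c → tip o′ r′ ≡ just c → o ≡ o′ × r ≡ r′
  tip-injective zero zero zero zero _ _ _ = refl , refl
  tip-injective _ (suc _) _ _ _ () _
  tip-injective _ _ _ (suc _) _ _ ()

  tip-P : ∀ i {x} (r : Region x) → proj₁ (regionP i r) ≡ except end → (i ≡ zero × x ≡ τ + τ × regionType i r ≡ false) × proj₁ (proj₂ (regionP i r)) ≡ zero
  tip-P zero (r₁ _ _) ()
  tip-P (suc zero) (r₁ _ _) ()
  tip-P (suc (suc zero)) (r₁ _ _) ()
  tip-P zero (r₂ _) ()
  tip-P (suc zero) (r₂ _) ()
  tip-P (suc (suc zero)) (r₂ _) ()
  tip-P zero (r₃ _ _) ()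
  tip-P (suc zero) (r₃ _ _) ()
  tip-P (suc (suc zero)) (r₃ _ _) ()
  tip-P zero (r₄ _) ()
  tip-P (suc zero) (r₄ _) ()
  tip-P (suc (suc zero)) (r₄ _) ()
  tip-P zero (r₅ _ _) ()
  tip-P (suc zero) (r₅ _ _) ()
  tip-P (suc (suc zero)) (r₅ _ _) ()
  tip-P zero (r₆ _ _) ()
  tip-P (suc zero) (r₆ _ _) ()
  tip-P (suc (suc zero)) (r₆ _ _) ()
  tip-P zero (r₇ f) _ = (refl , f , refl) , refl
  tip-P (suc zero) (r₇ _) ()
  tip-P (suc (suc zero)) (r₇ _) ()

  regionOf : ∀ x → Region (toℕ x)
  regionOf x = region (toℕ x) (FinP.toℕ<n x)

  from-tip : ∀ o r {c} → tip o r ≡ just c → c ≡ except end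
  from-tip _ zero refl = refl

  tip-outside : ∀ o r i x → tip o r ≡ just (proj₁ (regionP i (regionOf x))) →
    zero ≢ letterP i (regionType i (regionOf x)) × proj₁ (proj₂ (regionP i (regionOf x))) ≡ zero
  tip-outside o r i x t with tip-P i (regionOf x) (from-tip o r t)
  ... | (refl , _ , T) , b rewrite T = (λ ()) , b

  tip-B : ∀ o r k i x → tip o r ≡ just (proj₁ (regionP i (regionOf x))) → proj₁ (regionB i {x} (regionOf x)) ≢ inj₁ k
  tip-B o r k i x t = go (proj₂ (regionB i {x} (regionOf x))) (proj₁ (proj₂ (proj₁ (tip-P i (regionOf x) (from-tip o r t)))))
    where
    go : ∀ {c T} → SpecB i x c T → toℕ x ≡ τ + τ → c ≢ inj₁ k
    go (low h f) g _ = lin 4 (λ k x t n → x := t :+ t ∷ x := k ∷ k :< K 1 :+ n ∷ n :< t ∷ [] ⊢ absurd) (toℕ h) (toℕ x) τ n g f (FinP.toℕ<n h) n<τ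
    go (high h f) g _ = lin 4 (λ k x t n → x := t :+ t ∷ x := k :+ t ∷ k :< K 1 :+ n ∷ n :< t ∷ [] ⊢ absurd) (toℕ h) (toℕ x) τ n g f (FinP.toℕ<n h) n<τ

  open Glue {1} (λ i x → regionType i (regionOf x)) (λ i x → regionB i (regionOf x))
    (exceptions ⊕-code (↔-refl {A = Fin τ} ⊕-code (↔-sym FinP.*↔× ⊕-code ↔-sym FinP.*↔×))) member
    (λ i x → regionP i (regionOf x)) pairs
    (↔-refl {A = Fin μ}) (λ i x → x ⊕ η i) (column-A apart α< α-free) spokes tip
    (λ _ _ _ _ _ ()) spokes-B spokes-injective (λ _ _ _ _ _ _ _ ()) tip-injective tip-outside (λ _ _ _ _ _ _ _ ()) tip-B (λ _ → cong suc (sum-0 {suc (3 * j)} (λ _ → refl)))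
  open Build assembled using (columns)

  residue1 : ∀ {m l} (w : Vec ℕ (2 + m)) → Sorted w → Vec.head w ≡ suc n + s → suc n + s + (suc n + s + suc n) ≡ Vec.sum w →
    (suc n + s) * (6 * suc n + 2 * s + 1) ≤ l + (2 * j + 1) → Columns w (3 * μ + 1) l
  residue1 {l = l} w sorted main total room = columns w sorted main total (count n j) (vertices n j) ≤-refl (s≤s z≤n) (capacity room)
    where
    count : ∀ n j → n * (3 * suc (suc n + j + (suc n + j))) * 3 + (suc (suc n + j + (suc n + j)) * 3 + ((3 * suc n + (j + (j + 1))) * 3 + (4 + (suc n + j + (2 * n + 2 * j))) * 2)) ≡
      3 * suc (suc n + j + (suc n + j)) * (3 * suc n) + 1 * (3 * suc n + 1)
    count = solve-∀
    vertices : ∀ n j → 3 * suc (suc n + j + (suc n + j)) + 1 ≡ 6 * suc n + 2 * (2 + 3 * j)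
    vertices = solve-∀
    capacity : (suc n + s) * (6 * suc n + 2 * s + 1) ≤ l + (2 * j + 1) →
      2 * (n * (3 * μ) + (μ + ((3 * suc n + (j + (j + 1))) + (4 + (τ + (2 * n + 2 * j)))))) + 6 * (μ * s) + 1 * (2 * s + 1) ≤ 2 * l + 1 * 1
    -- After doubling, the left side exceeds an even number by 1; the summand 1 * 1, from the extra
    -- pair, absorbs it.
    capacity h = +-cancelʳ-≤ (2 * (2 * j + 1)) _ _ (≤-trans (≤-reflexive (e n j)) (≤-trans (+-monoˡ-≤ 1 (*-monoʳ-≤ 2 h)) (≤-reflexive (f l j))))
      where
      e : ∀ n j → 2 * (n * (3 * suc (suc n + j + (suc n + j))) + (suc (suc n + j + (suc n + j)) + ((3 * suc n + (j + (j + 1))) + (4 + (suc n + j + (2 * n + 2 * j)))))) +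
        6 * (suc (suc n + j + (suc n + j)) * (2 + 3 * j)) + 1 * (2 * (2 + 3 * j) + 1) + 2 * (2 * j + 1) ≡ 2 * ((suc n + (2 + 3 * j)) * (6 * suc n + 2 * (2 + 3 * j) + 1)) + 1
      e = solve-∀
      f : ∀ l j → 2 * (l + (2 * j + 1)) + 1 ≡ 2 * l + 1 * 1 + 2 * (2 * j + 1)
      f = solve-∀

-- The bound

data Thirds : ℕ → Set where
  thirds₀ : ∀ k → Thirds (3 * k)
  thirds₁ : ∀ k → Thirds (3 * k + 1)
  thirds₂ : ∀ k → Thirds (2 + 3 * k)

thirds : ∀ s → Thirds s
thirds zero = thirds₀ 0
thirds (suc s) with thirds s
... | thirds₀ k = subst Thirds (+-comm (3 * k) 1) (thirds₁ k)
... | thirds₁ k = subst Thirds (cong suc (+-comm 1 (3 * k))) (thirds₂ k)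
... | thirds₂ k = subst Thirds (*-suc 3 k) (thirds₀ (suc k))

-- The differences 1, ..., p of a cyclic system need M > 2p. At M = 2p the complete graph takes
-- over, and ⌊2s/2⌋ = s coordinates are saved.
two-rows : ∀ {m} (w : Vec ℕ (2 + m)) p s M {n} → Sorted w → Vec.head w ≡ p + s → p + s + (p + 0) ≡ Vec.sum w → 1 ≤ p →
  2 * p ≤ M → (p + s) * M ≤ n → (M ≡ 2 * p → (p + s) * (M + 1) ≤ n + s) → Columns w M n
two-rows w p s M {n} sorted main total 1≤p M≥ room tight with M ≟ 2 * p
... | no ne = CyclicDesign.columns 0 p M (≤-trans (≤-reflexive (+-comm (2 * p) 1)) (≤∧≢⇒< M≥ (λ e → ne (sym e)))) (inj₁ 1≤p) w sorted s main total (λ ()) room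
... | yes refl = PairDesign.columns w sorted main 1≤p (m≤m+n p s) total
  (+-cancelʳ-≤ s _ _ (≤-trans (≤-reflexive (e p s)) (tight refl)))
  where
  e : ∀ p s → 2 * p * (p + s) + p + s ≡ (p + s) * (2 * p + 1)
  e = solve-∀

steiner-size : ∀ t → 1 + 3 * (2 * t) ≡ 1 + 6 * t
steiner-size t = cong (1 +_) (sym (*-assoc 3 2 t))

bose-size : ∀ t → 2 * t + (suc (2 * t) + suc (2 * t)) ≡ 2 + 6 * t
bose-size t = lin 1 (λ t → [] ⊢ 2 :* t :+ (K 1 :+ 2 :* t :+ (K 1 :+ 2 :* t)) := K 2 :+ 6 :* t) t

cyclic-size : ∀ t → 6 * t + 2 * 0 + 1 + 2 ≡ 6 * t + 3
cyclic-size = solve-∀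

residue0-size : ∀ h k → 3 * (suc (suc h + k) + suc (suc h + k)) + 0 ≡ 6 * suc h + 2 * (3 * suc k)
residue0-size = solve-∀

residue2-size : ∀ h k → 3 * (suc (suc h + k) + suc (suc h + k)) + 2 ≡ 6 * suc h + 2 * (3 * suc k + 1)
residue2-size = solve-∀

residue1-size : ∀ h k → 3 * suc (suc h + k + (suc h + k)) + 1 ≡ 6 * suc h + 2 * (2 + 3 * k)
residue1-size = solve-∀

double₁ : ∀ k → 2 * (3 * suc k + 1) ≡ 6 * suc k + 2
double₁ = solve-∀

double₂ : ∀ k → 2 * (2 + 3 * k) ≡ 6 * k + 4
double₂ = solve-∀

-- For s = 0 the differences reach 3t + 1, which is below M / 2 only from M = 6t + 3 on; 6t + 1 and
-- 6t + 2 are the cases of Skolem and Bose.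
three-rows-loose : ∀ {m} (w : Vec ℕ (2 + m)) t s M {n} → Sorted w → Vec.head w ≡ t + s → t + s + (t + s + t) ≡ Vec.sum w → 1 ≤ t →
  6 * t + 2 * s < M → (t + s) * M ≤ n → Columns w M n
three-rows-loose w t (suc s) M sorted main total 1≤t M> room =
  CyclicDesign.columns t (suc s) M (≤-trans (≤-reflexive (+-comm (6 * t + 2 * suc s) 1)) M>) (inj₁ (s≤s z≤n)) w sorted 0
    (trans main (sym (+-identityʳ (t + suc s)))) (trans (cong (_+ (t + suc s + t)) (+-identityʳ (t + suc s))) total) (λ _ → +-identityʳ (t + suc s))
    (≤-trans (≤-reflexive (cong (_* M) (+-identityʳ (t + suc s)))) room)
three-rows-loose w t zero M {n} sorted main total 1≤t M> room with M ≟ suc (6 * t) | M ≟ 2 + 6 * t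
... | yes refl | _ = subst (λ z → Columns w z n) (steiner-size t)
  (ZigzagDesign.columns t {{>-nonZero 1≤t}} w sorted main′ total′ (≤-trans (≤-reflexive (trans (cong (t *_) (steiner-size t)) (cong (_* suc (6 * t)) (sym (+-identityʳ t))))) room))
  where
  main′ = trans main (+-identityʳ t)
  total′ = trans (cong₂ (λ x y → x + (y + t)) (sym (+-identityʳ t)) (sym (+-identityʳ t))) total
... | no _ | yes refl = subst (λ z → Columns w z n) (bose-size t)
  (Bose.columns t w sorted main′ total′ (≤-trans (≤-reflexive (trans (cong (t *_) (+-comm (6 * t) 2)) (cong (_* (2 + 6 * t)) (sym (+-identityʳ t))))) room))
  where
  main′ = trans main (+-identityʳ t)
  total′ = trans (cong₂ (λ x y → x + (y + t)) (sym (+-identityʳ t)) (sym (+-identityʳ t))) total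
... | no ne₁ | no ne₂ = CyclicDesign.columns t 0 M (≤-trans (m≤m+n (6 * t + 2 * 0 + 1) 2) (≤-trans (≤-reflexive (cyclic-size t)) M≥₃)) (inj₂ M≥₃) w sorted 0
    (trans main (sym (+-identityʳ (t + 0)))) (trans (cong (_+ (t + 0 + t)) (+-identityʳ (t + 0))) total) (λ _ → +-identityʳ (t + 0))
    (≤-trans (≤-reflexive (cong (_* M) (+-identityʳ (t + 0)))) room)
  where
  M≥₃ : 6 * t + 3 ≤ M
  M≥₃ = ≤-trans (≤-reflexive (+-comm (6 * t) 3)) (≤∧≢⇒< (≤∧≢⇒< (≤-trans (≤-reflexive (cong suc (sym (+-identityʳ (6 * t))))) M>)
    (λ z → ne₁ (sym z))) (λ z → ne₂ (sym z)))

-- The upper bound on n says that no further word fits, the last hypothesis that at most f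
-- coordinates are missing for it. For s ≤ 1 this makes f = 0, and the two contradict each other.
three-rows-tight : ∀ {m} (w : Vec ℕ (2 + m)) h s f {n} → Sorted w → Vec.head w ≡ suc h + s → suc h + s + (suc h + s + suc h) ≡ Vec.sum w →
  f * 3 ≤ 2 * s → n < (suc h + s) * (6 * suc h + 2 * s + 1) → (suc h + s) * (6 * suc h + 2 * s + 1) ≤ n + f → Columns w (6 * suc h + 2 * s) n
three-rows-tight w h s f {n} sorted main total f≤ room< tight with thirds s
... | thirds₀ zero = ⊥-elim (<-irrefl refl (<-≤-trans room< (≤-trans tight (≤-reflexive (trans (cong (n +_) f≡0) (+-identityʳ n))))))
  where
  f≡0 : f ≡ 0
  f≡0 = lin 1 (λ f → 3 :* f :≤ K 0 ∷ [] ⊢ f := K 0) f (≤-trans (≤-reflexive (*-comm 3 f)) f≤)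
... | thirds₁ zero = ⊥-elim (<-irrefl refl (<-≤-trans room< (≤-trans tight (≤-reflexive (trans (cong (n +_) f≡0) (+-identityʳ n))))))
  where
  f≡0 : f ≡ 0
  f≡0 = lin 1 (λ f → 3 :* f :≤ K 2 ∷ [] ⊢ f := K 0) f (≤-trans (≤-reflexive (*-comm 3 f)) f≤)
... | thirds₀ (suc k) = subst (λ z → Columns w z n) (residue0-size h k) (Residue0.residue0 h k w sorted main total (≤-trans tight (+-monoʳ-≤ n f≤′)))
  where
  f≤′ : f ≤ 2 * suc k
  f≤′ = lin 2 (λ f k → 3 :* f :≤ 6 :* (K 1 :+ k) ∷ [] ⊢ f :≤ 2 :* (K 1 :+ k)) f k (≤-trans (≤-reflexive (*-comm 3 f)) (≤-trans f≤ (≤-reflexive (sym (*-assoc 2 3 (suc k))))))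
... | thirds₁ (suc k) = subst (λ z → Columns w z n) (residue2-size h k) (Residue2.residue2 h k w sorted main total (≤-trans tight (+-monoʳ-≤ n f≤′)))
  where
  f≤′ : f ≤ 2 * suc k
  f≤′ = lin 2 (λ f k → 3 :* f :≤ 6 :* (K 1 :+ k) :+ K 2 ∷ [] ⊢ f :≤ 2 :* (K 1 :+ k)) f k (≤-trans (≤-reflexive (*-comm 3 f)) (≤-trans f≤ (≤-reflexive (double₁ k))))
... | thirds₂ k = subst (λ z → Columns w z n) (residue1-size h k) (Residue1.residue1 h k w sorted main total (≤-trans tight (+-monoʳ-≤ n f≤′)))
  where
  f≤′ : f ≤ 2 * k + 1
  f≤′ = lin 2 (λ f k → 3 :* f :≤ 6 :* k :+ K 4 ∷ [] ⊢ f :≤ 2 :* k :+ K 1) f k (≤-trans (≤-reflexive (*-comm 3 f)) (≤-trans f≤ (≤-reflexive (double₂ k))))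

three-rows : ∀ {m} (w : Vec ℕ (2 + m)) t s M f {n} → Sorted w → Vec.head w ≡ t + s → t + s + (t + s + t) ≡ Vec.sum w → 1 ≤ t →
  f * 3 ≤ 2 * s → 6 * t + 2 * s ≤ M → (t + s) * M ≤ n → n < (t + s) * (M + 1) → (M ≡ 6 * t + 2 * s → (t + s) * (M + 1) ≤ n + f) → Columns w M n
three-rows w t s M f sorted main total 1≤t f≤ M≥ room room< tight with M ≟ 6 * t + 2 * s
three-rows w t s M f sorted main total 1≤t f≤ M≥ room room< tight | no ne = three-rows-loose w t s M sorted main total 1≤t (≤∧≢⇒< M≥ (λ e → ne (sym e))) room
three-rows w (suc h) s _ f sorted main total 1≤t f≤ M≥ room room< tight | yes refl = three-rows-tight w h s f sorted main total f≤ room< (tight refl)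

ceilDiv-spec : ∀ n d → 1 ≤ d → n ≤ ceilDiv n d * d × ceilDiv n d * d < n + d
ceilDiv-spec n (suc d) _ = lin 4 (λ n d r q → n :+ d := r :+ q ∷ r :< K 1 :+ d ∷ [] ⊢ n :≤ q) n d _ _ (m≡m%n+[m/n]*n (n + d) (suc d)) (m%n<n (n + d) (suc d)) ,
  lin 4 (λ n d r q → n :+ d := r :+ q ∷ [] ⊢ q :< n :+ (K 1 :+ d)) n d _ _ (m≡m%n+[m/n]*n (n + d) (suc d))

floorDiv-spec : ∀ n d → 1 ≤ d → floorDiv n d * d ≤ n × n < floorDiv n d * d + d
floorDiv-spec n (suc d) _ = lin 3 (λ n r q → n := r :+ q ∷ [] ⊢ q :≤ n) n _ _ (m≡m%n+[m/n]*n n (suc d)) ,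
  lin 4 (λ n d r q → n := r :+ q ∷ r :< K 1 :+ d ∷ [] ⊢ n :< q :+ (K 1 :+ d)) n d _ _ (m≡m%n+[m/n]*n n (suc d)) (m%n<n n (suc d))

floorDiv-unique : ∀ {n} d M r → n ≡ d * M + r → r < d → floorDiv n d ≡ M
floorDiv-unique {n} d@(suc _) M r e r< = ≤-antisym
  (s≤s⁻¹ (*-cancelʳ-< d (floorDiv n d) (suc M) (≤-<-trans (proj₁ (floorDiv-spec n d (s≤s z≤n)))
    (lin 4 (λ n m r d → n := m :+ r ∷ r :< d ∷ [] ⊢ n :< d :+ m) n (M * d) r d (trans e (cong (_+ r) (*-comm d M))) r<))))
  (≤-floorDiv d (s≤s z≤n) (≤-trans (m≤m+n (M * d) r) (≤-reflexive (sym (trans e (cong (_+ r) (*-comm d M)))))))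

tri-double : ∀ n → 2 * tri n + n ≡ n * n
tri-double zero = refl
tri-double (suc n) = lin 3 (λ n t q → 2 :* t :+ n := q ∷ [] ⊢ 2 :* (n :+ t) :+ (K 1 :+ n) := K 1 :+ n :+ n :+ q) n (tri n) (n * n) (tri-double n)
  ∙ cong suc (trans (+-assoc n n (n * n)) (cong (n +_) (sym (*-suc n n))))
  where
  infixr 4 _∙_
  _∙_ : ∀ {x y z : ℕ} → x ≡ y → y ≡ z → x ≡ z
  _∙_ = trans

-- After division by L the count reads 0 ≤ 2 s - (L + 1)(f + 1).
pair-count-fails : ∀ L Q s a f r → suc L * a ≡ Q + 2 * s → r + suc f ≡ a → 2 * s < suc L * suc f → 1 ≤ L →
  L * (L * Q * (Q + s)) ≤ tri (L * Q) + (a * (L * Q) + r) * tri (suc L) → ⊥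
pair-count-fails L Q s a f r full rest deficit 1≤L count =
  lin 6 (λ c t u m L y → c :≤ t :+ u ∷ 2 :* t :+ m := y ∷ [] ⊢ 2 :* c :+ m :≤ y :+ 2 :* u) (L * (L * Q * (Q + s))) (tri (L * Q)) ((a * (L * Q) + r) * tri (suc L)) (L * Q) L (L * Q * (L * Q)) count (tri-double (L * Q))
    |> λ h → lin 7 (λ c m y u v LQs L → c := 2 :* y :+ 2 :* LQs ∷ c :+ m :≤ y :+ u ∷ u :+ L :≤ v ∷ v := y :+ 2 :* LQs :+ m ∷ K 1 :≤ L ∷ [] ⊢ absurd)
      (2 * (L * (L * Q * (Q + s)))) (L * Q) (L * Q * (L * Q)) (2 * ((a * (L * Q) + r) * tri (suc L))) (L * (L * Q * (Q + 2 * s) + Q)) (L * L * Q * s) L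
      (e₁ L Q s) h bound′ (e₂ L Q s) 1≤L
  where
  infixl 0 _|>_
  _|>_ : ∀ {A B : Set} → A → (A → B) → B
  x |> g = g x
  e₁ : ∀ L Q s → 2 * (L * (L * Q * (Q + s))) ≡ 2 * (L * Q * (L * Q)) + 2 * (L * L * Q * s)
  e₁ = solve-∀
  e₂ : ∀ L Q s → L * (L * Q * (Q + 2 * s) + Q) ≡ L * Q * (L * Q) + 2 * (L * L * Q * s) + L * Q
  e₂ = solve-∀
  -- r = a - (f + 1) and λ(f + 1) > 2s give λ r < λ a - 2s = Q.
  r-bound : r * suc L + 1 ≤ Q
  r-bound = lin 5 (λ r f c Q s → r :+ f := c ∷ c := Q :+ 2 :* s ∷ 2 :* s :< f ∷ [] ⊢ r :+ K 1 :≤ Q) (r * suc L) (suc f * suc L) (a * suc L) Q s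
    (trans (sym (*-distribʳ-+ (suc L) r (suc f))) (cong (_* suc L) rest)) (trans (*-comm a (suc L)) full) (≤-trans deficit (≤-reflexive (*-comm (suc L) (suc f))))
  n-bound : (a * (L * Q) + r) * suc L + 1 ≤ L * Q * (Q + 2 * s) + Q
  n-bound = ≤-trans (≤-reflexive (e₃ a L Q r)) (+-mono-≤ (≤-reflexive (trans (cong (L * Q *_) full) refl)) r-bound)
    where
    e₃ : ∀ a L Q r → (a * (L * Q) + r) * suc L + 1 ≡ L * Q * (suc L * a) + (r * suc L + 1)
    e₃ = solve-∀
  triangle : 2 * tri (suc L) ≡ suc L * L
  triangle = +-cancelʳ-≡ (suc L) _ _ (trans (tri-double (suc L)) (trans (*-suc (suc L) L) (+-comm (suc L) _)))
  bound′ : 2 * ((a * (L * Q) + r) * tri (suc L)) + L ≤ L * (L * Q * (Q + 2 * s) + Q)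
  bound′ = ≤-trans (≤-reflexive (trans (cong (_+ L) (trans (swap 2 (a * (L * Q) + r) (tri (suc L))) (cong ((a * (L * Q) + r) *_) triangle))) (e₄ (a * (L * Q) + r) L))) (*-monoʳ-≤ L n-bound)
    where
    swap : ∀ x y z → x * (y * z) ≡ y * (x * z)
    swap = solve-∀
    e₄ : ∀ x L → x * (suc L * L) + L ≡ L * (x * suc L + 1)
    e₄ = solve-∀

-- By λ w₁ = Q + 2s the first two terms combine to (λ - 1) w₁ Q. Only the subtraction of f remains,
-- and f ≤ a makes it exact over ℕ.
naturalBound : ∀ L s a Q f → suc L * a ≡ Q + 2 * s → f ≤ a →
  ℤ.+ (a * (L * Q + 1) ∸ f) ≡ (((ℤ.+ (suc L * L * a * a)) ℤ.- (ℤ.+ (2 * L * s * a))) ℤ.+ (ℤ.+ a)) ℤ.- (ℤ.+ f)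
naturalBound L s a Q f full f≤a = sym (begin
  (((ℤ.+ X) ℤ.- (ℤ.+ Y)) ℤ.+ (ℤ.+ a)) ℤ.- (ℤ.+ f) ≡⟨ cong (λ z → (z ℤ.+ (ℤ.+ a)) ℤ.- (ℤ.+ f)) (minus X Y Y≤X) ⟩
  (ℤ.+ (X ∸ Y + a)) ℤ.- (ℤ.+ f) ≡⟨ minus (X ∸ Y + a) f (≤-trans f≤a (m≤n+m a (X ∸ Y))) ⟩
  ℤ.+ (X ∸ Y + a ∸ f) ≡⟨ cong (λ z → ℤ.+ (z ∸ f)) (trans (cong (_+ a) (trans (cong (_∸ Y) X≡) (m+n∸n≡m _ Y))) (e a (L * Q))) ⟩
  ℤ.+ (a * (L * Q + 1) ∸ f) ∎)
  where
  open ≡-Reasoning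
  X = suc L * L * a * a
  Y = 2 * L * s * a
  minus : ∀ x y → y ≤ x → (ℤ.+ x) ℤ.- (ℤ.+ y) ≡ ℤ.+ (x ∸ y)
  minus x y y≤x = trans (ℤP.m-n≡m⊖n x y) (ℤP.⊖-≥ y≤x)
  e : ∀ a z → a * z + a ≡ a * (z + 1)
  e = solve-∀
  X≡ : X ≡ a * (L * Q) + Y
  X≡ = trans (e₁ L a) (trans (cong (L * a *_) full) (e₂ L a Q s))
    where
    e₁ : ∀ L a → suc L * L * a * a ≡ L * a * (suc L * a)
    e₁ = solve-∀
    e₂ : ∀ L a Q s → L * a * (Q + 2 * s) ≡ a * (L * Q) + 2 * L * s * a
    e₂ = solve-∀
  Y≤X : Y ≤ X
  Y≤X = ≤-trans (m≤n+m Y (a * (L * Q))) (≤-reflexive (sym X≡))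

-- Both inequalities for a given composition

module Composition {m} (w : Vec ℕ (2 + m)) (comp : IsComposition w) where

  a W s f : ℕ
  a = Vec.head w
  W = weight w
  s = sOf w
  f = floorDiv (2 * s) (lam w)

  1≤a : 1 ≤ a
  1≤a = first w (proj₁ comp zero)
    where
    first : ∀ (w : Vec ℕ (2 + m)) → 1 ≤ Vec.lookup w zero → 1 ≤ Vec.head w
    first (_ ∷ _) h = h

  a<W : a < W
  a<W = second w (proj₁ comp (suc zero))
    where
    second : ∀ (w : Vec ℕ (2 + m)) → 1 ≤ Vec.lookup w (suc zero) → Vec.head w < weight w
    second (x ∷ y ∷ v) h = ≤-trans (≤-reflexive (+-comm 1 x)) (+-monoʳ-≤ x (≤-trans h (m≤m+n y _)))

  2≤W : 2 ≤ W
  2≤W = ≤-trans (s≤s 1≤a) a<W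

  sorted : Sorted w
  sorted = proj₂ comp

  full₀ : W + s ≡ lam w * a
  full₀ = m+[n∸m]≡n (proj₁ (ceilDiv-spec W a 1≤a))

  s<a : s < a
  s<a = lin 4 (λ W s c a → W :+ s := c ∷ c :< W :+ a ∷ [] ⊢ s :< a) W s (lam w * a) a full₀ (proj₂ (ceilDiv-spec W a 1≤a))

  L : ℕ
  L = lam w ∸ 1

  1<lam : 1 < lam w
  1<lam = *-cancelʳ-< a 1 (lam w) (<-≤-trans (≤-<-trans (≤-reflexive (+-identityʳ a)) a<W) (proj₁ (ceilDiv-spec W a 1≤a)))

  1≤L : 1 ≤ L
  1≤L = m<n⇒0<n∸m 1<lam

  lam≡ : lam w ≡ suc L
  lam≡ = sym (m+[n∸m]≡n (<⇒≤ 1<lam))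

  -- As W = λ w₁ - s, this is λ w₁ - 2s, and L Q is the critical number of words.
  Q : ℕ
  Q = W ∸ s

  W≡ : W ≡ Q + s
  W≡ = sym (m∸n+n≡m (≤-trans (<⇒≤ s<a) (<⇒≤ a<W)))

  full : suc L * a ≡ Q + 2 * s
  full = lin 4 (λ c W s Q → W :+ s := c ∷ W := Q :+ s ∷ [] ⊢ c := Q :+ 2 :* s) (suc L * a) W s Q (trans full₀ (cong (_* a) lam≡)) W≡

  f-low : f * suc L ≤ 2 * s
  f-low = subst (λ l → f * l ≤ 2 * s) lam≡ (proj₁ (floorDiv-spec (2 * s) (lam w) (<⇒≤ 1<lam)))

  f-high : 2 * s < f * suc L + suc L
  f-high = subst (λ l → 2 * s < f * l + l) lam≡ (proj₂ (floorDiv-spec (2 * s) (lam w) (<⇒≤ 1<lam)))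

  f<a : f < a
  f<a = lin 4 (λ f s a z → 2 :* f :≤ z ∷ z :≤ 2 :* s ∷ s :< a ∷ [] ⊢ f :< a) f s a (f * suc L) (≤-trans (≤-reflexive (*-comm 2 f)) (*-monoʳ-≤ f (s≤s 1≤L))) f-low s<a

  b : ℕ
  b = a * (L * Q + 1) ∸ f

  b+f : b + f ≡ a * (L * Q + 1)
  b+f = m∸n+n≡m (≤-trans (<⇒≤ f<a) (≤-trans (≤-reflexive (sym (*-identityʳ a))) (*-monoʳ-≤ a (m≤n+m 1 (L * Q)))))

  b≡bound : ℤ.+ b ≡ bound w
  b≡bound = subst (λ l → ℤ.+ b ≡ (((ℤ.+ (l * (l ∸ 1) * a * a)) ℤ.- (ℤ.+ (2 * (l ∸ 1) * s * a))) ℤ.+ (ℤ.+ a)) ℤ.- (ℤ.+ f)) (sym lam≡) (naturalBound L s a Q f full (<⇒≤ f<a))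

  below : ∀ n0 → StableFrom w n0 → b ≤ n0
  below n0 stable with b ≤? n0
  ... | yes le = le
  ... | no gt = ⊥-elim (contradict (proj₁ (stable n n0≤n)))
    where
    -- n = b - 1 is the last length that must fail. As r < a, its quotient by w₁ is still L Q.
    r n : ℕ
    r = a ∸ suc f
    n = a * (L * Q) + r
    r+f : r + suc f ≡ a
    r+f = m∸n+n≡m f<a
    n0≤n : n0 ≤ n
    n0≤n = lin 7 (λ n0 b f z r a y → n0 :< b ∷ b :+ f := y ∷ y := z :+ a ∷ r :+ (K 1 :+ f) := a ∷ [] ⊢ n0 :≤ z :+ r) n0 b f (a * (L * Q)) r a (a * (L * Q + 1))
      (≰⇒> gt) b+f (trans (*-distribˡ-+ a (L * Q) 1) (cong (a * (L * Q) +_) (*-identityʳ a))) r+f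
    size : floorDiv n a ≡ L * Q
    size = floorDiv-unique a (L * Q) r refl (lin 3 (λ r f a → r :+ (K 1 :+ f) := a ∷ [] ⊢ r :< a) r f a r+f)
    contradict : Σ (List (Vec (Fin (3 + m)) n)) (λ C → IsCCC n (2 * weight w ∸ 1) w C × length C ≡ floorDiv n a) → ⊥
    contradict (words , ccc , len) = pair-count-fails L Q s a f r full r+f (<-≤-trans f-high (≤-reflexive (trans (+-comm (f * suc L) (suc L)) (*-comm (suc f) (suc L))))) 1≤L
      (subst₂ (λ M W → L * (M * W) ≤ tri M + n * tri (suc L)) (trans len size) W≡ (ccc-count w L (≤-trans (s≤s z≤n) 2≤W) words ccc))

  columns : 3 * a ≥ W → ∀ n → b ≤ n → Columns w (floorDiv n a) n
  columns 3a≥W n b≤n = split L refl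
    where
    M : ℕ
    M = floorDiv n a
    room : a * M ≤ n
    room = ≤-trans (≤-reflexive (*-comm a M)) (proj₁ (floorDiv-spec n a 1≤a))
    room< : n < a * (M + 1)
    room< = ≤-trans (proj₂ (floorDiv-spec n a 1≤a)) (≤-reflexive (e M a))
      where
      e : ∀ M a → M * a + a ≡ a * (M + 1)
      e = solve-∀
    bound′ : a * (L * Q + 1) ≤ n + f
    bound′ = ≤-trans (≤-reflexive (sym b+f)) (+-monoˡ-≤ f b≤n)
    -- n ≥ b = a L Q + a - f exceeds a L Q because f < a.
    M≥ : L * Q ≤ M
    M≥ = s≤s⁻¹ (*-cancelˡ-< a (L * Q) (suc M) (lin 6 (λ n x y f a z → n :< x ∷ y :≤ n :+ f ∷ f :< a ∷ y := z :+ a ∷ [] ⊢ z :< x) n (a * suc M) (a * (L * Q + 1)) f a (a * (L * Q))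
      (≤-trans room< (≤-reflexive (cong (a *_) (+-comm M 1)))) bound′ f<a (trans (*-distribˡ-+ a (L * Q) 1) (cong (a * (L * Q) +_) (*-identityʳ a)))))
    p : ℕ
    p = a ∸ s
    p+s : p + s ≡ a
    p+s = m∸n+n≡m (<⇒≤ s<a)
    1≤p : 1 ≤ p
    1≤p = m<n⇒0<n∸m s<a
    scaled : ∀ {x} → (p + s) * x ≡ a * x
    scaled {x} = cong (_* x) p+s
    tight : ∀ x → x ≡ L * Q → M ≡ x → (p + s) * (M + 1) ≤ n + f
    tight x e e′ = ≤-trans (≤-reflexive (trans scaled (cong (λ z → a * (z + 1)) (trans e′ e)))) bound′
    split : ∀ l → L ≡ l → Columns w M n
    split zero e = ⊥-elim (<-irrefl (sym e) 1≤L)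
    split (suc zero) e = two-rows w p s M sorted (sym p+s)
      (lin 5 (λ W Q s p a → W := Q :+ s ∷ 2 :* a := Q :+ 2 :* s ∷ p :+ s := a ∷ [] ⊢ p :+ s :+ (p :+ K 0) := W) W Q s p a W≡ full₁ p+s)
      1≤p (≤-trans (≤-reflexive (trans 2p (sym LQ))) M≥) (≤-trans (≤-reflexive scaled) room)
      (λ e′ → ≤-trans (tight (2 * p) (trans 2p (sym LQ)) e′) (+-monoʳ-≤ n (lin 2 (λ f s → 2 :* f :≤ 2 :* s ∷ [] ⊢ f :≤ s) f s (≤-trans (≤-reflexive (trans (*-comm 2 f) (cong (λ l → f * suc l) (sym e)))) f-low))))
      where
      full₁ : 2 * a ≡ Q + 2 * s
      full₁ = trans (cong (λ l → suc l * a) (sym e)) full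
      LQ : L * Q ≡ Q
      LQ = trans (cong (_* Q) e) (+-identityʳ Q)
      2p : 2 * p ≡ Q
      2p = lin 4 (λ p s a Q → p :+ s := a ∷ 2 :* a := Q :+ 2 :* s ∷ [] ⊢ 2 :* p := Q) p s a Q p+s full₁
    split (suc (suc zero)) e = three-rows w p s M f sorted (sym p+s)
      (lin 5 (λ W Q s p a → W := Q :+ s ∷ 3 :* a := Q :+ 2 :* s ∷ p :+ s := a ∷ [] ⊢ p :+ s :+ (p :+ s :+ p) := W) W Q s p a W≡ full₂ p+s)
      1≤p (subst (λ l → f * suc l ≤ 2 * s) e f-low)
      (≤-trans (≤-reflexive 6p) M≥) (≤-trans (≤-reflexive scaled) room) (≤-trans room< (≤-reflexive (sym scaled)))
      (tight (6 * p + 2 * s) 6p)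
      where
      full₂ : 3 * a ≡ Q + 2 * s
      full₂ = trans (cong (λ l → suc l * a) (sym e)) full
      6p : 6 * p + 2 * s ≡ L * Q
      6p = trans (lin 4 (λ p s a Q → p :+ s := a ∷ 3 :* a := Q :+ 2 :* s ∷ [] ⊢ 6 :* p :+ 2 :* s := 2 :* Q) p s a Q p+s full₂) (cong (_* Q) (sym e))
    -- λ ≥ 4 is impossible: 4 w₁ ≤ λ w₁ = W + s, but W ≤ 3 w₁ and s < w₁.
    split (suc (suc (suc l))) e = ⊥-elim (lin 5 (λ W Q s a c → W :≤ 3 :* a ∷ s :< a ∷ W := Q :+ s ∷ 4 :* a :+ c := Q :+ 2 :* s ∷ [] ⊢ absurd) W Q s a (l * a)
      3a≥W s<a W≡ (trans (sym (*-distribʳ-+ a 4 l)) (trans (cong (λ z → suc z * a) (sym e)) full)))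

  stable : 3 * a ≥ W → StableFrom w b
  stable 3a≥W n b≤n = columns⇒ccc w 2≤W (columns 3a≥W n b≤n) , ccc-upper w 1≤a

open import Data.Vec using (head)
open import Data.Integer using (+_) renaming (_≤_ to _≤ℤ_)

theorem1 : ∀ (m : ℕ) (w : Vec ℕ (2 + m)) → IsComposition w →
    (∀ (n0 : ℕ) → StableFrom w n0 → bound w ≤ℤ + n0) ×
    (3 * head w ≥ weight w →
    ¬ Refines w (4 ∷ 4 ∷ 2 ∷ []) →
    ¬ Refines w (4 ∷ 3 ∷ 3 ∷ []) →
    ¬ Refines w (5 ∷ 5 ∷ 3 ∷ []) →
    ¬ Refines w (5 ∷ 4 ∷ 4 ∷ []) →
    Σ ℕ (λ b → (+ b ≡ bound w) × IsNccc w b))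
theorem1 m w comp = (λ n0 h → subst (_≤ℤ + n0) b≡bound (ℤ.+≤+ (below n0 h))) ,
  λ 3a≥W _ _ _ _ → b , b≡bound , stable 3a≥W , below
  where open Composition w comp
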